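{- With $Q:=q^{13}$, the following hold: $$2q^3E(q^{16})E(Q^8)U(2,13,q^8)=(3,2,139)-(12,4,35),$$ $$2q^{7}E(q^8)E(Q^{16})U(1,26,q^8)=(7,4,60)-(15,4,28),$$ $$2q^{9}E(q^8)E(Q^{16})=(9,8,48)-(17,6,25),$$ $$2q^5E(q^{16})E(Q^8)=(5,4,84)-(20,4,21),$$ $$2q^5E(q^8)E(Q^{16})U(1,26,q^8)^2=(5,4,84)+(21,10,21)-(13,0,32)-(20,4,21)=2q^5E(q^{16})E(Q^{8})-2q^{13}\psi(Q^8)\varphi(-q^8),$$ $$2qE(q^{16})E(Q^8)U(2,13,q^8)^2=(1,0,416)+(17,6,25)-(4,4,105)-(9,8,48)=2q\psi(q^8)\varphi(-Q^8)-2q^9E(q^8)E(Q^{16}),$$ $$\frac{(5,4,84)+(21,10,21)-(13,0,32)-(20,4,21)}{(1,0,416)+(17,6,25)-(4,4,105)-(9,8,48)}=\frac{(9,8,48)-(17,6,25)}{(5,4,84)-(20,4,21)}=\frac{(7,4,60)-(15,4,28)}{(3,2,139)-(12,4,35)}=q^4\frac{E(q^8)E(Q^{16})}{E(q^{16})E(Q^8)}.$$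
   Context: Let $|q|<1$, $(a;q)_\infty=\prod_{k\ge0}(1-aq^k)$, $(a;q)_n=\prod_{k=0}^{n-1}(1-aq^k)$. $G(q)=\sum_{n\ge0}\frac{q^{n^2}}{(q;q)_n}$, $H(q)=\sum_{n\ge0}\frac{q^{n(n+1)}}{(q;q)_n}$. For positive integers $r,s$, $U(r,s,q)=G(q^r)G(q^s)+q^{(s+r)/5}H(q^r)H(q^s)$ if $s+r\equiv0\pmod5$ and $U(r,s,q)=H(q^r)G(q^s)-q^{(s-r)/5}G(q^r)H(q^s)$ if $s-r\equiv0\pmod5$; $U(r,s,x)$ denotes this expression with $q$ replaced by $x$. $E(q)=(q;q)_\infty$, $\varphi(q)=\sum_{n\in\mathbb Z}q^{n^2}$, $\psi(q)=\sum_{n\ge0}q^{n(n+1)/2}$. For integers $a,b,c$ with $a,c>0$, $b^2-4ac<0$, $(a,b,c)$ denotes $\sum_{n,m=-\infty}^{\infty}q^{an^2+bnm+cm^2}$. -}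

module Defs where

open import Data.Nat as ℕ using (ℕ; zero; suc; NonZero)
open import Data.Nat.DivMod using (_/_; _%_)
open import Data.Integer as ℤ using (ℤ; +_; -_; _+_; _-_; _*_; ∣_∣)
open import Data.Product using (Σ; _×_; _,_)
open import Relation.Nullary using (¬_; yes; no)
open import Relation.Binary.PropositionalEquality using (_≡_)

-- Formal power series in q with integer coefficients:
-- a series is its coefficient function, f n = [q^n] f.

Series : Set
Series = ℕ → ℤ

infix 4 _≐_
_≐_ : Series → Series → Set
f ≐ g = ∀ n → f n ≡ g n

NonZeroSeries : Series → Set
NonZeroSeries f = Σ ℕ (λ n → ¬ (f n ≡ + 0))

sumTo : ℕ → (ℕ → ℤ) → ℤ
sumTo zero    h = h 0
sumTo (suc n) h = sumTo n h + h (suc n)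

sumZ : ℕ → (ℤ → ℤ) → ℤ
sumZ N h = sumTo (N ℕ.+ N) (λ i → h ((+ i) - (+ N)))

δ : ℕ → ℕ → ℤ
δ a b with a ℕ.≟ b
... | yes _ = + 1
... | no  _ = + 0

δℤ : ℤ → ℤ → ℤ
δℤ a b with a ℤ.≟ b
... | yes _ = + 1
... | no  _ = + 0

infixl 6 _⊕_ _⊖_
infixl 7 _⊛_

_⊕_ : Series → Series → Series
(f ⊕ g) n = f n + g n

_⊖_ : Series → Series → Series
(f ⊖ g) n = f n - g n

_⊛_ : Series → Series → Series
(f ⊛ g) n = sumTo n (λ i → f i * g (n ℕ.∸ i))

scale : ℤ → Series → Series
scale c f n = c * f n

one : Series
one n = δ n 0

mono : ℕ → Series
mono k n = δ n k

shift : ℕ → Series → Series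
shift k f n with n ℕ.<? k
... | yes _ = + 0
... | no  _ = f (n ℕ.∸ k)

dil : (k : ℕ) → .{{NonZero k}} → Series → Series
dil k f n with n % k ℕ.≟ 0
... | yes _ = f (n / k)
... | no  _ = + 0

negv : Series → Series
negv f n = ((- + 1) ℤ.^ n) * f n

prodFrom1 : (ℕ → Series) → ℕ → Series
prodFrom1 F zero    = one
prodFrom1 F (suc m) = prodFrom1 F m ⊛ F (suc m)

qPoch : ℕ → Series
qPoch = prodFrom1 (λ k → one ⊖ mono k)

-- 1/(1 - q^k) = Σ_j q^{kj}, for k ≥ 1
geom : ℕ → Series
geom zero    n = + 0   -- never used
geom (suc k) n with n % suc k ℕ.≟ 0
... | yes _ = + 1
... | no  _ = + 0

invQPoch : ℕ → Series
invQPoch = prodFrom1 geom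

-- E(q) = (q;q)_∞ : the coefficient of q^n of the infinite product equals
-- that of the partial product (q;q)_n (factors with k > n are ≡ 1 mod q^{n+1}).
E : Series
E n = qPoch n n

-- Rogers–Ramanujan functions
-- G(q) = Σ_{m≥0} q^{m²}/(q;q)_m ,  H(q) = Σ_{m≥0} q^{m(m+1)}/(q;q)_m .
-- Terms with m > n do not contribute to the coefficient of q^n.

G : Series
G n = sumTo n (λ m → shift (m ℕ.* m) (invQPoch m) n)

H : Series
H n = sumTo n (λ m → shift (m ℕ.* suc m) (invQPoch m) n)

-- Ramanujan theta functions
-- φ(q) = Σ_{m ∈ ℤ} q^{m²} ,  ψ(q) = Σ_{m ≥ 0} q^{m(m+1)/2}.
-- Terms with |m| > n do not contribute to the coefficient of q^n.

φ : Series
φ n = sumZ n (λ m → δ (∣ m ∣ ℕ.* ∣ m ∣) n)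

ψ : Series
ψ n = sumTo n (λ m → δ ((m ℕ.* suc m) / 2) n)

-- Binary theta series (a,b,c) = Σ_{x,y ∈ ℤ} q^{a x² + b x y + c y²}
-- for a, c > 0 and b² - 4ac < 0 (positive definite).
-- For such a form, a x² + b x y + c y² = n forces
-- |x| ≤ 4cn and |y| ≤ 4an  (from 4a·Q = (2ax+by)² + (4ac-b²)y² and symmetrically),
-- so the coefficient of q^n is the number of (x,y) with |x|,|y| ≤ 4(|a|+|c|)n
-- representing n.

theta : ℤ → ℤ → ℤ → Series
theta a b c n =
  sumZ N (λ x → sumZ N (λ y →
    δℤ (a * x * x + b * x * y + c * y * y) (+ n)))
  where
  N : ℕ
  N = 4 ℕ.* (∣ a ∣ ℕ.+ ∣ c ∣) ℕ.* n

-- U(r,s,q)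
-- case s + r ≡ 0 (mod 5):  G(q^r)G(q^s) + q^{(s+r)/5} H(q^r)H(q^s)
Uplus : (r s : ℕ) → .{{NonZero r}} → .{{NonZero s}} → Series
Uplus r s = (dil r G ⊛ dil s G) ⊕ shift ((s ℕ.+ r) / 5) (dil r H ⊛ dil s H)

-- case s - r ≡ 0 (mod 5), s ≥ r:  H(q^r)G(q^s) - q^{(s-r)/5} G(q^r)H(q^s)
Uminus : (r s : ℕ) → .{{NonZero r}} → .{{NonZero s}} → Series
Uminus r s = (dil r H ⊛ dil s G) ⊖ shift ((s ℕ.∸ r) / 5) (dil r G ⊛ dil s H)

-- U(2,13,q) (2+13 = 15 ≡ 0 mod 5) and U(1,26,q) (26-1 = 25 ≡ 0 mod 5)
U-2-13 : Series
U-2-13 = Uplus 2 13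

U-1-26 : Series
U-1-26 = Uminus 1 26

-- Write a = E(q)E(q^26), b = E(q²)E(q^13), x = a U(1,26), y = b U(2,13).  By the pentagonal number theorem
-- and the Rogers–Ramanujan identities, 2q^9 a(q^8), 2q^5 b(q^8), 2q^7 x(q^8), 2q^3 y(q^8) are binary theta series
-- of discriminant -416 with a character mod 2, which are the stated differences of theta series.  Two ternary
-- theta identities, sharing the factor tW, give x b = y a.  The product x y is obtained from quaternions: x and y
-- are related to theta series of discriminant -104 by identities between quaternary theta series on the norm form
-- of a maximal order of (-2,-13), all of which are local (mod 16) consequences of the symmetry between left and
-- right divisors of norm 3.  Together with Gauss's product formulas for φ(-q) and ψ(q) this gives x y = b² - q a²,
-- whence x² = a (b - q φ(-q)ψ(q^13)) and y² = b (ψ(q)φ(-q^13) - q a), and everything else follows.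
module Submission where

open import Defs
open import Level using (0ℓ)
open import Algebra.Bundles using (CommutativeRing)
import Algebra.Solver.Ring as RS
import Algebra.Solver.Ring.AlmostCommutativeRing as ACR
open import Data.Bool using (Bool; true; false; _∧_; if_then_else_)
open import Data.Empty using (⊥-elim)
open import Data.Integer as ℤ using (ℤ; +_; -[1+_]; -_; _+_; _-_; _*_; ∣_∣; +≤+)
import Data.Integer.DivMod as ℤD
open ℤD using (_/ℕ_; _%ℕ_)
import Data.Integer.Properties as ℤₚ
open ℤₚ using () renaming (+-*-commutativeRing to ℤ-ring)
open import Data.Integer.Tactic.RingSolver using (solve-∀)
open import Data.List using (List; []; _∷_; length)
import Data.List.Relation.Unary.All as LA
open import Data.Maybe using (Maybe; just; nothing)
open import Data.Nat as ℕ using (ℕ; zero; suc; NonZero; z≤n; s≤s; _≡ᵇ_)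
import Data.Nat.DivMod as ℕD
open import Data.Nat.Divisibility using (_∣_; divides; m%n≡0⇒n∣m; n∣m⇒m%n≡0; ∣m∣n⇒∣m+n)
import Data.Nat.Properties as ℕₚ
import Data.Nat.Tactic.RingSolver as ℕR
open import Data.Product using (∃; _×_; _,_; proj₁; proj₂)
open import Data.Sum using (_⊎_; inj₁; inj₂)
open import Data.Vec using (Vec; []; _∷_; map; _++_; take; drop; replicate; zipWith)
open import Data.Vec.Relation.Unary.All using (All; []; _∷_)
import Data.Vec.Relation.Unary.All as All
open import Relation.Binary.Bundles using (Setoid)
open import Relation.Binary.PropositionalEquality using (_≡_; refl; sym; trans; cong; cong₂; subst; module ≡-Reasoning)
open import Relation.Nullary using (¬_; yes; no; Dec)


-- A product of two binary theta series is a theta series of a quaternary lattice with a weight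
-- periodic modulo a power of 2, so relations between such products become finite checks on residues
-- once everything lives on one lattice. Instead of asking that the weights cancel class by class,
-- the proof asks only that their combination be a sum of some `g` over left multiples minus the
-- same sum over right multiples by elements of norm 3, since that difference has theta series zero
-- for every weight `g`. The order has discriminant 13, class number one and units ±1, so the 3 + 1
-- ideals of norm 3 on either side are generated by four elements up to sign; 3 is the least prime
-- not dividing 2·13, so these multiplications permute the residues modulo powers of 2. The product
-- x y is not attacked directly: linear relations for x b(q²) and y a(q²) are multiplied, and a(q²)
-- b(q²) is cancelled by product identities at -q. Since the checks run by evaluation, every weight
-- carries an evaluator on residues beside its meaning, and the matrices are stored reduced.

-- The ring of formal power series.

sumTo-cong : ∀ n {f g : ℕ → ℤ} → (∀ i → i ℕ.≤ n → f i ≡ g i) → sumTo n f ≡ sumTo n g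
sumTo-cong zero    h = h 0 z≤n
sumTo-cong (suc n) h = cong₂ _+_ (sumTo-cong n (λ i p → h i (ℕₚ.m≤n⇒m≤1+n p))) (h (suc n) ℕₚ.≤-refl)

sumTo-cong′ : ∀ n {f g : ℕ → ℤ} → (∀ i → f i ≡ g i) → sumTo n f ≡ sumTo n g
sumTo-cong′ n h = sumTo-cong n (λ i _ → h i)

sumTo-head : ∀ n (h : ℕ → ℤ) → sumTo (suc n) h ≡ h 0 + sumTo n (λ i → h (suc i))
sumTo-head zero    h = refl
sumTo-head (suc n) h = trans (cong (_+ h (suc (suc n))) (sumTo-head n h)) (ℤₚ.+-assoc (h 0) _ _)

+-interchange : ∀ a b c d → (a + b) + (c + d) ≡ (a + c) + (b + d)
+-interchange = solve-∀

sumTo-+ : ∀ n (f g : ℕ → ℤ) → sumTo n (λ i → f i + g i) ≡ sumTo n f + sumTo n g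
sumTo-+ zero    f g = refl
sumTo-+ (suc n) f g = trans (cong (_+ (f (suc n) + g (suc n))) (sumTo-+ n f g)) (+-interchange (sumTo n f) (sumTo n g) (f (suc n)) (g (suc n)))

sumTo-*ˡ : ∀ n c (f : ℕ → ℤ) → sumTo n (λ i → c * f i) ≡ c * sumTo n f
sumTo-*ˡ zero    c f = refl
sumTo-*ˡ (suc n) c f = trans (cong (_+ c * f (suc n)) (sumTo-*ˡ n c f)) (sym (ℤₚ.*-distribˡ-+ c _ _))

sumTo-0 : ∀ n → sumTo n (λ _ → + 0) ≡ + 0
sumTo-0 zero    = refl
sumTo-0 (suc n) = trans (cong (_+ + 0) (sumTo-0 n)) refl

sumTo-zero : ∀ n {f : ℕ → ℤ} → (∀ i → i ℕ.≤ n → f i ≡ + 0) → sumTo n f ≡ + 0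
sumTo-zero n h = trans (sumTo-cong n h) (sumTo-0 n)

tl : Series → Series
tl f n = f (suc n)

zeroS : Series
zeroS _ = + 0

⊝_ : Series → Series
(⊝ f) n = - f n

cst : ℤ → Series
cst c = scale c one

≐-refl : ∀ {f} → f ≐ f
≐-refl _ = refl

≐-sym : ∀ {f g} → f ≐ g → g ≐ f
≐-sym p n = sym (p n)

≐-trans : ∀ {f g h} → f ≐ g → g ≐ h → f ≐ h
≐-trans p q n = trans (p n) (q n)

⊛-suc : ∀ f g n → (f ⊛ g) (suc n) ≡ f 0 * g (suc n) + (tl f ⊛ g) n
⊛-suc f g n = sumTo-head n (λ i → f i * g (suc n ℕ.∸ i))

⊛-cong : ∀ {f f′ g g′} → f ≐ f′ → g ≐ g′ → f ⊛ g ≐ f′ ⊛ g′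
⊛-cong p q n = sumTo-cong′ n (λ i → cong₂ _*_ (p i) (q (n ℕ.∸ i)))

⊛-distribʳ : ∀ h f g → (f ⊕ g) ⊛ h ≐ (f ⊛ h) ⊕ (g ⊛ h)
⊛-distribʳ h f g n = trans (sumTo-cong′ n (λ i → ℤₚ.*-distribʳ-+ (h (n ℕ.∸ i)) (f i) (g i))) (sumTo-+ n _ _)

⊛-scaleˡ : ∀ c f g → scale c f ⊛ g ≐ scale c (f ⊛ g)
⊛-scaleˡ c f g n = trans (sumTo-cong′ n (λ i → ℤₚ.*-assoc c (f i) _)) (sumTo-*ˡ n c _)

⊛-zeroˡ : ∀ g → zeroS ⊛ g ≐ zeroS
⊛-zeroˡ g n = sumTo-zero n (λ i _ → ℤₚ.*-zeroˡ (g (n ℕ.∸ i)))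

⊛-assoc : ∀ f g h → (f ⊛ g) ⊛ h ≐ f ⊛ (g ⊛ h)
⊛-assoc f g h zero    = ℤₚ.*-assoc (f 0) (g 0) (h 0)
⊛-assoc f g h (suc n) = begin
  ((f ⊛ g) ⊛ h) (suc n)
    ≡⟨ ⊛-suc (f ⊛ g) h n ⟩
  f 0 * g 0 * h (suc n) + (tl (f ⊛ g) ⊛ h) n
    ≡⟨ cong (λ z → f 0 * g 0 * h (suc n) + z) (trans (⊛-cong {g = h} (⊛-suc f g) ≐-refl n) (⊛-distribʳ h (scale (f 0) (tl g)) (tl f ⊛ g) n)) ⟩
  f 0 * g 0 * h (suc n) + ((scale (f 0) (tl g) ⊛ h) n + ((tl f ⊛ g) ⊛ h) n)
    ≡⟨ cong (λ z → f 0 * g 0 * h (suc n) + z) (cong₂ _+_ (⊛-scaleˡ (f 0) (tl g) h n) (⊛-assoc (tl f) g h n)) ⟩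
  f 0 * g 0 * h (suc n) + (f 0 * (tl g ⊛ h) n + (tl f ⊛ (g ⊛ h)) n)
    ≡⟨ lem (f 0) (g 0) (h (suc n)) _ _ ⟩
  f 0 * (g 0 * h (suc n) + (tl g ⊛ h) n) + (tl f ⊛ (g ⊛ h)) n
    ≡⟨ cong (λ z → f 0 * z + (tl f ⊛ (g ⊛ h)) n) (sym (⊛-suc g h n)) ⟩
  f 0 * (g ⊛ h) (suc n) + (tl f ⊛ (g ⊛ h)) n
    ≡⟨ sym (⊛-suc f (g ⊛ h) n) ⟩
  (f ⊛ (g ⊛ h)) (suc n) ∎
  where
  open ≡-Reasoning
  lem : ∀ a b c x y → a * b * c + (a * x + y) ≡ a * (b * c + x) + y
  lem = solve-∀

⊛-sucʳ : ∀ f g n → (f ⊛ g) (suc n) ≡ f (suc n) * g 0 + (f ⊛ tl g) n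
⊛-sucʳ f g zero    = ℤₚ.+-comm (f 0 * g 1) (f 1 * g 0)
⊛-sucʳ f g (suc n) = begin
  (f ⊛ g) (suc (suc n))                                       ≡⟨ ⊛-suc f g (suc n) ⟩
  f 0 * g (suc (suc n)) + (tl f ⊛ g) (suc n)                  ≡⟨ cong (λ z → f 0 * g (suc (suc n)) + z) (⊛-sucʳ (tl f) g n) ⟩
  f 0 * g (suc (suc n)) + (f (suc (suc n)) * g 0 + (tl f ⊛ tl g) n) ≡⟨ lem (f 0 * g (suc (suc n))) (f (suc (suc n)) * g 0) _ ⟩
  f (suc (suc n)) * g 0 + (f 0 * g (suc (suc n)) + (tl f ⊛ tl g) n) ≡⟨ cong (λ z → f (suc (suc n)) * g 0 + z) (sym (⊛-suc f (tl g) n)) ⟩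
  f (suc (suc n)) * g 0 + (f ⊛ tl g) (suc n) ∎
  where
  open ≡-Reasoning
  lem : ∀ a b c → a + (b + c) ≡ b + (a + c)
  lem = solve-∀

⊛-comm : ∀ f g → f ⊛ g ≐ g ⊛ f
⊛-comm f g zero    = ℤₚ.*-comm (f 0) (g 0)
⊛-comm f g (suc n) = begin
  (f ⊛ g) (suc n)                    ≡⟨ ⊛-suc f g n ⟩
  f 0 * g (suc n) + (tl f ⊛ g) n     ≡⟨ cong₂ _+_ (ℤₚ.*-comm (f 0) (g (suc n))) (⊛-comm (tl f) g n) ⟩
  g (suc n) * f 0 + (g ⊛ tl f) n     ≡⟨ sym (⊛-sucʳ g f n) ⟩
  (g ⊛ f) (suc n) ∎
  where open ≡-Reasoning

⊛-identityˡ : ∀ f → one ⊛ f ≐ f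
⊛-identityˡ f zero    = ℤₚ.*-identityˡ (f 0)
⊛-identityˡ f (suc n) = trans (⊛-suc one f n) (trans (cong₂ _+_ (ℤₚ.*-identityˡ (f (suc n))) (⊛-zeroˡ f n)) (ℤₚ.+-identityʳ _))

⊛-distribˡ : ∀ h f g → h ⊛ (f ⊕ g) ≐ (h ⊛ f) ⊕ (h ⊛ g)
⊛-distribˡ h f g = ≐-trans (⊛-comm h (f ⊕ g)) (≐-trans (⊛-distribʳ h f g) (λ n → cong₂ _+_ (⊛-comm f h n) (⊛-comm g h n)))

Ser : CommutativeRing 0ℓ 0ℓ
Ser = record
  { Carrier = Series ; _≈_ = _≐_ ; _+_ = _⊕_ ; _*_ = _⊛_ ; -_ = ⊝_ ; 0# = zeroS ; 1# = one
  ; isCommutativeRing = record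
    { isRing = record
      { +-isAbelianGroup = record
        { isGroup = record
          { isMonoid = record
            { isSemigroup = record
              { isMagma = record
                { isEquivalence = record { refl = ≐-refl ; sym = ≐-sym ; trans = ≐-trans }
                ; ∙-cong = λ p q n → cong₂ _+_ (p n) (q n) }
              ; assoc = λ f g h n → ℤₚ.+-assoc (f n) (g n) (h n) }
            ; identity = (λ f n → ℤₚ.+-identityˡ (f n)) , (λ f n → ℤₚ.+-identityʳ (f n)) }
          ; inverse = (λ f n → ℤₚ.+-inverseˡ (f n)) , (λ f n → ℤₚ.+-inverseʳ (f n))
          ; ⁻¹-cong = λ p n → cong -_ (p n) }
        ; comm = λ f g n → ℤₚ.+-comm (f n) (g n) }
      ; *-cong = ⊛-cong
      ; *-assoc = ⊛-assoc
      ; *-identity = ⊛-identityˡ , (λ f → ≐-trans (⊛-comm f one) (⊛-identityˡ f))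
      ; distrib = ⊛-distribˡ , ⊛-distribʳ }
    ; *-comm = ⊛-comm } }

serSetoid : Setoid 0ℓ 0ℓ
serSetoid = CommutativeRing.setoid Ser

private
  SerACR : ACR.AlmostCommutativeRing 0ℓ 0ℓ
  SerACR = ACR.fromCommutativeRing Ser

  ℤraw = CommutativeRing.rawRing ℤ-ring

  cst-hom : ℤraw ACR.-Raw-AlmostCommutative⟶ SerACR
  cst-hom = record
    { ⟦_⟧ = cst
    ; +-homo = λ a b n → ℤₚ.*-distribʳ-+ (one n) a b
    ; *-homo = λ a b n → sym (trans (⊛-scaleˡ a one (cst b) n) (trans (cong (a *_) (⊛-identityˡ (cst b) n)) (sym (ℤₚ.*-assoc a b (one n)))))
    ; -‿homo = λ a n → sym (ℤₚ.neg-distribˡ-* a (one n))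
    ; 0-homo = λ n → ℤₚ.*-zeroˡ (one n)
    ; 1-homo = λ n → ℤₚ.*-identityˡ (one n) }

  dec : ∀ a b → Maybe (cst a ≐ cst b)
  dec a b with a ℤ.≟ b
  ... | yes refl = just ≐-refl
  ... | no  _    = nothing

module Solver = RS ℤraw SerACR cst-hom dec
open Solver using (solve; _:+_; _:*_; _:-_; _:=_; con; :-_)
import Relation.Binary.Reasoning.Setoid serSetoid as SR

-- Monomials, dilation, the substitution q ↦ -q, and cancellation.

δ-refl : ∀ a → δ a a ≡ + 1
δ-refl a with a ℕ.≟ a
... | yes _ = refl
... | no  p = ⊥-elim (p refl)

δ-≢ : ∀ {a b} → ¬ (a ≡ b) → δ a b ≡ + 0
δ-≢ {a} {b} p with a ℕ.≟ b
... | yes q = ⊥-elim (p q)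
... | no  _ = refl

δ-suc : ∀ a b → δ (suc a) (suc b) ≡ δ a b
δ-suc a b with a ℕ.≟ b
... | yes refl = δ-refl (suc a)
... | no  p    = δ-≢ (λ q → p (ℕₚ.suc-injective q))

shift-< : ∀ k f {n} → n ℕ.< k → shift k f n ≡ + 0
shift-< k f {n} p with n ℕ.<? k
... | yes _ = refl
... | no  q = ⊥-elim (q p)

shift-+ : ∀ k f n → shift k f (k ℕ.+ n) ≡ f n
shift-+ k f n with k ℕ.+ n ℕ.<? k
... | yes p = ⊥-elim (ℕₚ.<⇒≱ p (ℕₚ.m≤m+n k n))
... | no  _ = cong f (ℕₚ.m+n∸m≡n k n)

shift-suc : ∀ k f n → shift (suc k) f (suc n) ≡ shift k f n
shift-suc k f n with n ℕ.<? k
... | yes p = shift-< (suc k) f (s≤s p)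
... | no  p = trans (cong (shift (suc k) f) (sym e)) (trans (shift-+ (suc k) f (n ℕ.∸ k)) refl)
  where
  e : suc k ℕ.+ (n ℕ.∸ k) ≡ suc n
  e = cong suc (ℕₚ.m+[n∸m]≡n (ℕₚ.≮⇒≥ p))

shift-mono : ∀ k f → shift k f ≐ mono k ⊛ f
shift-mono zero    f n       = trans (shift-+ 0 f n) (sym (⊛-identityˡ f n))
shift-mono (suc k) f zero    = refl
shift-mono (suc k) f (suc n) = begin
  shift (suc k) f (suc n)     ≡⟨ shift-suc k f n ⟩
  shift k f n                 ≡⟨ shift-mono k f n ⟩
  (mono k ⊛ f) n              ≡⟨ ⊛-cong {g = f} (λ i → sym (δ-suc i k)) ≐-refl n ⟩
  (tl (mono (suc k)) ⊛ f) n   ≡⟨ sym (ℤₚ.+-identityˡ _) ⟩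
  + 0 * f (suc n) + (tl (mono (suc k)) ⊛ f) n ≡⟨ sym (⊛-suc (mono (suc k)) f n) ⟩
  (mono (suc k) ⊛ f) (suc n) ∎
  where open ≡-Reasoning

mono-+ : ∀ a b → mono (a ℕ.+ b) ≐ mono a ⊛ mono b
mono-+ a b = ≐-trans (lem a) (shift-mono a (mono b))
  where
  lem : ∀ a → mono (a ℕ.+ b) ≐ shift a (mono b)
  lem zero    n       = sym (shift-+ 0 (mono b) n)
  lem (suc a) zero    = sym (shift-< (suc a) (mono b) (s≤s z≤n))
  lem (suc a) (suc n) = trans (δ-suc n (a ℕ.+ b)) (trans (lem a n) (sym (shift-suc a (mono b) n)))

module _ (k : ℕ) .{{_ : NonZero k}} where

  dil-* : ∀ f m → dil k f (m ℕ.* k) ≡ f m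
  dil-* f m with (m ℕ.* k) ℕ.% k ℕ.≟ 0
  ... | yes _ = cong f (ℕD.m*n/n≡m m k)
  ... | no  p = ⊥-elim (p (ℕD.m*n%n≡0 m k))

  dil-∤ : ∀ f {n} → ¬ (n ℕ.% k ≡ 0) → dil k f n ≡ + 0
  dil-∤ f {n} p with n ℕ.% k ℕ.≟ 0
  ... | yes q = ⊥-elim (p q)
  ... | no  _ = refl

  multiple : ∀ n → n ℕ.% k ≡ 0 → n ≡ (n ℕ./ k) ℕ.* k
  multiple n p = trans (ℕD.m≡m%n+[m/n]*n n k) (cong (ℕ._+ (n ℕ./ k) ℕ.* k) p)

  -- `dil k f` is determined by its values at the multiples of `k` and its vanishing elsewhere; the
  -- algebraic rules for `dil` are proved through this, without splitting on `n % k` each time.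
  dil-char : ∀ {f g} → (∀ m → g (m ℕ.* k) ≡ f m) → (∀ n → ¬ (n ℕ.% k ≡ 0) → g n ≡ + 0) → dil k f ≐ g
  dil-char {f} {g} p q n with n ℕ.% k ℕ.≟ 0
  ... | yes e = trans (sym (p (n ℕ./ k))) (cong g (sym (multiple n e)))
  ... | no  e = sym (q n e)

  dil-cong : ∀ {f g} → f ≐ g → dil k f ≐ dil k g
  dil-cong {f} {g} h = dil-char (λ m → trans (dil-* g m) (sym (h m))) (λ n → dil-∤ g)

  dil-injective : ∀ {f g} → dil k f ≐ dil k g → f ≐ g
  dil-injective {f} {g} h m = trans (sym (dil-* f m)) (trans (h (m ℕ.* k)) (dil-* g m))

  dil-⊕ : ∀ f g → dil k (f ⊕ g) ≐ dil k f ⊕ dil k g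
  dil-⊕ f g = dil-char (λ m → cong₂ _+_ (dil-* f m) (dil-* g m)) (λ n e → cong₂ _+_ (dil-∤ f e) (dil-∤ g e))

  dil-⊝ : ∀ f → dil k (⊝ f) ≐ ⊝ dil k f
  dil-⊝ f = dil-char (λ m → cong -_ (dil-* f m)) (λ n e → cong -_ (dil-∤ f e))

  dil-scale : ∀ c f → dil k (scale c f) ≐ scale c (dil k f)
  dil-scale c f = dil-char (λ m → cong (c *_) (dil-* f m)) (λ n e → trans (cong (c *_) (dil-∤ f e)) (ℤₚ.*-zeroʳ c))

  private
    gap : ∀ (h : ℕ → ℤ) b j → (∀ i → 1 ℕ.≤ i → i ℕ.≤ j → h (i ℕ.+ b) ≡ + 0) → sumTo (j ℕ.+ b) h ≡ sumTo b h
    gap h b zero    z = refl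
    gap h b (suc j) z = trans (cong₂ _+_ (gap h b j (λ i p q → z i p (ℕₚ.m≤n⇒m≤1+n q))) (z (suc j) (s≤s z≤n) ℕₚ.≤-refl)) (ℤₚ.+-identityʳ _)

    off : ∀ i m → 1 ℕ.≤ i → i ℕ.< k → ¬ ((i ℕ.+ m ℕ.* k) ℕ.% k ≡ 0)
    off (suc i) m _ p e with trans (sym (ℕD.m<n⇒m%n≡m p)) (trans (sym (ℕD.[m+kn]%n≡m%n (suc i) m k)) e)
    ... | ()

  -- Each stretch of length `k` contributes only its last term, since strictly between two multiples
  -- of `k` the summand is zero.
  sumTo-multiples : ∀ (h : ℕ → ℤ) → (∀ n → ¬ (n ℕ.% k ≡ 0) → h n ≡ + 0) → ∀ m → sumTo (m ℕ.* k) h ≡ sumTo m (λ j → h (j ℕ.* k))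
  sumTo-multiples h z zero    = refl
  sumTo-multiples h z (suc m) = trans (step k refl) (cong (_+ h (suc m ℕ.* k)) (sumTo-multiples h z m))
    where
    step : ∀ k′ → k′ ≡ k → sumTo (k′ ℕ.+ m ℕ.* k) h ≡ sumTo (m ℕ.* k) h + h (k ℕ.+ m ℕ.* k)
    step zero    e = ⊥-elim (ℕ.≢-nonZero⁻¹ k (sym e))
    step (suc j) e = cong₂ _+_ (gap h (m ℕ.* k) j (λ i p q → z _ (off i m p (subst (i ℕ.<_) e (s≤s q))))) (cong (λ t → h (t ℕ.+ m ℕ.* k)) e)

  dil-⊛ : ∀ f g → dil k (f ⊛ g) ≐ dil k f ⊛ dil k g
  dil-⊛ f g = dil-char on zero-off
    where
    on : ∀ m → (dil k f ⊛ dil k g) (m ℕ.* k) ≡ (f ⊛ g) m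
    on m = trans (sumTo-multiples (λ i → dil k f i * dil k g (m ℕ.* k ℕ.∸ i)) (λ n e → trans (cong (_* dil k g (m ℕ.* k ℕ.∸ n)) (dil-∤ f e)) (ℤₚ.*-zeroˡ (dil k g (m ℕ.* k ℕ.∸ n)))) m)
                 (sumTo-cong′ m (λ j → cong₂ _*_ (dil-* f j) (trans (cong (dil k g) (sym (ℕₚ.*-distribʳ-∸ k m j))) (dil-* g (m ℕ.∸ j)))))
    zero-off : ∀ n → ¬ (n ℕ.% k ≡ 0) → (dil k f ⊛ dil k g) n ≡ + 0
    zero-off n e = sumTo-zero n go
      where
      go : ∀ i → i ℕ.≤ n → dil k f i * dil k g (n ℕ.∸ i) ≡ + 0
      go i p with i ℕ.% k ℕ.≟ 0
      ... | no q  = ℤₚ.*-zeroˡ (dil k g (n ℕ.∸ i))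
      ... | yes q = trans (cong (f (i ℕ./ k) *_) (dil-∤ g (λ r → e (n∣m⇒m%n≡0 n k (subst (k ∣_) (ℕₚ.m+[n∸m]≡n p) (∣m∣n⇒∣m+n (m%n≡0⇒n∣m i k q) (m%n≡0⇒n∣m (n ℕ.∸ i) k r))))))) (ℤₚ.*-zeroʳ (f (i ℕ./ k)))

  dil-mono : ∀ a → dil k (mono a) ≐ mono (a ℕ.* k)
  dil-mono a = dil-char on λ n e → δ-≢ (λ p → e (trans (cong (ℕ._% k) p) (ℕD.m*n%n≡0 a k)))
    where
    on : ∀ m → δ (m ℕ.* k) (a ℕ.* k) ≡ δ m a
    on m with m ℕ.≟ a
    ... | yes refl = δ-refl (m ℕ.* k)
    ... | no  p    = δ-≢ (λ q → p (ℕₚ.*-cancelʳ-≡ m a k q))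

dil-dil : ∀ a b .{{_ : NonZero a}} .{{_ : NonZero b}} .{{_ : NonZero (b ℕ.* a)}} f → dil a (dil b f) ≐ dil (b ℕ.* a) f
dil-dil a b f = ≐-sym (dil-char (b ℕ.* a) {f = f} on zero-off)
  where
  on : ∀ m → dil a (dil b f) (m ℕ.* (b ℕ.* a)) ≡ f m
  on m = trans (cong (dil a (dil b f)) (sym (ℕₚ.*-assoc m b a))) (trans (dil-* a (dil b f) (m ℕ.* b)) (dil-* b f m))
  zero-off : ∀ n → ¬ (n ℕ.% (b ℕ.* a) ≡ 0) → dil a (dil b f) n ≡ + 0
  zero-off n e with n ℕ.% a ℕ.≟ 0
  ... | no _  = refl
  ... | yes p with (n ℕ./ a) ℕ.% b ℕ.≟ 0
  ...   | no _  = refl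
  ...   | yes q = ⊥-elim (e (trans (cong (ℕ._% (b ℕ.* a)) (trans (multiple a n p) (trans (cong (ℕ._* a) (multiple b (n ℕ./ a) q)) (ℕₚ.*-assoc (n ℕ./ a ℕ./ b) b a)))) (ℕD.m*n%n≡0 (n ℕ./ a ℕ./ b) (b ℕ.* a))))

negv-cong : ∀ {f g} → f ≐ g → negv f ≐ negv g
negv-cong h n = cong ((- + 1) ℤ.^ n *_) (h n)

negv-⊛ : ∀ f g → negv (f ⊛ g) ≐ negv f ⊛ negv g
negv-⊛ f g n = trans (sym (sumTo-*ˡ n ((- + 1) ℤ.^ n) _)) (sumTo-cong n go)
  where
  lem : ∀ a b x y → a * b * (x * y) ≡ a * x * (b * y)
  lem = solve-∀
  go : ∀ i → i ℕ.≤ n → (- + 1) ℤ.^ n * (f i * g (n ℕ.∸ i)) ≡ negv f i * negv g (n ℕ.∸ i)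
  go i p = trans (cong (_* (f i * g (n ℕ.∸ i))) (trans (cong ((- + 1) ℤ.^_) (sym (ℕₚ.m+[n∸m]≡n p))) (ℤₚ.^-distribˡ-+-* (- + 1) i (n ℕ.∸ i)))) (lem ((- + 1) ℤ.^ i) ((- + 1) ℤ.^ (n ℕ.∸ i)) (f i) (g (n ℕ.∸ i)))

-1^even : ∀ m → (- + 1) ℤ.^ (m ℕ.* 2) ≡ + 1
-1^even zero    = refl
-1^even (suc m) = trans (lem ((- + 1) ℤ.^ (m ℕ.* 2))) (-1^even m)
  where
  lem : ∀ x → - + 1 * (- + 1 * x) ≡ x
  lem = solve-∀

negv-involutive : ∀ f → negv (negv f) ≐ f
negv-involutive f n = trans (sym (ℤₚ.*-assoc ((- + 1) ℤ.^ n) _ (f n))) (trans (cong (_* f n) (trans (sym (ℤₚ.^-distribˡ-+-* (- + 1) n n)) (trans (cong ((- + 1) ℤ.^_) (trans (cong (n ℕ.+_) (sym (ℕₚ.+-identityʳ n))) (ℕₚ.*-comm 2 n))) (-1^even n)))) (ℤₚ.*-identityˡ (f n)))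

negv-even : ∀ f → negv (dil 2 f) ≐ dil 2 f
negv-even f n with n ℕ.% 2 ℕ.≟ 0
... | no _  = ℤₚ.*-zeroʳ ((- + 1) ℤ.^ n)
... | yes p = trans (cong (_* f (n ℕ./ 2)) (trans (cong ((- + 1) ℤ.^_) (multiple 2 n p)) (-1^even (n ℕ./ 2)))) (ℤₚ.*-identityˡ _)

sumTo-last : ∀ n (h : ℕ → ℤ) → (∀ i → i ℕ.< n → h i ≡ + 0) → sumTo n h ≡ h n
sumTo-last zero    h z = refl
sumTo-last (suc n) h z = trans (cong (_+ h (suc n)) (sumTo-zero n (λ i p → z i (s≤s p)))) (ℤₚ.+-identityˡ _)

-- Strong induction on the degree: once the lower coefficients of `g` vanish, the coefficient of
-- degree `i` in the product is `g i * f 0`.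
⊛-≐0 : ∀ f g → ¬ (f 0 ≡ + 0) → f ⊛ g ≐ zeroS → g ≐ zeroS
⊛-≐0 f g f0 p n = below (suc n) n ℕₚ.≤-refl
  where
  below : ∀ m i → i ℕ.< m → g i ≡ + 0
  below (suc m) i (s≤s i≤m) with ℤₚ.i*j≡0⇒i≡0∨j≡0 (g i) e
    where
    e : g i * f 0 ≡ + 0
    e = trans (cong (λ t → g i * f t) (sym (ℕₚ.n∸n≡0 i))) (trans (sym (sumTo-last i (λ j → g j * f (i ℕ.∸ j)) (λ j q → trans (cong (_* f (i ℕ.∸ j)) (below m j (ℕₚ.<-≤-trans q i≤m))) (ℤₚ.*-zeroˡ (f (i ℕ.∸ j)))))) (trans (⊛-comm g f i) (p i)))
  ... | inj₁ q = q
  ... | inj₂ q = ⊥-elim (f0 q)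

cancelˡ : ∀ f {g h} → ¬ (f 0 ≡ + 0) → f ⊛ g ≐ f ⊛ h → g ≐ h
cancelˡ f {g} {h} f0 p n = lem _ _ (⊛-≐0 f (g ⊖ h) f0 (λ m → trans (e m) (trans (cong (_- (f ⊛ h) m) (p m)) (ℤₚ.+-inverseʳ ((f ⊛ h) m)))) n)
  where
  e : f ⊛ (g ⊖ h) ≐ (f ⊛ g) ⊖ (f ⊛ h)
  e = solve 3 (λ f g h → f :* (g :- h) := f :* g :- f :* h) ≐-refl f g h
  lem : ∀ a b → a - b ≡ + 0 → a ≡ b
  lem a b q = ℤₚ.i-j≡0⇒i≡j a b q

scale-cst : ∀ c f → scale c f ≐ cst c ⊛ f
scale-cst c f = ≐-sym (≐-trans (⊛-scaleˡ c one f) (λ n → cong (c *_) (⊛-identityˡ f n)))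

-- The factor `f ⊕ g` of f² - g² has constant term 2, so it can be cancelled.
sqrt-unique : ∀ f g → f 0 ≡ + 1 → g 0 ≡ + 1 → f ⊛ f ≐ g ⊛ g → f ≐ g
sqrt-unique f g f0 g0 p = cancelˡ (f ⊕ g) (λ q → ⊥-elim (absurd (trans (sym (cong₂ _+_ f0 g0)) q)))
  (≐-trans (solve 2 (λ f g → (f :+ g) :* f := f :* f :+ f :* g) ≐-refl f g) (≐-trans (λ n → cong (_+ (f ⊛ g) n) (p n)) (solve 2 (λ f g → g :* g :+ f :* g := (f :+ g) :* g) ≐-refl f g)))
  where
  absurd : ¬ (+ 2 ≡ + 0)
  absurd ()

-- Finite sums of series and agreement up to a given order.

infix 8 1-_
1-_ : Series → Series
1- x = cst (+ 1) ⊖ x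

one≐ : one ≐ cst (+ 1)
one≐ n = sym (ℤₚ.*-identityˡ (one n))

⊕-cong : ∀ {f f′ g g′} → f ≐ f′ → g ≐ g′ → f ⊕ g ≐ f′ ⊕ g′
⊕-cong p q n = cong₂ _+_ (p n) (q n)

⊖-cong : ∀ {f f′ g g′} → f ≐ f′ → g ≐ g′ → f ⊖ g ≐ f′ ⊖ g′
⊖-cong p q n = cong₂ _-_ (p n) (q n)

1-cong : ∀ {f g} → f ≐ g → 1- f ≐ 1- g
1-cong p n = cong (λ t → cst (+ 1) n - t) (p n)

⊛-congˡ : ∀ f {g g′} → g ≐ g′ → f ⊛ g ≐ f ⊛ g′
⊛-congˡ f p = ⊛-cong {f} {f} ≐-refl p

⊛-congʳ : ∀ {f f′} g → f ≐ f′ → f ⊛ g ≐ f′ ⊛ g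
⊛-congʳ g p = ⊛-cong {g = g} {g} p ≐-refl

Ss : ℕ → (ℕ → Series) → Series
Ss zero    f = f 0
Ss (suc n) f = Ss n f ⊕ f (suc n)

Ss-at : ∀ n f i → Ss n f i ≡ sumTo n (λ j → f j i)
Ss-at zero    f i = refl
Ss-at (suc n) f i = cong (_+ f (suc n) i) (Ss-at n f i)

Ss-cong : ∀ n {f g} → (∀ j → j ℕ.≤ n → f j ≐ g j) → Ss n f ≐ Ss n g
Ss-cong n {f} {g} h i = trans (Ss-at n f i) (trans (sumTo-cong n (λ j p → h j p i)) (sym (Ss-at n g i)))

Ss-⊕ : ∀ n f g → Ss n (λ j → f j ⊕ g j) ≐ Ss n f ⊕ Ss n g
Ss-⊕ n f g i = trans (Ss-at n _ i) (trans (sumTo-+ n _ _) (sym (cong₂ _+_ (Ss-at n f i) (Ss-at n g i))))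

Ss-⊛ : ∀ n h f → Ss n (λ j → h ⊛ f j) ≐ h ⊛ Ss n f
Ss-⊛ zero    h f = ≐-refl
Ss-⊛ (suc n) h f = ≐-trans (⊕-cong (Ss-⊛ n h f) ≐-refl) (≐-sym (⊛-distribˡ h (Ss n f) (f (suc n))))

Ss-head : ∀ n f → Ss (suc n) f ≐ f 0 ⊕ Ss n (λ j → f (suc j))
Ss-head n f i = trans (Ss-at (suc n) f i) (trans (sumTo-head n (λ j → f j i)) (cong (λ t → f 0 i + t) (sym (Ss-at n (λ j → f (suc j)) i))))

Ss-triangle : ∀ n (f : ℕ → ℕ → Series) → Ss n (λ s → Ss s (λ j → f j (s ℕ.∸ j))) ≐ Ss n (λ j → Ss (n ℕ.∸ j) (f j))
Ss-triangle zero    f = ≐-refl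
Ss-triangle (suc n) f i = begin
  Ss n (λ s → Ss s (λ j → f j (s ℕ.∸ j))) i + Ss (suc n) (λ j → f j (suc n ℕ.∸ j)) i
    ≡⟨ cong (_+ Ss (suc n) (λ j → f j (suc n ℕ.∸ j)) i) (Ss-triangle n f i) ⟩
  Ss n (λ j → Ss (n ℕ.∸ j) (f j)) i + (Ss n (λ j → f j (suc n ℕ.∸ j)) i + f (suc n) (n ℕ.∸ n) i)
    ≡⟨ sym (ℤₚ.+-assoc (Ss n (λ j → Ss (n ℕ.∸ j) (f j)) i) _ _) ⟩
  Ss n (λ j → Ss (n ℕ.∸ j) (f j)) i + Ss n (λ j → f j (suc n ℕ.∸ j)) i + f (suc n) (n ℕ.∸ n) i
    ≡⟨ cong₂ _+_ (trans (sym (Ss-⊕ n (λ j → Ss (n ℕ.∸ j) (f j)) (λ j → f j (suc n ℕ.∸ j)) i)) (Ss-cong n (λ j p i → same j p i) i)) (last (n ℕ.∸ n) (ℕₚ.n∸n≡0 n)) ⟩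
  Ss n (λ j → Ss (suc n ℕ.∸ j) (f j)) i + Ss (n ℕ.∸ n) (f (suc n)) i ∎
  where
  open ≡-Reasoning
  same : ∀ j → j ℕ.≤ n → Ss (n ℕ.∸ j) (f j) ⊕ f j (suc n ℕ.∸ j) ≐ Ss (suc n ℕ.∸ j) (f j)
  same j p rewrite ℕₚ.+-∸-assoc 1 p = ≐-refl
  last : ∀ k → k ≡ 0 → f (suc n) k i ≡ Ss k (f (suc n)) i
  last zero refl = refl

Ss-telescope : ∀ m (h : ℕ → Series) → Ss m (λ s → h (suc s) ⊖ h s) ≐ h (suc m) ⊖ h 0
Ss-telescope zero    h = ≐-refl
Ss-telescope (suc m) h = ≐-trans (⊕-cong (Ss-telescope m h) ≐-refl) (λ i → lem (h (suc m) i) (h 0 i) (h (suc (suc m)) i))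
  where
  lem : ∀ a b c → a - b + (c - a) ≡ c - b
  lem = solve-∀

infix 4 _≈[_]_
-- Congruence modulo q^{m+1}. It replaces convergence: an identity between infinite sums or products
-- follows if, for every `m`, some finite identity implies it up to order `m`.
_≈[_]_ : Series → ℕ → Series → Set
f ≈[ m ] g = ∀ i → i ℕ.≤ m → f i ≡ g i

≈-trans : ∀ {m f g h} → f ≈[ m ] g → g ≈[ m ] h → f ≈[ m ] h
≈-trans p q i r = trans (p i r) (q i r)

≈-sym : ∀ {m f g} → f ≈[ m ] g → g ≈[ m ] f
≈-sym p i r = sym (p i r)

≐⇒≈ : ∀ {m f g} → f ≐ g → f ≈[ m ] g
≐⇒≈ p i _ = p i

≈-⊛ : ∀ {m f f′ g g′} → f ≈[ m ] f′ → g ≈[ m ] g′ → f ⊛ g ≈[ m ] f′ ⊛ g′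
≈-⊛ p q i r = sumTo-cong i (λ j s → cong₂ _*_ (p j (ℕₚ.≤-trans s r)) (q (i ℕ.∸ j) (ℕₚ.≤-trans (ℕₚ.m∸n≤m i j) r)))

≈-⊛ˡ : ∀ {m} f {g g′} → g ≈[ m ] g′ → f ⊛ g ≈[ m ] f ⊛ g′
≈-⊛ˡ f = ≈-⊛ {f = f} {f} (λ _ _ → refl)

≈-⊛ʳ : ∀ {m f f′} g → f ≈[ m ] f′ → f ⊛ g ≈[ m ] f′ ⊛ g
≈-⊛ʳ g p = ≈-⊛ {g = g} {g} p (λ _ _ → refl)

≈-0 : ∀ {m} f g → f ≈[ m ] zeroS → f ⊛ g ≈[ m ] zeroS
≈-0 f g p = ≈-trans (≈-⊛ {f = f} {zeroS} {g} {g} p (λ _ _ → refl)) (≐⇒≈ (⊛-zeroˡ g))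

mono-≈0 : ∀ {m k} → m ℕ.< k → mono k ≈[ m ] zeroS
mono-≈0 p i q = δ-≢ (λ e → ℕₚ.<⇒≢ (ℕₚ.≤-<-trans q p) e)

≈-Ss : ∀ {m} n {f g} → (∀ j → j ℕ.≤ n → f j ≈[ m ] g j) → Ss n f ≈[ m ] Ss n g
≈-Ss n {f} {g} h i p = trans (Ss-at n f i) (trans (sumTo-cong n (λ j q → h j q i p)) (sym (Ss-at n g i)))

≈-Ss-head : ∀ {m} n f → (∀ j → f (suc j) ≈[ m ] zeroS) → Ss n f ≈[ m ] f 0
≈-Ss-head zero    f h i p = refl
≈-Ss-head (suc n) f h i p = trans (cong₂ _+_ (≈-Ss-head n f h i p) (h n i p)) (ℤₚ.+-identityʳ (f 0 i))

≈-Ss-stable : ∀ {m} k f → (∀ j → m ℕ.< j → f j ≈[ m ] zeroS) → Ss (k ℕ.+ m) f ≈[ m ] Ss m f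
≈-Ss-stable zero    f h i p = refl
≈-Ss-stable {m} (suc k) f h i p = trans (cong₂ _+_ (≈-Ss-stable k f h i p) (h (suc k ℕ.+ m) (s≤s (ℕₚ.m≤n+m m k)) i p)) (ℤₚ.+-identityʳ (Ss m f i))

≈-dil : ∀ {m} k .{{_ : NonZero k}} {f g} → f ≈[ m ] g → dil k f ≈[ m ] dil k g
≈-dil k h i p with i ℕ.% k ℕ.≟ 0
... | yes _ = h (i ℕ./ k) (ℕₚ.≤-trans (ℕD.m/n≤m i k) p)
... | no  _ = refl

-- The diagonal limit of a sum whose j-th term has order at least j.
lim : (ℕ → Series) → Series
lim f i = Ss i f i

lim-≈ : ∀ f → (∀ m j → m ℕ.< j → f j ≈[ m ] zeroS) → ∀ m → lim f ≈[ m ] Ss m f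
lim-≈ f h m i p = trans (sym (≈-Ss-stable (m ℕ.∸ i) f (h i) i ℕₚ.≤-refl)) (cong (λ t → Ss t f i) (ℕₚ.m∸n+n≡m p))

-- Finite q-factorials and their inverses.

fac : ∀ k → one ⊖ mono k ≐ 1- mono k
fac k n = cong (_- mono k n) (one≐ n)

-- The dilation by `suc k` of (1 - q)(1 + q + q² + ...) = 1.
geom-inverse : ∀ k → 1- mono (suc k) ⊛ geom (suc k) ≐ one
geom-inverse k = begin
  1- mono (suc k) ⊛ geom (suc k)         ≈⟨ ⊛-cong (≐-sym (fac (suc k))) as-dil ⟩
  (one ⊖ mono (suc k)) ⊛ dil (suc k) ones ≈⟨ ⊛-congʳ (dil (suc k) ones) (≐-sym (≐-trans (dil-⊕ (suc k) one (⊝ mono 1)) (⊕-cong (dil-mono (suc k) 0) (≐-trans (dil-⊝ (suc k) (mono 1)) (λ n → cong -_ (trans (dil-mono (suc k) 1 n) (cong (λ t → mono t n) (ℕₚ.*-identityˡ (suc k))))))))) ⟩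
  dil (suc k) (one ⊖ mono 1) ⊛ dil (suc k) ones ≈⟨ ≐-sym (dil-⊛ (suc k) (one ⊖ mono 1) ones) ⟩
  dil (suc k) ((one ⊖ mono 1) ⊛ ones)    ≈⟨ dil-cong (suc k) base ⟩
  dil (suc k) one                        ≈⟨ dil-mono (suc k) 0 ⟩
  one ∎
  where
  open SR
  ones : Series
  ones _ = + 1
  as-dil : geom (suc k) ≐ dil (suc k) ones
  as-dil n with n ℕ.% suc k ℕ.≟ 0
  ... | yes _ = refl
  ... | no  _ = refl
  diff : ones ⊖ shift 1 ones ≐ one
  diff zero    = refl
  diff (suc n) = trans (cong (λ t → + 1 - t) (trans (shift-suc 0 ones n) (shift-+ 0 ones n))) refl
  base : (one ⊖ mono 1) ⊛ ones ≐ one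
  base = ≐-trans (⊛-congʳ ones (fac 1)) (≐-trans (solve 2 (λ x o → (con (+ 1) :- x) :* o := o :- x :* o) ≐-refl (mono 1) ones) (≐-trans (⊖-cong {ones} ≐-refl (≐-sym (shift-mono 1 ones))) diff))

inv : ℕ → Series
inv = invQPoch

inv-step : ∀ n → 1- mono (suc n) ⊛ inv (suc n) ≐ inv n
inv-step n = ≐-trans (solve 3 (λ a b c → a :* (b :* c) := b :* (a :* c)) ≐-refl (1- mono (suc n)) (inv n) (geom (suc n))) (≐-trans (⊛-congˡ (inv n) (geom-inverse n)) (≐-trans (⊛-comm (inv n) one) (⊛-identityˡ (inv n))))

qPoch-inv : ∀ n → qPoch n ⊛ inv n ≐ one
qPoch-inv zero    = ⊛-identityˡ one
qPoch-inv (suc n) = begin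
  (qPoch n ⊛ (one ⊖ mono (suc n))) ⊛ inv (suc n) ≈⟨ ⊛-congʳ (inv (suc n)) (⊛-congˡ (qPoch n) (fac (suc n))) ⟩
  (qPoch n ⊛ 1- mono (suc n)) ⊛ inv (suc n)      ≈⟨ ⊛-assoc (qPoch n) (1- mono (suc n)) (inv (suc n)) ⟩
  qPoch n ⊛ (1- mono (suc n) ⊛ inv (suc n))      ≈⟨ ⊛-congˡ (qPoch n) (inv-step n) ⟩
  qPoch n ⊛ inv n                                ≈⟨ qPoch-inv n ⟩
  one ∎
  where open SR

1-≈ : ∀ {m k} → m ℕ.< k → 1- mono k ≈[ m ] cst (+ 1)
1-≈ {m} {k} p i q = trans (cong (λ t → cst (+ 1) i - t) (mono-≈0 p i q)) (ℤₚ.+-identityʳ (cst (+ 1) i))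

qPoch-stable : ∀ m k → qPoch (k ℕ.+ m) ≈[ m ] qPoch m
qPoch-stable m zero    i p = refl
qPoch-stable m (suc k) = ≈-trans (≈-⊛ {f = qPoch (k ℕ.+ m)} {qPoch m} (qPoch-stable m k) (≈-trans (≐⇒≈ (fac (suc k ℕ.+ m))) (1-≈ (s≤s (ℕₚ.m≤n+m m k))))) (≐⇒≈ (solve 1 (λ x → x :* con (+ 1) := x) ≐-refl (qPoch m)))

qPoch-E : ∀ m n → m ℕ.≤ n → qPoch n ≈[ m ] E
qPoch-E m n p i q = trans (cong (λ t → qPoch t i) (sym (ℕₚ.m∸n+n≡m (ℕₚ.≤-trans q p)))) (qPoch-stable i (n ℕ.∸ i) i ℕₚ.≤-refl)

E-inv : ∀ m n → m ℕ.≤ n → E ⊛ inv n ≈[ m ] one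
E-inv m n p = ≈-trans (≈-⊛ʳ (inv n) (≈-sym (qPoch-E m n p))) (≐⇒≈ (qPoch-inv n))

-- Gauss's product formulas for φ(-q) and ψ(q).

1S : Series
1S = cst (+ 1)

1S-⊛ : ∀ f → 1S ⊛ f ≐ f
1S-⊛ f = solve 1 (λ x → con (+ 1) :* x := x) ≐-refl f

pw : Series → ℕ → Series
pw f zero    = 1S
pw f (suc n) = f ⊛ pw f n

pw-⊛ : ∀ f g n → pw (f ⊛ g) n ≐ pw f n ⊛ pw g n
pw-⊛ f g zero    = ≐-sym (1S-⊛ 1S)
pw-⊛ f g (suc n) = ≐-trans (⊛-congˡ (f ⊛ g) (pw-⊛ f g n)) (solve 4 (λ a b c d → (a :* b) :* (c :* d) := (a :* c) :* (b :* d)) ≐-refl f g (pw f n) (pw g n))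

pw-cong : ∀ {f g} n → f ≐ g → pw f n ≐ pw g n
pw-cong zero    p = ≐-refl
pw-cong (suc n) p = ⊛-cong p (pw-cong n p)

pw-mono : ∀ k n → pw (mono k) n ≐ mono (n ℕ.* k)
pw-mono k zero    = ≐-sym one≐
pw-mono k (suc n) = ≐-trans (⊛-congˡ (mono k) (pw-mono k n)) (≐-sym (mono-+ k (n ℕ.* k)))

pw-cst : ∀ c n → pw (cst c) n ≐ cst (c ℤ.^ n)
pw-cst c zero    = ≐-refl
pw-cst c (suc n) = ≐-trans (⊛-congˡ (cst c) (pw-cst c n)) (≐-trans (⊛-scaleˡ c one (cst (c ℤ.^ n))) (λ i → trans (cong (c *_) (⊛-identityˡ (cst (c ℤ.^ n)) i)) (sym (ℤₚ.*-assoc c (c ℤ.^ n) (one i)))))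

-- Shanks' finite form of Gauss's theta identities: with r = a x and x_n = rⁿ x,
--   (r;r)_n Σ_{s≤n} (a;r)_s/(r;r)_s x_n^s = (x;r)_n Σ_{s≤n} t_s,
-- by telescoping the difference of consecutive n.
module Shanks (a x : Series) (iC : ℕ → Series) (iC0 : iC 0 ≐ 1S)
  (iC-step : ∀ s → 1- pw (a ⊛ x) (suc s) ⊛ iC (suc s) ≐ iC s)
  (t : ℕ → Series) (t0 : t 0 ≐ 1S) where

  R X C D N v : ℕ → Series
  R = pw (a ⊛ x)
  X n = R n ⊛ x
  C zero    = 1S
  C (suc n) = C n ⊛ 1- R (suc n)
  D zero    = 1S
  D (suc n) = D n ⊛ 1- X n
  N zero    = 1S
  N (suc n) = N n ⊛ 1- (a ⊛ R n)
  v s = N s ⊛ iC s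

  v-step : ∀ s → 1- R (suc s) ⊛ v (suc s) ≐ 1- (a ⊛ R s) ⊛ v s
  v-step s = ≐-trans (solve 4 (λ r n f i → r :* ((n :* f) :* i) := (f :* n) :* (r :* i)) ≐-refl (1- R (suc s)) (N s) (1- (a ⊛ R s)) (iC (suc s))) (≐-trans (⊛-congˡ (1- (a ⊛ R s) ⊛ N s) (iC-step s)) (⊛-assoc (1- (a ⊛ R s)) (N s) (iC s)))

  C-v : ∀ n → C n ⊛ v n ≐ N n
  C-v zero    = ≐-trans (1S-⊛ (v 0)) (≐-trans (1S-⊛ (iC 0)) iC0)
  C-v (suc n) = begin
    (C n ⊛ 1- R (suc n)) ⊛ v (suc n)   ≈⟨ ⊛-assoc (C n) (1- R (suc n)) (v (suc n)) ⟩
    C n ⊛ (1- R (suc n) ⊛ v (suc n))   ≈⟨ ⊛-congˡ (C n) (v-step n) ⟩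
    C n ⊛ (1- (a ⊛ R n) ⊛ v n)         ≈⟨ solve 3 (λ c f v → c :* (f :* v) := (c :* v) :* f) ≐-refl (C n) (1- (a ⊛ R n)) (v n) ⟩
    (C n ⊛ v n) ⊛ 1- (a ⊛ R n)         ≈⟨ ⊛-congʳ (1- (a ⊛ R n)) (C-v n) ⟩
    N (suc n) ∎
    where open SR

  module _ (y b : Series) (b≐ : b ≐ a ⊛ y) where
    h : ℕ → Series
    h s = 1- R s ⊛ (v s ⊛ pw y s)

    -- The series F(y) = Σ (a;r)_s/(r;r)_s y^s satisfies (1 - ay) F(ry) = (1 - y) F(y). Termwise the
    -- difference of the two sides is `h (suc s) ⊖ h s`, so for the truncated series only a boundary
    -- term survives.
    h-step : ∀ s → ((1- b) ⊛ R s ⊖ 1- y) ⊛ (v s ⊛ pw y s) ≐ h (suc s) ⊖ h s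
    h-step s = begin
      ((1- b) ⊛ R s ⊖ 1- y) ⊛ (v s ⊛ pw y s)
        ≈⟨ ⊛-congʳ (v s ⊛ pw y s) (⊖-cong (⊛-congʳ (R s) (1-cong b≐)) (≐-refl {1- y})) ⟩
      ((1- (a ⊛ y)) ⊛ R s ⊖ 1- y) ⊛ (v s ⊛ pw y s)
        ≈⟨ solve 5 (λ a y r v p → ((con (+ 1) :- a :* y) :* r :- (con (+ 1) :- y)) :* (v :* p) := (y :* p) :* ((con (+ 1) :- a :* r) :* v) :- (con (+ 1) :- r) :* (v :* p)) ≐-refl a y (R s) (v s) (pw y s) ⟩
      (y ⊛ pw y s) ⊛ (1- (a ⊛ R s) ⊛ v s) ⊖ h s
        ≈⟨ ⊖-cong (⊛-congˡ (y ⊛ pw y s) (≐-sym (v-step s))) (≐-refl {h s}) ⟩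
      (y ⊛ pw y s) ⊛ (1- R (suc s) ⊛ v (suc s)) ⊖ h s
        ≈⟨ ⊖-cong (solve 3 (λ p r v → p :* (r :* v) := r :* (v :* p)) ≐-refl (y ⊛ pw y s) (1- R (suc s)) (v (suc s))) (≐-refl {h s}) ⟩
      h (suc s) ⊖ h s ∎
      where open SR

    h-sum : ∀ m → Ss m (λ s → ((1- b) ⊛ R s ⊖ 1- y) ⊛ (v s ⊛ pw y s)) ≐ h (suc m)
    h-sum m = ≐-trans (Ss-cong m (λ s _ → h-step s)) (≐-trans (Ss-telescope m h) (≐-trans (⊖-cong (≐-refl {h (suc m)}) h0) (λ i → ℤₚ.+-identityʳ (h (suc m) i))))
      where
      h0 : h 0 ≐ zeroS
      h0 = ≐-trans (⊛-congʳ (v 0 ⊛ 1S) (λ i → ℤₚ.+-inverseʳ (1S i))) (⊛-zeroˡ (v 0 ⊛ 1S))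

  W : ℕ → Series → Series
  W m y = Ss m (λ s → v s ⊛ pw y s)

  X-pw : ∀ n s → pw (X (suc n)) s ≐ R s ⊛ pw (X n) s
  X-pw n s = ≐-trans (pw-cong s (⊛-assoc (a ⊛ x) (R n) x)) (pw-⊛ (a ⊛ x) (X n) s)

  -- Going from `n` to `suc n` replaces y = `X n` by ry, which the truncated difference equation
  -- controls; its boundary term and the new last summand of `W` combine to N_{n+1} (1 + r^{n+1})
  -- y^{n+1}, and the hypothesis evaluates exactly this.
  shanks : (∀ n → N (suc n) ⊛ ((cst (+ 1) ⊕ R (suc n)) ⊛ pw (X n) (suc n)) ≐ D (suc n) ⊛ t (suc n)) → ∀ n → C n ⊛ W n (X n) ≐ D n ⊛ Ss n t
  shanks ht zero    = ⊛-congˡ 1S (≐-trans (⊛-comm (v 0) 1S) (≐-trans (1S-⊛ (v 0)) (≐-trans (1S-⊛ (iC 0)) (≐-trans iC0 (≐-sym t0)))))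
  shanks ht (suc n) = begin
    (C n ⊛ 1- b) ⊛ (W n (X (suc n)) ⊕ v (suc n) ⊛ pw (X (suc n)) (suc n))
      ≈⟨ ⊛-congˡ (C n ⊛ 1- b) (⊕-cong (Ss-cong n (λ s _ → ≐-trans (⊛-congˡ (v s) (X-pw n s)) (solve 3 (λ v r p → v :* (r :* p) := r :* (v :* p)) ≐-refl (v s) (R s) (pw y s)))) (⊛-congˡ (v (suc n)) (X-pw n (suc n)))) ⟩
    (C n ⊛ 1- b) ⊛ (S ⊕ v (suc n) ⊛ (b ⊛ p))
      ≈⟨ solve 6 (λ c b s v p w → (c :* (con (+ 1) :- b)) :* (s :+ v :* (b :* p)) := c :* ((con (+ 1) :- b) :* s :- w) :+ c :* w :+ (c :* (con (+ 1) :- b)) :* (v :* (b :* p))) ≐-refl (C n) b S (v (suc n)) p (1- y ⊛ W n y) ⟩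
    C n ⊛ ((1- b) ⊛ S ⊖ 1- y ⊛ W n y) ⊕ C n ⊛ (1- y ⊛ W n y) ⊕ (C n ⊛ 1- b) ⊛ (v (suc n) ⊛ (b ⊛ p))
      ≈⟨ ⊕-cong (⊕-cong (⊛-congˡ (C n) main) (solve 3 (λ c y w → c :* (y :* w) := (c :* w) :* y) ≐-refl (C n) (1- y) (W n y))) (≐-refl {(C n ⊛ 1- b) ⊛ (v (suc n) ⊛ (b ⊛ p))}) ⟩
    C n ⊛ (1- b ⊛ (v (suc n) ⊛ p)) ⊕ (C n ⊛ W n y) ⊛ 1- y ⊕ (C n ⊛ 1- b) ⊛ (v (suc n) ⊛ (b ⊛ p))
      ≈⟨ solve 5 (λ c b v p e → c :* ((con (+ 1) :- b) :* (v :* p)) :+ e :+ (c :* (con (+ 1) :- b)) :* (v :* (b :* p)) := e :+ ((c :* (con (+ 1) :- b)) :* v) :* ((con (+ 1) :+ b) :* p)) ≐-refl (C n) b (v (suc n)) p ((C n ⊛ W n y) ⊛ 1- y) ⟩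
    (C n ⊛ W n y) ⊛ 1- y ⊕ (C (suc n) ⊛ v (suc n)) ⊛ ((cst (+ 1) ⊕ b) ⊛ p)
      ≈⟨ ⊕-cong (⊛-congʳ (1- y) (shanks ht n)) (≐-trans (⊛-congʳ ((cst (+ 1) ⊕ b) ⊛ p) (C-v (suc n))) (ht n)) ⟩
    (D n ⊛ Ss n t) ⊛ 1- y ⊕ D (suc n) ⊛ t (suc n)
      ≈⟨ solve 4 (λ d s y t → (d :* s) :* (con (+ 1) :- y) :+ (d :* (con (+ 1) :- y)) :* t := (d :* (con (+ 1) :- y)) :* (s :+ t)) ≐-refl (D n) (Ss n t) y (t (suc n)) ⟩
    D (suc n) ⊛ Ss (suc n) t ∎
    where
    open SR
    y b p S : Series
    y = X n
    b = R (suc n)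
    p = pw y (suc n)
    S = Ss n (λ s → R s ⊛ (v s ⊛ pw y s))
    b≐ : b ≐ a ⊛ y
    b≐ = solve 3 (λ a x r → (a :* x) :* r := a :* (r :* x)) ≐-refl a x (R n)
    main : (1- b) ⊛ S ⊖ 1- y ⊛ W n y ≐ 1- b ⊛ (v (suc n) ⊛ p)
    main = begin
      (1- b) ⊛ S ⊖ 1- y ⊛ W n y
        ≈⟨ solve 4 (λ b s y w → b :* s :- y :* w := b :* s :+ (:- y) :* w) ≐-refl (1- b) S (1- y) (W n y) ⟩
      (1- b) ⊛ S ⊕ (⊝ (1- y)) ⊛ W n y
        ≈⟨ ⊕-cong (≐-sym (Ss-⊛ n (1- b) (λ s → R s ⊛ (v s ⊛ pw y s)))) (≐-sym (Ss-⊛ n (⊝ (1- y)) (λ s → v s ⊛ pw y s))) ⟩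
      Ss n (λ s → (1- b) ⊛ (R s ⊛ (v s ⊛ pw y s))) ⊕ Ss n (λ s → (⊝ (1- y)) ⊛ (v s ⊛ pw y s))
        ≈⟨ ≐-sym (Ss-⊕ n (λ s → (1- b) ⊛ (R s ⊛ (v s ⊛ pw y s))) (λ s → (⊝ (1- y)) ⊛ (v s ⊛ pw y s))) ⟩
      Ss n (λ s → (1- b) ⊛ (R s ⊛ (v s ⊛ pw y s)) ⊕ (⊝ (1- y)) ⊛ (v s ⊛ pw y s))
        ≈⟨ Ss-cong n (λ s _ → solve 4 (λ b r y u → b :* (r :* u) :+ (:- y) :* u := (b :* r :- y) :* u) ≐-refl (1- b) (R s) (1- y) (v s ⊛ pw y s)) ⟩
      Ss n (λ s → ((1- b) ⊛ R s ⊖ 1- y) ⊛ (v s ⊛ pw y s))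
        ≈⟨ h-sum y b b≐ n ⟩
      1- b ⊛ (v (suc n) ⊛ p) ∎

  W-limit : ∀ {m} n y → y ≈[ m ] zeroS → W n y ≈[ m ] 1S
  W-limit n y p = ≈-trans (≈-Ss-head n (λ s → v s ⊛ pw y s) (λ s → ≈-trans (≐⇒≈ (solve 3 (λ v y p → v :* (y :* p) := y :* (v :* p)) ≐-refl (v (suc s)) y (pw y s))) (≈-0 y (v (suc s) ⊛ pw y s) p))) (≐⇒≈ (≐-trans (⊛-comm (v 0) 1S) (≐-trans (1S-⊛ (v 0)) (≐-trans (1S-⊛ (iC 0)) iC0))))

1-dil : ∀ k .{{_ : NonZero k}} a → dil k (one ⊖ mono a) ≐ 1- mono (a ℕ.* k)
1-dil k a = ≐-trans (dil-⊕ k one (⊝ mono a)) (⊕-cong (≐-trans (dil-mono k 0) one≐) (≐-trans (dil-⊝ k (mono a)) (λ n → cong -_ (dil-mono k a n))))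

mono-cong : ∀ {a b} → a ≡ b → mono a ≐ mono b
mono-cong refl = ≐-refl

tri : ℕ → ℕ
tri zero    = 0
tri (suc n) = suc n ℕ.+ tri n

tri-double : ∀ n → tri n ℕ.+ tri n ≡ n ℕ.* suc n
tri-double zero    = refl
tri-double (suc n) = trans (lem n (tri n)) (trans (cong (2 ℕ.* suc n ℕ.+_) (tri-double n)) (lem′ n))
  where
  lem : ∀ n t → (suc n ℕ.+ t) ℕ.+ (suc n ℕ.+ t) ≡ 2 ℕ.* suc n ℕ.+ (t ℕ.+ t)
  lem = ℕR.solve-∀
  lem′ : ∀ n → 2 ℕ.* suc n ℕ.+ n ℕ.* suc n ≡ suc n ℕ.* suc (suc n)
  lem′ = ℕR.solve-∀

halve : ∀ a b → a ℕ.+ a ≡ b ℕ.+ b → a ≡ b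
halve a b e = ℕₚ.*-cancelˡ-≡ a b 2 (trans (cong (a ℕ.+_) (ℕₚ.+-identityʳ a)) (trans e (cong (b ℕ.+_) (sym (ℕₚ.+-identityʳ b)))))

n≤tri : ∀ n → n ℕ.≤ tri n
n≤tri zero    = z≤n
n≤tri (suc n) = ℕₚ.m≤m+n (suc n) (tri n)

tφ : ℕ → Series
tφ zero    = 1S
tφ (suc n) = cst (+ 2 * (- + 1) ℤ.^ suc n) ⊛ mono (suc n ℕ.* suc n)

private
  Rφ : ∀ s → pw (cst (- + 1) ⊛ ⊝ mono 1) s ≐ mono s
  Rφ s = ≐-trans (pw-cong s (solve 1 (λ x → con (- + 1) :* (:- x) := x) ≐-refl (mono 1))) (≐-trans (pw-mono 1 s) (mono-cong (ℕₚ.*-identityʳ s)))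

  module Φ = Shanks (cst (- + 1)) (⊝ mono 1) inv one≐ (λ s → ≐-trans (⊛-congʳ (inv (suc s)) (1-cong (Rφ (suc s)))) (inv-step s)) tφ ≐-refl

  Xφ : ∀ n → Φ.X n ≐ cst (- + 1) ⊛ mono (suc n)
  Xφ n = ≐-trans (⊛-congʳ (⊝ mono 1) (Rφ n)) (≐-trans (solve 2 (λ a b → a :* (:- b) := con (- + 1) :* (b :* a)) ≐-refl (mono n) (mono 1)) (⊛-congˡ (cst (- + 1)) (≐-sym (mono-+ 1 n))))

  Nφ : ∀ n → Φ.N (suc n) ⊛ (cst (+ 1) ⊕ Φ.R (suc n)) ≐ cst (+ 2) ⊛ Φ.D (suc n)
  Nφ zero    = solve 1 (λ x → (con (+ 1) :* (con (+ 1) :- con (- + 1) :* con (+ 1))) :* (con (+ 1) :+ (con (- + 1) :* x) :* con (+ 1)) := con (+ 2) :* (con (+ 1) :* (con (+ 1) :- con (+ 1) :* x))) ≐-refl (⊝ mono 1)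
  Nφ (suc n) = ≐-trans (solve 3 (λ m r x → (m :* (con (+ 1) :- con (- + 1) :* r)) :* (con (+ 1) :+ (con (- + 1) :* x) :* r) := (m :* (con (+ 1) :+ r)) :* (con (+ 1) :- r :* x)) ≐-refl (Φ.N (suc n)) (Φ.R (suc n)) (⊝ mono 1)) (≐-trans (⊛-congʳ (1- Φ.X (suc n)) (Nφ n)) (⊛-assoc (cst (+ 2)) (Φ.D (suc n)) (1- Φ.X (suc n))))

  cst-* : ∀ a b f → cst a ⊛ (cst b ⊛ f) ≐ cst (a * b) ⊛ f
  cst-* a b f = ≐-trans (≐-sym (⊛-assoc (cst a) (cst b) f)) (⊛-congʳ f (≐-trans (⊛-scaleˡ a one (cst b)) (λ i → trans (cong (a *_) (⊛-identityˡ (cst b) i)) (sym (ℤₚ.*-assoc a b (one i))))))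

  φ-finite : ∀ n → Φ.C n ⊛ Φ.W n (Φ.X n) ≐ Φ.D n ⊛ Ss n tφ
  φ-finite = Φ.shanks λ n → begin
    Φ.N (suc n) ⊛ ((cst (+ 1) ⊕ Φ.R (suc n)) ⊛ pw (Φ.X n) (suc n)) ≈⟨ ≐-sym (⊛-assoc (Φ.N (suc n)) (cst (+ 1) ⊕ Φ.R (suc n)) (pw (Φ.X n) (suc n))) ⟩
    (Φ.N (suc n) ⊛ (cst (+ 1) ⊕ Φ.R (suc n))) ⊛ pw (Φ.X n) (suc n) ≈⟨ ⊛-cong (Nφ n) (pow n) ⟩
    (cst (+ 2) ⊛ Φ.D (suc n)) ⊛ (cst ((- + 1) ℤ.^ suc n) ⊛ mono (suc n ℕ.* suc n)) ≈⟨ solve 3 (λ d a b → (con (+ 2) :* d) :* (a :* b) := d :* (con (+ 2) :* (a :* b))) ≐-refl (Φ.D (suc n)) (cst ((- + 1) ℤ.^ suc n)) (mono (suc n ℕ.* suc n)) ⟩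
    Φ.D (suc n) ⊛ (cst (+ 2) ⊛ (cst ((- + 1) ℤ.^ suc n) ⊛ mono (suc n ℕ.* suc n))) ≈⟨ ⊛-congˡ (Φ.D (suc n)) (cst-* (+ 2) ((- + 1) ℤ.^ suc n) (mono (suc n ℕ.* suc n))) ⟩
    Φ.D (suc n) ⊛ tφ (suc n) ∎
    where
    open SR
    pow : ∀ n → pw (Φ.X n) (suc n) ≐ cst ((- + 1) ℤ.^ suc n) ⊛ mono (suc n ℕ.* suc n)
    pow n = ≐-trans (pw-cong (suc n) (Xφ n)) (≐-trans (pw-⊛ (cst (- + 1)) (mono (suc n)) (suc n)) (⊛-cong (pw-cst (- + 1) (suc n)) (pw-mono (suc n) (suc n))))

  Cφ : ∀ n → Φ.C n ≐ qPoch n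
  Cφ zero    = ≐-sym one≐
  Cφ (suc n) = ⊛-cong (Cφ n) (≐-trans (1-cong (Rφ (suc n))) (≐-sym (fac (suc n))))

  CDφ : ∀ n → Φ.C n ⊛ Φ.D n ≐ dil 2 (qPoch n)
  CDφ zero    = ≐-trans (1S-⊛ 1S) (≐-trans (≐-sym one≐) (≐-sym (dil-mono 2 0)))
  CDφ (suc n) = begin
    (Φ.C n ⊛ 1- Φ.R (suc n)) ⊛ (Φ.D n ⊛ 1- Φ.X n) ≈⟨ ⊛-cong (⊛-congˡ (Φ.C n) (1-cong (Rφ (suc n)))) (⊛-congˡ (Φ.D n) (1-cong (Xφ n))) ⟩
    (Φ.C n ⊛ 1- m) ⊛ (Φ.D n ⊛ 1- (cst (- + 1) ⊛ m)) ≈⟨ solve 3 (λ c d m → (c :* (con (+ 1) :- m)) :* (d :* (con (+ 1) :- con (- + 1) :* m)) := (c :* d) :* (con (+ 1) :- m :* m)) ≐-refl (Φ.C n) (Φ.D n) m ⟩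
    (Φ.C n ⊛ Φ.D n) ⊛ 1- (m ⊛ m) ≈⟨ ⊛-cong (CDφ n) (1-cong (≐-trans (≐-sym (mono-+ (suc n) (suc n))) (mono-cong (trans (cong (suc n ℕ.+_) (sym (ℕₚ.+-identityʳ (suc n)))) (ℕₚ.*-comm 2 (suc n)))))) ⟩
    dil 2 (qPoch n) ⊛ 1- mono (suc n ℕ.* 2) ≈⟨ ⊛-congˡ (dil 2 (qPoch n)) (≐-sym (1-dil 2 (suc n))) ⟩
    dil 2 (qPoch n) ⊛ dil 2 (one ⊖ mono (suc n)) ≈⟨ ≐-sym (dil-⊛ 2 (qPoch n) (one ⊖ mono (suc n))) ⟩
    dil 2 (qPoch (suc n)) ∎
    where
    open SR
    m = mono (suc n)

⊛-1S : ∀ f → f ⊛ 1S ≐ f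
⊛-1S f = ≐-trans (⊛-comm f 1S) (1S-⊛ f)

tφ-order : ∀ m j → m ℕ.< j → tφ j ≈[ m ] zeroS
tφ-order m (suc j) p = ≈-trans (≐⇒≈ (⊛-comm (cst (+ 2 * (- + 1) ℤ.^ suc j)) (mono (suc j ℕ.* suc j)))) (≈-0 (mono (suc j ℕ.* suc j)) (cst (+ 2 * (- + 1) ℤ.^ suc j)) (mono-≈0 (ℕₚ.≤-trans p (ℕₚ.m≤m*n (suc j) (suc j)))))

-- The finite identity is multiplied by `Φ.C n`, because (q;q)_n (-q;q)_n = (q²;q²)_n; as n grows,
-- `Φ.X n` tends to 0 and `Φ.W` to 1.
gauss-φ : E ⊛ E ≐ dil 2 E ⊛ lim tφ
gauss-φ n = chain n ℕₚ.≤-refl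
  where
  chain : E ⊛ E ≈[ n ] dil 2 E ⊛ lim tφ
  chain = ≈-trans (≈-⊛ (≈-sym qE) (≈-sym qE))
    (≈-trans (≐⇒≈ (⊛-cong (≐-sym (Cφ n)) (≐-trans (≐-sym (Cφ n)) (≐-sym (⊛-1S (Φ.C n))))))
    (≈-trans (≈-⊛ˡ (Φ.C n) (≈-⊛ˡ (Φ.C n) (≈-sym (Φ.W-limit n (Φ.X n) (≈-trans (≐⇒≈ (≐-trans (Xφ n) (⊛-comm (cst (- + 1)) (mono (suc n))))) (≈-0 (mono (suc n)) (cst (- + 1)) (mono-≈0 ℕₚ.≤-refl)))))))
    (≈-trans (≐⇒≈ (≐-trans (⊛-congˡ (Φ.C n) (φ-finite n)) (≐-trans (≐-sym (⊛-assoc (Φ.C n) (Φ.D n) (Ss n tφ))) (⊛-congʳ (Ss n tφ) (CDφ n)))))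
    (≈-⊛ (≈-dil 2 qE) (≈-sym (lim-≈ tφ tφ-order n))))))
    where
    qE : qPoch n ≈[ n ] E
    qE = qPoch-E n n ℕₚ.≤-refl

tψ : ℕ → Series
tψ zero    = 1S
tψ (suc n) = mono (tri (suc (n ℕ.* 2))) ⊕ mono (tri (suc (suc (n ℕ.* 2))))

private
  Rψ : ∀ s → pw (mono 1 ⊛ mono 1) s ≐ mono (s ℕ.* 2)
  Rψ s = ≐-trans (pw-cong s (≐-sym (mono-+ 1 1))) (pw-mono 2 s)

  dil2-step : ∀ s → 1- pw (mono 1 ⊛ mono 1) (suc s) ⊛ dil 2 (inv (suc s)) ≐ dil 2 (inv s)
  dil2-step s = ≐-trans (⊛-congʳ (dil 2 (inv (suc s))) (≐-trans (1-cong (Rψ (suc s))) (≐-sym (1-dil 2 (suc s))))) (≐-trans (≐-sym (dil-⊛ 2 (one ⊖ mono (suc s)) (inv (suc s)))) (dil-cong 2 (≐-trans (⊛-congʳ (inv (suc s)) (fac (suc s))) (inv-step s))))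

  module Ψ = Shanks (mono 1) (mono 1) (λ s → dil 2 (inv s)) (≐-trans (dil-mono 2 0) one≐) dil2-step tψ ≐-refl

  Xψ : ∀ n → Ψ.X n ≐ mono (suc (n ℕ.* 2))
  Xψ n = ≐-trans (⊛-congʳ (mono 1) (Rψ n)) (≐-trans (≐-sym (mono-+ (n ℕ.* 2) 1)) (mono-cong (ℕₚ.+-comm (n ℕ.* 2) 1)))

  Nψ : ∀ n → Ψ.N n ≐ Ψ.D n
  Nψ zero    = ≐-refl
  Nψ (suc n) = ⊛-cong (Nψ n) (1-cong (⊛-comm (mono 1) (Ψ.R n)))

  tri-odd : ∀ n → suc n ℕ.* suc (n ℕ.* 2) ≡ tri (suc (n ℕ.* 2))
  tri-odd n = halve _ _ (trans (lem n) (sym (tri-double (suc (n ℕ.* 2)))))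
    where
    lem : ∀ n → suc n ℕ.* suc (n ℕ.* 2) ℕ.+ suc n ℕ.* suc (n ℕ.* 2) ≡ suc (n ℕ.* 2) ℕ.* suc (suc (n ℕ.* 2))
    lem = ℕR.solve-∀

  ψ-finite : ∀ n → Ψ.C n ⊛ Ψ.W n (Ψ.X n) ≐ Ψ.D n ⊛ Ss n tψ
  ψ-finite = Ψ.shanks λ n → ⊛-cong (Nψ (suc n)) (≐-trans (⊛-cong (⊕-cong (≐-refl {cst (+ 1)}) (Rψ (suc n))) (pow n)) (≐-trans (solve 2 (λ r p → (con (+ 1) :+ r) :* p := p :+ r :* p) ≐-refl (mono (suc n ℕ.* 2)) (mono (tri (suc (n ℕ.* 2))))) (⊕-cong (≐-refl {mono (tri (suc (n ℕ.* 2)))}) (≐-sym (mono-+ (suc n ℕ.* 2) (tri (suc (n ℕ.* 2))))))))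
    where
    pow : ∀ n → pw (Ψ.X n) (suc n) ≐ mono (tri (suc (n ℕ.* 2)))
    pow n = ≐-trans (pw-cong (suc n) (Xψ n)) (≐-trans (pw-mono (suc (n ℕ.* 2)) (suc n)) (mono-cong (tri-odd n)))

  Cψ : ∀ n → Ψ.C n ≐ dil 2 (qPoch n)
  Cψ zero    = ≐-sym (≐-trans (dil-mono 2 0) one≐)
  Cψ (suc n) = ≐-trans (⊛-cong (Cψ n) (≐-trans (1-cong (Rψ (suc n))) (≐-sym (1-dil 2 (suc n))))) (≐-sym (dil-⊛ 2 (qPoch n) (one ⊖ mono (suc n))))

  CDψ : ∀ n → Ψ.C n ⊛ Ψ.D n ≐ qPoch (n ℕ.* 2)
  CDψ zero    = ≐-trans (1S-⊛ 1S) (≐-sym one≐)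
  CDψ (suc n) = ≐-trans (solve 4 (λ c r d x → (c :* r) :* (d :* x) := ((c :* d) :* x) :* r) ≐-refl (Ψ.C n) (1- Ψ.R (suc n)) (Ψ.D n) (1- Ψ.X n)) (⊛-cong (⊛-cong (CDψ n) (≐-trans (1-cong (Xψ n)) (≐-sym (fac (suc (n ℕ.* 2)))))) (≐-trans (1-cong (Rψ (suc n))) (≐-sym (fac (suc (suc (n ℕ.* 2)))))))

tψ-order : ∀ m j → m ℕ.< j → tψ j ≈[ m ] zeroS
tψ-order m (suc j) p i q = trans (cong₂ _+_ (mono-≈0 (ℕₚ.≤-trans p big) i q) (mono-≈0 (ℕₚ.≤-trans p (ℕₚ.≤-trans big (ℕₚ.m≤n+m (tri (suc (j ℕ.* 2))) (suc (suc (j ℕ.* 2)))))) i q)) refl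
  where
  big : suc j ℕ.≤ tri (suc (j ℕ.* 2))
  big = ℕₚ.≤-trans (s≤s (ℕₚ.m≤m*n j 2)) (n≤tri (suc (j ℕ.* 2)))

-- The same limit in base q² with a = x = q. There `Ψ.N` and `Ψ.D` coincide, so the boundary term is
-- already a sum of two monomials, and (q²;q²)_n (q;q²)_n = (q;q)_{2n}.
gauss-ψ : dil 2 E ⊛ dil 2 E ≐ E ⊛ lim tψ
gauss-ψ n = chain n ℕₚ.≤-refl
  where
  chain : dil 2 E ⊛ dil 2 E ≈[ n ] E ⊛ lim tψ
  chain = ≈-trans (≈-⊛ (≈-dil 2 (≈-sym qE)) (≈-dil 2 (≈-sym qE)))
    (≈-trans (≐⇒≈ (⊛-cong (≐-sym (Cψ n)) (≐-trans (≐-sym (Cψ n)) (≐-sym (⊛-1S (Ψ.C n))))))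
    (≈-trans (≈-⊛ˡ (Ψ.C n) (≈-⊛ˡ (Ψ.C n) (≈-sym (Ψ.W-limit n (Ψ.X n) (≈-trans (≐⇒≈ (Xψ n)) (mono-≈0 (s≤s (ℕₚ.m≤m*n n 2))))))))
    (≈-trans (≐⇒≈ (≐-trans (⊛-congˡ (Ψ.C n) (ψ-finite n)) (≐-trans (≐-sym (⊛-assoc (Ψ.C n) (Ψ.D n) (Ss n tψ))) (⊛-congʳ (Ss n tψ) (CDψ n)))))
    (≈-⊛ (qPoch-E n (n ℕ.* 2) (ℕₚ.m≤m*n n 2)) (≈-sym (lim-≈ tψ tψ-order n))))))
    where
    qE : qPoch n ≈[ n ] E
    qE = qPoch-E n n ℕₚ.≤-refl

-- Bailey's lemma, Euler's pentagonal theorem and the Rogers-Ramanujan identities.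

-- 1/(q;q)_{k-1}, read as 0 at k = 0.
inv⁻ : ℕ → Series
inv⁻ zero    = zeroS
inv⁻ (suc k) = inv k

inv-lower : ∀ k → 1- mono k ⊛ inv k ≐ inv⁻ k
inv-lower zero    = ≐-trans (⊛-congʳ one (λ i → trans (cong (_- one i) (sym (one≐ i))) (ℤₚ.+-inverseʳ (one i)))) (⊛-zeroˡ one)
inv-lower (suc k) = inv-step k

⊛-zeroʳ : ∀ f → f ⊛ zeroS ≐ zeroS
⊛-zeroʳ f = ≐-trans (⊛-comm f zeroS) (⊛-zeroˡ f)

-- q-Chu–Vandermonde, by the q-Pascal rule.
vandermonde : ∀ a m → Ss a (λ t → mono (t ℕ.* (t ℕ.+ m)) ⊛ ((inv (a ℕ.∸ t) ⊛ inv t) ⊛ inv (t ℕ.+ m))) ≐ inv a ⊛ inv (a ℕ.+ m)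
vandermonde zero    m = ≐-trans (⊛-identityˡ ((one ⊛ one) ⊛ inv m)) (⊛-congʳ (inv m) (⊛-identityˡ one))
vandermonde (suc a) m = cancelˡ (1- mono (suc a)) (λ ()) (begin
  1- mono (suc a) ⊛ Ss (suc a) f
    ≈⟨ ≐-sym (Ss-⊛ (suc a) (1- mono (suc a)) f) ⟩
  Ss (suc a) (λ t → 1- mono (suc a) ⊛ f t)
    ≈⟨ Ss-cong (suc a) pascal ⟩
  Ss (suc a) (λ t → P t ⊕ R t)
    ≈⟨ Ss-⊕ (suc a) P R ⟩
  (Ss a P ⊕ P (suc a)) ⊕ Ss (suc a) R
    ≈⟨ ⊕-cong (⊕-cong (Ss-cong a lowP) Plast) (≐-trans (Ss-head a R) (⊕-cong R0 (≐-refl {Ss a (λ t → R (suc t))}))) ⟩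
  (Ss a P′ ⊕ zeroS) ⊕ (zeroS ⊕ Ss a (λ t → R (suc t)))
    ≈⟨ (λ i → pad (Ss a P′ i) (Ss a (λ t → R (suc t)) i)) ⟩
  Ss a P′ ⊕ Ss a (λ t → R (suc t))
    ≈⟨ ≐-sym (Ss-⊕ a P′ (λ t → R (suc t))) ⟩
  Ss a (λ t → P′ t ⊕ R (suc t))
    ≈⟨ Ss-cong a (λ t _ → merge t) ⟩
  Ss a (λ t → mono (t ℕ.* (t ℕ.+ suc m)) ⊛ ((inv (a ℕ.∸ t) ⊛ inv t) ⊛ inv (t ℕ.+ suc m)))
    ≈⟨ vandermonde a (suc m) ⟩
  inv a ⊛ inv (a ℕ.+ suc m)
    ≈⟨ ⊛-cong (≐-sym (inv-step a)) (λ i → cong (λ k → inv k i) (ℕₚ.+-suc a m)) ⟩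
  (1- mono (suc a) ⊛ inv (suc a)) ⊛ inv (suc a ℕ.+ m)
    ≈⟨ ⊛-assoc (1- mono (suc a)) (inv (suc a)) (inv (suc a ℕ.+ m)) ⟩
  1- mono (suc a) ⊛ (inv (suc a) ⊛ inv (suc a ℕ.+ m)) ∎)
  where
  open SR
  f P P′ R : ℕ → Series
  f t = mono (t ℕ.* (t ℕ.+ m)) ⊛ ((inv (suc a ℕ.∸ t) ⊛ inv t) ⊛ inv (t ℕ.+ m))
  P t = mono (t ℕ.* (t ℕ.+ m)) ⊛ ((mono t ⊛ (inv⁻ (suc a ℕ.∸ t) ⊛ inv t)) ⊛ inv (t ℕ.+ m))
  P′ t = mono (t ℕ.* (t ℕ.+ m)) ⊛ ((mono t ⊛ (inv (a ℕ.∸ t) ⊛ inv t)) ⊛ inv (t ℕ.+ m))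
  R t = mono (t ℕ.* (t ℕ.+ m)) ⊛ ((inv (suc a ℕ.∸ t) ⊛ inv⁻ t) ⊛ inv (t ℕ.+ m))
  pad : ∀ x y → (x + + 0) + (+ 0 + y) ≡ x + y
  pad = solve-∀
  -- This is the splitting 1 - q^{a+1} = q^t (1 - q^{a+1-t}) + (1 - q^t); each bracket lowers the
  -- index of one inverse factorial.
  pascal : ∀ t → t ℕ.≤ suc a → 1- mono (suc a) ⊛ f t ≐ P t ⊕ R t
  pascal t p = begin
    1- mono (suc a) ⊛ f t
      ≈⟨ ⊛-congʳ (f t) (1-cong (≐-trans (mono-cong (sym (ℕₚ.m+[n∸m]≡n p))) (mono-+ t k))) ⟩
    1- (mono t ⊛ mono k) ⊛ f t
      ≈⟨ solve 6 (λ x y e i j w → (con (+ 1) :- x :* y) :* (e :* ((i :* j) :* w)) := e :* ((x :* (((con (+ 1) :- y) :* i) :* j)) :* w) :+ e :* ((i :* ((con (+ 1) :- x) :* j)) :* w)) ≐-refl (mono t) (mono k) (mono (t ℕ.* (t ℕ.+ m))) (inv k) (inv t) (inv (t ℕ.+ m)) ⟩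
    mono (t ℕ.* (t ℕ.+ m)) ⊛ ((mono t ⊛ ((1- mono k ⊛ inv k) ⊛ inv t)) ⊛ inv (t ℕ.+ m)) ⊕ mono (t ℕ.* (t ℕ.+ m)) ⊛ ((inv k ⊛ (1- mono t ⊛ inv t)) ⊛ inv (t ℕ.+ m))
      ≈⟨ ⊕-cong (⊛-congˡ (mono (t ℕ.* (t ℕ.+ m))) (⊛-congʳ (inv (t ℕ.+ m)) (⊛-congˡ (mono t) (⊛-congʳ (inv t) (inv-lower k))))) (⊛-congˡ (mono (t ℕ.* (t ℕ.+ m))) (⊛-congʳ (inv (t ℕ.+ m)) (⊛-congˡ (inv k) (inv-lower t)))) ⟩
    P t ⊕ R t ∎
    where
    k = suc a ℕ.∸ t
  lowP : ∀ t → t ℕ.≤ a → P t ≐ P′ t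
  lowP t p i = cong (λ k → (mono (t ℕ.* (t ℕ.+ m)) ⊛ ((mono t ⊛ (inv⁻ k ⊛ inv t)) ⊛ inv (t ℕ.+ m))) i) (ℕₚ.+-∸-assoc 1 p)
  Plast : P (suc a) ≐ zeroS
  Plast = ≐-trans (λ i → cong (λ k → (mono (suc a ℕ.* (suc a ℕ.+ m)) ⊛ ((mono (suc a) ⊛ (inv⁻ k ⊛ inv (suc a))) ⊛ inv (suc a ℕ.+ m))) i) (ℕₚ.n∸n≡0 a)) (≐-trans (solve 5 (λ e x z i w → e :* ((x :* (z :* i)) :* w) := z :* (e :* (x :* (i :* w)))) ≐-refl (mono (suc a ℕ.* (suc a ℕ.+ m))) (mono (suc a)) zeroS (inv (suc a)) (inv (suc a ℕ.+ m))) (⊛-zeroˡ (mono (suc a ℕ.* (suc a ℕ.+ m)) ⊛ (mono (suc a) ⊛ (inv (suc a) ⊛ inv (suc a ℕ.+ m))))))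
  R0 : R 0 ≐ zeroS
  R0 = ≐-trans (⊛-identityˡ ((inv (suc a) ⊛ zeroS) ⊛ inv m)) (≐-trans (⊛-congʳ (inv m) (⊛-zeroʳ (inv (suc a)))) (⊛-zeroˡ (inv m)))
  -- After the shift of `R` by one, the two parts carry the weights 1 - q^{t+m+1} and q^{t+m+1} of
  -- one summand of the same sum with `suc m` in place of `m`.
  merge : ∀ t → P′ t ⊕ R (suc t) ≐ mono (t ℕ.* (t ℕ.+ suc m)) ⊛ ((inv (a ℕ.∸ t) ⊛ inv t) ⊛ inv (t ℕ.+ suc m))
  merge t = begin
    P′ t ⊕ R (suc t)
      ≈⟨ ⊕-cong (⊛-congˡ (mono (t ℕ.* (t ℕ.+ m))) (⊛-congˡ (mono t ⊛ F) (≐-sym (inv-step (t ℕ.+ m))))) (⊛-congʳ (F ⊛ w) (≐-trans (mono-cong (up t m)) (mono-+ (t ℕ.* (t ℕ.+ suc m)) (suc (t ℕ.+ m))))) ⟩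
    mono (t ℕ.* (t ℕ.+ m)) ⊛ ((mono t ⊛ F) ⊛ (1- g ⊛ w)) ⊕ (A ⊛ g) ⊛ (F ⊛ w)
      ≈⟨ ⊕-cong (solve 5 (λ e x F g w → e :* ((x :* F) :* ((con (+ 1) :- g) :* w)) := (e :* x) :* (F :* ((con (+ 1) :- g) :* w))) ≐-refl (mono (t ℕ.* (t ℕ.+ m))) (mono t) F g w) (≐-refl {(A ⊛ g) ⊛ (F ⊛ w)}) ⟩
    (mono (t ℕ.* (t ℕ.+ m)) ⊛ mono t) ⊛ (F ⊛ (1- g ⊛ w)) ⊕ (A ⊛ g) ⊛ (F ⊛ w)
      ≈⟨ ⊕-cong (⊛-congʳ (F ⊛ (1- g ⊛ w)) (≐-trans (≐-sym (mono-+ (t ℕ.* (t ℕ.+ m)) t)) (mono-cong (low t m)))) (≐-refl {(A ⊛ g) ⊛ (F ⊛ w)}) ⟩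
    A ⊛ (F ⊛ (1- g ⊛ w)) ⊕ (A ⊛ g) ⊛ (F ⊛ w)
      ≈⟨ solve 4 (λ A F g w → A :* (F :* ((con (+ 1) :- g) :* w)) :+ (A :* g) :* (F :* w) := A :* (F :* w)) ≐-refl A F g w ⟩
    A ⊛ (F ⊛ w)
      ≈⟨ ⊛-congˡ A (⊛-congˡ F (λ i → cong (λ k → inv k i) (sym (ℕₚ.+-suc t m)))) ⟩
    A ⊛ (F ⊛ inv (t ℕ.+ suc m)) ∎
    where
    F A g w : Series
    F = inv (a ℕ.∸ t) ⊛ inv t
    A = mono (t ℕ.* (t ℕ.+ suc m))
    g = mono (suc (t ℕ.+ m))
    w = inv (suc (t ℕ.+ m))
    up : ∀ t m → suc t ℕ.* (suc t ℕ.+ m) ≡ t ℕ.* (t ℕ.+ suc m) ℕ.+ suc (t ℕ.+ m)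
    up = ℕR.solve-∀
    low : ∀ t m → t ℕ.* (t ℕ.+ m) ℕ.+ t ≡ t ℕ.* (t ℕ.+ suc m)
    low = ℕR.solve-∀

-- Bailey's lemma in Bressoud's polynomial form; ε = 0, 1 for the two Rogers–Ramanujan identities.
module Bailey (ε : ℕ) where

  -- The sequence β of a Bailey pair (α, β) relative to q^ε, with (q^{1+ε};q)_{n+j} completed to
  -- (q;q)_{n+j+ε}.
  B : (ℕ → Series) → ℕ → Series
  B α n = Ss n (λ j → α j ⊛ (inv (n ℕ.∸ j) ⊛ inv (ε ℕ.+ (n ℕ.+ j))))

  raise : (ℕ → Series) → ℕ → Series
  raise α j = mono (j ℕ.* (j ℕ.+ ε)) ⊛ α j

  -- Written out, the left side is a sum over a triangle; summed by columns, the column of α_j is a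
  -- q-Chu-Vandermonde sum with parameter 2j + ε.
  bailey : ∀ α n → Ss n (λ s → raise (λ s → inv (n ℕ.∸ s) ⊛ B α s) s) ≐ B (raise α) n
  bailey α n = begin
    Ss n (λ s → mono (s ℕ.* (s ℕ.+ ε)) ⊛ (inv (n ℕ.∸ s) ⊛ B α s))
      ≈⟨ Ss-cong n (λ s _ → inner s) ⟩
    Ss n (λ s → Ss s (λ j → f j (s ℕ.∸ j)))
      ≈⟨ Ss-triangle n f ⟩
    Ss n (λ j → Ss (n ℕ.∸ j) (f j))
      ≈⟨ Ss-cong n column ⟩
    B (raise α) n ∎
    where
    open SR
    f : ℕ → ℕ → Series
    f j t = mono ((j ℕ.+ t) ℕ.* ((j ℕ.+ t) ℕ.+ ε)) ⊛ (inv (n ℕ.∸ (j ℕ.+ t)) ⊛ (α j ⊛ (inv t ⊛ inv (ε ℕ.+ ((j ℕ.+ t) ℕ.+ j)))))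
    inner : ∀ s → mono (s ℕ.* (s ℕ.+ ε)) ⊛ (inv (n ℕ.∸ s) ⊛ B α s) ≐ Ss s (λ j → f j (s ℕ.∸ j))
    inner s = ≐-trans (⊛-congˡ (mono (s ℕ.* (s ℕ.+ ε))) (≐-sym (Ss-⊛ s (inv (n ℕ.∸ s)) b))) (≐-trans (≐-sym (Ss-⊛ s (mono (s ℕ.* (s ℕ.+ ε))) (λ j → inv (n ℕ.∸ s) ⊛ b j))) (Ss-cong s (λ j p i → cong (λ k → (mono (k ℕ.* (k ℕ.+ ε)) ⊛ (inv (n ℕ.∸ k) ⊛ (α j ⊛ (inv (s ℕ.∸ j) ⊛ inv (ε ℕ.+ (k ℕ.+ j)))))) i) (sym (ℕₚ.m+[n∸m]≡n p)))))
      where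
      b : ℕ → Series
      b j = α j ⊛ (inv (s ℕ.∸ j) ⊛ inv (ε ℕ.+ (s ℕ.+ j)))
    column : ∀ j → j ℕ.≤ n → Ss (n ℕ.∸ j) (f j) ≐ raise α j ⊛ (inv (n ℕ.∸ j) ⊛ inv (ε ℕ.+ (n ℕ.+ j)))
    column j p = begin
      Ss (n ℕ.∸ j) (f j)
        ≈⟨ Ss-cong (n ℕ.∸ j) (λ t _ → cell t) ⟩
      Ss (n ℕ.∸ j) (λ t → raise α j ⊛ g t)
        ≈⟨ Ss-⊛ (n ℕ.∸ j) (raise α j) g ⟩
      raise α j ⊛ Ss (n ℕ.∸ j) g
        ≈⟨ ⊛-congˡ (raise α j) (≐-trans (vandermonde (n ℕ.∸ j) M) (⊛-congˡ (inv (n ℕ.∸ j)) (λ i → cong (λ k → inv k i) index))) ⟩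
      raise α j ⊛ (inv (n ℕ.∸ j) ⊛ inv (ε ℕ.+ (n ℕ.+ j))) ∎
      where
      M = ε ℕ.+ (j ℕ.+ j)
      g : ℕ → Series
      g t = mono (t ℕ.* (t ℕ.+ M)) ⊛ ((inv (n ℕ.∸ j ℕ.∸ t) ⊛ inv t) ⊛ inv (t ℕ.+ M))
      index : n ℕ.∸ j ℕ.+ M ≡ ε ℕ.+ (n ℕ.+ j)
      index = trans (l (n ℕ.∸ j) ε j) (cong (λ k → ε ℕ.+ (k ℕ.+ j)) (ℕₚ.m∸n+n≡m p))
        where
        l : ∀ k e j → k ℕ.+ (e ℕ.+ (j ℕ.+ j)) ≡ e ℕ.+ ((k ℕ.+ j) ℕ.+ j)
        l = ℕR.solve-∀
      cell : ∀ t → f j t ≐ raise α j ⊛ g t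
      cell t = begin
        f j t
          ≈⟨ ⊛-cong (≐-trans (mono-cong (sq t)) (mono-+ (j ℕ.* (j ℕ.+ ε)) (t ℕ.* (t ℕ.+ M)))) (λ i → cong₂ (λ k l → (inv k ⊛ (α j ⊛ (inv t ⊛ inv l))) i) (sym (ℕₚ.∸-+-assoc n j t)) (ix j t ε)) ⟩
        (mono (j ℕ.* (j ℕ.+ ε)) ⊛ mono (t ℕ.* (t ℕ.+ M))) ⊛ (inv (n ℕ.∸ j ℕ.∸ t) ⊛ (α j ⊛ (inv t ⊛ inv (t ℕ.+ M))))
          ≈⟨ solve 6 (λ a b c d e f → (a :* b) :* (c :* (d :* (e :* f))) := (a :* d) :* (b :* ((c :* e) :* f))) ≐-refl (mono (j ℕ.* (j ℕ.+ ε))) (mono (t ℕ.* (t ℕ.+ M))) (inv (n ℕ.∸ j ℕ.∸ t)) (α j) (inv t) (inv (t ℕ.+ M)) ⟩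
        raise α j ⊛ g t ∎
        where
        sq : ∀ t → (j ℕ.+ t) ℕ.* ((j ℕ.+ t) ℕ.+ ε) ≡ j ℕ.* (j ℕ.+ ε) ℕ.+ t ℕ.* (t ℕ.+ (ε ℕ.+ (j ℕ.+ j)))
        sq t = l j t ε
          where
          l : ∀ j t e → (j ℕ.+ t) ℕ.* ((j ℕ.+ t) ℕ.+ e) ≡ j ℕ.* (j ℕ.+ e) ℕ.+ t ℕ.* (t ℕ.+ (e ℕ.+ (j ℕ.+ j)))
          l = ℕR.solve-∀
        ix : ∀ j t e → e ℕ.+ ((j ℕ.+ t) ℕ.+ j) ≡ t ℕ.+ (e ℕ.+ (j ℕ.+ j))
        ix = ℕR.solve-∀

  raise-order : ∀ α m j → m ℕ.< j → raise α j ≈[ m ] zeroS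
  raise-order α m (suc j) p = ≈-0 (mono (suc j ℕ.* (suc j ℕ.+ ε))) (α (suc j)) (mono-≈0 (ℕₚ.≤-trans p (ℕₚ.m≤m*n (suc j) (suc j ℕ.+ ε))))

  -- The index m + m leaves room: for j ≤ m both (q;q)_{2m-j} and (q;q)_{2m+j+ε} agree with `E` up
  -- to order `m`, so the two factors `E` cancel both denominators.
  B-limit : ∀ α m → (∀ m j → m ℕ.< j → α j ≈[ m ] zeroS) → E ⊛ (E ⊛ B α (m ℕ.+ m)) ≈[ m ] Ss m α
  B-limit α m ord = ≈-trans (≐⇒≈ expand) (≈-trans (≈-Ss-stable m g (λ j p → ≈-0 (α j) ((E ⊛ inv (n ℕ.∸ j)) ⊛ (E ⊛ inv (ε ℕ.+ (n ℕ.+ j)))) (ord m j p))) (≈-Ss m (λ j p → ≈-trans (≈-⊛ˡ (α j) (≈-⊛ (E-inv m ((m ℕ.+ m) ℕ.∸ j) (far j p)) (E-inv m (ε ℕ.+ ((m ℕ.+ m) ℕ.+ j)) (ℕₚ.≤-trans (ℕₚ.m≤m+n m m) (ℕₚ.≤-trans (ℕₚ.m≤m+n (m ℕ.+ m) j) (ℕₚ.m≤n+m _ ε)))))) (≐⇒≈ (≐-trans (⊛-congˡ (α j) (⊛-identityˡ one)) (≐-trans (⊛-comm (α j) one) (⊛-identityˡ (α j))))))))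
    where
    n = m ℕ.+ m
    g : ℕ → Series
    g j = α j ⊛ ((E ⊛ inv (n ℕ.∸ j)) ⊛ (E ⊛ inv (ε ℕ.+ (n ℕ.+ j))))
    far : ∀ j → j ℕ.≤ m → m ℕ.≤ n ℕ.∸ j
    far j p = ℕₚ.≤-trans (ℕₚ.≤-reflexive (sym (ℕₚ.m+n∸n≡m m m))) (ℕₚ.∸-monoʳ-≤ n p)
    b : ℕ → Series
    b j = α j ⊛ (inv (n ℕ.∸ j) ⊛ inv (ε ℕ.+ (n ℕ.+ j)))
    expand : E ⊛ (E ⊛ B α n) ≐ Ss n g
    expand = ≐-trans (⊛-congˡ E (≐-sym (Ss-⊛ n E b))) (≐-trans (≐-sym (Ss-⊛ n E (λ j → E ⊛ b j))) (Ss-cong n (λ j _ → solve 4 (λ e a i k → e :* (e :* (a :* (i :* k))) := a :* ((e :* i) :* (e :* k))) ≐-refl E (α j) (inv (n ℕ.∸ j)) (inv (ε ℕ.+ (n ℕ.+ j))))))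

  module _ (α : ℕ → Series) (unit₀ : B α 0 ≐ one) (unit₊ : ∀ n → B α (suc n) ≐ zeroS) where

    -- For the unit pair only the summand s = 0 of Bailey's lemma survives. One step gives
    -- 1/(q;q)_n, and a further step in the limit gives the Rogers-Ramanujan sums.
    first : ∀ n → B (raise α) n ≐ inv n
    first n = ≐-trans (≐-sym (bailey α n)) (≐-trans (λ i → ≈-Ss-head {i} n (raise (λ s → inv (n ℕ.∸ s) ⊛ B α s)) (λ s → ≐⇒≈ (≐-trans (⊛-congˡ (mono (suc s ℕ.* (suc s ℕ.+ ε))) (≐-trans (⊛-congˡ (inv (n ℕ.∸ suc s)) (unit₊ s)) (⊛-zeroʳ (inv (n ℕ.∸ suc s))))) (⊛-zeroʳ (mono (suc s ℕ.* (suc s ℕ.+ ε)))))) i ℕₚ.≤-refl) (≐-trans (⊛-identityˡ (inv n ⊛ B α 0)) (≐-trans (⊛-congˡ (inv n) unit₀) (≐-trans (⊛-comm (inv n) one) (⊛-identityˡ (inv n))))))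

    pentagonal : E ≐ lim (raise α)
    pentagonal m = ≈-trans (≈-trans (≐⇒≈ (≐-sym (≐-trans (⊛-comm E one) (⊛-identityˡ E)))) (≈-trans (≈-⊛ˡ E (≈-sym (E-inv m (m ℕ.+ m) (ℕₚ.m≤m+n m m)))) (≐⇒≈ (⊛-congˡ E (⊛-congˡ E (≐-sym (first (m ℕ.+ m)))))))) (≈-trans (B-limit (raise α) m (raise-order α)) (≈-sym (lim-≈ (raise α) (raise-order α) m))) m ℕₚ.≤-refl

    rogers-ramanujan : E ⊛ lim (raise inv) ≐ lim (raise (raise α))
    rogers-ramanujan m = ≈-trans (≈-⊛ˡ E (≈-trans (lim-≈ (raise inv) (raise-order inv) m) (≈-sym left))) (≈-trans (≐⇒≈ (⊛-congˡ E (⊛-congˡ E second))) (≈-trans (B-limit (raise (raise α)) m (raise-order (raise α))) (≈-sym (lim-≈ (raise (raise α)) (raise-order (raise α)) m)))) m ℕₚ.≤-refl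
      where
      n = m ℕ.+ m
      second : Ss n (raise (λ s → inv (n ℕ.∸ s) ⊛ inv s)) ≐ B (raise (raise α)) n
      second = ≐-trans (Ss-cong n (λ s _ → ⊛-congˡ (mono (s ℕ.* (s ℕ.+ ε))) (⊛-congˡ (inv (n ℕ.∸ s)) (≐-sym (first s))))) (bailey (raise α) n)
      far : ∀ j → j ℕ.≤ m → m ℕ.≤ n ℕ.∸ j
      far j p = ℕₚ.≤-trans (ℕₚ.≤-reflexive (sym (ℕₚ.m+n∸n≡m m m))) (ℕₚ.∸-monoʳ-≤ n p)
      left : E ⊛ Ss n (raise (λ s → inv (n ℕ.∸ s) ⊛ inv s)) ≈[ m ] Ss m (raise inv)
      left = ≈-trans (≐⇒≈ (≐-trans (≐-sym (Ss-⊛ n E (raise (λ s → inv (n ℕ.∸ s) ⊛ inv s)))) (Ss-cong n (λ s _ → solve 4 (λ e x i k → e :* (x :* (i :* k)) := x :* (k :* (e :* i))) ≐-refl E (mono (s ℕ.* (s ℕ.+ ε))) (inv (n ℕ.∸ s)) (inv s)))))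
        (≈-trans (≈-Ss-stable m (raise (λ s → inv s ⊛ (E ⊛ inv (n ℕ.∸ s)))) (raise-order (λ s → inv s ⊛ (E ⊛ inv (n ℕ.∸ s))) m)) (≈-Ss m (λ s p → ≈-⊛ˡ (mono (s ℕ.* (s ℕ.+ ε))) (≈-trans (≈-⊛ˡ (inv s) (E-inv m (n ℕ.∸ s) (far s p))) (≐⇒≈ (≐-trans (⊛-comm (inv s) one) (⊛-identityˡ (inv s))))))))

sg : ℕ → Series
sg k = cst ((- + 1) ℤ.^ k)

sg-suc : ∀ k → sg (suc k) ≐ cst (- + 1) ⊛ sg k
sg-suc k = ≐-trans (≐-sym (pw-cst (- + 1) (suc k))) (⊛-congˡ (cst (- + 1)) (pw-cst (- + 1) k))

-- The unit Bailey pairs relative to 1 and to q. The second is multiplied by 1 - q, to match the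
-- completed denominator in `B`.
α⁰ α¹ : ℕ → Series
α⁰ zero    = 1S
α⁰ (suc j) = sg (suc j) ⊛ (mono (tri j) ⊕ mono (tri (suc j)))
α¹ zero    = 1- mono 1
α¹ (suc j) = sg (suc j) ⊛ (mono (tri j) ⊖ mono (tri (suc (suc j))))

private
  module Step (n k : ℕ) (p : suc k ℕ.≤ n) where
    r = n ℕ.∸ suc k
    g ρ T ι : Series
    g = mono (suc k)
    ρ = mono r
    T = mono (tri k)
    ι = inv r
    N≐ : mono n ≐ g ⊛ ρ
    N≐ = ≐-trans (mono-cong (sym (ℕₚ.m+[n∸m]≡n p))) (mono-+ (suc k) r)
    low≐ : inv⁻ (n ℕ.∸ k) ≐ ι
    low≐ i = cong (λ t → inv⁻ t i) (ℕₚ.+-∸-assoc 1 p)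

-- A closed form for the partial sums makes the vanishing of the unit pair an induction on `k`: at k
-- = n the factor `inv⁻ 0` is zero. The multiplier 1 - q^n, cancelled afterwards, keeps the formula
-- free of division.
partial⁰ : ∀ n k → k ℕ.≤ n → 1- mono n ⊛ Ss k (λ j → α⁰ j ⊛ (inv (n ℕ.∸ j) ⊛ inv (n ℕ.+ j))) ≐ sg k ⊛ (mono (tri k) ⊛ (inv⁻ (n ℕ.∸ k) ⊛ inv (n ℕ.+ k)))
partial⁰ n zero    _ = ≐-trans (⊛-congˡ (1- mono n) (≐-trans (1S-⊛ (inv n ⊛ inv (n ℕ.+ 0))) ≐-refl)) (≐-trans (≐-sym (⊛-assoc (1- mono n) (inv n) (inv (n ℕ.+ 0)))) (≐-trans (⊛-congʳ (inv (n ℕ.+ 0)) (inv-lower n)) (≐-sym (≐-trans (1S-⊛ (mono 0 ⊛ (inv⁻ n ⊛ inv (n ℕ.+ 0)))) (⊛-identityˡ (inv⁻ n ⊛ inv (n ℕ.+ 0)))))))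
partial⁰ n (suc k) p = begin
  1- mono n ⊛ (S ⊕ α⁰ (suc k) ⊛ (ι ⊛ inv (n ℕ.+ suc k)))
    ≈⟨ ⊛-distribˡ (1- mono n) S (α⁰ (suc k) ⊛ (ι ⊛ inv (n ℕ.+ suc k))) ⟩
  1- mono n ⊛ S ⊕ 1- mono n ⊛ (α⁰ (suc k) ⊛ (ι ⊛ inv (n ℕ.+ suc k)))
    ≈⟨ ⊕-cong (≐-trans (partial⁰ n k (ℕₚ.<⇒≤ p)) (⊛-congˡ (sg k) (⊛-congˡ T (⊛-cong low≐ w≐)))) (⊛-cong (1-cong N≐) (⊛-cong (⊛-cong (sg-suc k) (⊕-cong (≐-refl {T}) (mono-+ (suc k) (tri k)))) (≐-refl {ι ⊛ w}))) ⟩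
  sg k ⊛ (T ⊛ (ι ⊛ (1- ((g ⊛ ρ) ⊛ g) ⊛ w))) ⊕ 1- (g ⊛ ρ) ⊛ (((cst (- + 1) ⊛ sg k) ⊛ (T ⊕ g ⊛ T)) ⊛ (ι ⊛ w))
    ≈⟨ solve 6 (λ c T g ρ ι w → c :* (T :* (ι :* ((con (+ 1) :- (g :* ρ) :* g) :* w))) :+ (con (+ 1) :- g :* ρ) :* (((con (- + 1) :* c) :* (T :+ g :* T)) :* (ι :* w)) := (con (- + 1) :* c) :* ((g :* T) :* (((con (+ 1) :- ρ) :* ι) :* w))) ≐-refl (sg k) T g ρ ι w ⟩
  (cst (- + 1) ⊛ sg k) ⊛ ((g ⊛ T) ⊛ ((1- ρ ⊛ ι) ⊛ w))
    ≈⟨ ≐-sym (⊛-cong (sg-suc k) (⊛-cong (mono-+ (suc k) (tri k)) (⊛-congʳ w (≐-sym (inv-lower r))))) ⟩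
  sg (suc k) ⊛ (mono (tri (suc k)) ⊛ (inv⁻ r ⊛ w)) ∎
  where
  open SR
  open Step n k p
  S w : Series
  S = Ss k (λ j → α⁰ j ⊛ (inv (n ℕ.∸ j) ⊛ inv (n ℕ.+ j)))
  w = inv (n ℕ.+ suc k)
  w≐ : inv (n ℕ.+ k) ≐ 1- ((g ⊛ ρ) ⊛ g) ⊛ w
  w≐ = ≐-trans (≐-sym (inv-step (n ℕ.+ k))) (⊛-cong (1-cong (≐-trans (mono-cong (sym (ℕₚ.+-suc n k))) (≐-trans (mono-+ n (suc k)) (⊛-congʳ g N≐)))) (λ i → cong (λ t → inv t i) (sym (ℕₚ.+-suc n k))))

partial¹ : ∀ n k → k ℕ.≤ n → 1- mono n ⊛ Ss k (λ j → α¹ j ⊛ (inv (n ℕ.∸ j) ⊛ inv (suc (n ℕ.+ j)))) ≐ sg k ⊛ (mono (tri k) ⊛ (1- mono (suc k) ⊛ (inv⁻ (n ℕ.∸ k) ⊛ inv (suc (n ℕ.+ k)))))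
partial¹ n zero    _ = ≐-trans (solve 4 (λ m e i w → m :* (e :* (i :* w)) := e :* ((m :* i) :* w)) ≐-refl (1- mono n) (1- mono 1) (inv n) (inv (suc (n ℕ.+ 0)))) (≐-trans (⊛-congˡ (1- mono 1) (⊛-congʳ (inv (suc (n ℕ.+ 0))) (inv-lower n))) (≐-sym (≐-trans (1S-⊛ (mono 0 ⊛ z)) (⊛-identityˡ z))))
  where
  z = 1- mono 1 ⊛ (inv⁻ n ⊛ inv (suc (n ℕ.+ 0)))
partial¹ n (suc k) p = begin
  1- mono n ⊛ (S ⊕ α¹ (suc k) ⊛ (ι ⊛ w))
    ≈⟨ ⊛-distribˡ (1- mono n) S (α¹ (suc k) ⊛ (ι ⊛ w)) ⟩
  1- mono n ⊛ S ⊕ 1- mono n ⊛ (α¹ (suc k) ⊛ (ι ⊛ w))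
    ≈⟨ ⊕-cong (≐-trans (partial¹ n k (ℕₚ.<⇒≤ p)) (⊛-congˡ (sg k) (⊛-congˡ T (⊛-congˡ (1- g) (⊛-cong low≐ w≐))))) (⊛-cong (1-cong N≐) (⊛-cong (⊛-cong (sg-suc k) (⊖-cong (≐-refl {T}) T₂)) (≐-refl {ι ⊛ w}))) ⟩
  sg k ⊛ (T ⊛ (1- g ⊛ (ι ⊛ (1- ((g ⊛ ρ) ⊛ g₂) ⊛ w)))) ⊕ 1- (g ⊛ ρ) ⊛ (((cst (- + 1) ⊛ sg k) ⊛ (T ⊖ g₂ ⊛ (g ⊛ T))) ⊛ (ι ⊛ w))
    ≈⟨ solve 7 (λ c T g ρ ι w h → c :* (T :* ((con (+ 1) :- g) :* (ι :* ((con (+ 1) :- (g :* ρ) :* h) :* w)))) :+ (con (+ 1) :- g :* ρ) :* (((con (- + 1) :* c) :* (T :- h :* (g :* T))) :* (ι :* w)) := (con (- + 1) :* c) :* ((g :* T) :* ((con (+ 1) :- h) :* (((con (+ 1) :- ρ) :* ι) :* w)))) ≐-refl (sg k) T g ρ ι w g₂ ⟩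
  (cst (- + 1) ⊛ sg k) ⊛ ((g ⊛ T) ⊛ (1- g₂ ⊛ ((1- ρ ⊛ ι) ⊛ w)))
    ≈⟨ ≐-sym (⊛-cong (sg-suc k) (⊛-cong (mono-+ (suc k) (tri k)) (⊛-congˡ (1- g₂) (⊛-congʳ w (≐-sym (inv-lower r)))))) ⟩
  sg (suc k) ⊛ (mono (tri (suc k)) ⊛ (1- g₂ ⊛ (inv⁻ r ⊛ w))) ∎
  where
  open SR
  open Step n k p
  S w g₂ : Series
  S = Ss k (λ j → α¹ j ⊛ (inv (n ℕ.∸ j) ⊛ inv (suc (n ℕ.+ j))))
  w = inv (suc (n ℕ.+ suc k))
  g₂ = mono (suc (suc k))
  T₂ : mono (tri (suc (suc k))) ≐ g₂ ⊛ (g ⊛ T)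
  T₂ = ≐-trans (mono-+ (suc (suc k)) (tri (suc k))) (⊛-congˡ g₂ (mono-+ (suc k) (tri k)))
  w≐ : inv (suc (n ℕ.+ k)) ≐ 1- ((g ⊛ ρ) ⊛ g₂) ⊛ w
  w≐ = ≐-trans (≐-sym (inv-step (suc (n ℕ.+ k)))) (⊛-cong (1-cong (≐-trans (mono-cong (sym (trans (ℕₚ.+-suc n (suc k)) (cong suc (ℕₚ.+-suc n k))))) (≐-trans (mono-+ n (suc (suc k))) (⊛-congʳ g₂ N≐)))) (λ i → cong (λ t → inv (suc t) i) (sym (ℕₚ.+-suc n k))))

module B⁰ = Bailey 0
module B¹ = Bailey 1

private
  vanish₀ : ∀ n → B⁰.B α⁰ (suc n) ≐ zeroS
  vanish₀ n = ⊛-≐0 (1- mono (suc n)) (B⁰.B α⁰ (suc n)) (λ ()) (≐-trans (partial⁰ (suc n) (suc n) ℕₚ.≤-refl) (≐-trans (⊛-congˡ (sg (suc n)) (≐-trans (⊛-congˡ (mono (tri (suc n))) (≐-trans (⊛-congʳ (inv (suc n ℕ.+ suc n)) (λ i → cong (λ t → inv⁻ t i) (ℕₚ.n∸n≡0 n))) (⊛-zeroˡ (inv (suc n ℕ.+ suc n))))) (⊛-zeroʳ (mono (tri (suc n)))))) (⊛-zeroʳ (sg (suc n)))))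

  vanish₁ : ∀ n → B¹.B α¹ (suc n) ≐ zeroS
  vanish₁ n = ⊛-≐0 (1- mono (suc n)) (B¹.B α¹ (suc n)) (λ ()) (≐-trans (partial¹ (suc n) (suc n) ℕₚ.≤-refl) (≐-trans (⊛-congˡ (sg (suc n)) (≐-trans (⊛-congˡ (mono (tri (suc n))) (≐-trans (⊛-congˡ (1- mono (suc (suc n))) (≐-trans (⊛-congʳ (inv (suc (suc n ℕ.+ suc n))) (λ i → cong (λ t → inv⁻ t i) (ℕₚ.n∸n≡0 n))) (⊛-zeroˡ (inv (suc (suc n ℕ.+ suc n)))))) (⊛-zeroʳ (1- mono (suc (suc n)))))) (⊛-zeroʳ (mono (tri (suc n)))))) (⊛-zeroʳ (sg (suc n)))))

  start₀ : B⁰.B α⁰ 0 ≐ one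
  start₀ = ≐-trans (1S-⊛ (one ⊛ one)) (⊛-identityˡ one)

  start₁ : B¹.B α¹ 0 ≐ one
  start₁ = ≐-trans (⊛-congˡ (1- mono 1) (⊛-identityˡ (inv 1))) (inv-step 0)

euler : E ≐ lim (B⁰.raise α⁰)
euler = B⁰.pentagonal α⁰ start₀ vanish₀

E⊛G : E ⊛ G ≐ lim (B⁰.raise (B⁰.raise α⁰))
E⊛G = ≐-trans (⊛-congˡ E (λ n → sym (trans (Ss-at n (B⁰.raise inv) n) (sumTo-cong′ n (λ s → trans (sym (shift-mono (s ℕ.* (s ℕ.+ 0)) (inv s) n)) (cong (λ t → shift (s ℕ.* t) (inv s) n) (ℕₚ.+-identityʳ s))))))) (B⁰.rogers-ramanujan α⁰ start₀ vanish₀)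

E⊛H : E ⊛ H ≐ lim (B¹.raise (B¹.raise α¹))
E⊛H = ≐-trans (⊛-congˡ E (λ n → sym (trans (Ss-at n (B¹.raise inv) n) (sumTo-cong′ n (λ s → trans (sym (shift-mono (s ℕ.* (s ℕ.+ 1)) (inv s) n)) (cong (λ t → shift (s ℕ.* t) (inv s) n) (ℕₚ.+-comm s 1))))))) (B¹.rogers-ramanujan α¹ start₁ vanish₁)

-- Sums over boxes of integer vectors.

sumTo-δ : ∀ n j (h : ℕ → ℤ) → j ℕ.≤ n → sumTo n (λ i → δ i j * h i) ≡ h j
sumTo-δ zero    zero h z≤n = ℤₚ.*-identityˡ (h 0)
sumTo-δ (suc n) j h p with suc n ℕ.≟ j
... | yes refl = trans (cong (_+ + 1 * h (suc n)) (sumTo-zero n (λ i q → trans (cong (_* h i) (δ-≢ (λ e → ℕₚ.<⇒≢ (s≤s q) e))) (ℤₚ.*-zeroˡ (h i))))) (trans (ℤₚ.+-identityˡ _) (ℤₚ.*-identityˡ (h (suc n))))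
... | no  q    = trans (cong₂ _+_ (sumTo-δ n j h (ℕₚ.≤-pred (ℕₚ.≤∧≢⇒< p (λ e → q (sym e))))) (ℤₚ.*-zeroˡ (h (suc n)))) (ℤₚ.+-identityʳ (h j))

δℤ-refl : ∀ a → δℤ a a ≡ + 1
δℤ-refl a with a ℤ.≟ a
... | yes _ = refl
... | no  p = ⊥-elim (p refl)

δℤ-≢ : ∀ {a b} → ¬ (a ≡ b) → δℤ a b ≡ + 0
δℤ-≢ {a} {b} p with a ℤ.≟ b
... | yes q = ⊥-elim (p q)
... | no  _ = refl

δℤ-cong : ∀ {a b c d} → (a ≡ b → c ≡ d) → (c ≡ d → a ≡ b) → δℤ a b ≡ δℤ c d
δℤ-cong {a} {b} {c} {d} p q with a ℤ.≟ b
... | yes e = sym (trans (cong (λ t → δℤ t d) (p e)) (δℤ-refl d))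
... | no  e = sym (δℤ-≢ (λ r → e (q r)))

sumZ-cong : ∀ N {f g : ℤ → ℤ} → (∀ x → f x ≡ g x) → sumZ N f ≡ sumZ N g
sumZ-cong N h = sumTo-cong′ (N ℕ.+ N) (λ i → h (+ i - + N))

sumZ-δ : ∀ N a (h : ℤ → ℤ) → ∣ a ∣ ℕ.≤ N → sumZ N (λ x → δℤ x a * h x) ≡ h a
sumZ-δ N a h p = begin
  sumTo (N ℕ.+ N) (λ i → δℤ (+ i - + N) a * h (+ i - + N))
    ≡⟨ sumTo-cong′ (N ℕ.+ N) (λ i → cong (_* h (+ i - + N)) (conv i)) ⟩
  sumTo (N ℕ.+ N) (λ i → δ i j * h (+ i - + N))
    ≡⟨ sumTo-δ (N ℕ.+ N) j (λ i → h (+ i - + N)) j≤ ⟩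
  h (+ j - + N) ≡⟨ cong h (trans (cong (_- + N) ej) (lem a (+ N))) ⟩
  h a ∎
  where
  open ≡-Reasoning
  lem : ∀ a n → a + n - n ≡ a
  lem = solve-∀
  lem′ : ∀ i n → i - n + n ≡ i
  lem′ = solve-∀
  j = ∣ a + + N ∣
  nonneg : ∀ a → ∣ a ∣ ℕ.≤ N → + 0 ℤ.≤ a + + N
  nonneg (+ m) _ = +≤+ z≤n
  nonneg -[1+ m ] q = subst (+ 0 ℤ.≤_) (ℤₚ.+-comm (+ N) -[1+ m ]) (ℤₚ.i≤j⇒0≤j-i (+≤+ q))
  ej : + j ≡ a + + N
  ej = ℤₚ.0≤i⇒+∣i∣≡i (nonneg a p)
  j≤ : j ℕ.≤ N ℕ.+ N
  j≤ = ℕₚ.≤-trans (ℤₚ.∣i+j∣≤∣i∣+∣j∣ a (+ N)) (ℕₚ.+-monoˡ-≤ N p)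
  conv : ∀ i → δℤ (+ i - + N) a ≡ δ i j
  conv i with i ℕ.≟ j
  ... | yes e = trans (cong (λ t → δℤ t a) (trans (cong (λ t → + t - + N) e) (trans (cong (_- + N) ej) (lem a (+ N))))) (δℤ-refl a)
  ... | no  e = δℤ-≢ (λ q → e (ℤₚ.+-injective (trans (sym (lem′ (+ i) (+ N))) (trans (cong (_+ + N) q) (sym ej)))))

V : ℕ → Set
V k = Vec ℤ k

Σb : ℕ → (k : ℕ) → (V k → ℤ) → ℤ
Σb N zero    w = w []
Σb N (suc k) w = sumZ N (λ x → Σb N k (λ v → w (x ∷ v)))

Σb-cong : ∀ N k {w w′ : V k → ℤ} → (∀ v → w v ≡ w′ v) → Σb N k w ≡ Σb N k w′
Σb-cong N zero    h = h []
Σb-cong N (suc k) h = sumZ-cong N (λ x → Σb-cong N k (λ v → h (x ∷ v)))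

Σb-+ : ∀ N k (w w′ : V k → ℤ) → Σb N k (λ v → w v + w′ v) ≡ Σb N k w + Σb N k w′
Σb-+ N zero    w w′ = refl
Σb-+ N (suc k) w w′ = trans (sumZ-cong N (λ x → Σb-+ N k (λ v → w (x ∷ v)) (λ v → w′ (x ∷ v)))) (sumTo-+ (N ℕ.+ N) _ _)

Σb-*ˡ : ∀ N k c (w : V k → ℤ) → Σb N k (λ v → c * w v) ≡ c * Σb N k w
Σb-*ˡ N zero    c w = refl
Σb-*ˡ N (suc k) c w = trans (sumZ-cong N (λ x → Σb-*ˡ N k c (λ v → w (x ∷ v)))) (sumTo-*ˡ (N ℕ.+ N) c _)

Σb-sumTo : ∀ N k m (w : ℕ → V k → ℤ) → Σb N k (λ v → sumTo m (λ i → w i v)) ≡ sumTo m (λ i → Σb N k (w i))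
Σb-sumTo N k zero    w = refl
Σb-sumTo N k (suc m) w = trans (Σb-+ N k _ _) (cong (_+ Σb N k (w (suc m))) (Σb-sumTo N k m w))

Σb-swap : ∀ N k M l (w : V k → V l → ℤ) → Σb N k (λ v → Σb M l (w v)) ≡ Σb M l (λ u → Σb N k (λ v → w v u))
Σb-swap N zero    M l w = refl
Σb-swap N (suc k) M l w = trans (sumZ-cong N (λ x → Σb-swap N k M l (λ v → w (x ∷ v)))) (sym (Σb-sumTo M l (N ℕ.+ N) (λ i u → Σb N k (λ v → w ((+ i - + N) ∷ v) u))))

InBox : ℕ → ∀ {k} → V k → Set
InBox N v = All (λ x → ∣ x ∣ ℕ.≤ N) v

δV : ∀ {k} → V k → V k → ℤ
δV []      []      = + 1
δV (x ∷ v) (y ∷ u) = δℤ x y * δV v u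

δV-refl : ∀ {k} (v : V k) → δV v v ≡ + 1
δV-refl []      = refl
δV-refl (x ∷ v) = cong₂ _*_ (δℤ-refl x) (δV-refl v)

δV-≢ : ∀ {k} (v u : V k) → ¬ (v ≡ u) → δV v u ≡ + 0
δV-≢ []      []      p = ⊥-elim (p refl)
δV-≢ (x ∷ v) (y ∷ u) p with x ℤ.≟ y
... | no  _    = ℤₚ.*-zeroˡ (δV v u)
... | yes refl = trans (ℤₚ.*-identityˡ _) (δV-≢ v u (λ e → p (cong (x ∷_) e)))

_≟V_ : ∀ {k} (v u : V k) → Dec (v ≡ u)
[] ≟V [] = yes refl
(x ∷ v) ≟V (y ∷ u) with x ℤ.≟ y | v ≟V u
... | yes refl | yes refl = yes refl
... | no p     | _        = no λ { refl → p refl }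
... | _        | no p     = no λ { refl → p refl }

δV-cong : ∀ {k l} {v u : V k} {v′ u′ : V l} → (v ≡ u → v′ ≡ u′) → (v′ ≡ u′ → v ≡ u) → δV v u ≡ δV v′ u′
δV-cong {v = v} {u} {v′} {u′} p q with v ≟V u
... | yes e = trans (cong (λ t → δV t u) e) (trans (δV-refl u) (sym (trans (cong (λ t → δV t u′) (p e)) (δV-refl u′))))
... | no  e = trans (δV-≢ v u e) (sym (δV-≢ v′ u′ (λ r → e (q r))))

δV-subst : ∀ {k} (v u : V k) (h : V k → ℤ) → δV v u * h v ≡ δV v u * h u
δV-subst v u h with v ≟V u
... | yes refl = refl
... | no  e    = trans (cong (_* h v) (δV-≢ v u e)) (trans (ℤₚ.*-zeroˡ (h v)) (sym (trans (cong (_* h u) (δV-≢ v u e)) (ℤₚ.*-zeroˡ (h u)))))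

Σb-δ : ∀ N {k} (a : V k) (h : V k → ℤ) → InBox N a → Σb N k (λ v → δV v a * h v) ≡ h a
Σb-δ N []      h []       = ℤₚ.*-identityˡ (h [])
Σb-δ N (a ∷ b) h (p ∷ ps) = trans (sumZ-cong N (λ x → trans (Σb-cong N _ (λ v → ℤₚ.*-assoc (δℤ x a) (δV v b) (h (x ∷ v)))) (trans (Σb-*ˡ N _ (δℤ x a) (λ v → δV v b * h (x ∷ v))) (cong (δℤ x a *_) (Σb-δ N b (λ v → h (x ∷ v)) ps))))) (sumZ-δ N a (λ x → h (x ∷ b)) p)

-- Insert Σ_u δ(u, φ′ v) = 1 and exchange the sums. The last hypothesis says at once that `φ′` and
-- `ψ′` are mutually inverse and that the weights correspond; being multiplied by the weights, it
-- demands nothing off the supports.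
Σb-bijection : ∀ {k l} N N′ (w : V k → ℤ) (w′ : V l → ℤ) (φ′ : V k → V l) (ψ′ : V l → V k) →
  (∀ v → ¬ (w v ≡ + 0) → InBox N′ (φ′ v)) → (∀ u → ¬ (w′ u ≡ + 0) → InBox N (ψ′ u)) →
  (∀ v u → δV u (φ′ v) * w v ≡ δV v (ψ′ u) * w′ u) → Σb N k w ≡ Σb N′ l w′
Σb-bijection {k} {l} N N′ w w′ φ′ ψ′ b b′ e = begin
  Σb N k w                                              ≡⟨ Σb-cong N k (λ v → sym (expand N′ w φ′ b v)) ⟩
  Σb N k (λ v → Σb N′ l (λ u → δV u (φ′ v) * w v))       ≡⟨ Σb-swap N k N′ l _ ⟩
  Σb N′ l (λ u → Σb N k (λ v → δV u (φ′ v) * w v))       ≡⟨ Σb-cong N′ l (λ u → Σb-cong N k (λ v → e v u)) ⟩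
  Σb N′ l (λ u → Σb N k (λ v → δV v (ψ′ u) * w′ u))      ≡⟨ Σb-cong N′ l (λ u → expand N w′ ψ′ b′ u) ⟩
  Σb N′ l w′ ∎
  where
  open ≡-Reasoning
  expand : ∀ {k l} M (w : V k → ℤ) (φ″ : V k → V l) → (∀ v → ¬ (w v ≡ + 0) → InBox M (φ″ v)) → ∀ v → Σb M l (λ u → δV u (φ″ v) * w v) ≡ w v
  expand {k} {l} M w φ″ b v with w v ℤ.≟ + 0
  ... | no  p = Σb-δ M (φ″ v) (λ _ → w v) (b v p)
  ... | yes p = trans (Σb-cong M l (λ u → trans (cong (δV u (φ″ v) *_) p) (trans (ℤₚ.*-zeroʳ (δV u (φ″ v))) (sym (ℤₚ.*-zeroˡ (+ 0)))))) (trans (Σb-*ˡ M l (+ 0) (λ _ → + 0)) (sym p))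

Σb-support : ∀ {k} N N′ (w : V k → ℤ) → (∀ v → ¬ (w v ≡ + 0) → InBox N v × InBox N′ v) → Σb N k w ≡ Σb N′ k w
Σb-support N N′ w h = Σb-bijection N N′ w w (λ v → v) (λ v → v) (λ v p → proj₂ (h v p)) (λ v p → proj₁ (h v p)) λ v u → trans (δV-subst′ u v) (cong (_* w u) (δV-cong {v = u} {v} {v} {u} sym sym))
  where
  δV-subst′ : ∀ u v → δV u v * w v ≡ δV u v * w u
  δV-subst′ u v = sym (δV-subst u v w)

-- Matrices and quadratic forms.

Mat : ℕ → Set
Mat k = Vec (V k) k

dot : ∀ {k} → V k → V k → ℤ
dot []      []      = + 0
dot (a ∷ v) (b ∷ u) = a * b + dot v u

mv : ∀ {k l} → Vec (V k) l → V k → V l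
mv A x = map (λ r → dot r x) A

zeroV : ∀ {k} → V k
zeroV {k} = replicate k (+ 0)

infixl 6 _+V_
infixr 7 _*V_

_+V_ : ∀ {k} → V k → V k → V k
_+V_ = zipWith _+_

_*V_ : ∀ {k} → ℤ → V k → V k
c *V v = map (c *_) v

vm : ∀ {k l} → V l → Vec (V k) l → V k
vm []      []      = zeroV
vm (a ∷ r) (b ∷ B) = (a *V b) +V vm r B

_⊡_ : ∀ {k l m} → Vec (V l) m → Vec (V k) l → Vec (V k) m
A ⊡ B = map (λ r → vm r B) A

dot-0 : ∀ {k} (x : V k) → dot zeroV x ≡ + 0
dot-0 []      = refl
dot-0 (x ∷ v) = trans (cong₂ _+_ (ℤₚ.*-zeroˡ x) (dot-0 v)) refl

dot-+ : ∀ {k} (a b x : V k) → dot (a +V b) x ≡ dot a x + dot b x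
dot-+ []      []      []      = refl
dot-+ (a ∷ v) (b ∷ u) (x ∷ w) = trans (cong₂ _+_ (ℤₚ.*-distribʳ-+ x a b) (dot-+ v u w)) (+-interchange (a * x) (b * x) (dot v w) (dot u w))

dot-* : ∀ {k} c (a x : V k) → dot (c *V a) x ≡ c * dot a x
dot-* c []      []      = sym (ℤₚ.*-zeroʳ c)
dot-* c (a ∷ v) (x ∷ w) = trans (cong₂ _+_ (ℤₚ.*-assoc c a x) (dot-* c v w)) (sym (ℤₚ.*-distribˡ-+ c (a * x) (dot v w)))

dot-comm : ∀ {k} (a b : V k) → dot a b ≡ dot b a
dot-comm []      []      = refl
dot-comm (a ∷ v) (b ∷ u) = cong₂ _+_ (ℤₚ.*-comm a b) (dot-comm v u)

dot-vm : ∀ {k l} (r : V l) (B : Vec (V k) l) (x : V k) → dot (vm r B) x ≡ dot r (mv B x)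
dot-vm []      []      x = dot-0 x
dot-vm (a ∷ r) (b ∷ B) x = trans (dot-+ (a *V b) (vm r B) x) (cong₂ _+_ (dot-* a b x) (dot-vm r B x))

mv-⊡ : ∀ {k l m} (A : Vec (V l) m) (B : Vec (V k) l) x → mv A (mv B x) ≡ mv (A ⊡ B) x
mv-⊡ []      B x = refl
mv-⊡ (r ∷ A) B x = cong₂ _∷_ (sym (dot-vm r B x)) (mv-⊡ A B x)

scalar : ∀ k → ℤ → Mat k
scalar zero    c = []
scalar (suc k) c = (c ∷ zeroV) ∷ map (+ 0 ∷_) (scalar k c)

mv-scalar : ∀ {k} c (x : V k) → mv (scalar k c) x ≡ c *V x
mv-scalar c []      = refl
mv-scalar {suc k} c (x ∷ v) = cong₂ _∷_ (trans (cong (λ t → c * x + t) (dot-0 v)) (ℤₚ.+-identityʳ (c * x))) (trans (pad (scalar k c)) (mv-scalar c v))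
  where
  pad : ∀ {l} (A : Vec (V k) l) → mv (map (+ 0 ∷_) A) (x ∷ v) ≡ mv A v
  pad []      = refl
  pad (r ∷ A) = cong₂ _∷_ (trans (cong (_+ dot r v) (ℤₚ.*-zeroˡ x)) (ℤₚ.+-identityˡ (dot r v))) (pad A)

Q : ∀ {k} → Mat k → V k → ℤ
Q T x = dot x (mv T x)

tr : ∀ {k l} → Vec (V k) l → Vec (V l) k
tr []      = replicate _ []
tr (r ∷ A) = zipWith _∷_ r (tr A)

mv-tr : ∀ {k l} (A : Vec (V k) l) (z : V l) → mv (tr A) z ≡ vm z A
mv-tr []      []      = lem _
  where
  lem : ∀ k → mv (replicate k []) [] ≡ zeroV {k}
  lem zero    = refl
  lem (suc k) = cong (+ 0 ∷_) (lem k)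
mv-tr (r ∷ A) (z ∷ zs) = trans (lem r (tr A)) (cong ((z *V r) +V_) (mv-tr A zs))
  where
  lem : ∀ {k l} (r : V k) (C : Vec (V l) k) {z : ℤ} {zs : V l} → mv (zipWith _∷_ r C) (z ∷ zs) ≡ (z *V r) +V mv C zs
  lem []      []      = refl
  lem (a ∷ r) (c ∷ C) = cong₂ _∷_ (cong (_+ _) (ℤₚ.*-comm a _)) (lem r C)

Q-mv : ∀ {k l} (T : Mat l) (B : Vec (V k) l) (x : V k) → Q T (mv B x) ≡ Q (tr B ⊡ (T ⊡ B)) x
Q-mv T B x = begin
  dot (mv B x) (mv T (mv B x))         ≡⟨ cong (dot (mv B x)) (mv-⊡ T B x) ⟩
  dot (mv B x) z                       ≡⟨ dot-comm (mv B x) z ⟩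
  dot z (mv B x)                       ≡⟨ sym (dot-vm z B x) ⟩
  dot (vm z B) x                       ≡⟨ cong (λ t → dot t x) (sym (mv-tr B z)) ⟩
  dot (mv (tr B) z) x                  ≡⟨ dot-comm _ x ⟩
  dot x (mv (tr B) z)                  ≡⟨ cong (dot x) (mv-⊡ (tr B) (T ⊡ B) x) ⟩
  Q (tr B ⊡ (T ⊡ B)) x ∎
  where
  open ≡-Reasoning
  z = mv (T ⊡ B) x

_+M_ : ∀ {k l} → Vec (V k) l → Vec (V k) l → Vec (V k) l
_+M_ = zipWith _+V_

mv-+M : ∀ {k l} (A B : Vec (V k) l) x → mv (A +M B) x ≡ mv A x +V mv B x
mv-+M []      []      x = refl
mv-+M (a ∷ A) (b ∷ B) x = cong₂ _∷_ (dot-+ a b x) (mv-+M A B x)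

Q-sym : ∀ {k} (T : Mat k) x → Q (T +M tr T) x ≡ + 2 * Q T x
Q-sym T x = begin
  dot x (mv (T +M tr T) x)            ≡⟨ cong (dot x) (mv-+M T (tr T) x) ⟩
  dot x (mv T x +V mv (tr T) x)       ≡⟨ dot-comm x _ ⟩
  dot (mv T x +V mv (tr T) x) x       ≡⟨ dot-+ (mv T x) (mv (tr T) x) x ⟩
  dot (mv T x) x + dot (mv (tr T) x) x ≡⟨ cong₂ _+_ (dot-comm _ x) (trans (cong (λ t → dot t x) (mv-tr T x)) (dot-vm x T x)) ⟩
  Q T x + Q T x                       ≡⟨ lem (Q T x) ⟩
  + 2 * Q T x ∎
  where
  open ≡-Reasoning
  lem : ∀ a → a + a ≡ + 2 * a
  lem = solve-∀

-- Quadratic forms are compared through their symmetrised Gram matrices.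
Q-cong : ∀ {k} (T T′ : Mat k) → T +M tr T ≡ T′ +M tr T′ → ∀ x → Q T x ≡ Q T′ x
Q-cong T T′ e x = ℤₚ.*-cancelˡ-≡ (+ 2) (Q T x) (Q T′ x) (trans (sym (Q-sym T x)) (trans (cong (λ A → Q A x) e) (Q-sym T′ x)))

*M : ∀ {k l} → ℤ → Vec (V k) l → Vec (V k) l
*M c A = map (c *V_) A

Q-*M : ∀ {k} c (T : Mat k) x → Q (*M c T) x ≡ c * Q T x
Q-*M c T x = trans (dot-comm x _) (trans (cong (λ t → dot t x) (lem T)) (trans (dot-* c (mv T x) x) (cong (c *_) (dot-comm _ x))))
  where
  lem : ∀ {l} (A : Vec (V _) l) → mv (*M c A) x ≡ c *V mv A x
  lem []      = refl
  lem (r ∷ A) = cong₂ _∷_ (dot-* c r x) (lem A)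

-- Weighted theta series of lattices.

-- Positive definiteness in the form in which it is used: a linear bound on the vectors representing
-- `n`, which makes every coefficient a finite sum.
record Form (k : ℕ) : Set where
  field
    gram    : Mat k
    bound   : ℕ
    nonneg  : ∀ x → ∃ λ m → Q gram x ≡ + m
    bounded : ∀ x n → Q gram x ≡ + n → InBox (bound ℕ.* n) x
open Form

term : ∀ {k} → (V k → ℤ) → Form k → ℕ → V k → ℤ
term f F n x = f x * δℤ (Q (gram F) x) (+ n)

-- The theta series Σ f(x) q^{Q(x)}. By `Lat-box` any larger box gives the same coefficient, so
-- series of different forms can be compared in a common box.
Lat : ∀ {k} → (V k → ℤ) → Form k → Series
Lat {k} f F n = Σb (bound F ℕ.* n) k (term f F n)

term-≢0 : ∀ {k} f (F : Form k) n x → ¬ (term f F n x ≡ + 0) → Q (gram F) x ≡ + n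
term-≢0 f F n x p with Q (gram F) x ℤ.≟ + n
... | yes e = e
... | no  _ = ⊥-elim (p (ℤₚ.*-zeroʳ (f x)))

InBox-mono : ∀ {k N M} {x : V k} → N ℕ.≤ M → InBox N x → InBox M x
InBox-mono p = All.map (λ q → ℕₚ.≤-trans q p)

Lat-box : ∀ {k} f (F : Form k) N n → bound F ℕ.* n ℕ.≤ N → Lat f F n ≡ Σb N k (term f F n)
Lat-box f F N n p = Σb-support (bound F ℕ.* n) N (term f F n) λ x q →
  let b = bounded F x n (term-≢0 f F n x q) in b , InBox-mono p b

Lat-cong : ∀ {k} {f g : V k → ℤ} (F : Form k) → (∀ x → f x ≡ g x) → Lat f F ≐ Lat g F
Lat-cong F h n = Σb-cong (bound F ℕ.* n) _ (λ x → cong (_* δℤ (Q (gram F) x) (+ n)) (h x))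

Lat-form : ∀ {k} (f : V k → ℤ) (F G : Form k) → (∀ x → Q (gram F) x ≡ Q (gram G) x) → Lat f F ≐ Lat f G
Lat-form {k} f F G h n = begin
  Lat f F n            ≡⟨ Lat-box f F N n (ℕₚ.m≤m+n (bound F ℕ.* n) (bound G ℕ.* n)) ⟩
  Σb N k (term f F n)  ≡⟨ Σb-cong N k (λ x → cong (λ t → f x * δℤ t (+ n)) (h x)) ⟩
  Σb N k (term f G n)  ≡⟨ sym (Lat-box f G N n (ℕₚ.m≤n+m (bound G ℕ.* n) (bound F ℕ.* n))) ⟩
  Lat f G n ∎
  where
  open ≡-Reasoning
  N = bound F ℕ.* n ℕ.+ bound G ℕ.* n

Lat-⊕ : ∀ {k} (f g : V k → ℤ) (F : Form k) → Lat (λ x → f x + g x) F ≐ Lat f F ⊕ Lat g F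
Lat-⊕ f g F n = trans (Σb-cong (bound F ℕ.* n) _ (λ x → ℤₚ.*-distribʳ-+ (δℤ (Q (gram F) x) (+ n)) (f x) (g x))) (Σb-+ (bound F ℕ.* n) _ (term f F n) (term g F n))

Lat-scale : ∀ {k} c (f : V k → ℤ) (F : Form k) → Lat (λ x → c * f x) F ≐ scale c (Lat f F)
Lat-scale c f F n = trans (Σb-cong (bound F ℕ.* n) _ (λ x → ℤₚ.*-assoc c (f x) (δℤ (Q (gram F) x) (+ n)))) (Σb-*ˡ (bound F ℕ.* n) _ c (term f F n))

Lat-0 : ∀ {k} (f : V k → ℤ) (F : Form k) → (∀ x → f x ≡ + 0) → Lat f F ≐ zeroS
Lat-0 f F h n = trans (Lat-cong F (λ x → trans (h x) (sym (ℤₚ.*-zeroˡ (+ 0)))) n) (trans (Lat-scale (+ 0) (λ _ → + 0) F n) (ℤₚ.*-zeroˡ (Lat (λ _ → + 0) F n)))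

Lat-dil : ∀ {k} d .{{_ : NonZero d}} (f : V k → ℤ) (F G : Form k) → (∀ x → Q (gram G) x ≡ + d * Q (gram F) x) → dil d (Lat f F) ≐ Lat f G
Lat-dil {k} d f F G h = dil-char d {f = Lat f F} on off
  where
  open ≡-Reasoning
  on : ∀ m → Lat f G (m ℕ.* d) ≡ Lat f F m
  on m = begin
    Lat f G (m ℕ.* d)            ≡⟨ Lat-box f G N (m ℕ.* d) (ℕₚ.m≤m+n _ _) ⟩
    Σb N k (term f G (m ℕ.* d))  ≡⟨ Σb-cong N k (λ x → cong (f x *_) (δℤ-cong {Q (gram G) x} {+ (m ℕ.* d)} {Q (gram F) x} {+ m} (λ e → ℤₚ.*-cancelˡ-≡ (+ d) _ _ (trans (sym (h x)) (trans e (sw m)))) (λ e → trans (h x) (trans (cong (+ d *_) e) (sym (sw m)))))) ⟩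
    Σb N k (term f F m)          ≡⟨ sym (Lat-box f F N m (ℕₚ.m≤n+m _ _)) ⟩
    Lat f F m ∎
    where
    N = bound G ℕ.* (m ℕ.* d) ℕ.+ bound F ℕ.* m
    sw : ∀ m → + (m ℕ.* d) ≡ + d * + m
    sw m = trans (ℤₚ.pos-* m d) (ℤₚ.*-comm (+ m) (+ d))
  off : ∀ n → ¬ (n ℕ.% d ≡ 0) → Lat f G n ≡ + 0
  off n e = trans (Σb-cong (bound G ℕ.* n) k (λ x → trans (cong (f x *_) (δℤ-≢ (no-rep x))) (trans (ℤₚ.*-zeroʳ (f x)) (sym (ℤₚ.*-zeroˡ (+ 0)))))) (Σb-*ˡ (bound G ℕ.* n) k (+ 0) (λ _ → + 0))
    where
    no-rep : ∀ x → ¬ (Q (gram G) x ≡ + n)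
    no-rep x q with nonneg F x
    ... | m , r = e (trans (cong (ℕ._% d) (ℤₚ.+-injective (trans (sym q) (trans (h x) (trans (cong (+ d *_) r) (trans (ℤₚ.*-comm (+ d) (+ m)) (sym (ℤₚ.pos-* m d)))))))) (ℕD.m*n%n≡0 m d))

Σb-++ : ∀ N k l (w : V (k ℕ.+ l) → ℤ) → Σb N (k ℕ.+ l) w ≡ Σb N k (λ v → Σb N l (λ u → w (v ++ u)))
Σb-++ N zero    l w = refl
Σb-++ N (suc k) l w = sumZ-cong N (λ x → Σb-++ N k l (λ v → w (x ∷ v)))

_⊗_ : ∀ {k l} → (V k → ℤ) → (V l → ℤ) → V (k ℕ.+ l) → ℤ
_⊗_ {k} f g x = f (take k x) * g (drop k x)

take-++ : ∀ {k l} (v : V k) (u : V l) → take k (v ++ u) ≡ v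
take-++ []      u = refl
take-++ (x ∷ v) u = cong (x ∷_) (take-++ v u)

drop-++ : ∀ {k l} (v : V k) (u : V l) → drop k (v ++ u) ≡ u
drop-++ []      u = refl
drop-++ (x ∷ v) u = drop-++ v u

sumTo-δδ : ∀ n α β → sumTo n (λ i → δℤ (+ α) (+ i) * δℤ (+ β) (+ (n ℕ.∸ i))) ≡ δℤ (+ α + + β) (+ n)
sumTo-δδ n α β with α ℕ.≤? n
... | yes p = begin
  sumTo n (λ i → δℤ (+ α) (+ i) * δℤ (+ β) (+ (n ℕ.∸ i))) ≡⟨ sumTo-cong′ n (λ i → cong (_* δℤ (+ β) (+ (n ℕ.∸ i))) (conv i)) ⟩
  sumTo n (λ i → δ i α * δℤ (+ β) (+ (n ℕ.∸ i)))          ≡⟨ sumTo-δ n α (λ i → δℤ (+ β) (+ (n ℕ.∸ i))) p ⟩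
  δℤ (+ β) (+ (n ℕ.∸ α))                                  ≡⟨ δℤ-cong {+ β} {+ (n ℕ.∸ α)} {+ α + + β} {+ n} (λ e → cong +_ (trans (cong (α ℕ.+_) (ℤₚ.+-injective e)) (ℕₚ.m+[n∸m]≡n p))) (λ e → cong +_ (trans (sym (ℕₚ.m+n∸m≡n α β)) (cong (ℕ._∸ α) (ℤₚ.+-injective e)))) ⟩
  δℤ (+ α + + β) (+ n) ∎
  where
  open ≡-Reasoning
  conv : ∀ i → δℤ (+ α) (+ i) ≡ δ i α
  conv i with i ℕ.≟ α
  ... | yes refl = δℤ-refl (+ i)
  ... | no  q    = δℤ-≢ (λ e → q (sym (ℤₚ.+-injective e)))
... | no  p = trans (sumTo-zero n (λ i q → trans (cong (_* δℤ (+ β) (+ (n ℕ.∸ i))) (δℤ-≢ (λ e → p (subst (ℕ._≤ n) (sym (ℤₚ.+-injective e)) q)))) (ℤₚ.*-zeroˡ (δℤ (+ β) (+ (n ℕ.∸ i)))))) (sym (δℤ-≢ (λ e → p (subst (α ℕ.≤_) (ℤₚ.+-injective e) (ℕₚ.m≤m+n α β)))))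

Lat-⊛ : ∀ {k l} (f : V k → ℤ) (g : V l → ℤ) (F : Form k) (G : Form l) (H : Form (k ℕ.+ l)) →
  (∀ v u → Q (gram H) (v ++ u) ≡ Q (gram F) v + Q (gram G) u) → Lat f F ⊛ Lat g G ≐ Lat (f ⊗ g) H
Lat-⊛ {k} {l} f g F G H h n = begin
  sumTo n (λ i → Lat f F i * Lat g G (n ℕ.∸ i))
    ≡⟨ sumTo-cong n (λ i p → trans (cong₂ _*_ (Lat-box f F N i (bF i p)) (Lat-box g G N (n ℕ.∸ i) (bG (n ℕ.∸ i) (ℕₚ.m∸n≤m n i)))) (prod i)) ⟩
  sumTo n (λ i → Σb N k (λ v → Σb N l (λ u → a v u * c v u i)))
    ≡⟨ sym (Σb-sumTo N k n _) ⟩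
  Σb N k (λ v → sumTo n (λ i → Σb N l (λ u → a v u * c v u i)))
    ≡⟨ Σb-cong N k (λ v → sym (Σb-sumTo N l n _)) ⟩
  Σb N k (λ v → Σb N l (λ u → sumTo n (λ i → a v u * c v u i)))
    ≡⟨ Σb-cong N k (λ v → Σb-cong N l (λ u → trans (sumTo-*ˡ n (a v u) (c v u)) (trans (cong (a v u *_) (conv v u)) (cong (_* δℤ (Q (gram H) (v ++ u)) (+ n)) (sym (cong₂ _*_ (cong f (take-++ v u)) (cong g (drop-++ v u)))))))) ⟩
  Σb N k (λ v → Σb N l (λ u → term (f ⊗ g) H n (v ++ u)))
    ≡⟨ sym (Σb-++ N k l (term (f ⊗ g) H n)) ⟩
  Σb N (k ℕ.+ l) (term (f ⊗ g) H n)
    ≡⟨ sym (Lat-box (f ⊗ g) H N n (ℕₚ.m≤n+m _ _)) ⟩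
  Lat (f ⊗ g) H n ∎
  where
  open ≡-Reasoning
  N = bound F ℕ.* n ℕ.+ bound G ℕ.* n ℕ.+ bound H ℕ.* n
  a : V k → V l → ℤ
  a v u = f v * g u
  c : V k → V l → ℕ → ℤ
  c v u i = δℤ (Q (gram F) v) (+ i) * δℤ (Q (gram G) u) (+ (n ℕ.∸ i))
  bF : ∀ i → i ℕ.≤ n → bound F ℕ.* i ℕ.≤ N
  bF i p = ℕₚ.≤-trans (ℕₚ.*-monoʳ-≤ (bound F) p) (ℕₚ.≤-trans (ℕₚ.m≤m+n _ _) (ℕₚ.m≤m+n _ _))
  bG : ∀ i → i ℕ.≤ n → bound G ℕ.* i ℕ.≤ N
  bG i p = ℕₚ.≤-trans (ℕₚ.*-monoʳ-≤ (bound G) p) (ℕₚ.≤-trans (ℕₚ.m≤n+m _ (bound F ℕ.* n)) (ℕₚ.m≤m+n _ _))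
  lem : ∀ x y z t → x * y * (z * t) ≡ x * z * (y * t)
  lem = solve-∀
  prod : ∀ i → Σb N k (term f F i) * Σb N l (term g G (n ℕ.∸ i)) ≡ Σb N k (λ v → Σb N l (λ u → a v u * c v u i))
  prod i = trans (ℤₚ.*-comm (Σb N k (term f F i)) _) (trans (sym (Σb-*ˡ N k (Σb N l (term g G (n ℕ.∸ i))) (term f F i))) (Σb-cong N k (λ v → trans (ℤₚ.*-comm _ (term f F i v)) (trans (sym (Σb-*ˡ N l (term f F i v) (term g G (n ℕ.∸ i)))) (Σb-cong N l (λ u → lem (f v) _ (g u) _))))))
  conv : ∀ v u → sumTo n (c v u) ≡ δℤ (Q (gram H) (v ++ u)) (+ n)
  conv v u with nonneg F v | nonneg G u
  ... | α , p | β , q = trans (sumTo-cong′ n (λ i → cong₂ (λ s t → δℤ s (+ i) * δℤ t (+ (n ℕ.∸ i))) p q)) (trans (sumTo-δδ n α β) (cong (λ t → δℤ t (+ n)) (sym (trans (h v u) (cong₂ _+_ p q)))))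

-- Changes of variables with denominators.

ind : (d : ℕ) .{{_ : NonZero d}} → ℤ → ℤ
ind d p = δ (p %ℕ d) 0

divI : (d : ℕ) .{{_ : NonZero d}} → ∀ {k} → V k → ℤ
divI d []      = + 1
divI d (p ∷ v) = ind d p * divI d v

mask : ∀ {k} → Mat k → (d : ℕ) .{{_ : NonZero d}} → (V k → ℤ) → V k → ℤ
mask B d f c = divI d (mv B c) * f c

-- The counterpart of `mask` after the substitution c = A u / d: both weights vanish where the
-- substitution in question leaves the lattice.
pl : ∀ {k} → Mat k → (d : ℕ) .{{_ : NonZero d}} → (V k → ℤ) → V k → ℤ
pl A d f u = divI d (mv A u) * f (map (_/ℕ d) (mv A u))

/ℕ-exact : ∀ d .{{_ : NonZero d}} p → p %ℕ d ≡ 0 → p ≡ + d * (p /ℕ d)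
/ℕ-exact d p e = trans (ℤD.a≡a%ℕn+[a/ℕn]*n p d) (trans (cong (λ t → + t + (p /ℕ d) * + d) e) (trans (ℤₚ.+-identityˡ _) (ℤₚ.*-comm (p /ℕ d) (+ d))))

-- Two remainders differ by less than `d`, whereas distinct quotients would force a difference of at
-- least `d`.
ℤ-res-unique : ∀ d .{{_ : NonZero d}} r r′ (q q′ : ℤ) → r ℕ.< d → r′ ℕ.< d → + r + q * + d ≡ + r′ + q′ * + d → r ≡ r′ × q ≡ q′
ℤ-res-unique d r r′ q q′ p p′ e with q ℤ.≟ q′
... | yes refl = ℤₚ.+-injective (trans (sym (ab (+ r) (q * + d))) (trans (cong (_- q * + d) e) (ab (+ r′) (q * + d)))) , refl
  where
  ab : ∀ a b → a + b - b ≡ a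
  ab = solve-∀
... | no  ne = ⊥-elim (ℕₚ.<⇒≱ small big)
  where
  lem : ∀ r r′ q q′ d → r + q * d ≡ r′ + q′ * d → r - r′ ≡ (q′ - q) * d
  lem r r′ q q′ d e = trans (a r r′ q d) (trans (cong (λ t → t - (r′ + q * d)) e) (b r′ q q′ d))
    where
    a : ∀ r r′ q d → r - r′ ≡ r + q * d - (r′ + q * d)
    a = solve-∀
    b : ∀ r′ q q′ d → r′ + q′ * d - (r′ + q * d) ≡ (q′ - q) * d
    b = solve-∀
  eqd = lem (+ r) (+ r′) q q′ (+ d) e
  bnd′ : ∣ r ℤ.⊖ r′ ∣ ℕ.< d
  bnd′ with ℕₚ.≤-total r r′
  ... | inj₁ le = ℕₚ.≤-<-trans (ℕₚ.≤-reflexive (ℤₚ.∣⊖∣-≤ le)) (ℕₚ.≤-<-trans (ℕₚ.m∸n≤m r′ r) p′)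
  ... | inj₂ le = ℕₚ.≤-<-trans (ℕₚ.≤-reflexive (trans (ℤₚ.∣m⊖n∣≡∣n⊖m∣ r r′) (ℤₚ.∣⊖∣-≤ le))) (ℕₚ.≤-<-trans (ℕₚ.m∸n≤m r r′) p)
  small : ∣ + r - + r′ ∣ ℕ.< d
  small = subst (ℕ._< d) (sym (cong ∣_∣ (ℤₚ.m-n≡m⊖n r r′))) bnd′
  nz : ¬ (∣ q′ - q ∣ ≡ 0)
  nz z = ne (sym (ℤₚ.i-j≡0⇒i≡j q′ q (ℤₚ.∣i∣≡0⇒i≡0 z)))
  big : d ℕ.≤ ∣ + r - + r′ ∣
  big = subst (d ℕ.≤_) (sym (trans (cong ∣_∣ eqd) (ℤₚ.abs-* (q′ - q) (+ d)))) (ℕₚ.m≤n*m d ∣ q′ - q ∣ {{ℕ.≢-nonZero nz}})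

%ℕ-unique : ∀ d .{{_ : NonZero d}} x r q → r ℕ.< d → x ≡ + r + q * + d → x %ℕ d ≡ r × x /ℕ d ≡ q
%ℕ-unique d x r q p e = ℤ-res-unique d (x %ℕ d) r (x /ℕ d) q (ℤD.n%ℕd<d x d) p (trans (sym (ℤD.a≡a%ℕn+[a/ℕn]*n x d)) e)

δ-exact : ∀ d .{{_ : NonZero d}} u p → δℤ u (p /ℕ d) * ind d p ≡ δℤ (+ d * u) p
δ-exact d u p with p %ℕ d ℕ.≟ 0
... | yes e = trans (ℤₚ.*-identityʳ _) (δℤ-cong {u} {p /ℕ d} {+ d * u} {p} (λ q → trans (cong (+ d *_) q) (sym (/ℕ-exact d p e))) (λ q → ℤₚ.*-cancelˡ-≡ (+ d) u (p /ℕ d) (trans q (/ℕ-exact d p e))))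
... | no  e = trans (ℤₚ.*-zeroʳ (δℤ u (p /ℕ d))) (sym (δℤ-≢ (λ q → e (proj₁ (%ℕ-unique d p 0 u (ℕₚ.n≢0⇒n>0 (ℕ.≢-nonZero⁻¹ d)) (trans (sym q) (trans (ℤₚ.*-comm (+ d) u) (sym (ℤₚ.+-identityˡ _)))))))))

δV-exact : ∀ d .{{_ : NonZero d}} {k} (u p : V k) → δV u (map (_/ℕ d) p) * divI d p ≡ δV (+ d *V u) p
δV-exact d []      []      = refl
δV-exact d (u ∷ us) (p ∷ ps) = trans (lem (δℤ u (p /ℕ d)) _ (ind d p) _) (cong₂ _*_ (δ-exact d u p) (δV-exact d us ps))
  where
  lem : ∀ x y z t → x * y * (z * t) ≡ x * z * (y * t)
  lem = solve-∀

*V-injective : ∀ d .{{_ : NonZero d}} {k} (u v : V k) → + d *V u ≡ + d *V v → u ≡ v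
*V-injective d []      []      e = refl
*V-injective d (x ∷ u) (y ∷ v) e = cong₂ _∷_ (ℤₚ.*-cancelˡ-≡ (+ d) x y (cong head′ e)) (*V-injective d u v (cong tail′ e))
  where
  head′ : ∀ {k} → V (suc k) → ℤ
  head′ (x ∷ _) = x
  tail′ : ∀ {k} → V (suc k) → V k
  tail′ (_ ∷ v) = v

*V-*V : ∀ a b {k} (u : V k) → a *V (b *V u) ≡ (a * b) *V u
*V-*V a b []      = refl
*V-*V a b (x ∷ u) = cong₂ _∷_ (sym (ℤₚ.*-assoc a b x)) (*V-*V a b u)

dot-*ʳ : ∀ {k} c (a x : V k) → dot a (c *V x) ≡ c * dot a x
dot-*ʳ c a x = trans (dot-comm a (c *V x)) (trans (dot-* c x a) (cong (c *_) (dot-comm x a)))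

mv-* : ∀ {k l} (A : Vec (V k) l) c x → mv A (c *V x) ≡ c *V mv A x
mv-* []      c x = refl
mv-* (r ∷ A) c x = cong₂ _∷_ (dot-*ʳ c r x) (mv-* A c x)

Q-* : ∀ {k} (T : Mat k) c x → Q T (c *V x) ≡ c * c * Q T x
Q-* T c x = trans (cong (dot (c *V x)) (mv-* T c x)) (trans (dot-* c x _) (trans (cong (c *_) (dot-*ʳ c x (mv T x))) (sym (ℤₚ.*-assoc c c _))))

module _ {k} (A B : Mat k) (d₁ d₂ : ℕ) .{{_ : NonZero d₁}} .{{_ : NonZero d₂}}
         (AB : A ⊡ B ≡ scalar k (+ d₁ * + d₂)) (BA : B ⊡ A ≡ scalar k (+ d₁ * + d₂))
         (F G : Form k) (hQ : ∀ c → Q (gram G) (mv B c) ≡ + d₂ * + d₂ * Q (gram F) c) (f : V k → ℤ) where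

  private
    →′ : ∀ c u → + d₂ *V u ≡ mv B c → + d₁ *V c ≡ mv A u
    →′ c u e = *V-injective d₂ _ _ (begin
      + d₂ *V (+ d₁ *V c)     ≡⟨ *V-*V (+ d₂) (+ d₁) c ⟩
      (+ d₂ * + d₁) *V c      ≡⟨ cong (_*V c) (ℤₚ.*-comm (+ d₂) (+ d₁)) ⟩
      (+ d₁ * + d₂) *V c      ≡⟨ sym (mv-scalar (+ d₁ * + d₂) c) ⟩
      mv (scalar k (+ d₁ * + d₂)) c ≡⟨ cong (λ X → mv X c) (sym AB) ⟩
      mv (A ⊡ B) c            ≡⟨ sym (mv-⊡ A B c) ⟩
      mv A (mv B c)           ≡⟨ cong (mv A) (sym e) ⟩
      mv A (+ d₂ *V u)        ≡⟨ mv-* A (+ d₂) u ⟩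
      + d₂ *V mv A u ∎)
      where open ≡-Reasoning
    ←′ : ∀ c u → + d₁ *V c ≡ mv A u → + d₂ *V u ≡ mv B c
    ←′ c u e = *V-injective d₁ _ _ (begin
      + d₁ *V (+ d₂ *V u)     ≡⟨ *V-*V (+ d₁) (+ d₂) u ⟩
      (+ d₁ * + d₂) *V u      ≡⟨ sym (mv-scalar (+ d₁ * + d₂) u) ⟩
      mv (scalar k (+ d₁ * + d₂)) u ≡⟨ cong (λ X → mv X u) (sym BA) ⟩
      mv (B ⊡ A) u            ≡⟨ sym (mv-⊡ B A u) ⟩
      mv B (mv A u)           ≡⟨ cong (mv B) (sym e) ⟩
      mv B (+ d₁ *V c)        ≡⟨ mv-* B (+ d₁) c ⟩
      + d₁ *V mv B c ∎)
      where open ≡-Reasoning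
    form-eq : ∀ c u → + d₂ *V u ≡ mv B c → Q (gram G) u ≡ Q (gram F) c
    form-eq c u e = ℤₚ.*-cancelˡ-≡ (+ d₂) _ _ (ℤₚ.*-cancelˡ-≡ (+ d₂) _ _ (trans (sym (ℤₚ.*-assoc (+ d₂) (+ d₂) _)) (trans (sym (Q-* (gram G) (+ d₂) u)) (trans (cong (Q (gram G)) e) (trans (hQ c) (ℤₚ.*-assoc (+ d₂) (+ d₂) _))))))

    divI-≢0 : ∀ d .{{_ : NonZero d}} {k} (p : V k) → ¬ (divI d p ≡ + 0) → + d *V map (_/ℕ d) p ≡ p
    divI-≢0 d []      h = refl
    divI-≢0 d (p ∷ v) h with p %ℕ d ℕ.≟ 0
    ... | yes e = cong₂ _∷_ (sym (/ℕ-exact d p e)) (divI-≢0 d v (λ z → h (trans (ℤₚ.*-identityˡ _) z)))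
    ... | no  e = ⊥-elim (h (ℤₚ.*-zeroˡ (divI d v)))

    fst≢0 : ∀ a b c → ¬ (a * b * c ≡ + 0) → ¬ (a ≡ + 0)
    fst≢0 a b c h refl = h (trans (cong (_* c) (ℤₚ.*-zeroˡ b)) (ℤₚ.*-zeroˡ c))

  -- Change of variables u = Bc/d₂, c = Au/d₁.
  transfer : Lat (mask B d₂ f) F ≐ Lat (pl A d₁ f) G
  transfer n = Σb-bijection (bound F ℕ.* n) (bound G ℕ.* n) (term (mask B d₂ f) F n) (term (pl A d₁ f) G n) (λ c → map (_/ℕ d₂) (mv B c)) (λ u → map (_/ℕ d₁) (mv A u)) bd bd′ eqn
    where
    bd : ∀ c → ¬ (term (mask B d₂ f) F n c ≡ + 0) → InBox (bound G ℕ.* n) (map (_/ℕ d₂) (mv B c))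
    bd c h = bounded G _ n (trans (form-eq c _ (divI-≢0 d₂ (mv B c) (fst≢0 (divI d₂ (mv B c)) (f c) _ h))) (term-≢0 (mask B d₂ f) F n c h))
    bd′ : ∀ u → ¬ (term (pl A d₁ f) G n u ≡ + 0) → InBox (bound F ℕ.* n) (map (_/ℕ d₁) (mv A u))
    bd′ u h = bounded F _ n (trans (sym (form-eq _ u (←′ _ u (divI-≢0 d₁ (mv A u) (fst≢0 (divI d₁ (mv A u)) (f (map (_/ℕ d₁) (mv A u))) _ h))))) (term-≢0 (pl A d₁ f) G n u h))
    r1 : ∀ x y z t → x * (y * z * t) ≡ x * y * (z * t)
    r1 = solve-∀
    eqn : ∀ c u → δV u (map (_/ℕ d₂) (mv B c)) * term (mask B d₂ f) F n c ≡ δV c (map (_/ℕ d₁) (mv A u)) * term (pl A d₁ f) G n u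
    eqn c u = begin
      δV u (map (_/ℕ d₂) (mv B c)) * (divI d₂ (mv B c) * f c * δℤ (Q (gram F) c) (+ n))
        ≡⟨ r1 (δV u (map (_/ℕ d₂) (mv B c))) (divI d₂ (mv B c)) (f c) _ ⟩
      δV u (map (_/ℕ d₂) (mv B c)) * divI d₂ (mv B c) * (f c * δℤ (Q (gram F) c) (+ n))
        ≡⟨ cong (_* (f c * δℤ (Q (gram F) c) (+ n))) (δV-exact d₂ u (mv B c)) ⟩
      δV (+ d₂ *V u) (mv B c) * (f c * δℤ (Q (gram F) c) (+ n))
        ≡⟨ swapQ ⟩
      δV (+ d₁ *V c) (mv A u) * (f c * δℤ (Q (gram G) u) (+ n))
        ≡⟨ cong (_* (f c * δℤ (Q (gram G) u) (+ n))) (sym (δV-exact d₁ c (mv A u))) ⟩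
      δV c w * divI d₁ (mv A u) * (f c * δℤ (Q (gram G) u) (+ n))
        ≡⟨ r2 (δV c w) (divI d₁ (mv A u)) (f c) _ ⟩
      δV c w * f c * (divI d₁ (mv A u) * δℤ (Q (gram G) u) (+ n))
        ≡⟨ cong (_* (divI d₁ (mv A u) * δℤ (Q (gram G) u) (+ n))) (δV-subst c w f) ⟩
      δV c w * f w * (divI d₁ (mv A u) * δℤ (Q (gram G) u) (+ n))
        ≡⟨ r3 (δV c w) (f w) (divI d₁ (mv A u)) _ ⟩
      δV c w * (divI d₁ (mv A u) * f w * δℤ (Q (gram G) u) (+ n)) ∎
      where
      open ≡-Reasoning
      w = map (_/ℕ d₁) (mv A u)
      r2 : ∀ x y z t → x * y * (z * t) ≡ x * z * (y * t)
      r2 = solve-∀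
      r3 : ∀ x y z t → x * y * (z * t) ≡ x * (z * y * t)
      r3 = solve-∀
      swapQ : δV (+ d₂ *V u) (mv B c) * (f c * δℤ (Q (gram F) c) (+ n)) ≡ δV (+ d₁ *V c) (mv A u) * (f c * δℤ (Q (gram G) u) (+ n))
      swapQ with (+ d₂ *V u) ≟V mv B c
      ... | yes e = cong₂ _*_ (δV-cong (→′ c u) (←′ c u)) (cong (λ t → f c * δℤ t (+ n)) (sym (form-eq c u e)))
      ... | no  e = trans (cong (_* (f c * δℤ (Q (gram F) c) (+ n))) (δV-≢ _ _ e)) (trans (ℤₚ.*-zeroˡ (f c * δℤ (Q (gram F) c) (+ n))) (sym (trans (cong (_* (f c * δℤ (Q (gram G) u) (+ n))) (δV-≢ _ _ (λ z → e (←′ c u z)))) (ℤₚ.*-zeroˡ (f c * δℤ (Q (gram G) u) (+ n))))))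

-- Periodic weights and their exhaustive verification.

data Cong (M : ℕ) (x y : ℤ) : Set where
  cong-by : (q : ℤ) → x ≡ y + q * + M → Cong M x y

Cong-res : ∀ M .{{_ : NonZero M}} x → Cong M x (+ (x %ℕ M))
Cong-res M x = cong-by (x /ℕ M) (ℤD.a≡a%ℕn+[a/ℕn]*n x M)

Cong-∣ : ∀ {m M x y} → m ∣ M → Cong M x y → Cong m x y
Cong-∣ {m} {M} {x} {y} (divides t e) (cong-by q p) = cong-by (q * + t) (trans p (cong (λ z → y + z) (trans (cong (q *_) (trans (cong +_ e) (ℤₚ.pos-* t m))) (sym (ℤₚ.*-assoc q (+ t) (+ m))))))

Cong-%ℕ : ∀ M .{{_ : NonZero M}} {x y} → Cong M x y → x %ℕ M ≡ y %ℕ M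
Cong-%ℕ M {x} {y} (cong-by q p) = proj₁ (%ℕ-unique M x (y %ℕ M) (y /ℕ M + q) (ℤD.n%ℕd<d y M) (trans p (trans (cong (_+ q * + M) (ℤD.a≡a%ℕn+[a/ℕn]*n y M)) (lem (+ (y %ℕ M)) (y /ℕ M) q (+ M)))))
  where
  lem : ∀ a b c d → a + b * d + c * d ≡ a + (b + c) * d
  lem = solve-∀

dotN : ∀ {k} → Vec ℕ k → Vec ℕ k → ℕ
dotN []      []      = 0
dotN (a ∷ v) (b ∷ u) = a ℕ.* b ℕ.+ dotN v u

resV : (M : ℕ) .{{_ : NonZero M}} → ∀ {k} → V k → Vec ℕ k
resV M = map (_%ℕ M)

dot-Cong : ∀ m .{{_ : NonZero m}} {M} .{{_ : NonZero M}} → m ∣ M → ∀ {k} (a u : V k) → Cong m (dot a u) (+ dotN (resV m a) (resV M u))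
dot-Cong m d []      []      = cong-by (+ 0) refl
dot-Cong m {M} d (a ∷ v) (x ∷ u) with Cong-res m a | Cong-∣ d (Cong-res M x) | dot-Cong m {M} d v u
... | cong-by p e | cong-by q e′ | cong-by r e″ = cong-by ((+ (a %ℕ m) * q + p * + (x %ℕ M) + p * q * + m) + r) (trans (cong₂ _+_ (cong₂ _*_ e e′) e″) (trans (lem (+ (a %ℕ m)) p (+ (x %ℕ M)) q (+ dotN (resV m v) (resV M u)) r (+ m)) (cong (_+ ((+ (a %ℕ m) * q + p * + (x %ℕ M) + p * q * + m) + r) * + m) (sym (trans (ℤₚ.pos-+ ((a %ℕ m) ℕ.* (x %ℕ M)) _) (cong (_+ + dotN (resV m v) (resV M u)) (ℤₚ.pos-* (a %ℕ m) (x %ℕ M))))))))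
  where
  lem : ∀ A p X q D r m → (A + p * m) * (X + q * m) + (D + r * m) ≡ A * X + D + ((A * q + p * X + p * q * m) + r) * m
  lem = solve-∀

indN : (d : ℕ) .{{_ : NonZero d}} → ℕ → ℤ
indN d r = δ (r ℕ.% d) 0

divN : (d : ℕ) .{{_ : NonZero d}} → ∀ {k} → Vec ℕ k → ℤ
divN d []      = + 1
divN d (r ∷ v) = indN d r * divN d v

linN : (m : ℕ) .{{_ : NonZero m}} → ∀ {k l} → Vec (V k) l → Vec ℕ k → Vec ℕ l
linN m A ρ = map (λ a → dotN (resV m a) ρ ℕ.% m) A

linN-res : ∀ m .{{_ : NonZero m}} {M} .{{_ : NonZero M}} → m ∣ M → ∀ {k l} (A : Vec (V k) l) u → linN m A (resV M u) ≡ resV m (mv A u)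
linN-res m {M} d []      u = refl
linN-res m {M} d (a ∷ A) u = cong₂ _∷_ (sym (Cong-%ℕ m (dot-Cong m {M} d a u))) (linN-res m {M} d A u)

-- A weight with period `M`, kept together with an evaluator on residues. Only `rep` is ever run;
-- `fun≡rep` carries the outcome over to all integer vectors.
record Per (k M : ℕ) .{{_ : NonZero M}} : Set where
  constructor per
  field
    fun : V k → ℤ
    rep : Vec ℕ k → ℤ
    fun≡rep : ∀ u → fun u ≡ rep (resV M u)
open Per public

_∔_ : ∀ {k M} .{{_ : NonZero M}} → Per k M → Per k M → Per k M
P ∔ P′ = per (λ u → fun P u + fun P′ u) (λ ρ → rep P ρ + rep P′ ρ) (λ u → cong₂ _+_ (fun≡rep P u) (fun≡rep P′ u))

_·_ : ∀ {k M} .{{_ : NonZero M}} → ℤ → Per k M → Per k M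
c · P = per (λ u → c * fun P u) (λ ρ → c * rep P ρ) (λ u → cong (c *_) (fun≡rep P u))

infixl 6 _∔_
infixr 7 _·_

resV-resV : ∀ m .{{_ : NonZero m}} {M} .{{_ : NonZero M}} → m ∣ M → ∀ {k} (u : V k) → resV m u ≡ map (ℕ._% m) (resV M u)
resV-resV m {M} d []      = refl
resV-resV m {M} d (x ∷ u) = cong₂ _∷_ (Cong-%ℕ m (Cong-∣ d (Cong-res M x))) (resV-resV m {M} d u)

perB : ∀ m .{{_ : NonZero m}} {M} .{{_ : NonZero M}} → m ∣ M → ∀ {k} → (Vec ℕ k → ℤ) → Per k M
perB m {M} d f = per (λ u → f (resV m u)) (λ ρ → f (map (ℕ._% m) ρ)) (λ u → cong f (resV-resV m {M} d u))

perMask : ∀ d .{{_ : NonZero d}} {M} .{{_ : NonZero M}} → d ∣ M → ∀ {k} → Mat k → Per k M → Per k M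
perMask d {M} e B P = per (mask B d (fun P)) (λ ρ → divN d (linN d B ρ) * rep P ρ) (λ u → cong₂ _*_ (trans (divI-res (mv B u)) (cong (divN d) (sym (linN-res d {M} e B u)))) (fun≡rep P u))
  where
  divI-res : ∀ {k} (p : V k) → divI d p ≡ divN d (resV d p)
  divI-res []      = refl
  divI-res (p ∷ v) = cong₂ _*_ (cong (λ t → δ t 0) (sym (ℕD.m<n⇒m%n≡m (ℤD.n%ℕd<d p d)))) (divI-res v)

divN-step : ∀ d m .{{_ : NonZero d}} .{{_ : NonZero m}} .{{_ : NonZero (d ℕ.* m)}} p → p %ℕ d ≡ 0 → (p /ℕ d) %ℕ m ≡ ((p %ℕ (d ℕ.* m)) ℕ./ d) ℕ.% m
divN-step d m p e = Cong-%ℕ m {y = + (r ℕ./ d)} (cong-by (p /ℕ (d ℕ.* m)) (ℤₚ.*-cancelˡ-≡ (+ d) _ _ (begin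
  + d * (p /ℕ d)                       ≡⟨ sym (/ℕ-exact d p e) ⟩
  p                                    ≡⟨ ℤD.a≡a%ℕn+[a/ℕn]*n p (d ℕ.* m) ⟩
  + r + q * + (d ℕ.* m)                ≡⟨ cong₂ (λ s t → s + q * t) (trans (cong +_ (trans (multiple d r r%d) (ℕₚ.*-comm (r ℕ./ d) d))) (ℤₚ.pos-* d (r ℕ./ d))) (ℤₚ.pos-* d m) ⟩
  + d * + (r ℕ./ d) + q * (+ d * + m)  ≡⟨ lem (+ d) (+ (r ℕ./ d)) q (+ m) ⟩
  + d * (+ (r ℕ./ d) + q * + m) ∎)))
  where
  open ≡-Reasoning
  r = p %ℕ (d ℕ.* m)
  q = p /ℕ (d ℕ.* m)
  r%d : r ℕ.% d ≡ 0
  r%d = trans (sym (Cong-%ℕ d (Cong-∣ (divides m (ℕₚ.*-comm d m)) (Cong-res (d ℕ.* m) p)))) e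
  lem : ∀ d a q m → d * a + q * (d * m) ≡ d * (a + q * m)
  lem = solve-∀

perPl : ∀ d m .{{_ : NonZero d}} .{{_ : NonZero m}} .{{_ : NonZero (d ℕ.* m)}} {M} .{{_ : NonZero M}} → (d ℕ.* m) ∣ M → ∀ {k} → Mat k → (Vec ℕ k → ℤ) → Per k M
perPl d m {M} e A f = per (pl A d (λ u → f (resV m u))) (λ ρ → out (linN (d ℕ.* m) A ρ)) (λ u → trans (correct (mv A u)) (cong out (sym (linN-res (d ℕ.* m) {M} e A u))))
  where
  quo : ∀ {l} → Vec ℕ l → Vec ℕ l
  quo = map (λ x → (x ℕ./ d) ℕ.% m)
  out : _ → ℤ
  out r = divN d r * f (quo r)
  ind-res : ∀ p → ind d p ≡ indN d (p %ℕ (d ℕ.* m))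
  ind-res p = cong (λ t → δ t 0) (Cong-%ℕ d (Cong-∣ (divides m (ℕₚ.*-comm d m)) (Cong-res (d ℕ.* m) p)))
  divI-res : ∀ {l} (p : V l) → divI d p ≡ divN d (resV (d ℕ.* m) p)
  divI-res []      = refl
  divI-res (p ∷ v) = cong₂ _*_ (ind-res p) (divI-res v)
  -- If some entry is not divisible by `d`, the quotient residues may disagree, but the weight is
  -- zero there.
  split : ∀ {l} (p : V l) → (divI d p ≡ + 0) ⊎ (resV m (map (_/ℕ d) p) ≡ quo (resV (d ℕ.* m) p))
  split []      = inj₂ refl
  split (p ∷ v) with p %ℕ d ℕ.≟ 0
  ... | no  _ = inj₁ (ℤₚ.*-zeroˡ (divI d v))
  ... | yes z with split v
  ...   | inj₁ w = inj₁ (trans (cong (+ 1 *_) w) refl)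
  ...   | inj₂ w = inj₂ (cong₂ _∷_ (divN-step d m p z) w)
  correct : ∀ p → divI d p * f (resV m (map (_/ℕ d) p)) ≡ out (resV (d ℕ.* m) p)
  correct p with split p
  ... | inj₂ w = cong₂ _*_ (divI-res p) (cong f w)
  ... | inj₁ w = trans (cong (_* f (resV m (map (_/ℕ d) p))) w) (trans (ℤₚ.*-zeroˡ (f (resV m (map (_/ℕ d) p)))) (sym (trans (cong (_* f (quo (resV (d ℕ.* m) p))) (trans (sym (divI-res p)) w)) (ℤₚ.*-zeroˡ (f (quo (resV (d ℕ.* m) p)))))))

allN : ℕ → (ℕ → Bool) → Bool
allN zero    P = true
allN (suc n) P = P n ∧ allN n P

allV : (M k : ℕ) → (Vec ℕ k → Bool) → Bool
allV M zero    P = P []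
allV M (suc k) P = allN M (λ i → allV M k (λ v → P (i ∷ v)))

∧-l : ∀ a b → a ∧ b ≡ true → a ≡ true
∧-l true b p = refl

∧-r : ∀ a b → a ∧ b ≡ true → b ≡ true
∧-r true b p = p

allN-sound : ∀ n P → allN n P ≡ true → ∀ i → i ℕ.< n → P i ≡ true
allN-sound (suc n) P h i (s≤s p) with i ℕ.≟ n
... | yes refl = ∧-l (P i) (allN i P) h
... | no  q    = allN-sound n P (∧-r (P n) (allN n P) h) i (ℕₚ.≤∧≢⇒< p q)

allV-sound : ∀ M .{{_ : NonZero M}} k P → allV M k P ≡ true → ∀ (u : V k) → P (resV M u) ≡ true
allV-sound M zero    P h []      = h
allV-sound M (suc k) P h (x ∷ u) = allV-sound M k (λ v → P ((x %ℕ M) ∷ v)) (allN-sound M _ h (x %ℕ M) (ℤD.n%ℕd<d x M)) u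

isZero : ℤ → Bool
isZero (+ 0) = true
isZero _     = false

isZero-sound : ∀ x → isZero x ≡ true → x ≡ + 0
isZero-sound (+ 0) p = refl
isZero-sound (+ suc n) ()
isZero-sound -[1+ n ] ()

-- The hypothesis is a closed Boolean over all M^k residue vectors, so in each application `refl`
-- makes the type checker do the verification.
vanishes : ∀ {k M} .{{_ : NonZero M}} (P : Per k M) → allV M k (λ ρ → isZero (rep P ρ)) ≡ true → ∀ u → fun P u ≡ + 0
vanishes {k} {M} P h u = trans (fun≡rep P u) (isZero-sound _ (allV-sound M k _ h u))

-- Unary and binary forms and orthogonal sums.

sq : ∀ x → x * x ≡ + (∣ x ∣ ℕ.* ∣ x ∣)
sq (+ n)    = sym (ℤₚ.pos-* n n)
sq -[1+ n ] = refl

∣x∣≤∣x∣² : ∀ n → n ℕ.≤ n ℕ.* n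
∣x∣≤∣x∣² zero    = z≤n
∣x∣≤∣x∣² (suc n) = ℕₚ.m≤m*n (suc n) (suc n)

nonneg-cancel : ∀ a m z → + suc a * z ≡ + m → ∃ λ n → z ≡ + n
nonneg-cancel a m (+ n)    e = n , refl
nonneg-cancel a m -[1+ n ] ()

unary : (a : ℕ) .{{_ : NonZero a}} → Form 1
unary a = record
  { gram = (+ a ∷ []) ∷ [] ; bound = 1
  ; nonneg = λ { (x ∷ []) → a ℕ.* (∣ x ∣ ℕ.* ∣ x ∣) , val x }
  ; bounded = λ { (x ∷ []) n e → ℕₚ.≤-trans (∣x∣≤∣x∣² ∣ x ∣) (ℕₚ.≤-trans (ℕₚ.m≤n*m (∣ x ∣ ℕ.* ∣ x ∣) a) (ℕₚ.≤-reflexive (trans (ℤₚ.+-injective (trans (sym (val x)) e)) (sym (ℕₚ.+-identityʳ n))))) ∷ [] } }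
  where
  lem : ∀ x a → x * (a * x + + 0) + + 0 ≡ a * (x * x)
  lem = solve-∀
  val : ∀ x → x * (+ a * x + + 0) + + 0 ≡ + (a ℕ.* (∣ x ∣ ℕ.* ∣ x ∣))
  val x = trans (lem x (+ a)) (trans (cong (+ a *_) (sq x)) (sym (ℤₚ.pos-* a _)))

blk : ∀ {k l} → Mat k → Mat l → Mat (k ℕ.+ l)
blk {k} {l} S T = map (_++ zeroV) S ++ map (zeroV ++_) T

dot-++ : ∀ {k l} (a v : V k) (b u : V l) → dot (a ++ b) (v ++ u) ≡ dot a v + dot b u
dot-++ []      []      b u = sym (ℤₚ.+-identityˡ _)
dot-++ (x ∷ a) (y ∷ v) b u = trans (cong (λ z → x * y + z) (dot-++ a v b u)) (sym (ℤₚ.+-assoc (x * y) (dot a v) (dot b u)))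

Q-blk : ∀ {k l} (S : Mat k) (T : Mat l) v u → Q (blk S T) (v ++ u) ≡ Q S v + Q T u
Q-blk {k} {l} S T v u = trans (cong (dot (v ++ u)) (rows S)) (dot-++ v (mv S v) u (mv T u))
  where
  bot : ∀ {m} (T : Vec (V l) m) → mv (map (zeroV {k} ++_) T) (v ++ u) ≡ mv T u
  bot []      = refl
  bot (t ∷ T) = cong₂ _∷_ (trans (dot-++ (zeroV {k}) v t u) (trans (cong (_+ dot t u) (dot-0 v)) (ℤₚ.+-identityˡ _))) (bot T)
  rows : ∀ {m} (S : Vec (V k) m) → mv (map (_++ zeroV {l}) S ++ map (zeroV {k} ++_) T) (v ++ u) ≡ mv S v ++ mv T u
  rows []      = bot T
  rows (s ∷ S) = cong₂ _∷_ (trans (dot-++ s v (zeroV {l}) u) (trans (cong (λ z → dot s v + z) (dot-0 u)) (ℤₚ.+-identityʳ _))) (rows S)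

split-++ : ∀ k {l} (x : V (k ℕ.+ l)) → ∃ λ (v : V k) → ∃ λ (u : V l) → x ≡ v ++ u
split-++ zero    x       = [] , x , refl
split-++ (suc k) (a ∷ x) with split-++ k x
... | v , u , refl = a ∷ v , u , refl

InBox-++ : ∀ {k l N} {v : V k} {u : V l} → InBox N v → InBox N u → InBox N (v ++ u)
InBox-++ []       q = q
InBox-++ (p ∷ ps) q = p ∷ InBox-++ ps q

_⊞_ : ∀ {k l} → Form k → Form l → Form (k ℕ.+ l)
_⊞_ {k} {l} F G = record
  { gram = blk (gram F) (gram G) ; bound = bound F ℕ.+ bound G ; nonneg = nn ; bounded = bd }
  where
  nn : ∀ x → ∃ λ m → Q (blk (gram F) (gram G)) x ≡ + m
  nn x with split-++ k x
  ... | v , u , refl with nonneg F v | nonneg G u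
  ...   | a , p | b , q = a ℕ.+ b , trans (Q-blk (gram F) (gram G) v u) (cong₂ _+_ p q)
  bd : ∀ x n → Q (blk (gram F) (gram G)) x ≡ + n → InBox ((bound F ℕ.+ bound G) ℕ.* n) x
  bd x n e with split-++ k x
  ... | v , u , refl with nonneg F v | nonneg G u
  ...   | a , p | b , q = InBox-++ (InBox-mono (ℕₚ.*-mono-≤ (ℕₚ.m≤m+n (bound F) (bound G)) (subst (a ℕ.≤_) s (ℕₚ.m≤m+n a b))) (bounded F v a p)) (InBox-mono (ℕₚ.*-mono-≤ (ℕₚ.m≤n+m (bound G) (bound F)) (subst (b ℕ.≤_) s (ℕₚ.m≤n+m b a))) (bounded G u b q))
    where
    s : a ℕ.+ b ≡ n
    s = ℤₚ.+-injective (trans (sym (cong₂ _+_ p q)) (trans (sym (Q-blk (gram F) (gram G) v u)) e))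

Lat-⊞ : ∀ {k l} (f : V k → ℤ) (g : V l → ℤ) (F : Form k) (G : Form l) → Lat f F ⊛ Lat g G ≐ Lat (f ⊗ g) (F ⊞ G)
Lat-⊞ f g F G = Lat-⊛ f g F G (F ⊞ G) (Q-blk (gram F) (gram G))

bgram : ℕ → ℕ → ℕ → Mat 2
bgram a b c = (+ a ∷ + b ∷ []) ∷ (+ 0 ∷ + c ∷ []) ∷ []

Q-bgram : ∀ a b c x y → Q (bgram a b c) (x ∷ y ∷ []) ≡ + a * x * x + + b * x * y + + c * y * y
Q-bgram a b c x y = lem (+ a) (+ b) (+ c) x y
  where
  lem : ∀ a b c x y → x * (a * x + (b * y + + 0)) + (y * (+ 0 * x + (c * y + + 0)) + + 0) ≡ a * x * x + b * x * y + c * y * y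
  lem = solve-∀

-- The positive definite form ax² + bxy + cy²; here 4ac - b² = D + 1, and the bound
-- comes from 4aF = (2ax + by)² + (4ac - b²)y² and its mirror image.
binary : (a b c D : ℕ) → 4 ℕ.* suc a ℕ.* suc c ≡ b ℕ.* b ℕ.+ suc D → Form 2
binary a b c D disc = record { gram = bgram (suc a) b (suc c) ; bound = 4 ℕ.* (suc a ℕ.+ suc c) ; nonneg = nn ; bounded = bd }
  where
  discℤ : + 4 * + suc a * + suc c ≡ + b * + b + + suc D
  discℤ = trans (cong (_* + suc c) (sym (ℤₚ.pos-* 4 (suc a)))) (trans (sym (ℤₚ.pos-* (4 ℕ.* suc a) (suc c))) (trans (cong +_ disc) (trans (ℤₚ.pos-+ (b ℕ.* b) (suc D)) (cong (_+ + suc D) (ℤₚ.pos-* b b)))))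
  complete : ∀ a b c D x y → + 4 * a * c ≡ b * b + D → + 4 * a * (a * x * x + b * x * y + c * y * y) ≡ (+ 2 * a * x + b * y) * (+ 2 * a * x + b * y) + D * (y * y)
  complete a b c D x y e = trans (l1 a b c x y) (trans (cong (λ t → + 4 * a * (a * x * x + b * x * y) + t * (y * y)) e) (l2 a b D x y))
    where
    l1 : ∀ a b c x y → + 4 * a * (a * x * x + b * x * y + c * y * y) ≡ + 4 * a * (a * x * x + b * x * y) + + 4 * a * c * (y * y)
    l1 = solve-∀
    l2 : ∀ a b D x y → + 4 * a * (a * x * x + b * x * y) + (b * b + D) * (y * y) ≡ (+ 2 * a * x + b * y) * (+ 2 * a * x + b * y) + D * (y * y)
    l2 = solve-∀
  sos : ∀ P y → P * P + + suc D * (y * y) ≡ + (∣ P ∣ ℕ.* ∣ P ∣ ℕ.+ suc D ℕ.* (∣ y ∣ ℕ.* ∣ y ∣))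
  sos P y = trans (cong₂ (λ s t → s + + suc D * t) (sq P) (sq y)) (trans (cong (λ t → + (∣ P ∣ ℕ.* ∣ P ∣) + t) (sym (ℤₚ.pos-* (suc D) (∣ y ∣ ℕ.* ∣ y ∣)))) (sym (ℤₚ.pos-+ (∣ P ∣ ℕ.* ∣ P ∣) _)))
  one-side : ∀ a c x y n → + 4 * + suc a * + suc c ≡ + b * + b + + suc D → + suc a * x * x + + b * x * y + + suc c * y * y ≡ + n → ∣ y ∣ ℕ.≤ 4 ℕ.* suc a ℕ.* n
  one-side a c x y n h e = ℕₚ.≤-trans (∣x∣≤∣x∣² ∣ y ∣) (ℕₚ.≤-trans (ℕₚ.m≤n*m (∣ y ∣ ℕ.* ∣ y ∣) (suc D)) (ℕₚ.≤-trans (ℕₚ.m≤n+m _ (∣ P ∣ ℕ.* ∣ P ∣)) (ℕₚ.≤-reflexive (ℤₚ.+-injective (trans (sym (sos P y)) (trans (sym (complete (+ suc a) (+ b) (+ suc c) (+ suc D) x y h)) (trans (cong (+ 4 * + suc a *_) e) (trans (cong (_* + n) (sym (ℤₚ.pos-* 4 (suc a)))) (sym (ℤₚ.pos-* (4 ℕ.* suc a) n))))))))))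
    where
    P = + 2 * + suc a * x + + b * y
  nn : ∀ v → ∃ λ m → Q (bgram (suc a) b (suc c)) v ≡ + m
  nn (x ∷ y ∷ []) = nonneg-cancel (a ℕ.+ 3 ℕ.* suc a) _ (Q (bgram (suc a) b (suc c)) (x ∷ y ∷ [])) (trans (cong (+ (4 ℕ.* suc a) *_) (Q-bgram (suc a) b (suc c) x y)) (trans (cong (_* (+ suc a * x * x + + b * x * y + + suc c * y * y)) (ℤₚ.pos-* 4 (suc a))) (trans (complete (+ suc a) (+ b) (+ suc c) (+ suc D) x y discℤ) (sos (+ 2 * + suc a * x + + b * y) y))))
  flip′ : ∀ a b c x y → a * x * x + b * x * y + c * y * y ≡ c * y * y + b * y * x + a * x * x
  flip′ = solve-∀
  comm′ : ∀ a c → + 4 * c * a ≡ + 4 * a * c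
  comm′ = solve-∀
  bd : ∀ v n → Q (bgram (suc a) b (suc c)) v ≡ + n → InBox (4 ℕ.* (suc a ℕ.+ suc c) ℕ.* n) v
  bd (x ∷ y ∷ []) n e = ℕₚ.≤-trans (one-side c a y x n (trans (comm′ (+ suc a) (+ suc c)) discℤ) (trans (sym (flip′ (+ suc a) (+ b) (+ suc c) x y)) e′)) (ℕₚ.*-monoˡ-≤ n (ℕₚ.*-monoʳ-≤ 4 (ℕₚ.m≤n+m (suc c) (suc a))))
                       ∷ ℕₚ.≤-trans (one-side a c x y n discℤ e′) (ℕₚ.*-monoˡ-≤ n (ℕₚ.*-monoʳ-≤ 4 (ℕₚ.m≤m+n (suc a) (suc c)))) ∷ []
    where
    e′ = trans (sym (Q-bgram (suc a) b (suc c) x y)) e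

absdot : ∀ {k} (r x : V k) M → InBox M x → ∃ λ K → (K ≡ dotN (map ∣_∣ r) (replicate k 1)) × (∣ dot r x ∣ ℕ.≤ K ℕ.* M)
absdot []      []      M []       = 0 , refl , z≤n
absdot (a ∷ r) (x ∷ v) M (p ∷ ps) with absdot r v M ps
... | K , refl , q = _ , refl , ℕₚ.≤-trans (ℤₚ.∣i+j∣≤∣i∣+∣j∣ (a * x) (dot r v)) (ℕₚ.≤-trans (ℕₚ.+-mono-≤ (ℕₚ.≤-trans (ℕₚ.≤-reflexive (ℤₚ.abs-* a x)) (ℕₚ.≤-trans (ℕₚ.*-monoʳ-≤ ∣ a ∣ p) (ℕₚ.≤-reflexive (cong (ℕ._* M) (sym (ℕₚ.*-identityʳ ∣ a ∣)))))) q) (ℕₚ.≤-reflexive (sym (ℕₚ.*-distribʳ-+ M (∣ a ∣ ℕ.* 1) K))))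

-- Explicit matrices and certificates.

-- Multiplication by four elements of norm 3 and, starred, by their conjugates: on one side for the L, on the other for the R.
L0 L0* : Mat 4
L0  = ((+ 1 ∷ + 2 ∷ + 0 ∷ + 2 ∷ []) ∷ (- + 4 ∷ - + 5 ∷ - + 1 ∷ - + 4 ∷ []) ∷ (+ 4 ∷ + 2 ∷ - + 1 ∷ + 0 ∷ []) ∷ (+ 1 ∷ + 2 ∷ + 1 ∷ + 1 ∷ []) ∷ [])
L0* = ((- + 3 ∷ - + 2 ∷ + 0 ∷ - + 2 ∷ []) ∷ (+ 4 ∷ + 3 ∷ + 1 ∷ + 4 ∷ []) ∷ (- + 4 ∷ - + 2 ∷ - + 1 ∷ + 0 ∷ []) ∷ (- + 1 ∷ - + 2 ∷ - + 1 ∷ - + 3 ∷ []) ∷ [])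
R0 R0* : Mat 4
R0  = ((+ 1 ∷ + 0 ∷ - + 1 ∷ - + 2 ∷ []) ∷ (- + 4 ∷ - + 1 ∷ + 1 ∷ + 4 ∷ []) ∷ (+ 4 ∷ + 2 ∷ - + 1 ∷ + 0 ∷ []) ∷ (+ 1 ∷ - + 1 ∷ - + 1 ∷ - + 3 ∷ []) ∷ [])
R0* = ((- + 3 ∷ + 0 ∷ + 1 ∷ + 2 ∷ []) ∷ (+ 4 ∷ - + 1 ∷ - + 1 ∷ - + 4 ∷ []) ∷ (- + 4 ∷ - + 2 ∷ - + 1 ∷ + 0 ∷ []) ∷ (- + 1 ∷ + 1 ∷ + 1 ∷ + 1 ∷ []) ∷ [])
L1 L1* : Mat 4
L1  = ((+ 1 ∷ - + 5 ∷ - + 5 ∷ - + 5 ∷ []) ∷ (- + 3 ∷ + 3 ∷ + 6 ∷ - + 3 ∷ []) ∷ (+ 3 ∷ - + 5 ∷ - + 7 ∷ + 0 ∷ []) ∷ (+ 1 ∷ + 0 ∷ - + 1 ∷ + 1 ∷ []) ∷ [])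
L1* = ((- + 2 ∷ + 5 ∷ + 5 ∷ + 5 ∷ []) ∷ (+ 3 ∷ - + 4 ∷ - + 6 ∷ + 3 ∷ []) ∷ (- + 3 ∷ + 5 ∷ + 6 ∷ + 0 ∷ []) ∷ (- + 1 ∷ + 0 ∷ + 1 ∷ - + 2 ∷ []) ∷ [])
R1 R1* : Mat 4
R1  = ((+ 1 ∷ + 0 ∷ + 1 ∷ - + 8 ∷ []) ∷ (- + 3 ∷ - + 7 ∷ - + 6 ∷ + 3 ∷ []) ∷ (+ 3 ∷ + 8 ∷ + 6 ∷ + 0 ∷ []) ∷ (+ 1 ∷ + 1 ∷ + 1 ∷ - + 2 ∷ []) ∷ [])
R1* = ((- + 2 ∷ + 0 ∷ - + 1 ∷ + 8 ∷ []) ∷ (+ 3 ∷ + 6 ∷ + 6 ∷ - + 3 ∷ []) ∷ (- + 3 ∷ - + 8 ∷ - + 7 ∷ + 0 ∷ []) ∷ (- + 1 ∷ - + 1 ∷ - + 1 ∷ + 1 ∷ []) ∷ [])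
L2 L2* : Mat 4
L2  = ((+ 2 ∷ - + 5 ∷ - + 5 ∷ - + 5 ∷ []) ∷ (- + 3 ∷ + 4 ∷ + 6 ∷ - + 3 ∷ []) ∷ (+ 3 ∷ - + 5 ∷ - + 6 ∷ + 0 ∷ []) ∷ (+ 1 ∷ + 0 ∷ - + 1 ∷ + 2 ∷ []) ∷ [])
L2* = ((- + 1 ∷ + 5 ∷ + 5 ∷ + 5 ∷ []) ∷ (+ 3 ∷ - + 3 ∷ - + 6 ∷ + 3 ∷ []) ∷ (- + 3 ∷ + 5 ∷ + 7 ∷ + 0 ∷ []) ∷ (- + 1 ∷ + 0 ∷ + 1 ∷ - + 1 ∷ []) ∷ [])
R2 R2* : Mat 4
R2  = ((+ 2 ∷ + 0 ∷ + 1 ∷ - + 8 ∷ []) ∷ (- + 3 ∷ - + 6 ∷ - + 6 ∷ + 3 ∷ []) ∷ (+ 3 ∷ + 8 ∷ + 7 ∷ + 0 ∷ []) ∷ (+ 1 ∷ + 1 ∷ + 1 ∷ - + 1 ∷ []) ∷ [])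
R2* = ((- + 1 ∷ + 0 ∷ - + 1 ∷ + 8 ∷ []) ∷ (+ 3 ∷ + 7 ∷ + 6 ∷ - + 3 ∷ []) ∷ (- + 3 ∷ - + 8 ∷ - + 6 ∷ + 0 ∷ []) ∷ (- + 1 ∷ - + 1 ∷ - + 1 ∷ + 2 ∷ []) ∷ [])
L3 L3* : Mat 4
L3  = ((+ 3 ∷ + 2 ∷ + 0 ∷ + 2 ∷ []) ∷ (- + 4 ∷ - + 3 ∷ - + 1 ∷ - + 4 ∷ []) ∷ (+ 4 ∷ + 2 ∷ + 1 ∷ + 0 ∷ []) ∷ (+ 1 ∷ + 2 ∷ + 1 ∷ + 3 ∷ []) ∷ [])
L3* = ((- + 1 ∷ - + 2 ∷ + 0 ∷ - + 2 ∷ []) ∷ (+ 4 ∷ + 5 ∷ + 1 ∷ + 4 ∷ []) ∷ (- + 4 ∷ - + 2 ∷ + 1 ∷ + 0 ∷ []) ∷ (- + 1 ∷ - + 2 ∷ - + 1 ∷ - + 1 ∷ []) ∷ [])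
R3 R3* : Mat 4
R3  = ((+ 3 ∷ + 0 ∷ - + 1 ∷ - + 2 ∷ []) ∷ (- + 4 ∷ + 1 ∷ + 1 ∷ + 4 ∷ []) ∷ (+ 4 ∷ + 2 ∷ + 1 ∷ + 0 ∷ []) ∷ (+ 1 ∷ - + 1 ∷ - + 1 ∷ - + 1 ∷ []) ∷ [])
R3* = ((- + 1 ∷ + 0 ∷ + 1 ∷ + 2 ∷ []) ∷ (+ 4 ∷ + 1 ∷ - + 1 ∷ - + 4 ∷ []) ∷ (- + 4 ∷ - + 2 ∷ + 1 ∷ + 0 ∷ []) ∷ (- + 1 ∷ + 1 ∷ + 1 ∷ + 3 ∷ []) ∷ [])
-- Isometries B of a sum of two binary forms onto a sublattice of the (rescaled) norm form, with A B a scalar.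
P1A P1B : Mat 4
P1A = ((+ 0 ∷ - + 6 ∷ - + 4 ∷ - + 8 ∷ []) ∷ (+ 0 ∷ + 2 ∷ + 0 ∷ + 7 ∷ []) ∷ (+ 4 ∷ + 2 ∷ + 0 ∷ + 0 ∷ []) ∷ (+ 0 ∷ + 0 ∷ + 0 ∷ - + 1 ∷ []) ∷ [])
P1B = ((+ 0 ∷ - + 1 ∷ + 1 ∷ - + 7 ∷ []) ∷ (+ 0 ∷ + 2 ∷ + 0 ∷ + 14 ∷ []) ∷ (- + 1 ∷ - + 3 ∷ + 0 ∷ - + 13 ∷ []) ∷ (+ 0 ∷ + 0 ∷ + 0 ∷ - + 4 ∷ []) ∷ [])
P2A P2B : Mat 4
P2A = ((+ 0 ∷ - + 4 ∷ - + 2 ∷ - + 6 ∷ []) ∷ (- + 1 ∷ + 3 ∷ + 3 ∷ + 2 ∷ []) ∷ (- + 1 ∷ - + 5 ∷ - + 3 ∷ - + 8 ∷ []) ∷ (+ 1 ∷ + 1 ∷ + 1 ∷ - + 2 ∷ []) ∷ [])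
P2B = ((+ 2 ∷ - + 1 ∷ - + 2 ∷ + 1 ∷ []) ∷ (- + 5 ∷ - + 1 ∷ + 3 ∷ + 2 ∷ []) ∷ (+ 5 ∷ + 2 ∷ - + 3 ∷ - + 1 ∷ []) ∷ (+ 1 ∷ + 0 ∷ - + 1 ∷ - + 1 ∷ []) ∷ [])
P3A P3B : Mat 4
P3A = ((+ 0 ∷ + 0 ∷ - + 1 ∷ + 0 ∷ []) ∷ (+ 0 ∷ - + 2 ∷ - + 2 ∷ + 0 ∷ []) ∷ (+ 4 ∷ + 2 ∷ + 0 ∷ + 0 ∷ []) ∷ (+ 0 ∷ - + 2 ∷ - + 1 ∷ - + 4 ∷ []) ∷ [])
P3B = ((- + 2 ∷ + 1 ∷ + 1 ∷ + 0 ∷ []) ∷ (+ 4 ∷ - + 2 ∷ + 0 ∷ + 0 ∷ []) ∷ (- + 4 ∷ + 0 ∷ + 0 ∷ + 0 ∷ []) ∷ (- + 1 ∷ + 1 ∷ + 0 ∷ - + 1 ∷ []) ∷ [])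
P4A P4B : Mat 4
P4A = ((- + 1 ∷ - + 7 ∷ - + 3 ∷ - + 13 ∷ []) ∷ (+ 0 ∷ - + 2 ∷ - + 2 ∷ + 0 ∷ []) ∷ (- + 1 ∷ - + 1 ∷ - + 1 ∷ - + 1 ∷ []) ∷ (- + 1 ∷ + 1 ∷ + 1 ∷ + 3 ∷ []) ∷ [])
P4B = ((+ 0 ∷ + 1 ∷ - + 3 ∷ - + 1 ∷ []) ∷ (- + 1 ∷ - + 2 ∷ + 4 ∷ - + 3 ∷ []) ∷ (+ 1 ∷ + 0 ∷ - + 4 ∷ + 3 ∷ []) ∷ (+ 0 ∷ + 1 ∷ - + 1 ∷ + 1 ∷ []) ∷ [])
R1A R1B : Mat 4
R1A = ((+ 0 ∷ + 2 ∷ + 0 ∷ + 8 ∷ []) ∷ (+ 0 ∷ + 4 ∷ + 3 ∷ + 3 ∷ []) ∷ (- + 4 ∷ - + 2 ∷ + 0 ∷ + 0 ∷ []) ∷ (+ 0 ∷ - + 2 ∷ - + 2 ∷ - + 2 ∷ []) ∷ [])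
R1B = ((+ 0 ∷ - + 4 ∷ - + 2 ∷ - + 6 ∷ []) ∷ (+ 0 ∷ + 8 ∷ + 0 ∷ + 12 ∷ []) ∷ (- + 1 ∷ - + 6 ∷ + 0 ∷ - + 13 ∷ []) ∷ (+ 1 ∷ - + 2 ∷ + 0 ∷ - + 3 ∷ []) ∷ [])
R2A R2B : Mat 4
R2A = ((- + 1 ∷ - + 3 ∷ - + 2 ∷ - + 5 ∷ []) ∷ (- + 1 ∷ - + 1 ∷ + 0 ∷ - + 1 ∷ []) ∷ (- + 2 ∷ + 12 ∷ + 6 ∷ + 26 ∷ []) ∷ (+ 0 ∷ + 2 ∷ + 2 ∷ + 0 ∷ []) ∷ [])
R2B = ((- + 5 ∷ - + 1 ∷ - + 1 ∷ - + 2 ∷ []) ∷ (+ 7 ∷ - + 9 ∷ + 1 ∷ + 4 ∷ []) ∷ (- + 7 ∷ + 9 ∷ - + 1 ∷ + 0 ∷ []) ∷ (- + 2 ∷ + 2 ∷ + 0 ∷ - + 2 ∷ []) ∷ [])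
XB2A XB2B : Mat 4
XB2A = ((- + 1 ∷ - + 1 ∷ + 2 ∷ - + 8 ∷ []) ∷ (- + 1 ∷ + 3 ∷ + 2 ∷ + 4 ∷ []) ∷ (- + 2 ∷ - + 3 ∷ - + 2 ∷ + 1 ∷ []) ∷ (+ 0 ∷ - + 3 ∷ - + 2 ∷ - + 5 ∷ []) ∷ [])
XB2B = ((+ 0 ∷ - + 6 ∷ - + 1 ∷ - + 5 ∷ []) ∷ (- + 2 ∷ + 8 ∷ - + 3 ∷ + 9 ∷ []) ∷ (+ 3 ∷ - + 7 ∷ + 2 ∷ - + 10 ∷ []) ∷ (+ 0 ∷ - + 2 ∷ + 1 ∷ - + 3 ∷ []) ∷ [])
Y1AA Y1AB : Mat 4
Y1AA = ((- + 1 ∷ - + 7 ∷ - + 3 ∷ - + 13 ∷ []) ∷ (+ 0 ∷ - + 1 ∷ - + 1 ∷ + 0 ∷ []) ∷ (+ 2 ∷ - + 2 ∷ - + 2 ∷ - + 6 ∷ []) ∷ (+ 1 ∷ + 1 ∷ + 1 ∷ + 1 ∷ []) ∷ [])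
Y1AB = ((+ 0 ∷ + 4 ∷ + 1 ∷ + 6 ∷ []) ∷ (- + 2 ∷ - + 8 ∷ + 3 ∷ - + 8 ∷ []) ∷ (+ 2 ∷ + 0 ∷ - + 3 ∷ + 8 ∷ []) ∷ (+ 0 ∷ + 4 ∷ - + 1 ∷ + 2 ∷ []) ∷ [])
Y3AA Y3AB : Mat 4
Y3AA = ((+ 1 ∷ - + 1 ∷ - + 2 ∷ + 1 ∷ []) ∷ (+ 0 ∷ - + 2 ∷ - + 1 ∷ - + 3 ∷ []) ∷ (+ 2 ∷ + 2 ∷ + 2 ∷ - + 4 ∷ []) ∷ (- + 1 ∷ - + 5 ∷ - + 3 ∷ - + 8 ∷ []) ∷ [])
Y3AB = ((+ 2 ∷ + 10 ∷ + 1 ∷ - + 4 ∷ []) ∷ (+ 2 ∷ - + 18 ∷ + 2 ∷ + 6 ∷ []) ∷ (- + 4 ∷ + 16 ∷ - + 1 ∷ - + 6 ∷ []) ∷ (+ 0 ∷ + 4 ∷ - + 1 ∷ - + 2 ∷ []) ∷ [])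
YA2A YA2B : Mat 4
YA2A = ((+ 1 ∷ - + 8 ∷ - + 5 ∷ - + 18 ∷ []) ∷ (+ 1 ∷ + 0 ∷ - + 1 ∷ + 2 ∷ []) ∷ (+ 0 ∷ - + 4 ∷ - + 2 ∷ - + 6 ∷ []) ∷ (- + 1 ∷ - + 2 ∷ - + 2 ∷ + 1 ∷ []) ∷ [])
YA2B = ((- + 1 ∷ + 5 ∷ + 4 ∷ - + 4 ∷ []) ∷ (+ 3 ∷ - + 1 ∷ - + 9 ∷ + 2 ∷ []) ∷ (- + 3 ∷ - + 1 ∷ + 8 ∷ - + 4 ∷ []) ∷ (- + 1 ∷ + 1 ∷ + 2 ∷ + 0 ∷ []) ∷ [])
X2BA X2BB : Mat 4
X2BA = ((+ 2 ∷ + 1 ∷ + 0 ∷ + 0 ∷ []) ∷ (+ 0 ∷ - + 1 ∷ - + 1 ∷ - + 1 ∷ []) ∷ (+ 0 ∷ + 1 ∷ + 3 ∷ - + 9 ∷ []) ∷ (+ 0 ∷ - + 5 ∷ - + 3 ∷ - + 7 ∷ []) ∷ [])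
X2BB = ((+ 4 ∷ - + 12 ∷ - + 1 ∷ + 3 ∷ []) ∷ (+ 0 ∷ + 24 ∷ + 2 ∷ - + 6 ∷ []) ∷ (+ 0 ∷ - + 26 ∷ - + 1 ∷ + 5 ∷ []) ∷ (+ 0 ∷ - + 6 ∷ - + 1 ∷ + 1 ∷ []) ∷ [])
X5BA X5BB : Mat 4
X5BA = ((+ 1 ∷ - + 2 ∷ - + 2 ∷ - + 2 ∷ []) ∷ (+ 0 ∷ + 3 ∷ + 2 ∷ + 5 ∷ []) ∷ (- + 1 ∷ - + 6 ∷ - + 2 ∷ - + 10 ∷ []) ∷ (+ 1 ∷ + 2 ∷ + 2 ∷ - + 2 ∷ []) ∷ [])
X5BB = ((+ 8 ∷ + 8 ∷ + 2 ∷ + 2 ∷ []) ∷ (- + 6 ∷ - + 12 ∷ - + 5 ∷ + 1 ∷ []) ∷ (+ 4 ∷ + 12 ∷ + 5 ∷ + 1 ∷ []) ∷ (+ 2 ∷ + 4 ∷ + 1 ∷ - + 1 ∷ []) ∷ [])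
-- Certificates: weights on the maximal order modulo 4 and 8 whose left and right divisor sums differ by the
-- three quaternary combinations below; found by solving linear systems over the residues.
Ge : List (List (List (List ℤ)))
Ge =
  (((+ 0 ∷ + 2 ∷ + 0 ∷ + 2 ∷ []) ∷ (+ 0 ∷ + 0 ∷ + 1 ∷ []) ∷ [] ∷ (+ 0 ∷ + 0 ∷ + 1 ∷ []) ∷ []) ∷ ([] ∷ (+ 1 ∷ - + 1 ∷ + 0 ∷ + 1 ∷ []) ∷ [] ∷ (+ 0 ∷ + 0 ∷
   - + 1 ∷ - + 1 ∷ []) ∷ []) ∷ ((+ 0 ∷ - + 2 ∷ + 0 ∷ - + 2 ∷ []) ∷ (- + 1 ∷ + 0 ∷ + 0 ∷ - + 2 ∷ []) ∷ [] ∷ (- + 1 ∷ - + 2 ∷ []) ∷ []) ∷ ([] ∷ (+ 0 ∷ - + 1 ∷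
   - + 1 ∷ []) ∷ [] ∷ (+ 1 ∷ + 1 ∷ + 0 ∷ - + 1 ∷ []) ∷ []) ∷ []) ∷
  (((+ 0 ∷ + 0 ∷ + 0 ∷ + 1 ∷ []) ∷ (+ 0 ∷ - + 1 ∷ - + 1 ∷ + 1 ∷ []) ∷ (+ 0 ∷ + 0 ∷ + 1 ∷ + 1 ∷ []) ∷ (+ 0 ∷ - + 2 ∷ + 0 ∷ + 2 ∷ []) ∷ []) ∷ ((+ 0 ∷ - + 2 ∷
   - + 2 ∷ []) ∷ (+ 0 ∷ - + 1 ∷ []) ∷ (+ 2 ∷ + 0 ∷ - + 2 ∷ []) ∷ (+ 1 ∷ + 1 ∷ []) ∷ []) ∷ ((+ 0 ∷ + 0 ∷ - + 1 ∷ []) ∷ (+ 0 ∷ + 0 ∷ - + 1 ∷ []) ∷ [] ∷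
   (+ 0 ∷ - + 1 ∷ []) ∷ []) ∷ ((- + 2 ∷ + 0 ∷ + 2 ∷ []) ∷ [] ∷ [] ∷ (- + 1 ∷ + 0 ∷ + 0 ∷ - + 1 ∷ []) ∷ []) ∷ []) ∷
  (((+ 0 ∷ + 2 ∷ + 0 ∷ + 2 ∷ []) ∷ (+ 0 ∷ + 1 ∷ []) ∷ (- + 1 ∷ + 0 ∷ + 1 ∷ []) ∷ (+ 0 ∷ + 0 ∷ + 0 ∷ + 1 ∷ []) ∷ []) ∷ ((- + 2 ∷ - + 2 ∷ []) ∷ (+ 0 ∷ - + 2 ∷
   + 0 ∷ + 2 ∷ []) ∷ (+ 0 ∷ - + 2 ∷ + 0 ∷ + 2 ∷ []) ∷ []) ∷ ((+ 1 ∷ - + 2 ∷ - + 1 ∷ - + 2 ∷ []) ∷ (+ 0 ∷ + 0 ∷ - + 1 ∷ - + 1 ∷ []) ∷ (+ 1 ∷ + 0 ∷ - + 1 ∷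
   []) ∷ (+ 0 ∷ - + 1 ∷ - + 1 ∷ []) ∷ []) ∷ ((- + 2 ∷ + 0 ∷ + 0 ∷ - + 2 ∷ []) ∷ [] ∷ (+ 0 ∷ + 2 ∷ + 0 ∷ - + 2 ∷ []) ∷ (+ 0 ∷ + 2 ∷ + 0 ∷ - + 2 ∷ []) ∷
   []) ∷ []) ∷
  (((+ 0 ∷ + 1 ∷ []) ∷ (+ 0 ∷ + 2 ∷ + 0 ∷ - + 2 ∷ []) ∷ (+ 0 ∷ + 1 ∷ + 1 ∷ []) ∷ (+ 0 ∷ + 1 ∷ - + 1 ∷ - + 1 ∷ []) ∷ []) ∷ ((- + 2 ∷ + 0 ∷ + 2 ∷ []) ∷
   (- + 1 ∷ - + 1 ∷ []) ∷ []) ∷ ((+ 0 ∷ + 0 ∷ - + 1 ∷ []) ∷ (+ 0 ∷ + 0 ∷ + 0 ∷ - + 1 ∷ []) ∷ [] ∷ (+ 0 ∷ + 0 ∷ - + 1 ∷ []) ∷ []) ∷ ((+ 0 ∷ + 0 ∷ - + 2 ∷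
   - + 2 ∷ []) ∷ (+ 1 ∷ + 0 ∷ + 0 ∷ + 1 ∷ []) ∷ (+ 2 ∷ + 0 ∷ - + 2 ∷ []) ∷ (+ 0 ∷ + 0 ∷ + 0 ∷ - + 1 ∷ []) ∷ []) ∷ []) ∷ []
Gx : List (List (List (List ℤ)))
Gx =
  (([] ∷ [] ∷ [] ∷ (+ 0 ∷ + 0 ∷ + 3 ∷ []) ∷ [] ∷ (+ 0 ∷ + 0 ∷ + 0 ∷ + 0 ∷ + 0 ∷ + 0 ∷ + 3 ∷ []) ∷ []) ∷ ([] ∷ [] ∷ [] ∷ (+ 0 ∷ + 0 ∷ + 0 ∷ - + 1 ∷ []) ∷
   [] ∷ (+ 0 ∷ + 0 ∷ + 0 ∷ + 2 ∷ []) ∷ [] ∷ (+ 0 ∷ + 0 ∷ + 0 ∷ - + 1 ∷ []) ∷ []) ∷ ([] ∷ (+ 0 ∷ + 0 ∷ + 0 ∷ + 0 ∷ + 3 ∷ []) ∷ [] ∷ (+ 1 ∷ []) ∷ [] ∷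
   (+ 0 ∷ + 0 ∷ + 0 ∷ + 0 ∷ - + 1 ∷ []) ∷ []) ∷ ([] ∷ (+ 0 ∷ - + 2 ∷ []) ∷ [] ∷ [] ∷ [] ∷ (+ 0 ∷ - + 8 ∷ []) ∷ [] ∷ (+ 0 ∷ - + 1 ∷ []) ∷ []) ∷ ([] ∷
   (+ 0 ∷ + 0 ∷ + 3 ∷ []) ∷ [] ∷ [] ∷ [] ∷ [] ∷ [] ∷ (+ 0 ∷ + 0 ∷ + 0 ∷ + 0 ∷ + 0 ∷ + 0 ∷ + 3 ∷ []) ∷ []) ∷ ([] ∷ (+ 0 ∷ + 0 ∷ + 0 ∷ + 0 ∷ + 0 ∷ + 0 ∷
   + 0 ∷ - + 1 ∷ []) ∷ [] ∷ (+ 0 ∷ + 0 ∷ + 0 ∷ + 0 ∷ + 0 ∷ + 0 ∷ + 0 ∷ - + 8 ∷ []) ∷ [] ∷ [] ∷ [] ∷ (+ 0 ∷ + 0 ∷ + 0 ∷ + 0 ∷ + 0 ∷ + 0 ∷ + 0 ∷ - + 2 ∷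
   []) ∷ []) ∷ ([] ∷ [] ∷ [] ∷ (+ 0 ∷ + 0 ∷ + 0 ∷ + 0 ∷ - + 1 ∷ []) ∷ [] ∷ (+ 1 ∷ []) ∷ [] ∷ (+ 0 ∷ + 0 ∷ + 0 ∷ + 0 ∷ + 3 ∷ []) ∷ []) ∷ ([] ∷ (+ 0 ∷ + 0 ∷
   + 0 ∷ + 0 ∷ + 0 ∷ - + 1 ∷ []) ∷ [] ∷ (+ 0 ∷ + 0 ∷ + 0 ∷ + 0 ∷ + 0 ∷ + 2 ∷ []) ∷ [] ∷ (+ 0 ∷ + 0 ∷ + 0 ∷ + 0 ∷ + 0 ∷ - + 1 ∷ []) ∷ []) ∷ []) ∷
  (((+ 0 ∷ + 1 ∷ + 0 ∷ + 2 ∷ + 0 ∷ + 0 ∷ + 0 ∷ + 2 ∷ []) ∷ (+ 0 ∷ + 0 ∷ + 0 ∷ + 0 ∷ + 0 ∷ + 0 ∷ + 0 ∷ + 2 ∷ []) ∷ [] ∷ [] ∷ [] ∷ [] ∷ [] ∷ (+ 0 ∷ + 3 ∷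
   []) ∷ []) ∷ ([] ∷ [] ∷ [] ∷ (+ 0 ∷ + 2 ∷ []) ∷ []) ∷ ((- + 6 ∷ + 0 ∷ + 2 ∷ []) ∷ (+ 0 ∷ + 0 ∷ + 0 ∷ + 0 ∷ + 0 ∷ + 0 ∷ + 0 ∷ - + 1 ∷ []) ∷ (+ 3 ∷ + 4 ∷
   + 0 ∷ + 0 ∷ - + 4 ∷ []) ∷ (+ 0 ∷ - + 1 ∷ []) ∷ (+ 2 ∷ + 0 ∷ + 1 ∷ + 0 ∷ + 3 ∷ + 0 ∷ + 1 ∷ []) ∷ (+ 0 ∷ + 0 ∷ + 0 ∷ - + 1 ∷ []) ∷ (+ 0 ∷ + 0 ∷ + 0 ∷
   - + 8 ∷ + 0 ∷ + 0 ∷ + 0 ∷ + 5 ∷ []) ∷ (+ 0 ∷ + 0 ∷ + 0 ∷ + 0 ∷ + 0 ∷ + 1 ∷ []) ∷ []) ∷ ([] ∷ (+ 0 ∷ + 0 ∷ + 0 ∷ + 0 ∷ + 0 ∷ + 2 ∷ []) ∷ [] ∷ (+ 0 ∷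
   + 0 ∷ + 0 ∷ + 0 ∷ + 0 ∷ + 1 ∷ []) ∷ [] ∷ (+ 0 ∷ + 0 ∷ + 0 ∷ + 0 ∷ + 0 ∷ - + 1 ∷ []) ∷ [] ∷ (+ 0 ∷ + 0 ∷ + 0 ∷ + 0 ∷ + 0 ∷ - + 1 ∷ []) ∷ []) ∷ ([] ∷
   (+ 0 ∷ + 0 ∷ + 0 ∷ + 0 ∷ + 0 ∷ + 0 ∷ + 0 ∷ + 3 ∷ []) ∷ [] ∷ [] ∷ (+ 0 ∷ - + 6 ∷ + 0 ∷ + 7 ∷ + 0 ∷ + 0 ∷ + 0 ∷ - + 1 ∷ []) ∷ (+ 0 ∷ + 0 ∷ + 0 ∷ - + 2 ∷
   []) ∷ []) ∷ ([] ∷ (+ 0 ∷ + 0 ∷ + 0 ∷ + 0 ∷ + 0 ∷ + 2 ∷ []) ∷ [] ∷ (+ 0 ∷ + 3 ∷ []) ∷ [] ∷ [] ∷ [] ∷ (+ 0 ∷ - + 6 ∷ []) ∷ []) ∷ ([] ∷ (+ 0 ∷ + 0 ∷ + 0 ∷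
   + 0 ∷ + 0 ∷ + 0 ∷ + 0 ∷ - + 1 ∷ []) ∷ (+ 0 ∷ + 0 ∷ + 0 ∷ - + 3 ∷ + 0 ∷ + 0 ∷ - + 2 ∷ + 3 ∷ []) ∷ (+ 0 ∷ + 1 ∷ []) ∷ [] ∷ (+ 0 ∷ + 0 ∷ + 0 ∷ + 3 ∷
   []) ∷ (+ 0 ∷ + 0 ∷ - + 1 ∷ + 0 ∷ + 0 ∷ + 0 ∷ - + 1 ∷ []) ∷ (+ 0 ∷ + 0 ∷ + 0 ∷ + 0 ∷ + 0 ∷ + 6 ∷ []) ∷ []) ∷ ([] ∷ (+ 0 ∷ + 0 ∷ + 0 ∷ + 0 ∷ + 0 ∷ - + 5 ∷
   []) ∷ [] ∷ (+ 0 ∷ + 0 ∷ + 0 ∷ + 0 ∷ + 0 ∷ + 3 ∷ []) ∷ [] ∷ (+ 0 ∷ + 0 ∷ + 0 ∷ + 0 ∷ + 0 ∷ - + 2 ∷ []) ∷ [] ∷ (+ 0 ∷ + 0 ∷ + 0 ∷ + 0 ∷ + 0 ∷ + 4 ∷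
   []) ∷ []) ∷ []) ∷ (([] ∷ (+ 0 ∷ + 0 ∷ + 4 ∷ []) ∷ [] ∷ (+ 0 ∷ + 0 ∷ + 0 ∷ + 0 ∷ + 0 ∷ + 0 ∷ + 2 ∷ []) ∷ [] ∷ (+ 0 ∷ + 0 ∷ + 1 ∷ []) ∷ [] ∷ (+ 0 ∷ + 0 ∷
   + 0 ∷ + 0 ∷ + 0 ∷ + 0 ∷ + 1 ∷ []) ∷ []) ∷ ([] ∷ (+ 0 ∷ - + 4 ∷ []) ∷ [] ∷ (+ 0 ∷ + 0 ∷ + 0 ∷ + 0 ∷ + 0 ∷ - + 1 ∷ []) ∷ [] ∷ [] ∷ [] ∷ (+ 0 ∷ + 0 ∷
   + 0 ∷ + 0 ∷ + 0 ∷ + 4 ∷ []) ∷ []) ∷ ([] ∷ (+ 0 ∷ + 0 ∷ + 0 ∷ + 0 ∷ - + 3 ∷ []) ∷ [] ∷ [] ∷ [] ∷ (+ 0 ∷ + 0 ∷ + 0 ∷ + 0 ∷ + 2 ∷ []) ∷ [] ∷ (- + 2 ∷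
   []) ∷ []) ∷ ([] ∷ (+ 0 ∷ + 0 ∷ + 0 ∷ - + 2 ∷ []) ∷ [] ∷ (+ 0 ∷ + 0 ∷ + 0 ∷ + 0 ∷ + 0 ∷ + 0 ∷ + 0 ∷ + 1 ∷ []) ∷ [] ∷ [] ∷ [] ∷ (+ 0 ∷ + 0 ∷ + 0 ∷ + 0 ∷
   + 0 ∷ + 0 ∷ + 0 ∷ + 2 ∷ []) ∷ []) ∷ ([] ∷ (+ 0 ∷ + 0 ∷ + 0 ∷ + 0 ∷ + 0 ∷ + 0 ∷ + 3 ∷ []) ∷ [] ∷ [] ∷ [] ∷ (+ 0 ∷ + 0 ∷ + 0 ∷ + 0 ∷ + 0 ∷ + 0 ∷ + 1 ∷
   []) ∷ [] ∷ (+ 0 ∷ + 0 ∷ - + 2 ∷ []) ∷ []) ∷ ([] ∷ (+ 0 ∷ + 0 ∷ + 0 ∷ + 0 ∷ + 0 ∷ - + 2 ∷ []) ∷ [] ∷ [] ∷ [] ∷ [] ∷ [] ∷ (+ 0 ∷ - + 5 ∷ []) ∷ []) ∷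
   ([] ∷ (- + 1 ∷ []) ∷ [] ∷ (+ 0 ∷ + 0 ∷ + 0 ∷ + 0 ∷ - + 1 ∷ []) ∷ [] ∷ (+ 1 ∷ []) ∷ [] ∷ (+ 0 ∷ + 0 ∷ + 0 ∷ + 0 ∷ + 4 ∷ []) ∷ []) ∷ ([] ∷ (+ 0 ∷ + 0 ∷
   + 0 ∷ + 0 ∷ + 0 ∷ + 0 ∷ + 0 ∷ - + 6 ∷ []) ∷ [] ∷ [] ∷ [] ∷ [] ∷ [] ∷ (+ 0 ∷ + 0 ∷ + 0 ∷ + 2 ∷ []) ∷ []) ∷ []) ∷
  (((+ 0 ∷ - + 9 ∷ + 0 ∷ - + 7 ∷ + 0 ∷ - + 11 ∷ + 0 ∷ - + 6 ∷ []) ∷ (+ 0 ∷ + 0 ∷ + 0 ∷ + 0 ∷ + 0 ∷ + 0 ∷ + 0 ∷ - + 5 ∷ []) ∷ [] ∷ [] ∷ [] ∷ [] ∷ [] ∷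
   (+ 0 ∷ - + 4 ∷ []) ∷ []) ∷ ([] ∷ [] ∷ [] ∷ (+ 0 ∷ + 0 ∷ + 0 ∷ + 0 ∷ + 0 ∷ + 0 ∷ + 0 ∷ - + 4 ∷ []) ∷ []) ∷ ([] ∷ (+ 0 ∷ + 0 ∷ + 0 ∷ - + 1 ∷ []) ∷ (+ 0 ∷
   + 0 ∷ - + 1 ∷ - + 4 ∷ + 0 ∷ + 0 ∷ - + 1 ∷ + 4 ∷ []) ∷ (+ 0 ∷ + 0 ∷ + 0 ∷ + 0 ∷ + 0 ∷ + 2 ∷ []) ∷ [] ∷ [] ∷ (+ 0 ∷ + 1 ∷ + 2 ∷ + 0 ∷ + 0 ∷ - + 5 ∷
   []) ∷ (+ 0 ∷ + 4 ∷ []) ∷ []) ∷ ([] ∷ (+ 0 ∷ + 0 ∷ + 0 ∷ - + 3 ∷ []) ∷ [] ∷ (+ 0 ∷ + 0 ∷ + 0 ∷ + 0 ∷ + 0 ∷ + 0 ∷ + 0 ∷ + 2 ∷ []) ∷ [] ∷ (+ 0 ∷ + 0 ∷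
   + 0 ∷ - + 7 ∷ []) ∷ [] ∷ (+ 0 ∷ + 0 ∷ + 0 ∷ + 0 ∷ + 0 ∷ + 0 ∷ + 0 ∷ + 3 ∷ []) ∷ []) ∷ ([] ∷ (+ 0 ∷ + 0 ∷ + 0 ∷ + 0 ∷ + 0 ∷ + 0 ∷ + 0 ∷ + 4 ∷ []) ∷
   [] ∷ (+ 0 ∷ + 0 ∷ + 0 ∷ + 0 ∷ + 0 ∷ + 2 ∷ []) ∷ (+ 0 ∷ - + 6 ∷ + 0 ∷ + 4 ∷ + 0 ∷ + 1 ∷ + 0 ∷ - + 1 ∷ []) ∷ (+ 0 ∷ + 0 ∷ + 0 ∷ - + 2 ∷ []) ∷ [] ∷ (+ 0 ∷
   - + 1 ∷ []) ∷ []) ∷ ([] ∷ (+ 0 ∷ + 0 ∷ + 0 ∷ + 0 ∷ + 0 ∷ + 0 ∷ + 0 ∷ - + 3 ∷ []) ∷ [] ∷ (+ 0 ∷ + 0 ∷ + 0 ∷ + 0 ∷ + 0 ∷ + 0 ∷ + 0 ∷ - + 3 ∷ []) ∷ [] ∷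
   (+ 0 ∷ + 0 ∷ + 0 ∷ + 0 ∷ + 0 ∷ + 0 ∷ + 0 ∷ - + 5 ∷ []) ∷ []) ∷ ((- + 3 ∷ + 0 ∷ - + 3 ∷ []) ∷ (+ 0 ∷ + 0 ∷ + 0 ∷ + 4 ∷ []) ∷ (- + 5 ∷ + 5 ∷ + 0 ∷ + 0 ∷
   - + 3 ∷ - + 6 ∷ []) ∷ (+ 0 ∷ + 0 ∷ + 0 ∷ + 0 ∷ + 0 ∷ + 2 ∷ []) ∷ (+ 0 ∷ + 0 ∷ + 0 ∷ + 0 ∷ + 4 ∷ + 0 ∷ - + 1 ∷ []) ∷ [] ∷ (- + 3 ∷ + 0 ∷ + 0 ∷ + 0 ∷
   + 0 ∷ + 0 ∷ + 0 ∷ + 4 ∷ []) ∷ (+ 0 ∷ + 2 ∷ []) ∷ []) ∷ ([] ∷ [] ∷ [] ∷ (+ 0 ∷ + 0 ∷ + 0 ∷ + 0 ∷ + 0 ∷ + 0 ∷ + 0 ∷ - + 5 ∷ []) ∷ [] ∷ (+ 0 ∷ + 0 ∷ + 0 ∷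
   + 1 ∷ []) ∷ [] ∷ (+ 0 ∷ + 0 ∷ + 0 ∷ + 0 ∷ + 0 ∷ + 0 ∷ + 0 ∷ - + 3 ∷ []) ∷ []) ∷ []) ∷ (([] ∷ (+ 0 ∷ + 0 ∷ + 0 ∷ + 0 ∷ + 0 ∷ + 0 ∷ + 1 ∷ []) ∷ [] ∷
   [] ∷ [] ∷ [] ∷ [] ∷ (+ 0 ∷ + 0 ∷ + 1 ∷ []) ∷ []) ∷ ([] ∷ (+ 0 ∷ + 0 ∷ + 0 ∷ + 0 ∷ + 0 ∷ + 0 ∷ + 0 ∷ - + 1 ∷ []) ∷ [] ∷ (+ 0 ∷ + 0 ∷ + 0 ∷ + 0 ∷ + 0 ∷
   + 0 ∷ + 0 ∷ - + 3 ∷ []) ∷ []) ∷ ([] ∷ [] ∷ [] ∷ [] ∷ [] ∷ [] ∷ [] ∷ (- + 3 ∷ []) ∷ []) ∷ ([] ∷ [] ∷ [] ∷ (+ 0 ∷ + 0 ∷ + 0 ∷ + 0 ∷ + 0 ∷ + 1 ∷ []) ∷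
   [] ∷ (+ 0 ∷ + 0 ∷ + 0 ∷ + 0 ∷ + 0 ∷ + 2 ∷ []) ∷ [] ∷ (+ 0 ∷ + 0 ∷ + 0 ∷ + 0 ∷ + 0 ∷ - + 2 ∷ []) ∷ []) ∷ ([] ∷ [] ∷ [] ∷ (+ 0 ∷ + 0 ∷ + 0 ∷ + 0 ∷ + 0 ∷
   + 0 ∷ + 3 ∷ []) ∷ [] ∷ (+ 0 ∷ + 0 ∷ + 3 ∷ []) ∷ []) ∷ ([] ∷ (+ 0 ∷ + 0 ∷ + 0 ∷ - + 2 ∷ []) ∷ [] ∷ (+ 0 ∷ + 0 ∷ + 0 ∷ + 2 ∷ []) ∷ [] ∷ (+ 0 ∷ + 0 ∷
   + 0 ∷ + 1 ∷ []) ∷ []) ∷ ([] ∷ (- + 3 ∷ []) ∷ []) ∷ ([] ∷ [] ∷ [] ∷ [] ∷ [] ∷ (+ 0 ∷ - + 3 ∷ []) ∷ [] ∷ (+ 0 ∷ - + 1 ∷ []) ∷ []) ∷ []) ∷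
  (((+ 0 ∷ - + 6 ∷ + 0 ∷ - + 11 ∷ + 0 ∷ - + 7 ∷ + 0 ∷ - + 9 ∷ []) ∷ (+ 0 ∷ + 0 ∷ + 0 ∷ + 0 ∷ + 0 ∷ + 0 ∷ + 0 ∷ - + 4 ∷ []) ∷ [] ∷ [] ∷ [] ∷ [] ∷ [] ∷
   (+ 0 ∷ - + 5 ∷ []) ∷ []) ∷ ([] ∷ (+ 0 ∷ - + 3 ∷ []) ∷ [] ∷ (+ 0 ∷ + 0 ∷ + 0 ∷ + 0 ∷ + 0 ∷ + 1 ∷ []) ∷ [] ∷ (+ 0 ∷ - + 5 ∷ []) ∷ []) ∷ ((- + 3 ∷ + 0 ∷
   + 0 ∷ + 0 ∷ + 0 ∷ + 0 ∷ - + 3 ∷ []) ∷ (+ 0 ∷ + 0 ∷ + 0 ∷ + 0 ∷ + 0 ∷ + 0 ∷ + 0 ∷ + 2 ∷ []) ∷ (- + 3 ∷ + 4 ∷ []) ∷ [] ∷ (+ 0 ∷ + 0 ∷ - + 1 ∷ + 0 ∷ + 4 ∷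
   []) ∷ (+ 0 ∷ + 0 ∷ + 0 ∷ + 2 ∷ []) ∷ (- + 5 ∷ + 0 ∷ + 0 ∷ - + 6 ∷ - + 3 ∷ + 0 ∷ + 0 ∷ + 5 ∷ []) ∷ (+ 0 ∷ + 0 ∷ + 0 ∷ + 0 ∷ + 0 ∷ + 4 ∷ []) ∷ []) ∷
   ([] ∷ [] ∷ [] ∷ (+ 0 ∷ - + 5 ∷ []) ∷ [] ∷ (+ 0 ∷ - + 3 ∷ []) ∷ [] ∷ (+ 0 ∷ - + 3 ∷ []) ∷ []) ∷ ([] ∷ (+ 0 ∷ + 0 ∷ + 0 ∷ + 0 ∷ + 0 ∷ + 0 ∷ + 0 ∷ - + 1 ∷
   []) ∷ [] ∷ (+ 0 ∷ + 0 ∷ + 0 ∷ + 0 ∷ + 0 ∷ - + 2 ∷ []) ∷ (+ 0 ∷ - + 1 ∷ + 0 ∷ + 1 ∷ + 0 ∷ + 4 ∷ + 0 ∷ - + 6 ∷ []) ∷ (+ 0 ∷ + 0 ∷ + 0 ∷ + 2 ∷ []) ∷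
   [] ∷ (+ 0 ∷ + 4 ∷ []) ∷ []) ∷ ([] ∷ (+ 0 ∷ + 3 ∷ []) ∷ [] ∷ (+ 0 ∷ + 0 ∷ + 0 ∷ + 0 ∷ + 0 ∷ - + 7 ∷ []) ∷ [] ∷ (+ 0 ∷ + 2 ∷ []) ∷ [] ∷ (+ 0 ∷ + 0 ∷
   + 0 ∷ + 0 ∷ + 0 ∷ - + 3 ∷ []) ∷ []) ∷ ([] ∷ (+ 0 ∷ + 0 ∷ + 0 ∷ + 0 ∷ + 0 ∷ + 0 ∷ + 0 ∷ + 4 ∷ []) ∷ (+ 0 ∷ + 0 ∷ + 0 ∷ - + 5 ∷ + 0 ∷ + 0 ∷ + 2 ∷ + 1 ∷
   []) ∷ [] ∷ [] ∷ (+ 0 ∷ + 0 ∷ + 0 ∷ + 2 ∷ []) ∷ (+ 0 ∷ + 4 ∷ - + 1 ∷ + 0 ∷ + 0 ∷ - + 4 ∷ - + 1 ∷ []) ∷ (+ 0 ∷ + 0 ∷ + 0 ∷ + 0 ∷ + 0 ∷ - + 1 ∷ []) ∷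
   []) ∷ ([] ∷ [] ∷ [] ∷ [] ∷ [] ∷ (+ 0 ∷ - + 4 ∷ []) ∷ []) ∷ []) ∷ (([] ∷ (+ 0 ∷ + 0 ∷ + 1 ∷ []) ∷ [] ∷ (+ 0 ∷ + 0 ∷ + 0 ∷ + 0 ∷ + 0 ∷ + 0 ∷ + 1 ∷
   []) ∷ [] ∷ (+ 0 ∷ + 0 ∷ + 2 ∷ []) ∷ [] ∷ (+ 0 ∷ + 0 ∷ + 0 ∷ + 0 ∷ + 0 ∷ + 0 ∷ + 4 ∷ []) ∷ []) ∷ ([] ∷ (+ 0 ∷ + 0 ∷ + 0 ∷ + 0 ∷ + 0 ∷ + 2 ∷ []) ∷ [] ∷
   [] ∷ [] ∷ [] ∷ [] ∷ (+ 0 ∷ - + 6 ∷ []) ∷ []) ∷ ([] ∷ (+ 0 ∷ + 0 ∷ + 0 ∷ + 0 ∷ + 4 ∷ []) ∷ [] ∷ (+ 1 ∷ []) ∷ [] ∷ (+ 0 ∷ + 0 ∷ + 0 ∷ + 0 ∷ - + 1 ∷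
   []) ∷ [] ∷ (- + 1 ∷ []) ∷ []) ∷ ([] ∷ (+ 0 ∷ + 0 ∷ + 0 ∷ + 0 ∷ + 0 ∷ + 0 ∷ + 0 ∷ - + 5 ∷ []) ∷ [] ∷ [] ∷ [] ∷ [] ∷ [] ∷ (+ 0 ∷ + 0 ∷ + 0 ∷ - + 2 ∷
   []) ∷ []) ∷ ([] ∷ (+ 0 ∷ + 0 ∷ + 0 ∷ + 0 ∷ + 0 ∷ + 0 ∷ - + 2 ∷ []) ∷ [] ∷ (+ 0 ∷ + 0 ∷ + 1 ∷ []) ∷ [] ∷ [] ∷ [] ∷ (+ 0 ∷ + 0 ∷ + 3 ∷ []) ∷ []) ∷
   ([] ∷ (+ 0 ∷ + 2 ∷ []) ∷ [] ∷ [] ∷ [] ∷ (+ 0 ∷ + 1 ∷ []) ∷ [] ∷ (+ 0 ∷ + 0 ∷ + 0 ∷ + 0 ∷ + 0 ∷ - + 2 ∷ []) ∷ []) ∷ ([] ∷ (- + 2 ∷ []) ∷ [] ∷ (+ 0 ∷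
   + 0 ∷ + 0 ∷ + 0 ∷ + 2 ∷ []) ∷ [] ∷ [] ∷ [] ∷ (+ 0 ∷ + 0 ∷ + 0 ∷ + 0 ∷ - + 3 ∷ []) ∷ []) ∷ ([] ∷ (+ 0 ∷ + 0 ∷ + 0 ∷ + 4 ∷ []) ∷ [] ∷ [] ∷ [] ∷ (+ 0 ∷
   + 0 ∷ + 0 ∷ - + 1 ∷ []) ∷ [] ∷ (+ 0 ∷ + 0 ∷ + 0 ∷ + 0 ∷ + 0 ∷ + 0 ∷ + 0 ∷ - + 4 ∷ []) ∷ []) ∷ []) ∷
  (((+ 0 ∷ + 2 ∷ + 0 ∷ + 0 ∷ + 0 ∷ + 2 ∷ + 0 ∷ + 1 ∷ []) ∷ (+ 0 ∷ + 0 ∷ + 0 ∷ + 0 ∷ + 0 ∷ + 0 ∷ + 0 ∷ + 3 ∷ []) ∷ [] ∷ [] ∷ [] ∷ [] ∷ [] ∷ (+ 0 ∷ + 2 ∷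
   []) ∷ []) ∷ ([] ∷ (+ 0 ∷ + 0 ∷ + 0 ∷ + 4 ∷ []) ∷ [] ∷ (+ 0 ∷ + 0 ∷ + 0 ∷ - + 2 ∷ []) ∷ [] ∷ (+ 0 ∷ + 0 ∷ + 0 ∷ + 3 ∷ []) ∷ [] ∷ (+ 0 ∷ + 0 ∷ + 0 ∷
   - + 5 ∷ []) ∷ []) ∷ ([] ∷ (+ 0 ∷ + 0 ∷ + 0 ∷ + 6 ∷ []) ∷ (+ 0 ∷ + 0 ∷ - + 1 ∷ + 0 ∷ + 0 ∷ + 0 ∷ - + 1 ∷ []) ∷ (+ 0 ∷ + 0 ∷ + 0 ∷ + 0 ∷ + 0 ∷ + 3 ∷
   []) ∷ [] ∷ (+ 0 ∷ + 0 ∷ + 0 ∷ + 0 ∷ + 0 ∷ + 0 ∷ + 0 ∷ + 1 ∷ []) ∷ (+ 0 ∷ + 3 ∷ - + 2 ∷ + 0 ∷ + 0 ∷ - + 3 ∷ []) ∷ (+ 0 ∷ - + 1 ∷ []) ∷ []) ∷ ([] ∷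
   (+ 0 ∷ + 0 ∷ + 0 ∷ + 0 ∷ + 0 ∷ + 0 ∷ + 0 ∷ - + 6 ∷ []) ∷ [] ∷ [] ∷ [] ∷ (+ 0 ∷ + 0 ∷ + 0 ∷ + 0 ∷ + 0 ∷ + 0 ∷ + 0 ∷ + 3 ∷ []) ∷ [] ∷ (+ 0 ∷ + 0 ∷ + 0 ∷
   + 2 ∷ []) ∷ []) ∷ ([] ∷ [] ∷ [] ∷ (+ 0 ∷ + 0 ∷ + 0 ∷ + 0 ∷ + 0 ∷ - + 2 ∷ []) ∷ (+ 0 ∷ - + 1 ∷ + 0 ∷ + 0 ∷ + 0 ∷ + 7 ∷ + 0 ∷ - + 6 ∷ []) ∷ [] ∷ [] ∷
   (+ 0 ∷ + 3 ∷ []) ∷ []) ∷ ([] ∷ (+ 0 ∷ + 0 ∷ + 0 ∷ - + 1 ∷ []) ∷ [] ∷ (+ 0 ∷ + 0 ∷ + 0 ∷ - + 1 ∷ []) ∷ [] ∷ (+ 0 ∷ + 0 ∷ + 0 ∷ + 1 ∷ []) ∷ [] ∷ (+ 0 ∷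
   + 0 ∷ + 0 ∷ + 2 ∷ []) ∷ []) ∷ ((- + 6 ∷ + 0 ∷ + 0 ∷ + 0 ∷ + 0 ∷ + 0 ∷ + 2 ∷ []) ∷ (+ 0 ∷ + 0 ∷ + 0 ∷ + 1 ∷ []) ∷ (+ 0 ∷ + 5 ∷ + 0 ∷ + 0 ∷ + 0 ∷ - + 8 ∷
   []) ∷ (+ 0 ∷ + 0 ∷ + 0 ∷ + 0 ∷ + 0 ∷ - + 1 ∷ []) ∷ (+ 2 ∷ + 0 ∷ + 1 ∷ + 0 ∷ + 3 ∷ + 0 ∷ + 1 ∷ []) ∷ (+ 0 ∷ + 0 ∷ + 0 ∷ + 0 ∷ + 0 ∷ + 0 ∷ + 0 ∷ - + 1 ∷
   []) ∷ (+ 3 ∷ + 0 ∷ + 0 ∷ + 0 ∷ - + 4 ∷ + 0 ∷ + 0 ∷ + 4 ∷ []) ∷ (+ 0 ∷ - + 1 ∷ []) ∷ []) ∷ ([] ∷ [] ∷ [] ∷ [] ∷ [] ∷ (+ 0 ∷ + 0 ∷ + 0 ∷ + 0 ∷ + 0 ∷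
   + 0 ∷ + 0 ∷ + 2 ∷ []) ∷ []) ∷ []) ∷ []
Gy : List (List (List (List ℤ)))
Gy =
  (([] ∷ (+ 0 ∷ + 0 ∷ + 3 ∷ []) ∷ [] ∷ (+ 0 ∷ + 0 ∷ + 0 ∷ + 0 ∷ + 0 ∷ + 0 ∷ + 3 ∷ []) ∷ [] ∷ (+ 0 ∷ + 0 ∷ + 3 ∷ []) ∷ [] ∷ (+ 0 ∷ + 0 ∷ + 0 ∷ + 0 ∷ + 0 ∷
   + 0 ∷ + 3 ∷ []) ∷ []) ∷ ([] ∷ [] ∷ [] ∷ (+ 0 ∷ + 0 ∷ + 0 ∷ + 0 ∷ + 0 ∷ + 0 ∷ + 0 ∷ + 2 ∷ []) ∷ [] ∷ (+ 0 ∷ + 0 ∷ + 0 ∷ + 0 ∷ + 0 ∷ + 0 ∷ + 0 ∷ - + 3 ∷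
   []) ∷ [] ∷ (+ 0 ∷ + 0 ∷ + 0 ∷ + 0 ∷ + 0 ∷ + 0 ∷ + 0 ∷ - + 2 ∷ []) ∷ []) ∷ ([] ∷ (+ 4 ∷ []) ∷ [] ∷ (+ 0 ∷ + 0 ∷ + 0 ∷ + 0 ∷ + 6 ∷ []) ∷ [] ∷ (- + 2 ∷
   []) ∷ [] ∷ (+ 0 ∷ + 0 ∷ + 0 ∷ + 0 ∷ - + 2 ∷ []) ∷ []) ∷ ([] ∷ [] ∷ [] ∷ (+ 0 ∷ + 0 ∷ + 0 ∷ + 0 ∷ + 0 ∷ + 2 ∷ []) ∷ [] ∷ (+ 0 ∷ + 0 ∷ + 0 ∷ + 0 ∷ + 0 ∷
   + 1 ∷ []) ∷ [] ∷ (+ 0 ∷ + 0 ∷ + 0 ∷ + 0 ∷ + 0 ∷ - + 3 ∷ []) ∷ []) ∷ ([] ∷ [] ∷ [] ∷ (+ 0 ∷ + 0 ∷ - + 3 ∷ []) ∷ [] ∷ (+ 0 ∷ + 0 ∷ + 0 ∷ + 0 ∷ + 0 ∷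
   + 0 ∷ - + 3 ∷ []) ∷ []) ∷ ([] ∷ (+ 0 ∷ + 0 ∷ + 0 ∷ - + 3 ∷ []) ∷ [] ∷ (+ 0 ∷ + 0 ∷ + 0 ∷ + 1 ∷ []) ∷ [] ∷ (+ 0 ∷ + 0 ∷ + 0 ∷ + 2 ∷ []) ∷ []) ∷ ([] ∷
   (+ 0 ∷ + 0 ∷ + 0 ∷ + 0 ∷ - + 2 ∷ []) ∷ [] ∷ (- + 2 ∷ []) ∷ [] ∷ (+ 0 ∷ + 0 ∷ + 0 ∷ + 0 ∷ + 6 ∷ []) ∷ [] ∷ (+ 4 ∷ []) ∷ []) ∷ ([] ∷ (+ 0 ∷ - + 2 ∷
   []) ∷ [] ∷ (+ 0 ∷ - + 3 ∷ []) ∷ [] ∷ (+ 0 ∷ + 2 ∷ []) ∷ []) ∷ []) ∷ (([] ∷ (+ 0 ∷ + 0 ∷ + 0 ∷ + 1 ∷ []) ∷ [] ∷ (+ 0 ∷ - + 1 ∷ []) ∷ (+ 0 ∷ - + 6 ∷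
   + 0 ∷ + 0 ∷ + 0 ∷ + 0 ∷ + 0 ∷ - + 4 ∷ []) ∷ (+ 0 ∷ + 0 ∷ + 0 ∷ + 0 ∷ + 0 ∷ + 0 ∷ + 0 ∷ + 1 ∷ []) ∷ [] ∷ (+ 0 ∷ + 0 ∷ + 0 ∷ + 0 ∷ + 0 ∷ + 3 ∷ []) ∷
   []) ∷ ([] ∷ (+ 0 ∷ - + 5 ∷ []) ∷ [] ∷ [] ∷ [] ∷ (+ 0 ∷ + 2 ∷ []) ∷ [] ∷ (+ 0 ∷ + 0 ∷ + 0 ∷ + 0 ∷ + 0 ∷ - + 1 ∷ []) ∷ []) ∷ ([] ∷ (+ 0 ∷ + 0 ∷ + 0 ∷
   - + 1 ∷ []) ∷ (+ 0 ∷ + 0 ∷ + 4 ∷ + 0 ∷ + 0 ∷ + 0 ∷ + 0 ∷ - + 1 ∷ []) ∷ (+ 0 ∷ + 0 ∷ + 0 ∷ + 0 ∷ + 0 ∷ + 2 ∷ []) ∷ [] ∷ (+ 0 ∷ + 0 ∷ + 0 ∷ + 0 ∷ + 0 ∷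
   + 0 ∷ + 0 ∷ - + 4 ∷ []) ∷ (+ 0 ∷ - + 4 ∷ - + 1 ∷ + 0 ∷ + 0 ∷ - + 5 ∷ []) ∷ (+ 0 ∷ - + 1 ∷ []) ∷ []) ∷ ([] ∷ (+ 0 ∷ + 2 ∷ []) ∷ [] ∷ (+ 0 ∷ + 1 ∷
   []) ∷ [] ∷ (+ 0 ∷ + 2 ∷ []) ∷ [] ∷ (+ 0 ∷ + 1 ∷ []) ∷ []) ∷ ((+ 0 ∷ + 3 ∷ + 0 ∷ + 0 ∷ + 0 ∷ + 3 ∷ []) ∷ [] ∷ [] ∷ (+ 0 ∷ - + 1 ∷ []) ∷ [] ∷ (+ 0 ∷
   + 0 ∷ + 0 ∷ + 0 ∷ + 0 ∷ + 0 ∷ + 0 ∷ - + 3 ∷ []) ∷ [] ∷ (+ 0 ∷ + 0 ∷ + 0 ∷ + 0 ∷ + 0 ∷ + 2 ∷ []) ∷ []) ∷ ([] ∷ (+ 0 ∷ + 2 ∷ []) ∷ [] ∷ [] ∷ [] ∷ (+ 0 ∷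
   - + 2 ∷ []) ∷ []) ∷ ((- + 7 ∷ + 0 ∷ - + 8 ∷ []) ∷ [] ∷ (- + 3 ∷ + 0 ∷ + 0 ∷ + 0 ∷ + 2 ∷ []) ∷ (+ 0 ∷ + 0 ∷ + 0 ∷ + 0 ∷ + 0 ∷ - + 6 ∷ []) ∷ (+ 3 ∷ + 0 ∷
   + 4 ∷ []) ∷ (+ 0 ∷ + 0 ∷ + 0 ∷ + 0 ∷ + 0 ∷ + 0 ∷ + 0 ∷ + 4 ∷ []) ∷ (+ 2 ∷ + 0 ∷ + 0 ∷ + 9 ∷ []) ∷ []) ∷ ([] ∷ (+ 0 ∷ + 1 ∷ []) ∷ [] ∷ (+ 0 ∷ - + 4 ∷
   []) ∷ []) ∷ []) ∷ (([] ∷ (+ 0 ∷ + 0 ∷ + 0 ∷ + 0 ∷ + 0 ∷ + 0 ∷ + 4 ∷ []) ∷ [] ∷ [] ∷ [] ∷ (+ 0 ∷ + 0 ∷ + 0 ∷ + 0 ∷ + 0 ∷ + 0 ∷ + 1 ∷ []) ∷ [] ∷ (+ 0 ∷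
   + 0 ∷ + 1 ∷ []) ∷ []) ∷ ([] ∷ [] ∷ [] ∷ (+ 0 ∷ + 3 ∷ []) ∷ [] ∷ (+ 0 ∷ + 0 ∷ + 0 ∷ + 0 ∷ + 0 ∷ + 3 ∷ []) ∷ [] ∷ (+ 0 ∷ - + 1 ∷ []) ∷ []) ∷ ([] ∷ [] ∷
   [] ∷ (+ 0 ∷ + 0 ∷ + 0 ∷ + 0 ∷ + 3 ∷ []) ∷ [] ∷ (- + 2 ∷ []) ∷ [] ∷ (+ 0 ∷ + 0 ∷ + 0 ∷ + 0 ∷ - + 3 ∷ []) ∷ []) ∷ ([] ∷ (+ 0 ∷ + 0 ∷ + 0 ∷ + 0 ∷ + 0 ∷
   + 0 ∷ + 0 ∷ + 3 ∷ []) ∷ [] ∷ (+ 0 ∷ + 0 ∷ + 0 ∷ - + 5 ∷ []) ∷ [] ∷ (+ 0 ∷ + 0 ∷ + 0 ∷ + 0 ∷ + 0 ∷ + 0 ∷ + 0 ∷ - + 3 ∷ []) ∷ []) ∷ ([] ∷ (+ 0 ∷ + 0 ∷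
   + 3 ∷ []) ∷ []) ∷ ([] ∷ [] ∷ [] ∷ (+ 0 ∷ + 0 ∷ + 0 ∷ + 0 ∷ + 0 ∷ - + 1 ∷ []) ∷ [] ∷ [] ∷ [] ∷ (+ 0 ∷ + 0 ∷ + 0 ∷ + 0 ∷ + 0 ∷ + 1 ∷ []) ∷ []) ∷ ([] ∷
   [] ∷ [] ∷ [] ∷ [] ∷ (+ 0 ∷ + 0 ∷ + 0 ∷ + 0 ∷ + 2 ∷ []) ∷ [] ∷ (+ 4 ∷ []) ∷ []) ∷ ([] ∷ [] ∷ [] ∷ (+ 0 ∷ + 0 ∷ + 0 ∷ + 0 ∷ + 0 ∷ + 0 ∷ + 0 ∷ - + 1 ∷
   []) ∷ [] ∷ (+ 0 ∷ + 0 ∷ + 0 ∷ - + 1 ∷ []) ∷ [] ∷ (+ 0 ∷ + 0 ∷ + 0 ∷ + 0 ∷ + 0 ∷ + 0 ∷ + 0 ∷ - + 2 ∷ []) ∷ []) ∷ []) ∷ (([] ∷ [] ∷ [] ∷ [] ∷ (+ 0 ∷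
   + 2 ∷ + 0 ∷ - + 4 ∷ []) ∷ []) ∷ ([] ∷ (+ 0 ∷ + 0 ∷ + 0 ∷ + 1 ∷ []) ∷ [] ∷ (+ 0 ∷ + 0 ∷ + 0 ∷ - + 2 ∷ []) ∷ []) ∷ ((- + 3 ∷ + 0 ∷ + 6 ∷ + 0 ∷ + 7 ∷
   + 0 ∷ - + 5 ∷ []) ∷ (+ 0 ∷ + 0 ∷ + 0 ∷ + 0 ∷ + 0 ∷ + 0 ∷ + 0 ∷ + 7 ∷ []) ∷ (- + 2 ∷ + 0 ∷ + 0 ∷ + 0 ∷ + 2 ∷ + 1 ∷ []) ∷ (+ 0 ∷ + 9 ∷ []) ∷ (- + 4 ∷
   + 0 ∷ + 0 ∷ + 0 ∷ + 1 ∷ []) ∷ (+ 0 ∷ + 0 ∷ + 0 ∷ + 4 ∷ []) ∷ (+ 1 ∷ + 0 ∷ + 0 ∷ + 2 ∷ + 4 ∷ []) ∷ (+ 0 ∷ + 0 ∷ + 0 ∷ + 0 ∷ + 0 ∷ + 1 ∷ []) ∷ []) ∷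
   ([] ∷ [] ∷ [] ∷ (+ 0 ∷ + 0 ∷ + 0 ∷ - + 4 ∷ []) ∷ [] ∷ [] ∷ [] ∷ (+ 0 ∷ + 0 ∷ + 0 ∷ - + 1 ∷ []) ∷ []) ∷ ((+ 0 ∷ + 0 ∷ + 0 ∷ + 3 ∷ + 0 ∷ + 2 ∷ + 0 ∷
   + 1 ∷ []) ∷ (+ 0 ∷ + 0 ∷ + 0 ∷ + 2 ∷ []) ∷ [] ∷ (+ 0 ∷ + 3 ∷ []) ∷ [] ∷ (+ 0 ∷ + 0 ∷ + 0 ∷ + 0 ∷ + 0 ∷ + 0 ∷ + 0 ∷ - + 1 ∷ []) ∷ [] ∷ (+ 0 ∷ + 0 ∷
   + 0 ∷ + 0 ∷ + 0 ∷ + 2 ∷ []) ∷ []) ∷ ([] ∷ (+ 0 ∷ + 0 ∷ + 0 ∷ - + 4 ∷ []) ∷ [] ∷ (+ 0 ∷ + 0 ∷ + 0 ∷ + 4 ∷ []) ∷ []) ∷ ([] ∷ (+ 0 ∷ + 0 ∷ + 0 ∷ + 0 ∷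
   + 0 ∷ + 0 ∷ + 0 ∷ + 2 ∷ []) ∷ (+ 0 ∷ + 0 ∷ - + 4 ∷ - + 5 ∷ + 0 ∷ + 0 ∷ + 3 ∷ - + 4 ∷ []) ∷ (+ 0 ∷ - + 3 ∷ []) ∷ [] ∷ (+ 0 ∷ + 0 ∷ + 0 ∷ + 1 ∷ []) ∷
   (+ 0 ∷ + 1 ∷ + 2 ∷ + 0 ∷ + 0 ∷ - + 2 ∷ - + 2 ∷ []) ∷ []) ∷ ([] ∷ [] ∷ [] ∷ (+ 0 ∷ + 0 ∷ + 0 ∷ - + 1 ∷ []) ∷ [] ∷ (+ 0 ∷ + 0 ∷ + 0 ∷ + 0 ∷ + 0 ∷ + 0 ∷
   + 0 ∷ + 2 ∷ []) ∷ [] ∷ (+ 0 ∷ + 0 ∷ + 0 ∷ + 4 ∷ []) ∷ []) ∷ []) ∷ (([] ∷ [] ∷ [] ∷ (+ 0 ∷ + 0 ∷ + 0 ∷ + 0 ∷ + 0 ∷ + 0 ∷ + 6 ∷ []) ∷ [] ∷ (+ 0 ∷ + 0 ∷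
   + 6 ∷ []) ∷ []) ∷ ([] ∷ [] ∷ [] ∷ (+ 0 ∷ + 0 ∷ + 0 ∷ - + 2 ∷ []) ∷ [] ∷ [] ∷ [] ∷ (+ 0 ∷ + 0 ∷ + 0 ∷ + 1 ∷ []) ∷ []) ∷ ([] ∷ [] ∷ [] ∷ (+ 0 ∷ + 0 ∷
   + 0 ∷ + 0 ∷ - + 1 ∷ []) ∷ [] ∷ [] ∷ [] ∷ (+ 0 ∷ + 0 ∷ + 0 ∷ + 0 ∷ - + 1 ∷ []) ∷ []) ∷ ([] ∷ (+ 0 ∷ + 4 ∷ []) ∷ [] ∷ [] ∷ [] ∷ (+ 0 ∷ + 3 ∷ []) ∷ [] ∷
   (+ 0 ∷ - + 1 ∷ []) ∷ []) ∷ ([] ∷ (+ 0 ∷ + 0 ∷ + 0 ∷ + 0 ∷ + 0 ∷ + 0 ∷ - + 3 ∷ []) ∷ [] ∷ [] ∷ [] ∷ [] ∷ [] ∷ (+ 0 ∷ + 0 ∷ - + 3 ∷ []) ∷ []) ∷ ([] ∷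
   (+ 0 ∷ + 0 ∷ + 0 ∷ + 0 ∷ + 0 ∷ + 0 ∷ + 0 ∷ - + 1 ∷ []) ∷ [] ∷ (+ 0 ∷ + 0 ∷ + 0 ∷ + 0 ∷ + 0 ∷ + 0 ∷ + 0 ∷ + 3 ∷ []) ∷ [] ∷ [] ∷ [] ∷ (+ 0 ∷ + 0 ∷ + 0 ∷
   + 0 ∷ + 0 ∷ + 0 ∷ + 0 ∷ + 4 ∷ []) ∷ []) ∷ ([] ∷ (+ 0 ∷ + 0 ∷ + 0 ∷ + 0 ∷ - + 1 ∷ []) ∷ [] ∷ [] ∷ [] ∷ (+ 0 ∷ + 0 ∷ + 0 ∷ + 0 ∷ - + 1 ∷ []) ∷ []) ∷
   ([] ∷ (+ 0 ∷ + 0 ∷ + 0 ∷ + 0 ∷ + 0 ∷ + 1 ∷ []) ∷ [] ∷ [] ∷ [] ∷ (+ 0 ∷ + 0 ∷ + 0 ∷ + 0 ∷ + 0 ∷ - + 2 ∷ []) ∷ []) ∷ []) ∷ (([] ∷ [] ∷ [] ∷ [] ∷ (+ 0 ∷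
   + 0 ∷ + 0 ∷ + 0 ∷ + 0 ∷ - + 4 ∷ + 0 ∷ + 2 ∷ []) ∷ []) ∷ ([] ∷ (+ 0 ∷ + 0 ∷ + 0 ∷ + 0 ∷ + 0 ∷ + 4 ∷ []) ∷ [] ∷ (+ 0 ∷ + 2 ∷ []) ∷ [] ∷ (+ 0 ∷ + 0 ∷
   + 0 ∷ + 0 ∷ + 0 ∷ - + 1 ∷ []) ∷ []) ∷ ([] ∷ [] ∷ (+ 0 ∷ + 0 ∷ - + 2 ∷ - + 2 ∷ + 0 ∷ + 0 ∷ + 2 ∷ + 1 ∷ []) ∷ (+ 0 ∷ + 0 ∷ + 0 ∷ + 0 ∷ + 0 ∷ + 1 ∷
   []) ∷ [] ∷ (+ 0 ∷ + 0 ∷ + 0 ∷ + 0 ∷ + 0 ∷ + 0 ∷ + 0 ∷ - + 3 ∷ []) ∷ (+ 0 ∷ - + 4 ∷ + 3 ∷ + 0 ∷ + 0 ∷ - + 5 ∷ - + 4 ∷ []) ∷ (+ 0 ∷ + 2 ∷ []) ∷ []) ∷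
   ([] ∷ [] ∷ [] ∷ [] ∷ [] ∷ (+ 0 ∷ + 0 ∷ + 0 ∷ + 0 ∷ + 0 ∷ + 4 ∷ []) ∷ [] ∷ (+ 0 ∷ + 0 ∷ + 0 ∷ + 0 ∷ + 0 ∷ - + 4 ∷ []) ∷ []) ∷ ((+ 0 ∷ + 1 ∷ + 0 ∷ + 2 ∷
   + 0 ∷ + 3 ∷ []) ∷ (+ 0 ∷ + 0 ∷ + 0 ∷ + 2 ∷ []) ∷ [] ∷ (+ 0 ∷ - + 1 ∷ []) ∷ [] ∷ (+ 0 ∷ + 0 ∷ + 0 ∷ + 0 ∷ + 0 ∷ + 0 ∷ + 0 ∷ + 3 ∷ []) ∷ [] ∷ (+ 0 ∷
   + 0 ∷ + 0 ∷ + 0 ∷ + 0 ∷ + 2 ∷ []) ∷ []) ∷ ([] ∷ (+ 0 ∷ + 0 ∷ + 0 ∷ + 0 ∷ + 0 ∷ - + 1 ∷ []) ∷ [] ∷ [] ∷ [] ∷ (+ 0 ∷ + 0 ∷ + 0 ∷ + 0 ∷ + 0 ∷ - + 4 ∷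
   []) ∷ []) ∷ ((- + 3 ∷ + 0 ∷ - + 5 ∷ + 0 ∷ + 7 ∷ + 0 ∷ + 6 ∷ []) ∷ (+ 0 ∷ + 0 ∷ + 0 ∷ + 1 ∷ []) ∷ (+ 1 ∷ + 0 ∷ + 0 ∷ + 0 ∷ + 4 ∷ + 2 ∷ []) ∷ (+ 0 ∷
   + 0 ∷ + 0 ∷ + 0 ∷ + 0 ∷ + 4 ∷ []) ∷ (- + 4 ∷ + 0 ∷ + 0 ∷ + 0 ∷ + 1 ∷ []) ∷ (+ 0 ∷ + 0 ∷ + 0 ∷ + 0 ∷ + 0 ∷ + 0 ∷ + 0 ∷ + 9 ∷ []) ∷ (- + 2 ∷ + 0 ∷ + 0 ∷
   + 1 ∷ + 2 ∷ []) ∷ (+ 0 ∷ + 7 ∷ []) ∷ []) ∷ ([] ∷ [] ∷ [] ∷ [] ∷ [] ∷ (+ 0 ∷ + 0 ∷ + 0 ∷ + 0 ∷ + 0 ∷ - + 2 ∷ []) ∷ [] ∷ (+ 0 ∷ + 0 ∷ + 0 ∷ + 0 ∷ + 0 ∷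
   + 1 ∷ []) ∷ []) ∷ []) ∷ (([] ∷ (+ 0 ∷ + 0 ∷ + 0 ∷ + 0 ∷ + 0 ∷ + 0 ∷ + 1 ∷ []) ∷ [] ∷ (+ 0 ∷ + 0 ∷ + 1 ∷ []) ∷ [] ∷ [] ∷ [] ∷ (+ 0 ∷ + 0 ∷ + 4 ∷ []) ∷
   []) ∷ ([] ∷ (+ 0 ∷ - + 2 ∷ []) ∷ [] ∷ (+ 0 ∷ + 0 ∷ + 0 ∷ + 0 ∷ + 0 ∷ - + 1 ∷ []) ∷ [] ∷ (+ 0 ∷ - + 1 ∷ []) ∷ []) ∷ ([] ∷ (+ 4 ∷ []) ∷ [] ∷ (+ 0 ∷ + 0 ∷
   + 0 ∷ + 0 ∷ + 2 ∷ []) ∷ []) ∷ ([] ∷ (+ 0 ∷ + 0 ∷ + 0 ∷ + 1 ∷ []) ∷ [] ∷ [] ∷ [] ∷ (+ 0 ∷ + 0 ∷ + 0 ∷ - + 1 ∷ []) ∷ []) ∷ ([] ∷ [] ∷ [] ∷ [] ∷ [] ∷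
   [] ∷ [] ∷ (+ 0 ∷ + 0 ∷ + 0 ∷ + 0 ∷ + 0 ∷ + 0 ∷ + 3 ∷ []) ∷ []) ∷ ([] ∷ [] ∷ [] ∷ (+ 0 ∷ - + 3 ∷ []) ∷ [] ∷ (+ 0 ∷ + 0 ∷ + 0 ∷ + 0 ∷ + 0 ∷ - + 5 ∷
   []) ∷ [] ∷ (+ 0 ∷ + 3 ∷ []) ∷ []) ∷ ([] ∷ (+ 0 ∷ + 0 ∷ + 0 ∷ + 0 ∷ - + 3 ∷ []) ∷ [] ∷ (- + 2 ∷ []) ∷ [] ∷ (+ 0 ∷ + 0 ∷ + 0 ∷ + 0 ∷ + 3 ∷ []) ∷ []) ∷
   ([] ∷ (+ 0 ∷ + 0 ∷ + 0 ∷ + 0 ∷ + 0 ∷ + 0 ∷ + 0 ∷ - + 1 ∷ []) ∷ [] ∷ (+ 0 ∷ + 0 ∷ + 0 ∷ + 3 ∷ []) ∷ [] ∷ (+ 0 ∷ + 0 ∷ + 0 ∷ + 0 ∷ + 0 ∷ + 0 ∷ + 0 ∷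
   + 3 ∷ []) ∷ []) ∷ []) ∷ (([] ∷ (+ 0 ∷ + 0 ∷ + 0 ∷ + 3 ∷ []) ∷ [] ∷ (+ 0 ∷ + 1 ∷ []) ∷ (+ 0 ∷ - + 4 ∷ + 0 ∷ + 0 ∷ + 0 ∷ + 0 ∷ + 0 ∷ - + 6 ∷ []) ∷ (+ 0 ∷
   + 0 ∷ + 0 ∷ + 0 ∷ + 0 ∷ + 0 ∷ + 0 ∷ - + 1 ∷ []) ∷ [] ∷ (+ 0 ∷ + 0 ∷ + 0 ∷ + 0 ∷ + 0 ∷ + 1 ∷ []) ∷ []) ∷ ([] ∷ [] ∷ [] ∷ [] ∷ [] ∷ (+ 0 ∷ + 0 ∷ + 0 ∷
   + 0 ∷ + 0 ∷ + 0 ∷ + 0 ∷ - + 4 ∷ []) ∷ [] ∷ (+ 0 ∷ + 0 ∷ + 0 ∷ + 0 ∷ + 0 ∷ + 0 ∷ + 0 ∷ + 1 ∷ []) ∷ []) ∷ ((- + 7 ∷ + 0 ∷ + 0 ∷ + 0 ∷ + 0 ∷ + 0 ∷ - + 8 ∷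
   []) ∷ [] ∷ (+ 2 ∷ + 0 ∷ + 0 ∷ + 0 ∷ + 0 ∷ + 9 ∷ []) ∷ (+ 0 ∷ + 4 ∷ []) ∷ (+ 3 ∷ + 0 ∷ + 0 ∷ + 0 ∷ + 0 ∷ + 0 ∷ + 4 ∷ []) ∷ (+ 0 ∷ + 0 ∷ + 0 ∷ - + 6 ∷
   []) ∷ (- + 3 ∷ + 0 ∷ + 0 ∷ + 0 ∷ + 2 ∷ []) ∷ []) ∷ ([] ∷ [] ∷ [] ∷ (+ 0 ∷ + 0 ∷ + 0 ∷ + 0 ∷ + 0 ∷ + 0 ∷ + 0 ∷ - + 2 ∷ []) ∷ [] ∷ [] ∷ [] ∷ (+ 0 ∷ + 0 ∷
   + 0 ∷ + 0 ∷ + 0 ∷ + 0 ∷ + 0 ∷ + 2 ∷ []) ∷ []) ∷ ((+ 0 ∷ + 0 ∷ + 0 ∷ + 3 ∷ + 0 ∷ + 0 ∷ + 0 ∷ + 3 ∷ []) ∷ (+ 0 ∷ + 0 ∷ + 0 ∷ + 2 ∷ []) ∷ [] ∷ (+ 0 ∷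
   - + 3 ∷ []) ∷ [] ∷ (+ 0 ∷ + 0 ∷ + 0 ∷ + 0 ∷ + 0 ∷ + 0 ∷ + 0 ∷ - + 1 ∷ []) ∷ []) ∷ ([] ∷ (+ 0 ∷ + 0 ∷ + 0 ∷ + 0 ∷ + 0 ∷ + 0 ∷ + 0 ∷ + 1 ∷ []) ∷ [] ∷
   (+ 0 ∷ + 0 ∷ + 0 ∷ + 0 ∷ + 0 ∷ + 0 ∷ + 0 ∷ + 2 ∷ []) ∷ [] ∷ (+ 0 ∷ + 0 ∷ + 0 ∷ + 0 ∷ + 0 ∷ + 0 ∷ + 0 ∷ + 1 ∷ []) ∷ [] ∷ (+ 0 ∷ + 0 ∷ + 0 ∷ + 0 ∷ + 0 ∷
   + 0 ∷ + 0 ∷ + 2 ∷ []) ∷ []) ∷ ([] ∷ (+ 0 ∷ + 0 ∷ + 0 ∷ + 0 ∷ + 0 ∷ + 0 ∷ + 0 ∷ - + 1 ∷ []) ∷ (+ 0 ∷ + 0 ∷ + 0 ∷ - + 5 ∷ + 0 ∷ + 0 ∷ - + 1 ∷ - + 4 ∷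
   []) ∷ (+ 0 ∷ - + 4 ∷ []) ∷ [] ∷ (+ 0 ∷ + 0 ∷ + 0 ∷ + 2 ∷ []) ∷ (+ 0 ∷ - + 1 ∷ + 0 ∷ + 0 ∷ + 0 ∷ + 0 ∷ + 4 ∷ []) ∷ (+ 0 ∷ + 0 ∷ + 0 ∷ + 0 ∷ + 0 ∷ - + 1 ∷
   []) ∷ []) ∷ ([] ∷ (+ 0 ∷ + 0 ∷ + 0 ∷ - + 1 ∷ []) ∷ [] ∷ (+ 0 ∷ + 0 ∷ + 0 ∷ + 0 ∷ + 0 ∷ + 0 ∷ + 0 ∷ + 2 ∷ []) ∷ [] ∷ [] ∷ [] ∷ (+ 0 ∷ + 0 ∷ + 0 ∷ + 0 ∷
   + 0 ∷ + 0 ∷ + 0 ∷ - + 5 ∷ []) ∷ []) ∷ []) ∷ []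

-- The multiplications by elements of norm 3 modulo 4, for the table `Ge`, and modulo 8, for `Gx`
-- and `Gy`.
L0₄ L0₈ : Vec (Vec ℕ 4) 4
L0₄ = ((1 ∷ 2 ∷ 0 ∷ 2 ∷ []) ∷ (0 ∷ 3 ∷ 3 ∷ 0 ∷ []) ∷ (0 ∷ 2 ∷ 3 ∷ 0 ∷ []) ∷ (1 ∷ 2 ∷ 1 ∷ 1 ∷ []) ∷ [])
L0₈ = ((1 ∷ 2 ∷ 0 ∷ 2 ∷ []) ∷ (4 ∷ 3 ∷ 7 ∷ 4 ∷ []) ∷ (4 ∷ 2 ∷ 7 ∷ 0 ∷ []) ∷ (1 ∷ 2 ∷ 1 ∷ 1 ∷ []) ∷ [])
R0₄ R0₈ : Vec (Vec ℕ 4) 4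
R0₄ = ((1 ∷ 0 ∷ 3 ∷ 2 ∷ []) ∷ (0 ∷ 3 ∷ 1 ∷ 0 ∷ []) ∷ (0 ∷ 2 ∷ 3 ∷ 0 ∷ []) ∷ (1 ∷ 3 ∷ 3 ∷ 1 ∷ []) ∷ [])
R0₈ = ((1 ∷ 0 ∷ 7 ∷ 6 ∷ []) ∷ (4 ∷ 7 ∷ 1 ∷ 4 ∷ []) ∷ (4 ∷ 2 ∷ 7 ∷ 0 ∷ []) ∷ (1 ∷ 7 ∷ 7 ∷ 5 ∷ []) ∷ [])
L1₄ L1₈ : Vec (Vec ℕ 4) 4
L1₄ = ((1 ∷ 3 ∷ 3 ∷ 3 ∷ []) ∷ (1 ∷ 3 ∷ 2 ∷ 1 ∷ []) ∷ (3 ∷ 3 ∷ 1 ∷ 0 ∷ []) ∷ (1 ∷ 0 ∷ 3 ∷ 1 ∷ []) ∷ [])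
L1₈ = ((1 ∷ 3 ∷ 3 ∷ 3 ∷ []) ∷ (5 ∷ 3 ∷ 6 ∷ 5 ∷ []) ∷ (3 ∷ 3 ∷ 1 ∷ 0 ∷ []) ∷ (1 ∷ 0 ∷ 7 ∷ 1 ∷ []) ∷ [])
R1₄ R1₈ : Vec (Vec ℕ 4) 4
R1₄ = ((1 ∷ 0 ∷ 1 ∷ 0 ∷ []) ∷ (1 ∷ 1 ∷ 2 ∷ 3 ∷ []) ∷ (3 ∷ 0 ∷ 2 ∷ 0 ∷ []) ∷ (1 ∷ 1 ∷ 1 ∷ 2 ∷ []) ∷ [])
R1₈ = ((1 ∷ 0 ∷ 1 ∷ 0 ∷ []) ∷ (5 ∷ 1 ∷ 2 ∷ 3 ∷ []) ∷ (3 ∷ 0 ∷ 6 ∷ 0 ∷ []) ∷ (1 ∷ 1 ∷ 1 ∷ 6 ∷ []) ∷ [])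
L2₄ L2₈ : Vec (Vec ℕ 4) 4
L2₄ = ((2 ∷ 3 ∷ 3 ∷ 3 ∷ []) ∷ (1 ∷ 0 ∷ 2 ∷ 1 ∷ []) ∷ (3 ∷ 3 ∷ 2 ∷ 0 ∷ []) ∷ (1 ∷ 0 ∷ 3 ∷ 2 ∷ []) ∷ [])
L2₈ = ((2 ∷ 3 ∷ 3 ∷ 3 ∷ []) ∷ (5 ∷ 4 ∷ 6 ∷ 5 ∷ []) ∷ (3 ∷ 3 ∷ 2 ∷ 0 ∷ []) ∷ (1 ∷ 0 ∷ 7 ∷ 2 ∷ []) ∷ [])
R2₄ R2₈ : Vec (Vec ℕ 4) 4
R2₄ = ((2 ∷ 0 ∷ 1 ∷ 0 ∷ []) ∷ (1 ∷ 2 ∷ 2 ∷ 3 ∷ []) ∷ (3 ∷ 0 ∷ 3 ∷ 0 ∷ []) ∷ (1 ∷ 1 ∷ 1 ∷ 3 ∷ []) ∷ [])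
R2₈ = ((2 ∷ 0 ∷ 1 ∷ 0 ∷ []) ∷ (5 ∷ 2 ∷ 2 ∷ 3 ∷ []) ∷ (3 ∷ 0 ∷ 7 ∷ 0 ∷ []) ∷ (1 ∷ 1 ∷ 1 ∷ 7 ∷ []) ∷ [])
L3₄ L3₈ : Vec (Vec ℕ 4) 4
L3₄ = ((3 ∷ 2 ∷ 0 ∷ 2 ∷ []) ∷ (0 ∷ 1 ∷ 3 ∷ 0 ∷ []) ∷ (0 ∷ 2 ∷ 1 ∷ 0 ∷ []) ∷ (1 ∷ 2 ∷ 1 ∷ 3 ∷ []) ∷ [])
L3₈ = ((3 ∷ 2 ∷ 0 ∷ 2 ∷ []) ∷ (4 ∷ 5 ∷ 7 ∷ 4 ∷ []) ∷ (4 ∷ 2 ∷ 1 ∷ 0 ∷ []) ∷ (1 ∷ 2 ∷ 1 ∷ 3 ∷ []) ∷ [])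
R3₄ R3₈ : Vec (Vec ℕ 4) 4
R3₄ = ((3 ∷ 0 ∷ 3 ∷ 2 ∷ []) ∷ (0 ∷ 1 ∷ 1 ∷ 0 ∷ []) ∷ (0 ∷ 2 ∷ 1 ∷ 0 ∷ []) ∷ (1 ∷ 3 ∷ 3 ∷ 3 ∷ []) ∷ [])
R3₈ = ((3 ∷ 0 ∷ 7 ∷ 6 ∷ []) ∷ (4 ∷ 1 ∷ 1 ∷ 4 ∷ []) ∷ (4 ∷ 2 ∷ 1 ∷ 0 ∷ []) ∷ (1 ∷ 7 ∷ 7 ∷ 7 ∷ []) ∷ [])
-- The same matrices reduced to residues, so that the exhaustive checks do not recompute them.
P1N : Vec (Vec ℕ 4) 4
P1N = ((0 ∷ 2 ∷ 4 ∷ 0 ∷ []) ∷ (0 ∷ 2 ∷ 0 ∷ 7 ∷ []) ∷ (4 ∷ 2 ∷ 0 ∷ 0 ∷ []) ∷ (0 ∷ 0 ∷ 0 ∷ 7 ∷ []) ∷ [])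
P2N : Vec (Vec ℕ 4) 4
P2N = ((0 ∷ 4 ∷ 6 ∷ 2 ∷ []) ∷ (7 ∷ 3 ∷ 3 ∷ 2 ∷ []) ∷ (7 ∷ 3 ∷ 5 ∷ 0 ∷ []) ∷ (1 ∷ 1 ∷ 1 ∷ 6 ∷ []) ∷ [])
P3N : Vec (Vec ℕ 4) 4
P3N = ((0 ∷ 0 ∷ 7 ∷ 0 ∷ []) ∷ (0 ∷ 6 ∷ 6 ∷ 0 ∷ []) ∷ (4 ∷ 2 ∷ 0 ∷ 0 ∷ []) ∷ (0 ∷ 6 ∷ 7 ∷ 4 ∷ []) ∷ [])
P4N : Vec (Vec ℕ 4) 4
P4N = ((7 ∷ 1 ∷ 5 ∷ 3 ∷ []) ∷ (0 ∷ 6 ∷ 6 ∷ 0 ∷ []) ∷ (7 ∷ 7 ∷ 7 ∷ 7 ∷ []) ∷ (7 ∷ 1 ∷ 1 ∷ 3 ∷ []) ∷ [])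
R1N : Vec (Vec ℕ 4) 4
R1N = ((0 ∷ 2 ∷ 0 ∷ 0 ∷ []) ∷ (0 ∷ 0 ∷ 3 ∷ 3 ∷ []) ∷ (0 ∷ 2 ∷ 0 ∷ 0 ∷ []) ∷ (0 ∷ 2 ∷ 2 ∷ 2 ∷ []) ∷ [])
R2N : Vec (Vec ℕ 4) 4
R2N = ((3 ∷ 1 ∷ 2 ∷ 3 ∷ []) ∷ (3 ∷ 3 ∷ 0 ∷ 3 ∷ []) ∷ (2 ∷ 0 ∷ 2 ∷ 2 ∷ []) ∷ (0 ∷ 2 ∷ 2 ∷ 0 ∷ []) ∷ [])
XB2N : Vec (Vec ℕ 4) 4
XB2N = ((15 ∷ 15 ∷ 2 ∷ 8 ∷ []) ∷ (15 ∷ 3 ∷ 2 ∷ 4 ∷ []) ∷ (14 ∷ 13 ∷ 14 ∷ 1 ∷ []) ∷ (0 ∷ 13 ∷ 14 ∷ 11 ∷ []) ∷ [])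
Y1AN : Vec (Vec ℕ 4) 4
Y1AN = ((15 ∷ 9 ∷ 13 ∷ 3 ∷ []) ∷ (0 ∷ 15 ∷ 15 ∷ 0 ∷ []) ∷ (2 ∷ 14 ∷ 14 ∷ 10 ∷ []) ∷ (1 ∷ 1 ∷ 1 ∷ 1 ∷ []) ∷ [])
Y3AN : Vec (Vec ℕ 4) 4
Y3AN = ((1 ∷ 15 ∷ 14 ∷ 1 ∷ []) ∷ (0 ∷ 14 ∷ 15 ∷ 13 ∷ []) ∷ (2 ∷ 2 ∷ 2 ∷ 12 ∷ []) ∷ (15 ∷ 11 ∷ 13 ∷ 8 ∷ []) ∷ [])
YA2N : Vec (Vec ℕ 4) 4
YA2N = ((1 ∷ 8 ∷ 11 ∷ 14 ∷ []) ∷ (1 ∷ 0 ∷ 15 ∷ 2 ∷ []) ∷ (0 ∷ 12 ∷ 14 ∷ 10 ∷ []) ∷ (15 ∷ 14 ∷ 14 ∷ 1 ∷ []) ∷ [])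
X2BN : Vec (Vec ℕ 4) 4
X2BN = ((2 ∷ 1 ∷ 0 ∷ 0 ∷ []) ∷ (0 ∷ 15 ∷ 15 ∷ 15 ∷ []) ∷ (0 ∷ 1 ∷ 3 ∷ 7 ∷ []) ∷ (0 ∷ 11 ∷ 13 ∷ 9 ∷ []) ∷ [])
X5BN : Vec (Vec ℕ 4) 4
X5BN = ((1 ∷ 14 ∷ 14 ∷ 14 ∷ []) ∷ (0 ∷ 3 ∷ 2 ∷ 5 ∷ []) ∷ (15 ∷ 10 ∷ 14 ∷ 6 ∷ []) ∷ (1 ∷ 2 ∷ 2 ∷ 14 ∷ []) ∷ [])

-- The norm form of the quaternion order.

gram-check : ∀ {k l} (T′ : Mat l) (T : Mat k) (B : Vec (V k) l) (s : ℤ) → (tr B ⊡ (T′ ⊡ B)) +M tr (tr B ⊡ (T′ ⊡ B)) ≡ *M s T +M tr (*M s T) → ∀ c → Q T′ (mv B c) ≡ s * Q T c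
gram-check T′ T B s e c = trans (Q-mv T′ B c) (trans (Q-cong _ _ e c) (Q-*M s T c))

mv-box : ∀ {k l} (B : Vec (V k) l) x M → InBox M x → ∃ λ K → (K ≡ dotN (map (λ r → dotN (map ∣_∣ r) (replicate k 1)) B) (replicate l 1)) × InBox (K ℕ.* M) (mv B x)
mv-box []      x M h = 0 , refl , []
mv-box (r ∷ B) x M h with absdot r x M h | mv-box B x M h
... | K , refl , p | K′ , refl , q = _ , refl , ℕₚ.≤-trans p (ℕₚ.*-monoˡ-≤ M (ℕₚ.≤-trans (ℕₚ.≤-reflexive (sym (ℕₚ.*-identityʳ K))) (ℕₚ.m≤m+n (K ℕ.* 1) K′))) ∷ InBox-mono (ℕₚ.*-monoˡ-≤ M (ℕₚ.m≤n+m K′ (K ℕ.* 1))) q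

-- The reduced norm on the maximal order of the quaternion algebra (-2,-13) with basis
-- 1, (1+j+ij)/2, (i+2j+ij)/4, ij.
norm : Mat 4
norm = (+ 1 ∷ + 1 ∷ + 0 ∷ + 0 ∷ []) ∷ (+ 0 ∷ + 10 ∷ + 13 ∷ + 26 ∷ []) ∷ (+ 0 ∷ + 0 ∷ + 5 ∷ + 13 ∷ []) ∷ (+ 0 ∷ + 0 ∷ + 0 ∷ + 26 ∷ []) ∷ []

coords uncoords : Mat 4
coords   = (+ 4 ∷ + 2 ∷ + 0 ∷ + 0 ∷ []) ∷ (+ 0 ∷ + 0 ∷ + 1 ∷ + 0 ∷ []) ∷ (+ 0 ∷ + 2 ∷ + 2 ∷ + 0 ∷ []) ∷ (+ 0 ∷ + 2 ∷ + 1 ∷ + 4 ∷ []) ∷ []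
uncoords = (+ 1 ∷ + 2 ∷ - + 1 ∷ + 0 ∷ []) ∷ (+ 0 ∷ - + 4 ∷ + 2 ∷ + 0 ∷ []) ∷ (+ 0 ∷ + 4 ∷ + 0 ∷ + 0 ∷ []) ∷ (+ 0 ∷ + 1 ∷ - + 1 ∷ + 1 ∷ []) ∷ []

diag : Form 4
diag = unary 1 ⊞ (unary 2 ⊞ (unary 13 ⊞ unary 26))

absrow : ∀ {k l} → Vec (V k) l → ℕ
absrow {k} {l} B = dotN (map (λ r → dotN (map ∣_∣ r) (replicate k 1)) B) (replicate l 1)

-- If A embeds (ℤᵏ, s·T) isometrically into F, with BA = e, then T is bounded because F is.
pullForm : ∀ {k l} (F : Form l) (T : Mat k) (A : Vec (V k) l) (B : Vec (V l) k) (s e : ℕ) →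
  (∀ y → Q (gram F) (mv A y) ≡ + suc s * Q T y) → (∀ y → mv B (mv A y) ≡ + suc e *V y) → Form k
pullForm {k} F T A B s e hQ hB = record { gram = T ; bound = absrow B ℕ.* (bound F ℕ.* suc s) ; nonneg = nn ; bounded = bd }
  where
  nn : ∀ y → ∃ λ m → Q T y ≡ + m
  nn y = nonneg-cancel s _ (Q T y) (trans (sym (hQ y)) (proj₂ (nonneg F (mv A y))))
  unmul : ∀ {k N} (y : V k) → InBox N (+ suc e *V y) → InBox N y
  unmul []      []       = []
  unmul (x ∷ y) (p ∷ ps) = ℕₚ.≤-trans (ℕₚ.≤-trans (ℕₚ.m≤n*m ∣ x ∣ (suc e)) (ℕₚ.≤-reflexive (sym (ℤₚ.abs-* (+ suc e) x)))) p ∷ unmul y ps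
  bd : ∀ y n → Q T y ≡ + n → InBox (absrow B ℕ.* (bound F ℕ.* suc s) ℕ.* n) y
  bd y n h with mv-box B (mv A y) (bound F ℕ.* (suc s ℕ.* n)) (bounded F (mv A y) (suc s ℕ.* n) (trans (hQ y) (trans (cong (+ suc s *_) h) (sym (ℤₚ.pos-* (suc s) n)))))
  ... | K , refl , b = unmul y (subst (InBox _) (hB y) (InBox-mono (ℕₚ.≤-reflexive (trans (cong (absrow B ℕ.*_) (sym (ℕₚ.*-assoc (bound F) (suc s) n))) (sym (ℕₚ.*-assoc (absrow B) (bound F ℕ.* suc s) n)))) b))

scaleForm : ∀ {k} (c : ℕ) → Form k → Form k
scaleForm {k} c F = record { gram = *M (+ suc c) (gram F) ; bound = bound F ; nonneg = nn ; bounded = bd }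
  where
  nn : ∀ y → ∃ λ m → Q (*M (+ suc c) (gram F)) y ≡ + m
  nn y with nonneg F y
  ... | m , e = suc c ℕ.* m , trans (Q-*M (+ suc c) (gram F) y) (trans (cong (+ suc c *_) e) (sym (ℤₚ.pos-* (suc c) m)))
  bd : ∀ y n → Q (*M (+ suc c) (gram F)) y ≡ + n → InBox (bound F ℕ.* n) y
  bd y n e with nonneg F y
  ... | m , e′ = InBox-mono (ℕₚ.*-monoʳ-≤ (bound F) (ℕₚ.≤-trans (ℕₚ.m≤n*m m (suc c)) (ℕₚ.≤-reflexive (ℤₚ.+-injective (trans (ℤₚ.pos-* (suc c) m) (trans (cong (+ suc c *_) (sym e′)) (trans (sym (Q-*M (+ suc c) (gram F) y)) e))))))) (bounded F y m e′)

coords-gram : ∀ y → Q (gram diag) (mv coords y) ≡ + 16 * Q norm y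
coords-gram = gram-check (gram diag) norm coords (+ 16) refl

coords-back : uncoords ⊡ coords ≡ scalar 4 (+ 4)
coords-back = refl

N₁ N₃ N₈ : Form 4
-- `pullForm` takes predecessors: 15 and 3 stand for the scale 16 of `coords-gram` and the
-- multiplier 4 of `coords-back`; below, 2 and 7 stand for 3 and 8.
N₁ = pullForm diag norm coords uncoords 15 3 coords-gram (λ y → trans (mv-⊡ uncoords coords y) (trans (cong (λ X → mv X y) coords-back) (mv-scalar (+ 4) y)))
N₃ = scaleForm 2 N₁
N₈ = scaleForm 7 N₁

mask-1 : ∀ {k} (B : Mat k) (f : V k → ℤ) c → mask B 1 f c ≡ f c
mask-1 B f c = trans (cong (_* f c) (all1 (mv B c))) (ℤₚ.*-identityˡ (f c))
  where
  all1 : ∀ {l} (p : V l) → divI 1 p ≡ + 1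
  all1 []      = refl
  all1 (p ∷ v) = cong₂ _*_ (cong (λ t → δ t 0) (ℕₚ.n<1⇒n≡0 (ℤD.n%ℕd<d p 1))) (all1 v)

transfer₁ : ∀ {k} (A B : Mat k) (d : ℕ) .{{_ : NonZero d}} → A ⊡ B ≡ scalar k (+ d * + 1) → B ⊡ A ≡ scalar k (+ d * + 1) →
  (F G : Form k) → (∀ c → Q (gram G) (mv B c) ≡ + 1 * Q (gram F) c) → (f : V k → ℤ) → Lat f F ≐ Lat (pl A d f) G
transfer₁ A B d ab ba F G h f = ≐-trans (Lat-cong F (λ c → sym (mask-1 B f c))) (transfer A B d 1 ab ba F G h f)

-- Left and right divisors of norm 3.

-- Eichler's commutation relation at 3: an element of the order has as many right divisors
-- of norm 3 as left divisors of norm 3.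
∑L ∑R : (V 4 → ℤ) → V 4 → ℤ
∑L g y = pl L0 1 g y + (pl L1 1 g y + (pl L2 1 g y + pl L3 1 g y))
∑R g y = pl R0 1 g y + (pl R1 1 g y + (pl R2 1 g y + pl R3 1 g y))

private
  unit : Per 4 3
  unit = perB 1 (divides 3 refl) (λ _ → + 1)
  count : Mat 4 → Per 4 3
  count B = perMask 3 (divides 1 refl) B unit

  excess : Per 4 3
  excess = count L0* ∔ (count L1* ∔ (count L2* ∔ count L3*)) ∔ - + 1 · (count R0* ∔ (count R1* ∔ (count R2* ∔ count R3*)))

  -- Modulo 3 the order is the ring of 2 by 2 matrices over the field with three elements: an
  -- invertible class has no divisor of norm 3 on either side, a class of rank 1 has one on each
  -- side, and the zero class has all four on both.
  divisor-count : ∀ x → fun excess x ≡ + 0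
  divisor-count = vanishes excess refl

  Lat-⊕₄ : ∀ (a b c d : V 4 → ℤ) (F : Form 4) → Lat (λ x → a x + (b x + (c x + d x))) F ≐ Lat a F ⊕ (Lat b F ⊕ (Lat c F ⊕ Lat d F))
  Lat-⊕₄ a b c d F n = trans (Lat-⊕ a (λ x → b x + (c x + d x)) F n) (cong (λ t → Lat a F n + t) (trans (Lat-⊕ b (λ x → c x + d x) F n) (cong (λ t → Lat b F n + t) (Lat-⊕ c d F n))))

  divide : ∀ g (A B : Mat 4) → A ⊡ B ≡ scalar 4 (+ 3) → B ⊡ A ≡ scalar 4 (+ 3) →
    (tr B ⊡ (gram N₃ ⊡ B)) +M tr (tr B ⊡ (gram N₃ ⊡ B)) ≡ *M (+ 9) (gram N₁) +M tr (*M (+ 9) (gram N₁)) → Lat (mask B 3 g) N₁ ≐ Lat (pl A 1 g) N₃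
  divide g A B ab ba e = transfer A B 1 3 ab ba N₁ N₃ (gram-check (gram N₃) (gram N₁) B (+ 9) e) g

-- After the dilation by 3, a vector y is replaced by its multiple x of three times the norm. Each
-- side then becomes the sum of g(x) times the number of divisors of x of norm 3 on that side, the
-- starred matrices testing divisibility, and the two numbers agree.
eichler : ∀ g → Lat (∑L g) N₁ ≐ Lat (∑R g) N₁
eichler g = dil-injective 3 (≐-trans (to3 (∑L g)) (≐-trans (≐-sym left) (≐-trans mid (≐-trans right (≐-sym (to3 (∑R g)))))))
  where
  to3 : ∀ h → dil 3 (Lat h N₁) ≐ Lat h N₃
  to3 h = Lat-dil 3 h N₁ N₃ (Q-*M (+ 3) norm)
  mL mR : V 4 → ℤ
  mL x = mask L0* 3 g x + (mask L1* 3 g x + (mask L2* 3 g x + mask L3* 3 g x))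
  mR x = mask R0* 3 g x + (mask R1* 3 g x + (mask R2* 3 g x + mask R3* 3 g x))
  left : Lat mL N₁ ≐ Lat (∑L g) N₃
  left = ≐-trans (Lat-⊕₄ (mask L0* 3 g) (mask L1* 3 g) (mask L2* 3 g) (mask L3* 3 g) N₁) (≐-trans (λ n → cong₂ _+_ (divide g L0 L0* refl refl refl n) (cong₂ _+_ (divide g L1 L1* refl refl refl n) (cong₂ _+_ (divide g L2 L2* refl refl refl n) (divide g L3 L3* refl refl refl n)))) (≐-sym (Lat-⊕₄ (pl L0 1 g) (pl L1 1 g) (pl L2 1 g) (pl L3 1 g) N₃)))
  right : Lat mR N₁ ≐ Lat (∑R g) N₃
  right = ≐-trans (Lat-⊕₄ (mask R0* 3 g) (mask R1* 3 g) (mask R2* 3 g) (mask R3* 3 g) N₁) (≐-trans (λ n → cong₂ _+_ (divide g R0 R0* refl refl refl n) (cong₂ _+_ (divide g R1 R1* refl refl refl n) (cong₂ _+_ (divide g R2 R2* refl refl refl n) (divide g R3 R3* refl refl refl n)))) (≐-sym (Lat-⊕₄ (pl R0 1 g) (pl R1 1 g) (pl R2 1 g) (pl R3 1 g) N₃)))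
  mid : Lat mL N₁ ≐ Lat mR N₁
  mid = Lat-cong N₁ (λ x → regroup (divI 3 (mv L0* x)) (divI 3 (mv L1* x)) (divI 3 (mv L2* x)) (divI 3 (mv L3* x)) (divI 3 (mv R0* x)) (divI 3 (mv R1* x)) (divI 3 (mv R2* x)) (divI 3 (mv R3* x)) (g x) (divisor-count x))
    where
    lem : ∀ a b c d a′ b′ c′ d′ g → a * g + (b * g + (c * g + d * g)) - (a′ * g + (b′ * g + (c′ * g + d′ * g))) ≡ (a * + 1 + (b * + 1 + (c * + 1 + d * + 1)) + - + 1 * (a′ * + 1 + (b′ * + 1 + (c′ * + 1 + d′ * + 1)))) * g
    lem = solve-∀
    regroup : ∀ a b c d a′ b′ c′ d′ g → a * + 1 + (b * + 1 + (c * + 1 + d * + 1)) + - + 1 * (a′ * + 1 + (b′ * + 1 + (c′ * + 1 + d′ * + 1))) ≡ + 0 → a * g + (b * g + (c * g + d * g)) ≡ a′ * g + (b′ * g + (c′ * g + d′ * g))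
    regroup a b c d a′ b′ c′ d′ g e = ℤₚ.i-j≡0⇒i≡j _ _ (trans (lem a b c d a′ b′ c′ d′ g) (trans (cong (_* g) e) (ℤₚ.*-zeroˡ g)))

module _ (d m : ℕ) .{{_ : NonZero d}} .{{_ : NonZero m}} .{{_ : NonZero (d ℕ.* m)}} where

  -- Evaluates the residues of a linear map row by row, stopping at the first row not divisible by d.
  collect : ∀ {k l} → Vec (Vec ℕ k) l → Vec ℕ k → (Vec ℕ l → ℤ) → ℤ
  step : ∀ {k l} → ℕ → Vec (Vec ℕ k) l → Vec ℕ k → (Vec ℕ (suc l) → ℤ) → ℤ
  collect []      ρ c = c []
  collect (a ∷ A) ρ c = step (dotN a ρ ℕ.% (d ℕ.* m)) A ρ c
  step r A ρ c = if r ℕ.% d ≡ᵇ 0 then collect A ρ (λ v → c (((r ℕ./ d) ℕ.% m) ∷ v)) else + 0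

  collect≡ : ∀ {k l} (A : Vec (V k) l) ρ (c : Vec ℕ l → ℤ) → collect (map (resV (d ℕ.* m)) A) ρ c ≡ divN d (linN (d ℕ.* m) A ρ) * c (map (λ x → (x ℕ./ d) ℕ.% m) (linN (d ℕ.* m) A ρ))
  collect≡ []      ρ c = sym (ℤₚ.*-identityˡ (c []))
  collect≡ (a ∷ A) ρ c = go (dotN (resV (d ℕ.* m) a) ρ ℕ.% (d ℕ.* m))
    where
    rs = linN (d ℕ.* m) A ρ
    qs = map (λ x → (x ℕ./ d) ℕ.% m) rs
    go : ∀ r → step r (map (resV (d ℕ.* m)) A) ρ c ≡ indN d r * divN d rs * c (((r ℕ./ d) ℕ.% m) ∷ qs)
    go r with r ℕ.% d
    ... | zero  = trans (collect≡ A ρ (λ v → c (((r ℕ./ d) ℕ.% m) ∷ v))) (cong (_* c (((r ℕ./ d) ℕ.% m) ∷ qs)) (sym (ℤₚ.*-identityˡ (divN d rs))))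
    ... | suc _ = sym (trans (cong (_* c (((r ℕ./ d) ℕ.% m) ∷ qs)) (ℤₚ.*-zeroˡ (divN d rs))) (ℤₚ.*-zeroˡ (c (((r ℕ./ d) ℕ.% m) ∷ qs))))

  -- The weight of `perPl` with a cheaper evaluator: the matrix is already reduced, and `collect`
  -- gives up at the first row that is not divisible.
  fastPl : ∀ {M} .{{_ : NonZero M}} → (d ℕ.* m) ∣ M → ∀ {k} (A : Mat k) (Ā : Vec (Vec ℕ k) k) → Ā ≡ map (resV (d ℕ.* m)) A → (Vec ℕ k → ℤ) → Per k M
  fastPl {M} e A Ā h f = per (fun P) (λ ρ → collect Ā ρ f) (λ u → trans (fun≡rep P u) (sym (trans (cong (λ X → collect X (resV M u) f) h) (collect≡ A (resV M u) f))))
    where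
    P = perPl d m {M} e A f

-- Quaternary identities from products of binary theta series.

at : {A : Set} → A → List A → ℕ → A
at z []       n       = z
at z (x ∷ xs) zero    = x
at z (x ∷ xs) (suc n) = at z xs n

table : List (List (List (List ℤ))) → Vec ℕ 4 → ℤ
table G (a ∷ b ∷ c ∷ d ∷ []) = at (+ 0) (at [] (at [] (at [] G a) b) c) d

sgn : ℕ → ℤ
sgn n = if n ℕ.% 2 ≡ᵇ 0 then + 1 else - + 1

odd : ℕ → ℤ
odd n = if n ℕ.% 2 ≡ᵇ 0 then + 0 else + 1

-- Signs on the two odd classes mod 2 of the forms defining E(q^8)E(q^208) and E(q^16)E(q^104).
εA εB : Vec ℕ 2 → ℤ
εA (x ∷ z ∷ []) = if x ≡ᵇ 0 then + 0 else sgn z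
εB (x ∷ z ∷ []) = if x ≡ᵇ 0 then (if z ≡ᵇ 0 then + 0 else - + 1) else (if z ≡ᵇ 0 then + 1 else + 0)

-- The signs `s` are the signs `t` below multiplied by (-1)^Q for the form of the same index, that
-- is, their theta series are taken at -q. `ψψ` selects pairs of odd numbers, which give products of
-- two series ψ(q^8).
s₁ s₂ s₃ s₅ ψψ : Vec ℕ 2 → ℤ
s₁ (x ∷ y ∷ []) = sgn (x ℕ.+ y)
s₂ (x ∷ y ∷ []) = sgn (x ℕ.+ y)
s₃ (x ∷ y ∷ []) = sgn y
s₅ (x ∷ y ∷ []) = sgn (x ℕ.+ y)
ψψ (x ∷ y ∷ []) = odd x * odd y

_⊠_ : (Vec ℕ 2 → ℤ) → (Vec ℕ 2 → ℤ) → Vec ℕ 4 → ℤ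
(f ⊠ g) (a ∷ b ∷ c ∷ d ∷ []) = f (a ∷ b ∷ []) * g (c ∷ d ∷ [])

even₂ : (Vec ℕ 2 → ℤ) → V 2 → ℤ
even₂ f u = f (resV 2 u)

even₄ : (Vec ℕ 4 → ℤ) → V 4 → ℤ
even₄ f u = f (resV 2 u)

⊠-⊗ : ∀ f g x → (even₂ f ⊗ even₂ g) x ≡ even₄ (f ⊠ g) x
⊠-⊗ f g (a ∷ b ∷ c ∷ d ∷ []) = refl

L-∑ : ∀ {M} .{{_ : NonZero M}} m .{{_ : NonZero m}} .{{_ : NonZero (1 ℕ.* m)}} → (1 ℕ.* m) ∣ M → (Ā₀ Ā₁ Ā₂ Ā₃ : Vec (Vec ℕ 4) 4) (A₀ A₁ A₂ A₃ : Mat 4) →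
  Ā₀ ≡ map (resV (1 ℕ.* m)) A₀ → Ā₁ ≡ map (resV (1 ℕ.* m)) A₁ → Ā₂ ≡ map (resV (1 ℕ.* m)) A₂ → Ā₃ ≡ map (resV (1 ℕ.* m)) A₃ → (Vec ℕ 4 → ℤ) → Per 4 M
L-∑ m e Ā₀ Ā₁ Ā₂ Ā₃ A₀ A₁ A₂ A₃ h₀ h₁ h₂ h₃ g = fastPl 1 m e A₀ Ā₀ h₀ g ∔ (fastPl 1 m e A₁ Ā₁ h₁ g ∔ (fastPl 1 m e A₂ Ā₂ h₂ g ∔ fastPl 1 m e A₃ Ā₃ h₃ g))

ge : Vec ℕ 4 → ℤ
ge = table Ge

-- The six transported weights of `quat`, corrected by the left and right sums of the certificate.
-- Their coefficient 2 keeps the table integral: `Ge` has odd entries.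
perE : Per 4 8
perE = + 2 · fastPl 4 2 (divides 1 refl) P1A P1N refl (s₅ ⊠ s₁) ∔ - + 2 · fastPl 4 2 (divides 1 refl) P2A P2N refl (s₅ ⊠ s₃)
     ∔ - + 2 · fastPl 4 2 (divides 1 refl) P3A P3N refl (s₂ ⊠ s₁) ∔ + 2 · fastPl 4 2 (divides 1 refl) P4A P4N refl (s₂ ⊠ s₃)
     ∔ + 2 · fastPl 2 2 (divides 2 refl) R1A R1N refl (εA ⊠ ψψ) ∔ + 2 · fastPl 2 2 (divides 2 refl) R2A R2N refl (εB ⊠ ψψ)
     ∔ - + 1 · L-∑ 4 (divides 2 refl) L0₄ L1₄ L2₄ L3₄ L0 L1 L2 L3 refl refl refl refl ge
     ∔ L-∑ 4 (divides 2 refl) R0₄ R1₄ R2₄ R3₄ R0 R1 R2 R3 refl refl refl refl ge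

perE-0 : ∀ y → fun perE y ≡ + 0
perE-0 = vanishes perE refl

-- Multiplication that leaves its second argument unevaluated when the first is 0.
gate : ℤ → ℤ → ℤ
gate (+ 0) h = + 0
gate c     h = c * h

gate≡ : ∀ c h → gate c h ≡ c * h
gate≡ (+ 0)     h = sym (ℤₚ.*-zeroˡ h)
gate≡ (+ suc n) h = refl
gate≡ -[1+ n ]  h = refl

-- The coefficient at `n` sees only vectors of norm `n`, so a function of the norm comes out of the
-- sum. Eichler's relation therefore survives multiplication by any function of the norm.
Lat-gate : ∀ {k} (J : ℤ → ℤ) (h : V k → ℤ) (F : Form k) n → Lat (λ y → J (Q (gram F) y) * h y) F n ≡ J (+ n) * Lat h F n
Lat-gate {k} J h F n = trans (Σb-cong (bound F ℕ.* n) k go) (Σb-*ˡ (bound F ℕ.* n) k (J (+ n)) (term h F n))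
  where
  go : ∀ y → J (Q (gram F) y) * h y * δℤ (Q (gram F) y) (+ n) ≡ J (+ n) * (h y * δℤ (Q (gram F) y) (+ n))
  go y with Q (gram F) y ℤ.≟ + n
  ... | yes e = trans (cong (λ t → J t * h y * + 1) e) (ℤₚ.*-assoc (J (+ n)) (h y) (+ 1))
  ... | no  _ = trans (ℤₚ.*-zeroʳ (J (Q (gram F) y) * h y)) (sym (trans (cong (J (+ n) *_) (ℤₚ.*-zeroʳ (h y))) (ℤₚ.*-zeroʳ (J (+ n)))))

Q-res : ∀ m .{{_ : NonZero m}} {M} .{{_ : NonZero M}} → m ∣ M → ∀ {k} (T : Mat k) u → Q T u %ℕ m ≡ dotN (linN m T (resV M u)) (resV M u) ℕ.% m
Q-res m {M} e T u = trans (cong (_%ℕ m) (dot-comm u (mv T u))) (trans (Cong-%ℕ m (dot-Cong m {M} e (mv T u) u)) (cong (λ v → dotN v (resV M u) ℕ.% m) (sym (linN-res m {M} e T u))))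

perGate : ∀ m .{{_ : NonZero m}} {M} .{{_ : NonZero M}} → m ∣ M → (ℕ → ℤ) → ∀ {k} (T : Mat k) → Per k M → Per k M
perGate m {M} e j T P = per (λ u → j (Q T u %ℕ m) * fun P u) (λ ρ → gate (j (dotN (linN m T ρ) ρ ℕ.% m)) (rep P ρ))
  (λ u → trans (cong₂ _*_ (cong j (Q-res m {M} e T u)) (fun≡rep P u)) (sym (gate≡ (j (dotN (linN m T (resV M u)) (resV M u) ℕ.% m)) (rep P (resV M u)))))

negv-Lat : ∀ {k} (f g : V k → ℤ) (F : Form k) → (∀ x → sgn (Q (gram F) x %ℕ 2) * f x ≡ g x) → negv (Lat f F) ≐ Lat g F
negv-Lat f g F h n = trans (cong (_* Lat f F n) (pow n)) (trans (sym (Lat-gate (λ t → sgn (t %ℕ 2)) f F n)) (Lat-cong F h n))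
  where
  pow : ∀ n → (- + 1) ℤ.^ n ≡ sgn (n ℕ.% 2)
  pow 0             = refl
  pow 1             = refl
  pow (suc (suc n)) = trans (two ((- + 1) ℤ.^ n)) (trans (pow n) (cong sgn (trans (sym (ℕD.[m+n]%n≡m%n n 2)) (cong (ℕ._% 2) (ℕₚ.+-comm n 2)))))
    where
    two : ∀ x → - + 1 * (- + 1 * x) ≡ x
    two = solve-∀

-- The exponents in `link₁` are 7 + 2·5 ≡ 1 modulo 8, hence 1 or 9 modulo 16; those in `link₂` are 3
-- + 2·9 ≡ 5, hence 5 or 13. The certificates are used with opposite signs on the two classes.
jx jy : ℕ → ℤ
jx 1 = + 1
jx 9 = - + 1
jx _ = + 0
jy 5 = + 1
jy 13 = - + 1
jy _ = + 0

t₁ t₃ t₂ t₅ : Vec ℕ 2 → ℤ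
t₁ (x ∷ y ∷ []) = sgn y
t₃ (x ∷ y ∷ []) = sgn x
t₂ (x ∷ y ∷ []) = sgn x
t₅ (x ∷ y ∷ []) = sgn y

-- The quotients by 8 are needed modulo 2, whence the period 16 and 16⁴ residue vectors to check. On
-- norms outside the support of `jx` or `jy` the eight table sums are never evaluated.
perX perY : Per 4 16
perX = + 2 · (fastPl 8 2 (divides 1 refl) XB2A XB2N refl (εB ⊠ εB) ∔ - + 1 · fastPl 8 2 (divides 1 refl) Y1AA Y1AN refl (t₁ ⊠ εA) ∔ fastPl 8 2 (divides 1 refl) Y3AA Y3AN refl (t₃ ⊠ εA))
     ∔ - + 1 · perGate 16 (divides 1 refl) jx norm (L-∑ 8 (divides 2 refl) L0₈ L1₈ L2₈ L3₈ L0 L1 L2 L3 refl refl refl refl (table Gx) ∔ - + 1 · L-∑ 8 (divides 2 refl) R0₈ R1₈ R2₈ R3₈ R0 R1 R2 R3 refl refl refl refl (table Gx))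
perY = + 2 · (fastPl 8 2 (divides 1 refl) YA2A YA2N refl (εB ⊠ εA) ∔ - + 1 · fastPl 8 2 (divides 1 refl) X5BA X5BN refl (t₅ ⊠ εB) ∔ fastPl 8 2 (divides 1 refl) X2BA X2BN refl (t₂ ⊠ εB))
     ∔ - + 1 · perGate 16 (divides 1 refl) jy norm (L-∑ 8 (divides 2 refl) L0₈ L1₈ L2₈ L3₈ L0 L1 L2 L3 refl refl refl refl (table Gy) ∔ - + 1 · L-∑ 8 (divides 2 refl) R0₈ R1₈ R2₈ R3₈ R0 R1 R2 R3 refl refl refl refl (table Gy))

perX-0 : ∀ y → fun perX y ≡ + 0
perX-0 = vanishes perX refl

perY-0 : ∀ y → fun perY y ≡ + 0
perY-0 = vanishes perY refl

F₁ F₂ F₃ F₅ FA FB FX FY : Form 2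
F₁ = binary 0 0 25 103 refl
F₂ = binary 1 0 12 103 refl
F₃ = binary 2 2 8 103 refl
F₅ = binary 4 4 5 103 refl
FA = binary 8 4 11 415 refl
FB = binary 4 2 20 415 refl
FX = binary 6 2 14 415 refl
FY = binary 2 2 34 415 refl

tA tB tX tY θ₁ θ₂ θ₃ θ₅ ω₁ ω₂ : Series
tA = Lat (even₂ εA) FA
tB = Lat (even₂ εB) FB
tX = Lat (even₂ εB) FX
tY = Lat (even₂ εB) FY
θ₁ = Lat (even₂ t₁) F₁
θ₂ = Lat (even₂ t₂) F₂
θ₃ = Lat (even₂ t₃) F₃
θ₅ = Lat (even₂ t₅) F₅
ω₁ = Lat (even₂ ψψ) F₁
ω₂ = Lat (even₂ ψψ) F₂

dil-Lat : ∀ {k} c (f : V k → ℤ) (F : Form k) → dil (suc c) (Lat f F) ≐ Lat f (scaleForm c F)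
dil-Lat c f F = Lat-dil (suc c) f F (scaleForm c F) (Q-*M (+ suc c) (gram F))

product-in : ∀ (f g : Vec ℕ 2 → ℤ) (F G : Form 2) (N : Form 4) (A B : Mat 4) (d : ℕ) .{{_ : NonZero d}} →
  A ⊡ B ≡ scalar 4 (+ d * + 1) → B ⊡ A ≡ scalar 4 (+ d * + 1) →
  (tr B ⊡ (gram N ⊡ B)) +M tr (tr B ⊡ (gram N ⊡ B)) ≡ *M (+ 1) (gram (F ⊞ G)) +M tr (*M (+ 1) (gram (F ⊞ G))) →
  Lat (even₂ f) F ⊛ Lat (even₂ g) G ≐ Lat (pl A d (even₄ (f ⊠ g))) N
product-in f g F G N A B d ab ba e = ≐-trans (Lat-⊞ (even₂ f) (even₂ g) F G) (≐-trans (Lat-cong (F ⊞ G) (⊠-⊗ f g)) (transfer₁ A B d ab ba (F ⊞ G) N (gram-check (gram N) (gram (F ⊞ G)) B (+ 1) e) (even₄ (f ⊠ g))))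

-- Since `j` depends on the norm alone, the series of j·(p - q) vanishes with that of p - q; the
-- pointwise relation then leaves twice the claim.
link-lemma : (j : ℕ → ℤ) (a b c p q : V 4 → ℤ) → (∀ u → + 2 * (a u + - + 1 * b u + c u) + - + 1 * (j (Q norm u %ℕ 16) * (p u + - + 1 * q u)) ≡ + 0) →
  Lat p N₁ ≐ Lat q N₁ → Lat a N₁ ⊕ Lat c N₁ ≐ Lat b N₁
link-lemma j a b c p q h e n = finish (Lat a N₁ n) (Lat b N₁ n) (Lat c N₁ n) (begin
  + 2 * (Lat a N₁ n + - + 1 * Lat b N₁ n + Lat c N₁ n)   ≡⟨ cong (+ 2 *_) (sym split) ⟩
  + 2 * Lat s N₁ n                                       ≡⟨ sym (Lat-scale (+ 2) s N₁ n) ⟩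
  Lat (λ u → + 2 * s u) N₁ n                             ≡⟨ Lat-cong N₁ (λ u → move (+ 2 * s u) (j (Q norm u %ℕ 16) * r u) (h u)) n ⟩
  Lat (λ u → j (Q norm u %ℕ 16) * r u) N₁ n              ≡⟨ Lat-gate (λ t → j (t %ℕ 16)) r N₁ n ⟩
  j (n ℕ.% 16) * Lat r N₁ n                              ≡⟨ cong (j (n ℕ.% 16) *_) rzero ⟩
  j (n ℕ.% 16) * + 0                                     ≡⟨ ℤₚ.*-zeroʳ (j (n ℕ.% 16)) ⟩
  + 0 ∎)
  where
  open ≡-Reasoning
  s r : V 4 → ℤ
  s u = a u + - + 1 * b u + c u
  r u = p u + - + 1 * q u
  split : Lat s N₁ n ≡ Lat a N₁ n + - + 1 * Lat b N₁ n + Lat c N₁ n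
  split = trans (Lat-⊕ (λ u → a u + - + 1 * b u) c N₁ n) (cong (_+ Lat c N₁ n) (trans (Lat-⊕ a (λ u → - + 1 * b u) N₁ n) (cong (λ t → Lat a N₁ n + t) (Lat-scale (- + 1) b N₁ n))))
  lem0 : ∀ x → x + - + 1 * x ≡ + 0
  lem0 = solve-∀
  rzero : Lat r N₁ n ≡ + 0
  rzero = trans (Lat-⊕ p (λ u → - + 1 * q u) N₁ n) (trans (cong₂ _+_ (e n) (Lat-scale (- + 1) q N₁ n)) (lem0 (Lat q N₁ n)))
  move : ∀ x y → x + - + 1 * y ≡ + 0 → x ≡ y
  move x y e = ℤₚ.i-j≡0⇒i≡j x y (trans (l x y) e)
    where
    l : ∀ x y → x - y ≡ x + - + 1 * y
    l = solve-∀
  finish : ∀ x y z → + 2 * (x + - + 1 * y + z) ≡ + 0 → x + z ≡ y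
  finish x y z e = ℤₚ.i-j≡0⇒i≡j (x + z) y (trans (l x y z) (ℤₚ.*-cancelˡ-≡ (+ 2) (x + - + 1 * y + z) (+ 0) e))
    where
    l : ∀ x y z → x + z - y ≡ x + - + 1 * y + z
    l = solve-∀

gx gy : V 4 → ℤ
gx u = table Gx (resV 8 u)
gy u = table Gy (resV 8 u)

-- All three products are carried isometrically onto weighted theta series of the one norm form
-- `N₁`, where `perX` compares the weights.
link₁ : tX ⊛ dil 2 tB ≐ (dil 8 θ₁ ⊖ dil 8 θ₃) ⊛ tA
link₁ n = trans (lhs n) (trans (shuffle (Lat a N₁ n) (Lat b N₁ n) (Lat c N₁ n) (link-lemma jx a b c (∑L gx) (∑R gx) perX-0 (eichler gx) n)) (sym (trans (solve 3 (λ y z t → (y :- z) :* t := y :* t :- z :* t) ≐-refl (dil 8 θ₁) (dil 8 θ₃) tA n) (cong₂ _-_ (r₁ n) (r₃ n)))))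
  where
  a b c : V 4 → ℤ
  a = pl XB2A 8 (even₄ (εB ⊠ εB))
  b = pl Y1AA 8 (even₄ (t₁ ⊠ εA))
  c = pl Y3AA 8 (even₄ (t₃ ⊠ εA))
  lhs : tX ⊛ dil 2 tB ≐ Lat a N₁
  lhs = ≐-trans (⊛-cong {f = tX} ≐-refl (dil-Lat 1 (even₂ εB) FB)) (product-in εB εB FX (scaleForm 1 FB) N₁ XB2A XB2B 8 refl refl refl)
  r₁ : dil 8 θ₁ ⊛ tA ≐ Lat b N₁
  r₁ = ≐-trans (⊛-cong {g = tA} (dil-Lat 7 (even₂ t₁) F₁) ≐-refl) (product-in t₁ εA (scaleForm 7 F₁) FA N₁ Y1AA Y1AB 8 refl refl refl)
  r₃ : dil 8 θ₃ ⊛ tA ≐ Lat c N₁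
  r₃ = ≐-trans (⊛-cong {g = tA} (dil-Lat 7 (even₂ t₃) F₃) ≐-refl) (product-in t₃ εA (scaleForm 7 F₃) FA N₁ Y3AA Y3AB 8 refl refl refl)
  shuffle : ∀ x y z → x + z ≡ y → x ≡ y - z
  shuffle x y z e = trans (l x z) (cong (_- z) e)
    where
    l : ∀ x z → x ≡ x + z - z
    l = solve-∀

link₂ : tY ⊛ dil 2 tA ≐ (dil 8 θ₅ ⊖ dil 8 θ₂) ⊛ tB
link₂ n = trans (lhs n) (trans (shuffle (Lat a N₁ n) (Lat b N₁ n) (Lat c N₁ n) (link-lemma jy a b c (∑L gy) (∑R gy) perY-0 (eichler gy) n)) (sym (trans (solve 3 (λ y z t → (y :- z) :* t := y :* t :- z :* t) ≐-refl (dil 8 θ₅) (dil 8 θ₂) tB n) (cong₂ _-_ (r₁ n) (r₃ n)))))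
  where
  a b c : V 4 → ℤ
  a = pl YA2A 8 (even₄ (εB ⊠ εA))
  b = pl X5BA 8 (even₄ (t₅ ⊠ εB))
  c = pl X2BA 8 (even₄ (t₂ ⊠ εB))
  lhs : tY ⊛ dil 2 tA ≐ Lat a N₁
  lhs = ≐-trans (⊛-cong {f = tY} ≐-refl (dil-Lat 1 (even₂ εA) FA)) (product-in εB εA FY (scaleForm 1 FA) N₁ YA2A YA2B 8 refl refl refl)
  r₁ : dil 8 θ₅ ⊛ tB ≐ Lat b N₁
  r₁ = ≐-trans (⊛-cong {g = tB} (dil-Lat 7 (even₂ t₅) F₅) ≐-refl) (product-in t₅ εB (scaleForm 7 F₅) FB N₁ X5BA X5BB 8 refl refl refl)
  r₃ : dil 8 θ₂ ⊛ tB ≐ Lat c N₁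
  r₃ = ≐-trans (⊛-cong {g = tB} (dil-Lat 7 (even₂ t₂) F₂) ≐-refl) (product-in t₂ εB (scaleForm 7 F₂) FB N₁ X2BA X2BB 8 refl refl refl)
  shuffle : ∀ x y z → x + z ≡ y → x ≡ y - z
  shuffle x y z e = trans (l x z) (cong (_- z) e)
    where
    l : ∀ x z → x ≡ x + z - z
    l = solve-∀

σ₁ σ₂ σ₃ : Mat 4
σ₁ = (+ 1 ∷ + 0 ∷ + 0 ∷ + 0 ∷ []) ∷ (+ 0 ∷ + 1 ∷ + 0 ∷ + 0 ∷ []) ∷ (+ 0 ∷ + 0 ∷ - + 1 ∷ + 0 ∷ []) ∷ (+ 0 ∷ + 0 ∷ + 0 ∷ + 1 ∷ []) ∷ []
σ₂ = (+ 1 ∷ + 0 ∷ + 0 ∷ + 0 ∷ []) ∷ (+ 0 ∷ + 1 ∷ + 0 ∷ + 0 ∷ []) ∷ (+ 0 ∷ + 0 ∷ + 1 ∷ + 0 ∷ []) ∷ (+ 0 ∷ + 0 ∷ + 0 ∷ - + 1 ∷ []) ∷ []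
σ₃ = (+ 1 ∷ + 0 ∷ + 0 ∷ + 0 ∷ []) ∷ (+ 0 ∷ + 1 ∷ + 0 ∷ + 0 ∷ []) ∷ (+ 0 ∷ + 0 ∷ - + 1 ∷ + 0 ∷ []) ∷ (+ 0 ∷ + 0 ∷ + 0 ∷ - + 1 ∷ []) ∷ []

-- Only a sublattice of these orthogonal sums maps integrally into `N₈`. The second summand has no
-- cross term, so its two coordinates may change sign independently, and this recovers the full
-- product from that sublattice.
module Halving (f g : Vec ℕ 2 → ℤ) (F G : Form 2) (A B : Mat 4)
  (ab : A ⊡ B ≡ scalar 4 (+ 2 * + 4)) (ba : B ⊡ A ≡ scalar 4 (+ 2 * + 4))
  (hB : (tr B ⊡ (gram N₈ ⊡ B)) +M tr (tr B ⊡ (gram N₈ ⊡ B)) ≡ *M (+ 16) (gram (F ⊞ G)) +M tr (*M (+ 16) (gram (F ⊞ G))))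
  (h₁ : (tr σ₁ ⊡ (gram (F ⊞ G) ⊡ σ₁)) +M tr (tr σ₁ ⊡ (gram (F ⊞ G) ⊡ σ₁)) ≡ *M (+ 1) (gram (F ⊞ G)) +M tr (*M (+ 1) (gram (F ⊞ G))))
  (h₂ : (tr σ₂ ⊡ (gram (F ⊞ G) ⊡ σ₂)) +M tr (tr σ₂ ⊡ (gram (F ⊞ G) ⊡ σ₂)) ≡ *M (+ 1) (gram (F ⊞ G)) +M tr (*M (+ 1) (gram (F ⊞ G))))
  (h₃ : (tr σ₃ ⊡ (gram (F ⊞ G) ⊡ σ₃)) +M tr (tr σ₃ ⊡ (gram (F ⊞ G) ⊡ σ₃)) ≡ *M (+ 1) (gram (F ⊞ G)) +M tr (*M (+ 1) (gram (F ⊞ G)))) where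

  whole : Per 4 4
  whole = perB 2 (divides 2 refl) (f ⊠ g)

  half : Per 4 4
  half = perMask 4 (divides 1 refl) B whole

  balance : Per 4 4
  balance = half ∔ perPl 1 4 (divides 1 refl) σ₁ (rep half) ∔ perPl 1 4 (divides 1 refl) σ₂ (rep half) ∔ perPl 1 4 (divides 1 refl) σ₃ (rep half) ∔ - + 2 · whole

  sign-invariant : ∀ σ → σ ⊡ σ ≡ scalar 4 (+ 1) → (∀ c → Q (gram (F ⊞ G)) (mv σ c) ≡ + 1 * Q (gram (F ⊞ G)) c) → Lat (pl σ 1 (λ u → rep half (resV 4 u))) (F ⊞ G) ≐ Lat (fun half) (F ⊞ G)
  sign-invariant σ e h = ≐-sym (≐-trans (Lat-cong (F ⊞ G) (fun≡rep half)) (transfer₁ σ σ 1 e e (F ⊞ G) (F ⊞ G) h (λ u → rep half (resV 4 u))))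

  -- Exactly two of the four sign changes of the last two coordinates bring a vector into the sublattice B⁻¹(4ℤ⁴).
  halving : (∀ u → fun balance u ≡ + 0) → Lat (even₂ f) F ⊛ Lat (even₂ g) G ≐ scale (+ 2) (Lat (pl A 2 (even₄ (f ⊠ g))) N₈)
  halving bal = ≐-trans (Lat-⊞ (even₂ f) (even₂ g) F G) (≐-trans (Lat-cong (F ⊞ G) (⊠-⊗ f g)) (λ n → trans (twice n) (cong (+ 2 *_) (transfer A B 2 4 ab ba (F ⊞ G) N₈ (gram-check (gram N₈) (gram (F ⊞ G)) B (+ 16) hB) (even₄ (f ⊠ g)) n))))
    where
    P = F ⊞ G
    p₁ p₂ p₃ : V 4 → ℤ
    p₁ = pl σ₁ 1 (λ u → rep half (resV 4 u))
    p₂ = pl σ₂ 1 (λ u → rep half (resV 4 u))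
    p₃ = pl σ₃ 1 (λ u → rep half (resV 4 u))
    twice : ∀ n → Lat (fun whole) P n ≡ + 2 * Lat (fun half) P n
    twice n = fin (Lat (fun half) P n) (Lat (fun whole) P n) (begin
      x + x + x + x + - + 2 * Lat (fun whole) P n ≡⟨ cong (_+ - + 2 * Lat (fun whole) P n) (cong₂ _+_ (cong₂ _+_ (cong (λ t → x + t) (sym (sign-invariant σ₁ refl (gram-check (gram P) (gram P) σ₁ (+ 1) h₁) n))) (sym (sign-invariant σ₂ refl (gram-check (gram P) (gram P) σ₂ (+ 1) h₂) n))) (sym (sign-invariant σ₃ refl (gram-check (gram P) (gram P) σ₃ (+ 1) h₃) n))) ⟩
      x + Lat p₁ P n + Lat p₂ P n + Lat p₃ P n + - + 2 * Lat (fun whole) P n ≡⟨ cong₂ _+_ (trans (cong (_+ Lat p₃ P n) (trans (cong (_+ Lat p₂ P n) (sym (Lat-⊕ (fun half) p₁ P n))) (sym (Lat-⊕ (λ u → fun half u + p₁ u) p₂ P n)))) (sym (Lat-⊕ (λ u → fun half u + p₁ u + p₂ u) p₃ P n))) (sym (Lat-scale (- + 2) (fun whole) P n)) ⟩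
      Lat (λ u → fun half u + p₁ u + p₂ u + p₃ u) P n + Lat (λ u → - + 2 * fun whole u) P n ≡⟨ sym (Lat-⊕ (λ u → fun half u + p₁ u + p₂ u + p₃ u) (λ u → - + 2 * fun whole u) P n) ⟩
      Lat (fun balance) P n ≡⟨ Lat-0 (fun balance) P bal n ⟩
      + 0 ∎)
      where
      open ≡-Reasoning
      x = Lat (fun half) P n
      fin : ∀ x w → x + x + x + x + - + 2 * w ≡ + 0 → w ≡ + 2 * x
      fin x w e = sym (ℤₚ.i-j≡0⇒i≡j (+ 2 * x) w (ℤₚ.*-cancelˡ-≡ (+ 2) (+ 2 * x - w) (+ 0) (trans (l x w) e)))
        where
        l : ∀ x w → + 2 * (+ 2 * x - w) ≡ x + x + x + x + - + 2 * w
        l = solve-∀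

private
  module HA = Halving εA ψψ FA F₂ R1A R1B refl refl refl refl refl refl
  module HB = Halving εB ψψ FB F₁ R2A R2B refl refl refl refl refl refl

r1-in : tA ⊛ ω₂ ≐ scale (+ 2) (Lat (pl R1A 2 (even₄ (εA ⊠ ψψ))) N₈)
r1-in = HA.halving (vanishes HA.balance refl)

r2-in : tB ⊛ ω₁ ≐ scale (+ 2) (Lat (pl R2A 2 (even₄ (εB ⊠ ψψ))) N₈)
r2-in = HB.halving (vanishes HB.balance refl)

κ₁ κ₂ κ₃ κ₅ : Series
κ₁ = Lat (even₂ s₁) F₁
κ₂ = Lat (even₂ s₂) F₂
κ₃ = Lat (even₂ s₃) F₃
κ₅ = Lat (even₂ s₅) F₅

-- On `N₈` the total weight is `∑L gE` minus `∑R gE` by `perE-0`. The products with `ω₁` and `ω₂`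
-- enter without the factor 2 because `halving` supplies it.
quat : cst (+ 2) ⊛ ((dil 8 κ₅ ⊖ dil 8 κ₂) ⊛ (dil 8 κ₁ ⊖ dil 8 κ₃)) ⊕ (tA ⊛ ω₂ ⊕ tB ⊛ ω₁) ≐ zeroS
quat n = begin
  (cst (+ 2) ⊛ ((dil 8 κ₅ ⊖ dil 8 κ₂) ⊛ (dil 8 κ₁ ⊖ dil 8 κ₃)) ⊕ (tA ⊛ ω₂ ⊕ tB ⊛ ω₁)) n
    ≡⟨ cong (_+ ((tA ⊛ ω₂) n + (tB ⊛ ω₁) n)) (expand n) ⟩
  + 2 * (((dil 8 κ₅ ⊛ dil 8 κ₁) n - (dil 8 κ₅ ⊛ dil 8 κ₃) n) - ((dil 8 κ₂ ⊛ dil 8 κ₁) n - (dil 8 κ₂ ⊛ dil 8 κ₃) n)) + ((tA ⊛ ω₂) n + (tB ⊛ ω₁) n)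
    ≡⟨ cong₂ (λ s t → + 2 * s + t) (cong₂ _-_ (cong₂ _-_ (in₁ n) (in₂ n)) (cong₂ _-_ (in₃ n) (in₄ n))) (cong₂ _+_ (r1-in n) (r2-in n)) ⟩
  + 2 * ((x₁ - x₂) - (x₃ - x₄)) + (+ 2 * x₅ + + 2 * x₆)
    ≡⟨ arrange x₁ x₂ x₃ x₄ x₅ x₆ (Lat (∑L gE) N₈ n) ⟩
  + 2 * x₁ + - + 2 * x₂ + - + 2 * x₃ + + 2 * x₄ + + 2 * x₅ + + 2 * x₆ + - + 1 * Lat (∑L gE) N₈ n + Lat (∑L gE) N₈ n
    ≡⟨ cong (λ t → + 2 * x₁ + - + 2 * x₂ + - + 2 * x₃ + + 2 * x₄ + + 2 * x₅ + + 2 * x₆ + - + 1 * Lat (∑L gE) N₈ n + t) (eich₈ n) ⟩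
  + 2 * x₁ + - + 2 * x₂ + - + 2 * x₃ + + 2 * x₄ + + 2 * x₅ + + 2 * x₆ + - + 1 * Lat (∑L gE) N₈ n + Lat (∑R gE) N₈ n
    ≡⟨ sym collect-all ⟩
  Lat (fun perE) N₈ n
    ≡⟨ Lat-0 (fun perE) N₈ perE-0 n ⟩
  + 0 ∎
  where
  open ≡-Reasoning
  gE : V 4 → ℤ
  gE u = ge (resV 4 u)
  p₁ p₂ p₃ p₄ p₅ p₆ : V 4 → ℤ
  p₁ = pl P1A 4 (even₄ (s₅ ⊠ s₁))
  p₂ = pl P2A 4 (even₄ (s₅ ⊠ s₃))
  p₃ = pl P3A 4 (even₄ (s₂ ⊠ s₁))
  p₄ = pl P4A 4 (even₄ (s₂ ⊠ s₃))
  p₅ = pl R1A 2 (even₄ (εA ⊠ ψψ))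
  p₆ = pl R2A 2 (even₄ (εB ⊠ ψψ))
  x₁ = Lat p₁ N₈ n
  x₂ = Lat p₂ N₈ n
  x₃ = Lat p₃ N₈ n
  x₄ = Lat p₄ N₈ n
  x₅ = Lat p₅ N₈ n
  x₆ = Lat p₆ N₈ n
  expand : cst (+ 2) ⊛ ((dil 8 κ₅ ⊖ dil 8 κ₂) ⊛ (dil 8 κ₁ ⊖ dil 8 κ₃)) ≐ scale (+ 2) (((dil 8 κ₅ ⊛ dil 8 κ₁) ⊖ (dil 8 κ₅ ⊛ dil 8 κ₃)) ⊖ ((dil 8 κ₂ ⊛ dil 8 κ₁) ⊖ (dil 8 κ₂ ⊛ dil 8 κ₃)))
  expand = ≐-trans (⊛-cong {f = cst (+ 2)} ≐-refl (solve 4 (λ a b c d → (a :- b) :* (c :- d) := ((a :* c :- a :* d) :- (b :* c :- b :* d))) ≐-refl (dil 8 κ₅) (dil 8 κ₂) (dil 8 κ₁) (dil 8 κ₃))) (≐-sym (scale-cst (+ 2) _))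
  to8 : ∀ f g F G A B → A ⊡ B ≡ scalar 4 (+ 4 * + 1) → B ⊡ A ≡ scalar 4 (+ 4 * + 1) → (tr B ⊡ (gram N₈ ⊡ B)) +M tr (tr B ⊡ (gram N₈ ⊡ B)) ≡ *M (+ 1) (gram (scaleForm 7 F ⊞ scaleForm 7 G)) +M tr (*M (+ 1) (gram (scaleForm 7 F ⊞ scaleForm 7 G))) → dil 8 (Lat (even₂ f) F) ⊛ dil 8 (Lat (even₂ g) G) ≐ Lat (pl A 4 (even₄ (f ⊠ g))) N₈
  to8 f g F G A B ab ba e = ≐-trans (⊛-cong (dil-Lat 7 (even₂ f) F) (dil-Lat 7 (even₂ g) G)) (product-in f g (scaleForm 7 F) (scaleForm 7 G) N₈ A B 4 ab ba e)
  in₁ = to8 s₅ s₁ F₅ F₁ P1A P1B refl refl refl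
  in₂ = to8 s₅ s₃ F₅ F₃ P2A P2B refl refl refl
  in₃ = to8 s₂ s₁ F₂ F₁ P3A P3B refl refl refl
  in₄ = to8 s₂ s₃ F₂ F₃ P4A P4B refl refl refl
  eich₈ : Lat (∑L gE) N₈ ≐ Lat (∑R gE) N₈
  eich₈ = ≐-trans (≐-sym (dil-Lat 7 (∑L gE) N₁)) (≐-trans (dil-cong 8 (eichler gE)) (dil-Lat 7 (∑R gE) N₁))
  arrange : ∀ a b c d e f l → + 2 * ((a - b) - (c - d)) + (+ 2 * e + + 2 * f) ≡ + 2 * a + - + 2 * b + - + 2 * c + + 2 * d + + 2 * e + + 2 * f + - + 1 * l + l
  arrange = solve-∀
  collect-all : Lat (fun perE) N₈ n ≡ + 2 * x₁ + - + 2 * x₂ + - + 2 * x₃ + + 2 * x₄ + + 2 * x₅ + + 2 * x₆ + - + 1 * Lat (∑L gE) N₈ n + Lat (∑R gE) N₈ n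
  collect-all = trans (Lat-⊕ q₇ (∑R gE) N₈ n) (cong (_+ Lat (∑R gE) N₈ n) (trans (add· q₆ (- + 1) (∑L gE)) (cong (_+ - + 1 * Lat (∑L gE) N₈ n) (trans (add· q₅ (+ 2) p₆) (cong (_+ + 2 * x₆) (trans (add· q₄ (+ 2) p₅) (cong (_+ + 2 * x₅) (trans (add· q₃ (+ 2) p₄) (cong (_+ + 2 * x₄) (trans (add· q₂ (- + 2) p₃) (cong (_+ - + 2 * x₃) (trans (add· q₁ (- + 2) p₂) (cong (_+ - + 2 * x₂) (Lat-scale (+ 2) p₁ N₈ n))))))))))))))
    where
    q₁ q₂ q₃ q₄ q₅ q₆ q₇ : V 4 → ℤ
    q₁ u = + 2 * p₁ u
    q₂ u = q₁ u + - + 2 * p₂ u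
    q₃ u = q₂ u + - + 2 * p₃ u
    q₄ u = q₃ u + + 2 * p₄ u
    q₅ u = q₄ u + + 2 * p₅ u
    q₆ u = q₅ u + + 2 * p₆ u
    q₇ u = q₆ u + - + 1 * ∑L gE u
    add· : ∀ f c g → Lat (λ u → f u + c * g u) N₈ n ≡ Lat f N₈ n + c * Lat g N₈ n
    add· f c g = trans (Lat-⊕ f (λ u → c * g u) N₈ n) (cong (λ t → Lat f N₈ n + t) (Lat-scale c g N₈ n))

-- Relations that hold after averaging over isometries.

Isometry : ∀ {k} → Form k → Mat k → Set
Isometry {k} F σ = (σ ⊡ σ ≡ scalar k (+ 1 * + 1)) × ((tr σ ⊡ (gram F ⊡ σ)) +M tr (tr σ ⊡ (gram F ⊡ σ)) ≡ *M (+ 1) (gram F) +M tr (*M (+ 1) (gram F)))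

module _ {k M : ℕ} .{{_ : NonZero M}} .{{_ : NonZero (1 ℕ.* M)}} where

  flip′ : Mat k → Per k M → Per k M
  flip′ σ P = fastPl 1 M (divides 1 (sym (trans (ℕₚ.*-identityˡ (1 ℕ.* M)) (ℕₚ.*-identityˡ M)))) σ (map (resV (1 ℕ.* M)) σ) refl (rep P)

  flip-Lat : ∀ (F : Form k) σ → Isometry F σ → (P : Per k M) → Lat (fun (flip′ σ P)) F ≐ Lat (fun P) F
  flip-Lat F σ (i , g) P = ≐-sym (≐-trans (Lat-cong F (fun≡rep P)) (transfer₁ σ σ 1 i i F F (gram-check (gram F) (gram F) σ (+ 1) g) (λ u → rep P (resV M u))))

  average : List (Mat k) → Per k M → Per k M
  average []       P = per (λ _ → + 0) (λ _ → + 0) (λ _ → refl)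
  average (σ ∷ σs) P = flip′ σ P ∔ average σs P

  average-Lat : ∀ (F : Form k) σs → LA.All (Isometry F) σs → (P : Per k M) → ∀ n → Lat (fun (average σs P)) F n ≡ + length σs * Lat (fun P) F n
  average-Lat F []       LA.[]       P n = trans (Lat-0 (λ _ → + 0) F (λ _ → refl) n) (sym (ℤₚ.*-zeroˡ (Lat (fun P) F n)))
  average-Lat F (σ ∷ σs) (i LA.∷ is) P n = trans (Lat-⊕ (fun (flip′ σ P)) (fun (average σs P)) F n) (trans (cong₂ _+_ (flip-Lat F σ i P n) (average-Lat F σs is P n)) (lem (+ length σs) (Lat (fun P) F n)))
    where
    lem : ∀ l x → x + l * x ≡ (+ 1 + l) * x
    lem = solve-∀

  -- A weight and its transforms under isometries have the same theta series, so it is enough that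
  -- their sum vanishes on residues. The list is nonempty so that its length can be cancelled.
  vanish : ∀ (F : Form k) σ σs → LA.All (Isometry F) (σ ∷ σs) → (P : Per k M) → allV M k (λ ρ → isZero (rep (average (σ ∷ σs) P) ρ)) ≡ true → Lat (fun P) F ≐ zeroS
  vanish F σ σs is P h n = ℤₚ.*-cancelˡ-≡ (+ length (σ ∷ σs)) (Lat (fun P) F n) (+ 0) (trans (sym (average-Lat F (σ ∷ σs) is P n)) (trans (Lat-0 (fun (average (σ ∷ σs) P)) F (vanishes (average (σ ∷ σs) P) h) n) (sym (ℤₚ.*-zeroʳ (+ length (σ ∷ σs))))))

  relation : ∀ (F : Form k) σ σs → LA.All (Isometry F) (σ ∷ σs) → (c₁ c₂ c₃ : ℤ) (P₁ P₂ P₃ : Per k M) →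
    allV M k (λ ρ → isZero (rep (average (σ ∷ σs) (c₁ · P₁ ∔ c₂ · P₂ ∔ (- + 1 * c₃) · P₃)) ρ)) ≡ true →
    scale c₁ (Lat (fun P₁) F) ⊕ scale c₂ (Lat (fun P₂) F) ≐ scale c₃ (Lat (fun P₃) F)
  relation F σ σs is c₁ c₂ c₃ P₁ P₂ P₃ h n = finish (begin
    c₁ * x₁ + c₂ * x₂ + - + 1 * c₃ * x₃
      ≡⟨ cong₂ _+_ (cong₂ _+_ (sym (Lat-scale c₁ (fun P₁) F n)) (sym (Lat-scale c₂ (fun P₂) F n))) (sym (Lat-scale (- + 1 * c₃) (fun P₃) F n)) ⟩
    Lat (fun (c₁ · P₁)) F n + Lat (fun (c₂ · P₂)) F n + Lat (fun ((- + 1 * c₃) · P₃)) F n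
      ≡⟨ cong (_+ Lat (fun ((- + 1 * c₃) · P₃)) F n) (sym (Lat-⊕ (fun (c₁ · P₁)) (fun (c₂ · P₂)) F n)) ⟩
    Lat (fun (c₁ · P₁ ∔ c₂ · P₂)) F n + Lat (fun ((- + 1 * c₃) · P₃)) F n
      ≡⟨ sym (Lat-⊕ (fun (c₁ · P₁ ∔ c₂ · P₂)) (fun ((- + 1 * c₃) · P₃)) F n) ⟩
    Lat (fun (c₁ · P₁ ∔ c₂ · P₂ ∔ (- + 1 * c₃) · P₃)) F n
      ≡⟨ vanish F σ σs is (c₁ · P₁ ∔ c₂ · P₂ ∔ (- + 1 * c₃) · P₃) h n ⟩
    + 0 ∎)
    where
    open ≡-Reasoning
    x₁ = Lat (fun P₁) F n
    x₂ = Lat (fun P₂) F n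
    x₃ = Lat (fun P₃) F n
    finish : c₁ * x₁ + c₂ * x₂ + - + 1 * c₃ * x₃ ≡ + 0 → c₁ * x₁ + c₂ * x₂ ≡ c₃ * x₃
    finish e = ℤₚ.i-j≡0⇒i≡j _ _ (trans (lem (c₁ * x₁ + c₂ * x₂) c₃ x₃) e)
      where
      lem : ∀ a c x → a - c * x ≡ a + - + 1 * c * x
      lem = solve-∀

_⊗ₚ_ : ∀ {k l M} .{{_ : NonZero M}} → Per k M → Per l M → Per (k ℕ.+ l) M
_⊗ₚ_ {k} {l} {M} P P′ = per (fun P ⊗ fun P′) (λ ρ → gate (rep P (take k ρ)) (rep P′ (drop k ρ)))
  (λ u → trans (cong₂ _*_ (trans (fun≡rep P (take k u)) (cong (rep P) (take-res k u))) (trans (fun≡rep P′ (drop k u)) (cong (rep P′) (drop-res k u)))) (sym (gate≡ (rep P (take k (resV M u))) (rep P′ (drop k (resV M u))))))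
  where
  take-res : ∀ k {l} (u : V (k ℕ.+ l)) → resV M (take k u) ≡ take k (resV M u)
  take-res zero    u       = refl
  take-res (suc k) (x ∷ u) = cong ((x %ℕ M) ∷_) (take-res k u)
  drop-res : ∀ k {l} (u : V (k ℕ.+ l)) → resV M (drop k u) ≡ drop k (resV M u)
  drop-res zero    u       = refl
  drop-res (suc k) (x ∷ u) = drop-res k u

-- The stated differences of theta series.

-- The bound in `binary` is the radius used by `theta`, so the two sums agree term by term.
theta-Lat : ∀ a b c D disc → theta (+ suc a) (+ b) (+ suc c) ≐ Lat (λ _ → + 1) (binary a b c D disc)
theta-Lat a b c D disc n = sumZ-cong N (λ x → sumZ-cong N (λ y → sym (trans (ℤₚ.*-identityˡ (δℤ (Q (bgram (suc a) b (suc c)) (x ∷ y ∷ [])) (+ n))) (cong (λ t → δℤ t (+ n)) (Q-bgram (suc a) b (suc c) x y)))))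
  where
  N = 4 ℕ.* (suc a ℕ.+ suc c) ℕ.* n

sublattice : Mat 2 → Per 2 2
sublattice A = fastPl 2 1 (divides 1 refl) A (map (resV 2) A) refl (λ _ → + 1)

theta-in : ∀ a b c D disc (G : Form 2) (B A : Mat 2) → A ⊡ B ≡ scalar 2 (+ 2 * + 1) → B ⊡ A ≡ scalar 2 (+ 2 * + 1) →
  (tr B ⊡ (gram G ⊡ B)) +M tr (tr B ⊡ (gram G ⊡ B)) ≡ *M (+ 1) (bgram (suc a) b (suc c)) +M tr (*M (+ 1) (bgram (suc a) b (suc c))) →
  theta (+ suc a) (+ b) (+ suc c) ≐ Lat (fun (sublattice A)) G
theta-in a b c D disc G B A ab ba e = ≐-trans (theta-Lat a b c D disc) (transfer₁ A B 2 ab ba (binary a b c D disc) G (gram-check (gram G) (bgram (suc a) b (suc c)) B (+ 1) e) (λ _ → + 1))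

m₂ : ℤ → ℤ → ℤ → ℤ → Mat 2
m₂ a b c d = (a ∷ b ∷ []) ∷ (c ∷ d ∷ []) ∷ []

-- Both forms, of discriminant -1664, are restrictions of one form of discriminant -416 to two
-- sublattices of index 2; the difference of the indicator functions is a signed weight modulo 2.
theta-difference : ∀ {f g : Series} (G : Form 2) (P : Per 2 2) (A₁ A₂ : Mat 2) → f ≐ Lat (fun (sublattice A₁)) G → g ≐ Lat (fun (sublattice A₂)) G → Isometry G (scalar 2 (+ 1)) →
  allV 2 2 (λ ρ → isZero (rep (average (scalar 2 (+ 1) ∷ []) (+ 1 · sublattice A₁ ∔ - + 1 · sublattice A₂ ∔ (- + 1 * + 1) · P)) ρ)) ≡ true → f ⊖ g ≐ Lat (fun P) G
theta-difference {f} {g} G P A₁ A₂ e₁ e₂ i h n = trans (cong₂ _-_ (e₁ n) (e₂ n)) (trans (lem (Lat (fun P₁) G n) (Lat (fun P₂) G n)) (trans (relation G (scalar 2 (+ 1)) [] (i LA.∷ LA.[]) (+ 1) (- + 1) (+ 1) P₁ P₂ P h n) (ℤₚ.*-identityˡ (Lat (fun P) G n))))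
  where
  P₁ = sublattice A₁
  P₂ = sublattice A₂
  lem : ∀ x y → x - y ≡ + 1 * x + - + 1 * y
  lem = solve-∀

per₁ : ∀ m .{{_ : NonZero m}} → (ℕ → ℤ) → Per 1 m
per₁ m f = per (λ u → f′ (resV m u)) f′ (λ u → refl)
  where
  f′ : Vec ℕ 1 → ℤ
  f′ (x ∷ []) = f x

per₂ : (Vec ℕ 2 → ℤ) → Per 2 2
per₂ f = per (even₂ f) f (λ u → refl)

sq′ : (c : ℕ) → Form 1
sq′ c = scaleForm c (unary 1)

alt oddsq : Series
alt = Lat (fun (per₁ 2 sgn)) (unary 1)
oddsq = Lat (fun (per₁ 2 odd)) (unary 1)

FC FD : Form 2
FC = sq′ 12 ⊞ sq′ 7
FD = sq′ 0 ⊞ sq′ 103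

tC tD : Series
tC = Lat (fun (per₁ 2 odd ⊗ₚ per₁ 2 sgn)) FC
tD = Lat (fun (per₁ 2 odd ⊗ₚ per₁ 2 sgn)) FD

tC≐ : tC ≐ dil 13 oddsq ⊛ dil 8 alt
tC≐ = ≐-sym (≐-trans (⊛-cong (dil-Lat 12 (fun (per₁ 2 odd)) (unary 1)) (dil-Lat 7 (fun (per₁ 2 sgn)) (unary 1))) (Lat-⊞ (fun (per₁ 2 odd)) (fun (per₁ 2 sgn)) (sq′ 12) (sq′ 7)))

tD≐ : tD ≐ dil 1 oddsq ⊛ dil 104 alt
tD≐ = ≐-sym (≐-trans (⊛-cong (dil-Lat 0 (fun (per₁ 2 odd)) (unary 1)) (dil-Lat 103 (fun (per₁ 2 sgn)) (unary 1))) (Lat-⊞ (fun (per₁ 2 odd)) (fun (per₁ 2 sgn)) (sq′ 0) (sq′ 103)))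

θA : theta (+ 9) (+ 8) (+ 48) ⊖ theta (+ 17) (+ 6) (+ 25) ≐ tA
θA = theta-difference FA (per₂ εA) (m₂ (+ 2) (+ 0) (+ 0) (+ 1)) (m₂ (+ 1) (- + 1) (- + 1) (- + 1)) (theta-in 8 8 47 1663 refl FA (m₂ (+ 1) (+ 0) (+ 0) (+ 2)) (m₂ (+ 2) (+ 0) (+ 0) (+ 1)) refl refl refl) (theta-in 16 6 24 1663 refl FA (m₂ (+ 1) (- + 1) (- + 1) (- + 1)) (m₂ (+ 1) (- + 1) (- + 1) (- + 1)) refl refl refl) (refl , refl) refl

θB : theta (+ 5) (+ 4) (+ 84) ⊖ theta (+ 20) (+ 4) (+ 21) ≐ tB
θB = theta-difference FB (per₂ εB) (m₂ (+ 2) (+ 0) (+ 0) (+ 1)) (m₂ (+ 1) (+ 0) (+ 0) (+ 2)) (theta-in 4 4 83 1663 refl FB (m₂ (+ 1) (+ 0) (+ 0) (+ 2)) (m₂ (+ 2) (+ 0) (+ 0) (+ 1)) refl refl refl) (theta-in 19 4 20 1663 refl FB (m₂ (+ 2) (+ 0) (+ 0) (+ 1)) (m₂ (+ 1) (+ 0) (+ 0) (+ 2)) refl refl refl) (refl , refl) refl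

θX : theta (+ 7) (+ 4) (+ 60) ⊖ theta (+ 15) (+ 4) (+ 28) ≐ tX
θX = theta-difference FX (per₂ εB) (m₂ (+ 2) (+ 0) (+ 0) (+ 1)) (m₂ (+ 0) (+ 2) (+ 1) (+ 0)) (theta-in 6 4 59 1663 refl FX (m₂ (+ 1) (+ 0) (+ 0) (+ 2)) (m₂ (+ 2) (+ 0) (+ 0) (+ 1)) refl refl refl) (theta-in 14 4 27 1663 refl FX (m₂ (+ 0) (+ 2) (+ 1) (+ 0)) (m₂ (+ 0) (+ 2) (+ 1) (+ 0)) refl refl refl) (refl , refl) refl

θY : theta (+ 3) (+ 2) (+ 139) ⊖ theta (+ 12) (+ 4) (+ 35) ≐ tY
θY = theta-difference FY (per₂ εB) (m₂ (+ 2) (+ 1) (+ 0) (- + 1)) (m₂ (+ 1) (+ 0) (+ 0) (+ 2)) (theta-in 2 2 138 1663 refl FY (m₂ (+ 1) (+ 1) (+ 0) (- + 2)) (m₂ (+ 2) (+ 1) (+ 0) (- + 1)) refl refl refl) (theta-in 11 4 34 1663 refl FY (m₂ (+ 2) (+ 0) (+ 0) (+ 1)) (m₂ (+ 1) (+ 0) (+ 0) (+ 2)) refl refl refl) (refl , refl) refl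

θC : theta (+ 13) (+ 0) (+ 32) ⊖ theta (+ 21) (+ 10) (+ 21) ≐ tC
θC = theta-difference FC (per₁ 2 odd ⊗ₚ per₁ 2 sgn) (m₂ (+ 2) (+ 0) (+ 0) (+ 1)) (m₂ (+ 1) (+ 1) (+ 1) (- + 1)) (theta-in 12 0 31 1663 refl FC (m₂ (+ 1) (+ 0) (+ 0) (+ 2)) (m₂ (+ 2) (+ 0) (+ 0) (+ 1)) refl refl refl) (theta-in 20 10 20 1663 refl FC (m₂ (+ 1) (+ 1) (+ 1) (- + 1)) (m₂ (+ 1) (+ 1) (+ 1) (- + 1)) refl refl refl) (refl , refl) refl

θD : theta (+ 1) (+ 0) (+ 416) ⊖ theta (+ 4) (+ 4) (+ 105) ≐ tD
θD = theta-difference FD (per₁ 2 odd ⊗ₚ per₁ 2 sgn) (m₂ (+ 2) (+ 0) (+ 0) (+ 1)) (m₂ (+ 1) (- + 1) (+ 0) (+ 2)) (theta-in 0 0 415 1663 refl FD (m₂ (+ 1) (+ 0) (+ 0) (+ 2)) (m₂ (+ 2) (+ 0) (+ 0) (+ 1)) refl refl refl) (theta-in 3 4 104 1663 refl FD (m₂ (+ 2) (+ 1) (+ 0) (+ 1)) (m₂ (+ 1) (- + 1) (+ 0) (+ 2)) refl refl refl) (refl , refl) refl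

negv-θ : ∀ (F : Form 2) (t s : Vec ℕ 2 → ℤ) → allV 2 2 (λ ρ → isZero (rep (perGate 2 (divides 1 refl) sgn (gram F) (per₂ t) ∔ - + 1 · per₂ s) ρ)) ≡ true → negv (Lat (even₂ t) F) ≐ Lat (even₂ s) F
negv-θ F t s h = negv-Lat (even₂ t) (even₂ s) F (λ x → ℤₚ.i-j≡0⇒i≡j _ _ (trans (lem (sgn (Q (gram F) x %ℕ 2) * even₂ t x) (even₂ s x)) (vanishes (perGate 2 (divides 1 refl) sgn (gram F) (per₂ t) ∔ - + 1 · per₂ s) h x)))
  where
  lem : ∀ x y → x - y ≡ x + - + 1 * y
  lem = solve-∀

κ₁≐ : negv θ₁ ≐ κ₁
κ₁≐ = negv-θ F₁ t₁ s₁ refl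
κ₂≐ : negv θ₂ ≐ κ₂
κ₂≐ = negv-θ F₂ t₂ s₂ refl
κ₃≐ : negv θ₃ ≐ κ₃
κ₃≐ = negv-θ F₃ t₃ s₃ refl
κ₅≐ : negv θ₅ ≐ κ₅
κ₅≐ = negv-θ F₅ t₅ s₅ refl

ω₁≐ : ω₁ ≐ dil 1 oddsq ⊛ dil 26 oddsq
ω₁≐ = ≐-sym (≐-trans (⊛-cong (dil-Lat 0 (fun (per₁ 2 odd)) (unary 1)) (dil-Lat 25 (fun (per₁ 2 odd)) (unary 1))) (≐-trans (Lat-⊞ (fun (per₁ 2 odd)) (fun (per₁ 2 odd)) (sq′ 0) (sq′ 25)) (≐-trans (Lat-form (fun (per₁ 2 odd ⊗ₚ per₁ 2 odd)) (sq′ 0 ⊞ sq′ 25) F₁ (Q-cong (gram (sq′ 0 ⊞ sq′ 25)) (gram F₁) refl)) (Lat-cong {f = fun (per₁ 2 odd ⊗ₚ per₁ 2 odd)} {even₂ ψψ} F₁ (λ { (x ∷ y ∷ []) → refl })))))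

ω₂≐ : ω₂ ≐ dil 2 oddsq ⊛ dil 13 oddsq
ω₂≐ = ≐-sym (≐-trans (⊛-cong (dil-Lat 1 (fun (per₁ 2 odd)) (unary 1)) (dil-Lat 12 (fun (per₁ 2 odd)) (unary 1))) (≐-trans (Lat-⊞ (fun (per₁ 2 odd)) (fun (per₁ 2 odd)) (sq′ 1) (sq′ 12)) (≐-trans (Lat-form (fun (per₁ 2 odd ⊗ₚ per₁ 2 odd)) (sq′ 1 ⊞ sq′ 12) F₂ (Q-cong (gram (sq′ 1 ⊞ sq′ 12)) (gram F₂) refl)) (Lat-cong {f = fun (per₁ 2 odd ⊗ₚ per₁ 2 odd)} {even₂ ψψ} F₂ (λ { (x ∷ y ∷ []) → refl })))))

-- Products of unary theta series.

-- The even quadratic character modulo 12; by the pentagonal number theorem Σ χ(n) q^{n²} = 2q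
-- E(q^24).
χ : Per 1 12
χ = per₁ 12 (at (+ 0) (+ 0 ∷ + 1 ∷ + 0 ∷ + 0 ∷ + 0 ∷ - + 1 ∷ + 0 ∷ - + 1 ∷ + 0 ∷ + 0 ∷ + 0 ∷ + 1 ∷ []))

-- Supported on ±1, ±9 and on ±3, ±7. The series of squares are 2q E(q^40) G(q^40) and 2q^9 E(q^40)
-- H(q^40).
γ η : Per 1 20
γ = per₁ 20 (at (+ 0) (+ 0 ∷ + 1 ∷ + 0 ∷ + 0 ∷ + 0 ∷ + 0 ∷ + 0 ∷ + 0 ∷ + 0 ∷ - + 1 ∷ + 0 ∷ - + 1 ∷ + 0 ∷ + 0 ∷ + 0 ∷ + 0 ∷ + 0 ∷ + 0 ∷ + 0 ∷ + 1 ∷ []))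
η = per₁ 20 (at (+ 0) (+ 0 ∷ + 0 ∷ + 0 ∷ + 1 ∷ + 0 ∷ + 0 ∷ + 0 ∷ - + 1 ∷ + 0 ∷ + 0 ∷ + 0 ∷ + 0 ∷ + 0 ∷ - + 1 ∷ + 0 ∷ + 0 ∷ + 0 ∷ + 1 ∷ + 0 ∷ + 0 ∷ []))

χsq γsq ηsq : Series
χsq = Lat (fun χ) (unary 1)
γsq = Lat (fun γ) (unary 1)
ηsq = Lat (fun η) (unary 1)

product : ∀ {M} .{{_ : NonZero M}} (P P′ : Per 1 M) (c c′ : ℕ) → dil (suc c) (Lat (fun P) (unary 1)) ⊛ dil (suc c′) (Lat (fun P′) (unary 1)) ≐ Lat (fun (P ⊗ₚ P′)) (sq′ c ⊞ sq′ c′)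
product P P′ c c′ = ≐-trans (⊛-cong (dil-Lat c (fun P) (unary 1)) (dil-Lat c′ (fun P′) (unary 1))) (Lat-⊞ (fun P) (fun P′) (sq′ c) (sq′ c′))

dil-in : ∀ (f : Vec ℕ 2 → ℤ) (F : Form 2) c (K : Form 2) (A B : Mat 2) d .{{_ : NonZero d}} → A ⊡ B ≡ scalar 2 (+ d * + 1) → B ⊡ A ≡ scalar 2 (+ d * + 1) →
  (tr B ⊡ (gram K ⊡ B)) +M tr (tr B ⊡ (gram K ⊡ B)) ≡ *M (+ 1) (gram (scaleForm c F)) +M tr (*M (+ 1) (gram (scaleForm c F))) →
  dil (suc c) (Lat (even₂ f) F) ≐ Lat (pl A d (even₂ f)) K
dil-in f F c K A B d ab ba e = ≐-trans (dil-Lat c (even₂ f) F) (transfer₁ A B d ab ba (scaleForm c F) K (gram-check (gram K) (gram (scaleForm c F)) B (+ 1) e) (even₂ f))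

six : Mat 2 → (Vec ℕ 2 → ℤ) → Per 2 12
six A f = fastPl 6 2 (divides 1 refl) A (map (resV 12) A) refl f

ten : Mat 2 → (Vec ℕ 2 → ℤ) → Per 2 20
ten A f = fastPl 10 2 (divides 1 refl) A (map (resV 20) A) refl f

nought : ∀ {k M} .{{_ : NonZero M}} → Per k M
nought = per (λ _ → + 0) (λ _ → + 0) (λ _ → refl)

private
  I₂ σ₂₁ : Mat 2
  I₂ = m₂ (+ 1) (+ 0) (+ 0) (+ 1)
  σ₂₁ = m₂ (- + 1) (+ 0) (+ 0) (+ 1)

  two-terms : ∀ (c : ℤ) (x y z : ℤ) → + 1 * x + + 0 * y ≡ c * z → x ≡ c * z
  two-terms c x y z e = trans (lem x y) e
    where
    lem : ∀ x y → x ≡ + 1 * x + + 0 * y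
    lem = solve-∀

-- For u and v prime to 6, changing the sign of u if necessary gives u ≡ v modulo 6, whence the
-- factor 2. Then u = x + 6z and v = x turn u² + 26v² into 3(9x² + 4xz + 12z²), and χ(x + 6z) χ(x) =
-- (-1)^z.
χχ-A : dil 1 χsq ⊛ dil 26 χsq ≐ scale (+ 2) (dil 3 tA)
χχ-A n = trans (product χ χ 0 25 n) (trans (two-terms (+ 2) (Lat (fun (χ ⊗ₚ χ)) K n) (Lat (fun (nought {2} {12})) K n) (Lat (fun P) K n) (relation K I₂ (σ₂₁ ∷ []) ((refl , refl) LA.∷ (refl , refl) LA.∷ LA.[]) (+ 1) (+ 0) (+ 2) (χ ⊗ₚ χ) nought P refl n)) (cong (+ 2 *_) (sym (dil-in εA FA 2 K A (m₂ (+ 1) (+ 6) (+ 1) (+ 0)) 6 refl refl refl n))))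
  where
  K = sq′ 0 ⊞ sq′ 25
  A = m₂ (+ 0) (+ 6) (+ 1) (- + 1)
  P = six A εA

χχ-B : dil 2 χsq ⊛ dil 13 χsq ≐ scale (+ 2) (dil 3 tB)
χχ-B n = trans (product χ χ 1 12 n) (trans (two-terms (+ 2) (Lat (fun (χ ⊗ₚ χ)) K n) (Lat (fun (nought {2} {12})) K n) (Lat (fun P) K n) (relation K I₂ (σ₂₁ ∷ []) ((refl , refl) LA.∷ (refl , refl) LA.∷ LA.[]) (+ 1) (+ 0) (+ 2) (χ ⊗ₚ χ) nought P refl n)) (cong (+ 2 *_) (sym (dil-in εB FB 2 K A (m₂ (+ 1) (- + 5) (+ 1) (+ 1)) 6 refl refl refl n))))
  where
  K = sq′ 1 ⊞ sq′ 12
  A = m₂ (+ 1) (+ 5) (- + 1) (+ 1)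
  P = six A εB

-- On the supports u ≡ ±3v modulo 10. The choice u ≡ 3v is parametrised by u = 3x - 7z, v = x + z,
-- and u² + 26v² = 5(7x² + 2xz + 15z²).
γη-X : (dil 1 ηsq ⊛ dil 26 γsq) ⊖ (dil 1 γsq ⊛ dil 26 ηsq) ≐ scale (+ 2) (dil 5 tX)
γη-X n = trans (cong₂ _-_ (product η γ 0 25 n) (product γ η 0 25 n)) (trans (lem (Lat (fun (η ⊗ₚ γ)) K n) (Lat (fun (γ ⊗ₚ η)) K n)) (trans (relation K I₂ (σ₂₁ ∷ []) ((refl , refl) LA.∷ (refl , refl) LA.∷ LA.[]) (+ 1) (- + 1) (+ 2) (η ⊗ₚ γ) (γ ⊗ₚ η) P refl n) (cong (+ 2 *_) (sym (dil-in εB FX 4 K A (m₂ (+ 3) (- + 7) (+ 1) (+ 1)) 10 refl refl refl n)))))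
  where
  K = sq′ 0 ⊞ sq′ 25
  A = m₂ (+ 1) (+ 7) (- + 1) (+ 3)
  P = ten A εB
  lem : ∀ x y → x - y ≡ + 1 * x + - + 1 * y
  lem = solve-∀

-- Here u ≡ ±v modulo 10, and u = x + 9z, v = x - z give 2u² + 13v² = 5(3x² + 2xz + 35z²).
γη-Y : (dil 2 γsq ⊛ dil 13 γsq) ⊕ (dil 2 ηsq ⊛ dil 13 ηsq) ≐ scale (+ 2) (dil 5 tY)
γη-Y n = trans (cong₂ _+_ (product γ γ 1 12 n) (product η η 1 12 n)) (trans (lem (Lat (fun (γ ⊗ₚ γ)) K n) (Lat (fun (η ⊗ₚ η)) K n)) (trans (relation K I₂ (σ₂₁ ∷ []) ((refl , refl) LA.∷ (refl , refl) LA.∷ LA.[]) (+ 1) (+ 1) (+ 2) (γ ⊗ₚ γ) (η ⊗ₚ η) P refl n) (cong (+ 2 *_) (sym (dil-in εB FY 4 K A (m₂ (+ 1) (+ 9) (+ 1) (- + 1)) 10 refl refl refl n)))))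
  where
  K = sq′ 1 ⊞ sq′ 12
  A = m₂ (+ 1) (+ 9) (+ 1) (- + 1)
  P = ten A εB
  lem : ∀ x y → x + y ≡ + 1 * x + + 1 * y
  lem = solve-∀

ones : ∀ {k M} .{{_ : NonZero M}} → Per k M
ones = per (λ _ → + 1) (λ _ → + 1) (λ _ → refl)

-- φ(q)φ(-q) = φ(-q²)², by the rotation (x , y) ↦ (x + y , x - y).
alt² : dil 1 (Lat (fun (ones {1} {4})) (unary 1)) ⊛ dil 1 alt ≐ dil 2 (dil 1 alt ⊛ dil 1 alt)
alt² n = ℤₚ.*-cancelˡ-≡ (+ 2) _ _ (trans (cong (+ 2 *_) (product (ones {1} {4}) par 0 0 n)) (trans (lem (Lat (fun (ones {1} {4} ⊗ₚ par)) K n) (Lat (fun (nought {2} {4})) K n)) (trans (relation K I₂ (sw ∷ []) ((refl , refl) LA.∷ (refl , refl) LA.∷ LA.[]) (+ 2) (+ 0) (+ 2) (ones {1} {4} ⊗ₚ par) nought P refl n) (cong (+ 2 *_) (sym (≐-trans (dil-cong 2 (≐-trans (product (per₁ 2 sgn) (per₁ 2 sgn) 0 0) (Lat-cong {f = fun (per₁ 2 sgn ⊗ₚ per₁ 2 sgn)} {even₂ ss} K (λ { (x ∷ y ∷ []) → refl })))) (dil-in ss K 1 K A A 2 refl refl refl) n))))))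
  where
  K = sq′ 0 ⊞ sq′ 0
  par : Per 1 4
  par = perB 2 (divides 2 refl) (rep (per₁ 2 sgn))
  sw A : Mat 2
  sw = m₂ (+ 0) (+ 1) (+ 1) (+ 0)
  A = m₂ (+ 1) (+ 1) (+ 1) (- + 1)
  ss : Vec ℕ 2 → ℤ
  ss (x ∷ y ∷ []) = sgn x * sgn y
  P : Per 2 4
  P = fastPl 2 2 (divides 1 refl) A (map (resV 4) A) refl ss
  lem : ∀ x y → + 2 * x ≡ + 2 * x + + 0 * y
  lem = solve-∀

-- The two ternary identities.

weight : Per 2 12
weight = per (λ u → weight′ (resV 12 u)) weight′ (λ _ → refl)
  where
  third : ℕ → ℤ
  third n = if n ℕ.% 3 ≡ᵇ 0 then + 1 else + 0
  weight′ : Vec ℕ 2 → ℤ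
  weight′ (x ∷ y ∷ []) = gate (odd x) (gate (odd y) (third x - third y))

tW : Series
tW = Lat (fun weight) (sq′ 0 ⊞ sq′ 12)

m₃ : ℤ → ℤ → ℤ → ℤ → ℤ → ℤ → ℤ → ℤ → ℤ → Mat 3
m₃ a b c d e f g h i = (a ∷ b ∷ c ∷ []) ∷ (d ∷ e ∷ f ∷ []) ∷ (g ∷ h ∷ i ∷ []) ∷ []

-- The weights of the two sides agree only after averaging over sign changes and a transposition of coordinates.
module Ternary (f : Vec ℕ 2 → ℤ) (F K : Form 2) (A B : Mat 2) (cₗ cᵣ : ℕ) (A′ B′ swap : Mat 3)
  (ab : A ⊡ B ≡ scalar 2 (+ 6 * + 1)) (ba : B ⊡ A ≡ scalar 2 (+ 6 * + 1))
  (e : (tr B ⊡ (gram K ⊡ B)) +M tr (tr B ⊡ (gram K ⊡ B)) ≡ *M (+ 1) (gram (scaleForm 2 F)) +M tr (*M (+ 1) (gram (scaleForm 2 F))))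
  (ab′ : A′ ⊡ B′ ≡ scalar 3 (+ 1 * + 2)) (ba′ : B′ ⊡ A′ ≡ scalar 3 (+ 1 * + 2))
  (e′ : (tr B′ ⊡ (gram (K ⊞ sq′ cₗ) ⊡ B′)) +M tr (tr B′ ⊡ (gram (K ⊞ sq′ cₗ) ⊡ B′)) ≡ *M (+ 2 * + 2) (gram ((sq′ 0 ⊞ sq′ 12) ⊞ sq′ cᵣ)) +M tr (*M (+ 2 * + 2) (gram ((sq′ 0 ⊞ sq′ 12) ⊞ sq′ cᵣ)))) where

  full half : Per 3 12
  full = weight ⊗ₚ χ
  half = fastPl 1 12 (divides 1 refl) A′ (map (resV 12) A′) refl (rep full)

  -- The weight lives on triples of odd numbers, where the half sum and half difference formed by
  -- `B′` are integers.
  parity : Per 3 12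
  parity = perMask 2 (divides 6 refl) B′ full ∔ - + 1 · full

  right : (∀ u → fun parity u ≡ + 0) → tW ⊛ dil (suc cᵣ) χsq ≐ Lat (fun half) (K ⊞ sq′ cₗ)
  right h = ≐-trans (⊛-cong {f = tW} ≐-refl (dil-Lat cᵣ (fun χ) (unary 1))) (≐-trans (Lat-⊞ (fun weight) (fun χ) (sq′ 0 ⊞ sq′ 12) (sq′ cᵣ)) (≐-trans (Lat-cong {f = fun full} {mask B′ 2 (λ u → rep full (resV 12 u))} R (λ u → trans (sym (ℤₚ.i-j≡0⇒i≡j _ _ (trans (lem (mask B′ 2 (fun full) u) (fun full u)) (h u)))) (cong (divI 2 (mv B′ u) *_) (fun≡rep full u)))) (transfer A′ B′ 1 2 ab′ ba′ R (K ⊞ sq′ cₗ) (gram-check (gram (K ⊞ sq′ cₗ)) (gram R) B′ (+ 2 * + 2) e′) (λ u → rep full (resV 12 u)))))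
    where
    R = (sq′ 0 ⊞ sq′ 12) ⊞ sq′ cᵣ
    lem : ∀ x y → x - y ≡ x + - + 1 * y
    lem = solve-∀

  left : dil 3 (Lat (even₂ f) F) ⊛ dil (suc cₗ) χsq ≐ Lat (fun (six A f ⊗ₚ χ)) (K ⊞ sq′ cₗ)
  left = ≐-trans (⊛-cong (dil-in f F 2 K A B 6 ab ba e) (dil-Lat cₗ (fun χ) (unary 1))) (Lat-⊞ (pl A 6 (even₂ f)) (fun χ) K (sq′ cₗ))

  difference : Per 3 12
  difference = + 1 · (six A f ⊗ₚ χ) ∔ + 1 · flip′ swap (six A f ⊗ₚ χ) ∔ (- + 1 * + 1) · half

  signs : List (Mat 3)
  signs = m₃ (- + 1) (+ 0) (+ 0) (+ 0) (+ 1) (+ 0) (+ 0) (+ 0) (+ 1) ∷ m₃ (+ 1) (+ 0) (+ 0) (+ 0) (- + 1) (+ 0) (+ 0) (+ 0) (+ 1) ∷ m₃ (- + 1) (+ 0) (+ 0) (+ 0) (- + 1) (+ 0) (+ 0) (+ 0) (+ 1) ∷ []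

  ternary : (∀ u → fun parity u ≡ + 0) → LA.All (Isometry (K ⊞ sq′ cₗ)) (swap ∷ scalar 3 (+ 1) ∷ signs) → allV 12 3 (λ ρ → isZero (rep (average (scalar 3 (+ 1) ∷ signs) difference) ρ)) ≡ true →
    scale (+ 2) (dil 3 (Lat (even₂ f) F) ⊛ dil (suc cₗ) χsq) ≐ tW ⊛ dil (suc cᵣ) χsq
  ternary h (i LA.∷ is) v n = trans (cong (+ 2 *_) (left n)) (trans (lem (Lat (fun (six A f ⊗ₚ χ)) (K ⊞ sq′ cₗ) n)) (trans (cong (λ t → + 1 * Lat (fun (six A f ⊗ₚ χ)) (K ⊞ sq′ cₗ) n + + 1 * t) (sym (flip-Lat (K ⊞ sq′ cₗ) swap i (six A f ⊗ₚ χ) n))) (trans (relation (K ⊞ sq′ cₗ) (scalar 3 (+ 1)) signs is (+ 1) (+ 1) (+ 1) (six A f ⊗ₚ χ) (flip′ swap (six A f ⊗ₚ χ)) half v n) (trans (ℤₚ.*-identityˡ (Lat (fun half) (K ⊞ sq′ cₗ) n)) (sym (right h n))))))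
    where
    lem : ∀ x → + 2 * x ≡ + 1 * x + + 1 * x
    lem = solve-∀

private
  -- The changes of variables are 2u² + 2w² = (u + w)² + (w - u)² here and 26v² + 26w² = 13(v + w)²
  -- + 13(w - v)² in `T₂`; `swap` exchanges the two coordinates with equal coefficients.
  module T₁ = Ternary εB FX (sq′ 1 ⊞ sq′ 12) (m₂ (+ 1) (+ 4) (+ 1) (- + 2)) (m₂ (+ 2) (+ 4) (+ 1) (- + 1)) 1 0
    (m₃ (+ 1) (+ 0) (+ 1) (+ 0) (+ 1) (+ 0) (- + 1) (+ 0) (+ 1)) (m₃ (+ 1) (+ 0) (- + 1) (+ 0) (+ 2) (+ 0) (+ 1) (+ 0) (+ 1)) (m₃ (+ 0) (+ 0) (+ 1) (+ 0) (+ 1) (+ 0) (+ 1) (+ 0) (+ 0)) refl refl refl refl refl refl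
  module T₂ = Ternary εB FY (sq′ 0 ⊞ sq′ 25) (m₂ (+ 2) (- + 1) (+ 0) (+ 3)) (m₂ (+ 3) (+ 1) (+ 0) (+ 2)) 25 12
    (m₃ (+ 1) (+ 0) (+ 0) (+ 0) (+ 1) (+ 1) (+ 0) (- + 1) (+ 1)) (m₃ (+ 2) (+ 0) (+ 0) (+ 0) (+ 1) (- + 1) (+ 0) (+ 1) (+ 1)) (m₃ (+ 1) (+ 0) (+ 0) (+ 0) (+ 0) (+ 1) (+ 0) (+ 1) (+ 0)) refl refl refl refl refl refl

X-ternary : scale (+ 2) (dil 3 tX ⊛ dil 2 χsq) ≐ tW ⊛ dil 1 χsq
X-ternary = T₁.ternary (vanishes T₁.parity refl) ((refl , refl) LA.∷ (refl , refl) LA.∷ (refl , refl) LA.∷ (refl , refl) LA.∷ (refl , refl) LA.∷ LA.[]) refl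

Y-ternary : scale (+ 2) (dil 3 tY ⊛ dil 26 χsq) ≐ tW ⊛ dil 13 χsq
Y-ternary = T₂.ternary (vanishes T₂.parity refl) ((refl , refl) LA.∷ (refl , refl) LA.∷ (refl , refl) LA.∷ (refl , refl) LA.∷ (refl , refl) LA.∷ LA.[]) refl

-- Unary theta series as q-series.

sumZ-suc : ∀ N (h : ℤ → ℤ) → sumZ (suc N) h ≡ sumZ N h + (h (+ suc N) + h -[1+ N ])
sumZ-suc N h = begin
  sumTo (suc N ℕ.+ suc N) F                                    ≡⟨ cong (λ t → sumTo (suc t) F) (ℕₚ.+-suc N N) ⟩
  sumTo (suc (N ℕ.+ N)) F + F (suc (suc (N ℕ.+ N)))            ≡⟨ cong (_+ F (suc (suc (N ℕ.+ N)))) (sumTo-head (N ℕ.+ N) F) ⟩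
  F 0 + sumTo (N ℕ.+ N) (λ i → F (suc i)) + F (suc (suc (N ℕ.+ N))) ≡⟨ cong₂ (λ s t → F 0 + s + t) (sumTo-cong′ (N ℕ.+ N) (λ i → cong h (trans (ℤₚ.[1+m]⊖[1+n]≡m⊖n i N) (sym (ℤₚ.m-n≡m⊖n i N))))) (cong h top) ⟩
  F 0 + sumZ N h + h (+ suc N)                                 ≡⟨ lem (F 0) (sumZ N h) (h (+ suc N)) ⟩
  sumZ N h + (h (+ suc N) + h -[1+ N ]) ∎
  where
  open ≡-Reasoning
  F : ℕ → ℤ
  F i = h (+ i - + suc N)
  lem : ∀ a b c → a + b + c ≡ b + (c + a)
  lem = solve-∀
  top : + suc (suc (N ℕ.+ N)) - + suc N ≡ + suc N
  top = trans (cong (_- + suc N) (trans (cong +_ (cong suc (sym (ℕₚ.+-suc N N)))) (ℤₚ.pos-+ (suc N) (suc N)))) (cancel (+ suc N))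
    where
    cancel : ∀ a → a + a - a ≡ a
    cancel = solve-∀

sumZ-even : ∀ N (h : ℤ → ℤ) → (∀ k → h -[1+ k ] ≡ h (+ suc k)) → sumZ N h + h (+ 0) ≡ + 2 * sumTo N (λ x → h (+ x))
sumZ-even zero    h e = lem (h (+ 0))
  where
  lem : ∀ a → a + a ≡ + 2 * a
  lem = solve-∀
sumZ-even (suc N) h e = trans (cong (_+ h (+ 0)) (trans (sumZ-suc N h) (cong (λ t → sumZ N h + (h (+ suc N) + t)) (e N)))) (trans (lem (sumZ N h) (h (+ suc N)) (h (+ 0))) (trans (cong (_+ + 2 * h (+ suc N)) (sumZ-even N h e)) (sym (ℤₚ.*-distribˡ-+ (+ 2) (sumTo N (λ x → h (+ x))) (h (+ suc N))))))
  where
  lem : ∀ s a b → s + (a + a) + b ≡ s + b + + 2 * a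
  lem = solve-∀

module _ (M : ℕ) .{{_ : NonZero M}} (f : ℕ → ℤ) (even : allN M (λ r → isZero (f (M ℕ.∸ r) - f r)) ≡ true) where

  even-res : ∀ k → f (-[1+ k ] %ℕ M) ≡ f (suc k ℕ.% M)
  even-res k with suc k ℕ.% M in eq
  ... | zero  = refl
  ... | suc r = ℤₚ.i-j≡0⇒i≡j _ _ (isZero-sound _ (allN-sound M _ even (suc r) (subst (ℕ._< M) eq (ℕD.m%n<n (suc k) M))))

  -- The term at 0 occurs once in the sum over all integers but twice in the doubled half sum,
  -- whence the correction.
  Lat-unary : ∀ n → Lat (fun (per₁ M f)) (unary 1) n + f 0 * δ 0 n ≡ + 2 * sumTo n (λ x → f (x ℕ.% M) * δ (x ℕ.* x) n)
  Lat-unary n = trans (cong₂ _+_ (trans (cong (λ N → sumZ N (λ x → fun (per₁ M f) (x ∷ []) * δℤ (Q (gram (unary 1)) (x ∷ [])) (+ n))) (ℕₚ.*-identityˡ n)) (sumZ-cong n (λ x → cong (f (x %ℕ M) *_) (conv x)))) (cong (λ t → f t * δ 0 n) (sym (ℕD.m<n⇒m%n≡m (ℕₚ.n≢0⇒n>0 (ℕ.≢-nonZero⁻¹ M)))))) (sumZ-even n (λ x → f (x %ℕ M) * δ (∣ x ∣ ℕ.* ∣ x ∣) n) (λ k → cong (_* δ (suc k ℕ.* suc k) n) (even-res k)))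
    where
    val : ∀ x → x * (+ 1 * x + + 0) + + 0 ≡ x * x
    val = solve-∀
    conv : ∀ x → δℤ (Q (gram (unary 1)) (x ∷ [])) (+ n) ≡ δ (∣ x ∣ ℕ.* ∣ x ∣) n
    conv x with ∣ x ∣ ℕ.* ∣ x ∣ ℕ.≟ n
    ... | yes e = trans (cong (λ t → δℤ t (+ n)) (trans (val x) (trans (sq x) (cong +_ e)))) (δℤ-refl (+ n))
    ... | no  e = δℤ-≢ (λ q → e (ℤₚ.+-injective (trans (sym (sq x)) (trans (sym (val x)) q))))

sumTo-extend : ∀ n k (F : ℕ → ℤ) → (∀ x → n ℕ.< x → F x ≡ + 0) → sumTo (k ℕ.+ n) F ≡ sumTo n F
sumTo-extend n zero    F z = refl
sumTo-extend n (suc k) F z = trans (cong₂ _+_ (sumTo-extend n k F z) (z (suc k ℕ.+ n) (s≤s (ℕₚ.m≤n+m n k)))) (ℤₚ.+-identityʳ _)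

sumTo-split : ∀ b m (F : ℕ → ℤ) → sumTo (suc b ℕ.+ m) F ≡ sumTo m F + sumTo b (λ r → F (suc (r ℕ.+ m)))
sumTo-split zero    m F = refl
sumTo-split (suc b) m F = trans (cong (_+ F (suc (suc b ℕ.+ m))) (sumTo-split b m F)) (ℤₚ.+-assoc (sumTo m F) _ _)

sumTo-blocks : ∀ b K (F : ℕ → ℤ) → sumTo (b ℕ.+ K ℕ.* suc b) F ≡ sumTo K (λ j → sumTo b (λ r → F (r ℕ.+ j ℕ.* suc b)))
sumTo-blocks b zero    F = trans (cong (λ t → sumTo t F) (ℕₚ.+-identityʳ b)) (sumTo-cong′ b (λ r → cong F (sym (ℕₚ.+-identityʳ r))))
sumTo-blocks b (suc K) F = trans (cong (λ t → sumTo t F) (swap b (K ℕ.* suc b))) (trans (sumTo-split b (b ℕ.+ K ℕ.* suc b) F) (cong₂ _+_ (sumTo-blocks b K F) (sumTo-cong′ b (λ r → cong F (regroup r b (K ℕ.* suc b))))))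
  where
  swap : ∀ b k → b ℕ.+ (suc b ℕ.+ k) ≡ suc b ℕ.+ (b ℕ.+ k)
  swap = ℕR.solve-∀
  regroup : ∀ r b k → suc (r ℕ.+ (b ℕ.+ k)) ≡ r ℕ.+ (suc b ℕ.+ k)
  regroup = ℕR.solve-∀

square-large : ∀ {n x} → n ℕ.< x → δ (x ℕ.* x) n ≡ + 0
square-large {n} {x} p = δ-≢ (λ e → ℕₚ.<⇒≱ p (subst (x ℕ.≤_) e (∣x∣≤∣x∣² x)))

module _ (M b : ℕ) .{{_ : NonZero M}} (f : ℕ → ℤ) (σ : ℤ) (step : allN M (λ r → isZero (f ((r ℕ.+ suc b) ℕ.% M) - σ * f r)) ≡ true) where

  step-res : ∀ x → f ((suc b ℕ.+ x) ℕ.% M) ≡ σ * f (x ℕ.% M)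
  step-res x = trans (cong f (trans (cong (ℕ._% M) (ℕₚ.+-comm (suc b) x)) (trans (ℕD.%-distribˡ-+ x (suc b) M) (trans (cong (λ t → (t ℕ.+ suc b ℕ.% M) ℕ.% M) (sym (ℕD.m%n%n≡m%n x M))) (sym (ℕD.%-distribˡ-+ (x ℕ.% M) (suc b) M)))))) (ℤₚ.i-j≡0⇒i≡j _ _ (isZero-sound _ (allN-sound M _ step (x ℕ.% M) (ℕD.m%n<n x M))))

  power-res : ∀ r j → f ((r ℕ.+ j ℕ.* suc b) ℕ.% M) ≡ σ ℤ.^ j * f (r ℕ.% M)
  power-res r zero    = trans (cong (λ t → f (t ℕ.% M)) (ℕₚ.+-identityʳ r)) (sym (ℤₚ.*-identityˡ (f (r ℕ.% M))))
  power-res r (suc j) = trans (cong (λ t → f (t ℕ.% M)) (l r (suc b) (j ℕ.* suc b))) (trans (step-res (r ℕ.+ j ℕ.* suc b)) (trans (cong (σ *_) (power-res r j)) (sym (ℤₚ.*-assoc σ (σ ℤ.^ j) (f (r ℕ.% M))))))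
    where
    l : ∀ r b k → r ℕ.+ (b ℕ.+ k) ≡ b ℕ.+ (r ℕ.+ k)
    l = ℕR.solve-∀

  -- A shift by `suc b` multiplies `f` by `σ`, so the sum splits into blocks of that length with
  -- signs σ^j. The range may be extended to whole blocks because x > n gives x² > n.
  square-blocks : ∀ n → sumTo n (λ x → f (x ℕ.% M) * δ (x ℕ.* x) n) ≡ sumTo n (λ j → sumTo b (λ r → σ ℤ.^ j * f (r ℕ.% M) * δ ((r ℕ.+ j ℕ.* suc b) ℕ.* (r ℕ.+ j ℕ.* suc b)) n))
  square-blocks n = trans (sym (sumTo-extend n (b ℕ.+ n ℕ.* b) F (λ x p → trans (cong (f (x ℕ.% M) *_) (square-large p)) (ℤₚ.*-zeroʳ (f (x ℕ.% M)))))) (trans (cong (λ t → sumTo t F) (trans (ℕₚ.+-assoc b (n ℕ.* b) n) (cong (b ℕ.+_) (trans (ℕₚ.+-comm (n ℕ.* b) n) (sym (ℕₚ.*-suc n b)))))) (trans (sumTo-blocks b n F) (sumTo-cong′ n (λ j → sumTo-cong′ b (λ r → cong (_* δ ((r ℕ.+ j ℕ.* suc b) ℕ.* (r ℕ.+ j ℕ.* suc b)) n) (power-res r j))))))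
    where
    F : ℕ → ℤ
    F x = f (x ℕ.% M) * δ (x ℕ.* x) n

δ-sym : ∀ a b → δ a b ≡ δ b a
δ-sym a b with a ℕ.≟ b
... | yes refl = sym (δ-refl a)
... | no  p    = sym (δ-≢ (λ q → p (sym q)))

shift-dil-lim : ∀ a d .{{_ : NonZero d}} (β : ℕ → Series) → (∀ m j → m ℕ.< j → β j ≈[ m ] zeroS) → ∀ n → shift a (dil d (lim β)) n ≡ sumTo n (λ j → (mono a ⊛ dil d (β j)) n)
shift-dil-lim a d β ord n = trans (shift-mono a (dil d (lim β)) n) (trans (≈-⊛ˡ (mono a) (≈-dil d (lim-≈ β ord n)) n ℕₚ.≤-refl) (trans (⊛-congˡ (mono a) (dil-Ss n) n) (trans (≐-sym (Ss-⊛ n (mono a) (λ j → dil d (β j))) n) (Ss-at n (λ j → mono a ⊛ dil d (β j)) n))))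
  where
  dil-Ss : ∀ n → dil d (Ss n β) ≐ Ss n (λ j → dil d (β j))
  dil-Ss zero    = ≐-refl
  dil-Ss (suc n) = ≐-trans (dil-⊕ d (Ss n β) (β (suc n))) (⊕-cong (dil-Ss n) ≐-refl)

module _ (a d : ℕ) .{{_ : NonZero d}} where

  move-mono : ∀ x → mono a ⊛ dil d (mono x) ≐ mono (a ℕ.+ x ℕ.* d)
  move-mono x = ≐-trans (⊛-congˡ (mono a) (dil-mono d x)) (≐-sym (mono-+ a (x ℕ.* d)))

  move-scale : ∀ c f → mono a ⊛ dil d (scale c f) ≐ scale c (mono a ⊛ dil d f)
  move-scale c f = ≐-trans (⊛-congˡ (mono a) (dil-scale d c f)) (≐-trans (⊛-comm (mono a) (scale c (dil d f))) (≐-trans (⊛-scaleˡ c (dil d f) (mono a)) (λ n → cong (c *_) (⊛-comm (dil d f) (mono a) n))))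

  move-⊕ : ∀ x y → mono a ⊛ dil d (mono x ⊕ mono y) ≐ mono (a ℕ.+ x ℕ.* d) ⊕ mono (a ℕ.+ y ℕ.* d)
  move-⊕ x y = ≐-trans (⊛-congˡ (mono a) (dil-⊕ d (mono x) (mono y))) (≐-trans (⊛-distribˡ (mono a) (dil d (mono x)) (dil d (mono y))) (⊕-cong (move-mono x) (move-mono y)))

  move-⊖ : ∀ x y → mono a ⊛ dil d (mono x ⊖ mono y) ≐ mono (a ℕ.+ x ℕ.* d) ⊖ mono (a ℕ.+ y ℕ.* d)
  move-⊖ x y = ≐-trans (⊛-congˡ (mono a) (≐-trans (dil-⊕ d (mono x) (⊝ mono y)) (⊕-cong (≐-refl {dil d (mono x)}) (≐-trans (dil-⊝ d (mono y)) (λ n → refl))))) (≐-trans (solve 3 (λ a x y → a :* (x :- y) := a :* x :- a :* y) ≐-refl (mono a) (dil d (mono x)) (dil d (mono y))) (⊖-cong (move-mono x) (move-mono y)))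

absorb⊕ : ∀ e s x y → mono e ⊛ (cst s ⊛ (mono x ⊕ mono y)) ≐ scale s (mono (e ℕ.+ x) ⊕ mono (e ℕ.+ y))
absorb⊕ e s x y = ≐-trans (solve 4 (λ e s x y → e :* (s :* (x :+ y)) := s :* (e :* x :+ e :* y)) ≐-refl (mono e) (cst s) (mono x) (mono y)) (≐-trans (⊛-congˡ (cst s) (⊕-cong (≐-sym (mono-+ e x)) (≐-sym (mono-+ e y)))) (≐-sym (scale-cst s (mono (e ℕ.+ x) ⊕ mono (e ℕ.+ y)))))

absorb⊖ : ∀ e s x y → mono e ⊛ (cst s ⊛ (mono x ⊖ mono y)) ≐ scale s (mono (e ℕ.+ x) ⊖ mono (e ℕ.+ y))
absorb⊖ e s x y = ≐-trans (solve 4 (λ e s x y → e :* (s :* (x :- y)) := s :* (e :* x :- e :* y)) ≐-refl (mono e) (cst s) (mono x) (mono y)) (≐-trans (⊛-congˡ (cst s) (⊖-cong (≐-sym (mono-+ e x)) (≐-sym (mono-+ e y)))) (≐-sym (scale-cst s (mono (e ℕ.+ x) ⊖ mono (e ℕ.+ y)))))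

-- One part of the Bailey term j + 1 belongs to the theta block j. The reindexing leaves a single
-- boundary term `v n`, which vanishes later because its square exceeds `n`.
regroup : ∀ n (β u v : ℕ → ℤ) → β 0 ≡ u 0 → (∀ j → β (suc j) ≡ u (suc j) + v j) → sumTo n β + v n ≡ sumTo n (λ j → u j + v j)
regroup zero    β u v b₀ bs = cong (_+ v 0) b₀
regroup (suc n) β u v b₀ bs = trans (cong (λ t → sumTo n β + t + v (suc n)) (bs n)) (trans (lem (sumTo n β) (u (suc n)) (v n) (v (suc n))) (cong (_+ (u (suc n) + v (suc n))) (regroup n β u v b₀ bs)))
  where
  lem : ∀ s a b c → s + (a + b) + c ≡ s + b + (a + c)
  lem = solve-∀

tri₄ : ∀ j c → (tri j ℕ.+ tri j) ℕ.* c ≡ j ℕ.* suc j ℕ.* c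
tri₄ j c = cong (ℕ._* c) (tri-double j)

-- The Bailey sum pairs q^{(jB-p)²} with q^{(jB+p)²}, the theta sum pairs q^{(p+jB)²} with q^{(q+jB)²}, p + q = B.
module Unfold⁰ (a d p q B : ℕ) .{{_ : NonZero d}} (β : ℕ → Series) (eu ev : ℕ → ℕ)
  (ord : ∀ m j → m ℕ.< j → β j ≈[ m ] zeroS)
  (β₀ : β 0 ≐ mono (eu 0)) (βs : ∀ j → β (suc j) ≐ scale ((- + 1) ℤ.^ suc j) (mono (ev j) ⊕ mono (eu (suc j))))
  (su : ∀ j → a ℕ.+ eu j ℕ.* d ≡ (p ℕ.+ j ℕ.* B) ℕ.* (p ℕ.+ j ℕ.* B)) (sv : ∀ j → a ℕ.+ ev j ℕ.* d ≡ (q ℕ.+ j ℕ.* B) ℕ.* (q ℕ.+ j ℕ.* B))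
  (large : ∀ n → n ℕ.< q ℕ.+ n ℕ.* B) where

  unfold : ∀ n → sumTo n (λ j → (- + 1) ℤ.^ j * (δ ((p ℕ.+ j ℕ.* B) ℕ.* (p ℕ.+ j ℕ.* B)) n - δ ((q ℕ.+ j ℕ.* B) ℕ.* (q ℕ.+ j ℕ.* B)) n)) ≡ shift a (dil d (lim β)) n
  unfold n = sym (trans (shift-dil-lim a d β ord n) (trans (sym (trans (cong (λ t → sumTo n b + t) v0) (ℤₚ.+-identityʳ (sumTo n b)))) (trans (regroup n b u v b₀ bs) (sumTo-cong′ n (λ j → lem ((- + 1) ℤ.^ j) _ _)))))
    where
    b u v : ℕ → ℤ
    b j = (mono a ⊛ dil d (β j)) n
    u j = (- + 1) ℤ.^ j * δ ((p ℕ.+ j ℕ.* B) ℕ.* (p ℕ.+ j ℕ.* B)) n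
    v j = - + 1 * (- + 1) ℤ.^ j * δ ((q ℕ.+ j ℕ.* B) ℕ.* (q ℕ.+ j ℕ.* B)) n
    lem : ∀ s x y → s * x + - + 1 * s * y ≡ s * (x - y)
    lem = solve-∀
    at-sq : ∀ {k s} → k ≡ s → mono k n ≡ δ s n
    at-sq {s = s} h = trans (cong (δ n) h) (δ-sym n s)
    b₀ : b 0 ≡ u 0
    b₀ = trans (⊛-congˡ (mono a) (dil-cong d β₀) n) (trans (move-mono a d (eu 0) n) (trans (at-sq (su 0)) (sym (ℤₚ.*-identityˡ (δ ((p ℕ.+ 0) ℕ.* (p ℕ.+ 0)) n)))))
    bs : ∀ j → b (suc j) ≡ u (suc j) + v j
    bs j = trans (⊛-congˡ (mono a) (dil-cong d (βs j)) n) (trans (move-scale a d ((- + 1) ℤ.^ suc j) (mono (ev j) ⊕ mono (eu (suc j))) n) (trans (cong ((- + 1) ℤ.^ suc j *_) (trans (move-⊕ a d (ev j) (eu (suc j)) n) (cong₂ _+_ (at-sq (sv j)) (at-sq (su (suc j)))))) (l ((- + 1) ℤ.^ suc j) _ _)))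
      where
      l : ∀ s x y → s * (x + y) ≡ s * y + s * x
      l = solve-∀
    v0 : v n ≡ + 0
    v0 = trans (cong (- + 1 * (- + 1) ℤ.^ n *_) (square-large (large n))) (ℤₚ.*-zeroʳ (- + 1 * (- + 1) ℤ.^ n))

drop0 : ∀ x y z → y ≡ + 0 → x + y ≡ z → x ≡ z
drop0 x y z e h = trans (sym (ℤₚ.+-identityʳ x)) (trans (cong (λ t → x + t) (sym e)) h)

-- Completing the square: 24·j(3j ± 1)/2 + 1 = (6j ± 1)².
χsq≐ : χsq ≐ scale (+ 2) (shift 1 (dil 24 E))
χsq≐ n = drop0 (χsq n) (+ 0 * δ 0 n) _ (ℤₚ.*-zeroˡ (δ 0 n)) (trans (Lat-unary 12 χf refl n) (cong (+ 2 *_) (trans (square-blocks 12 5 χf (- + 1) refl n) (trans (sumTo-cong′ n (λ j → lem ((- + 1) ℤ.^ j) _ _ _ _ _ _)) (trans (U.unfold n) (trans (shift-mono 1 (dil 24 (lim (B⁰.raise α⁰))) n) (trans (⊛-congˡ (mono 1) (dil-cong 24 (≐-sym euler)) n) (sym (shift-mono 1 (dil 24 E) n)))))))))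
  where
  χf : ℕ → ℤ
  χf = at (+ 0) (+ 0 ∷ + 1 ∷ + 0 ∷ + 0 ∷ + 0 ∷ - + 1 ∷ + 0 ∷ - + 1 ∷ + 0 ∷ + 0 ∷ + 0 ∷ + 1 ∷ [])
  lem : ∀ s a b c d e f → s * + 0 * a + s * + 1 * b + s * + 0 * c + s * + 0 * d + s * + 0 * e + s * - + 1 * f ≡ s * (b - f)
  lem = solve-∀
  l₁ : ∀ j t → 1 ℕ.+ (j ℕ.* (j ℕ.+ 0) ℕ.+ t) ℕ.* 24 ≡ 1 ℕ.+ 24 ℕ.* (j ℕ.* j) ℕ.+ (t ℕ.+ t) ℕ.* 12
  l₁ = ℕR.solve-∀
  l₂ : ∀ j → 1 ℕ.+ 24 ℕ.* (j ℕ.* j) ℕ.+ j ℕ.* suc j ℕ.* 12 ≡ (1 ℕ.+ j ℕ.* 6) ℕ.* (1 ℕ.+ j ℕ.* 6)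
  l₂ = ℕR.solve-∀
  l₃ : ∀ j t → 1 ℕ.+ (suc j ℕ.* (suc j ℕ.+ 0) ℕ.+ t) ℕ.* 24 ≡ 1 ℕ.+ 24 ℕ.* (suc j ℕ.* suc j) ℕ.+ (t ℕ.+ t) ℕ.* 12
  l₃ = ℕR.solve-∀
  l₄ : ∀ j → 1 ℕ.+ 24 ℕ.* (suc j ℕ.* suc j) ℕ.+ j ℕ.* suc j ℕ.* 12 ≡ (5 ℕ.+ j ℕ.* 6) ℕ.* (5 ℕ.+ j ℕ.* 6)
  l₄ = ℕR.solve-∀
  module U = Unfold⁰ 1 24 1 5 6 (B⁰.raise α⁰) (λ j → j ℕ.* (j ℕ.+ 0) ℕ.+ tri j) (λ j → suc j ℕ.* (suc j ℕ.+ 0) ℕ.+ tri j) (B⁰.raise-order α⁰)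
    (≐-trans (⊛-identityˡ 1S) (≐-sym one≐)) (λ j → absorb⊕ (suc j ℕ.* (suc j ℕ.+ 0)) ((- + 1) ℤ.^ suc j) (tri j) (tri (suc j)))
    (λ j → trans (l₁ j (tri j)) (trans (cong (λ t → 1 ℕ.+ 24 ℕ.* (j ℕ.* j) ℕ.+ t) (tri₄ j 12)) (l₂ j))) (λ j → trans (l₃ j (tri j)) (trans (cong (λ t → 1 ℕ.+ 24 ℕ.* (suc j ℕ.* suc j) ℕ.+ t) (tri₄ j 12)) (l₄ j)))
    (λ n → ℕₚ.≤-trans (s≤s (ℕₚ.m≤m*n n 6)) (s≤s (ℕₚ.m≤n+m (n ℕ.* 6) 4)))

-- Completing the square: 40·j(5j ± 1)/2 + 1 = (10j ± 1)².
γsq≐ : γsq ≐ scale (+ 2) (shift 1 (dil 40 (E ⊛ G)))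
γsq≐ n = drop0 (γsq n) (+ 0 * δ 0 n) _ (ℤₚ.*-zeroˡ (δ 0 n)) (trans (Lat-unary 20 γf refl n) (cong (+ 2 *_) (trans (square-blocks 20 9 γf (- + 1) refl n) (trans (sumTo-cong′ n (λ j → lem ((- + 1) ℤ.^ j) _ _ _ _ _ _ _ _ _ _)) (trans (U.unfold n) (trans (shift-mono 1 (dil 40 (lim (B⁰.raise (B⁰.raise α⁰)))) n) (trans (⊛-congˡ (mono 1) (dil-cong 40 (≐-sym E⊛G)) n) (sym (shift-mono 1 (dil 40 (E ⊛ G)) n)))))))))
  where
  γf : ℕ → ℤ
  γf = at (+ 0) (+ 0 ∷ + 1 ∷ + 0 ∷ + 0 ∷ + 0 ∷ + 0 ∷ + 0 ∷ + 0 ∷ + 0 ∷ - + 1 ∷ + 0 ∷ - + 1 ∷ + 0 ∷ + 0 ∷ + 0 ∷ + 0 ∷ + 0 ∷ + 0 ∷ + 0 ∷ + 1 ∷ [])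
  lem : ∀ s a b c d e f g h i k → s * + 0 * a + s * + 1 * b + s * + 0 * c + s * + 0 * d + s * + 0 * e + s * + 0 * f + s * + 0 * g + s * + 0 * h + s * + 0 * i + s * - + 1 * k ≡ s * (b - k)
  lem = solve-∀
  square : ℕ → ℕ
  square j = j ℕ.* (j ℕ.+ 0)
  assoc : ∀ e s x y → mono e ⊛ (mono e ⊛ (cst s ⊛ (mono x ⊕ mono y))) ≐ scale s (mono (e ℕ.+ e ℕ.+ x) ⊕ mono (e ℕ.+ e ℕ.+ y))
  assoc e s x y = ≐-trans (≐-sym (⊛-assoc (mono e) (mono e) (cst s ⊛ (mono x ⊕ mono y)))) (≐-trans (⊛-congʳ (cst s ⊛ (mono x ⊕ mono y)) (≐-sym (mono-+ e e))) (absorb⊕ (e ℕ.+ e) s x y))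
  l₁ : ∀ j t → 1 ℕ.+ (j ℕ.* (j ℕ.+ 0) ℕ.+ j ℕ.* (j ℕ.+ 0) ℕ.+ t) ℕ.* 40 ≡ 1 ℕ.+ 80 ℕ.* (j ℕ.* j) ℕ.+ (t ℕ.+ t) ℕ.* 20
  l₁ = ℕR.solve-∀
  l₂ : ∀ j → 1 ℕ.+ 80 ℕ.* (j ℕ.* j) ℕ.+ j ℕ.* suc j ℕ.* 20 ≡ (1 ℕ.+ j ℕ.* 10) ℕ.* (1 ℕ.+ j ℕ.* 10)
  l₂ = ℕR.solve-∀
  l₃ : ∀ j t → 1 ℕ.+ (suc j ℕ.* (suc j ℕ.+ 0) ℕ.+ suc j ℕ.* (suc j ℕ.+ 0) ℕ.+ t) ℕ.* 40 ≡ 1 ℕ.+ 80 ℕ.* (suc j ℕ.* suc j) ℕ.+ (t ℕ.+ t) ℕ.* 20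
  l₃ = ℕR.solve-∀
  l₄ : ∀ j → 1 ℕ.+ 80 ℕ.* (suc j ℕ.* suc j) ℕ.+ j ℕ.* suc j ℕ.* 20 ≡ (9 ℕ.+ j ℕ.* 10) ℕ.* (9 ℕ.+ j ℕ.* 10)
  l₄ = ℕR.solve-∀
  module U = Unfold⁰ 1 40 1 9 10 (B⁰.raise (B⁰.raise α⁰)) (λ j → square j ℕ.+ square j ℕ.+ tri j) (λ j → square (suc j) ℕ.+ square (suc j) ℕ.+ tri j) (B⁰.raise-order (B⁰.raise α⁰))
    (≐-trans (⊛-identityˡ (mono 0 ⊛ 1S)) (≐-trans (⊛-identityˡ 1S) (≐-sym one≐))) (λ j → assoc (square (suc j)) ((- + 1) ℤ.^ suc j) (tri j) (tri (suc j)))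
    (λ j → trans (l₁ j (tri j)) (trans (cong (λ t → 1 ℕ.+ 80 ℕ.* (j ℕ.* j) ℕ.+ t) (tri₄ j 20)) (l₂ j))) (λ j → trans (l₃ j (tri j)) (trans (cong (λ t → 1 ℕ.+ 80 ℕ.* (suc j ℕ.* suc j) ℕ.+ t) (tri₄ j 20)) (l₄ j)))
    (λ n → ℕₚ.≤-trans (s≤s (ℕₚ.m≤m*n n 10)) (s≤s (ℕₚ.m≤n+m (n ℕ.* 10) 8)))

ηsq≐ : ηsq ≐ scale (+ 2) (shift 9 (dil 40 (E ⊛ H)))
ηsq≐ n = drop0 (ηsq n) (+ 0 * δ 0 n) _ (ℤₚ.*-zeroˡ (δ 0 n)) (trans (Lat-unary 20 ηf refl n) (cong (+ 2 *_) (trans (square-blocks 20 9 ηf (- + 1) refl n) (trans (sumTo-cong′ n (λ j → trans (lem ((- + 1) ℤ.^ j) _ _ _ _ _ _ _ _ _ _) (sym (cell j)))) (trans (sym (shift-dil-lim 9 40 β (B¹.raise-order (B¹.raise α¹)) n)) (trans (shift-mono 9 (dil 40 (lim β)) n) (trans (⊛-congˡ (mono 9) (dil-cong 40 (≐-sym E⊛H)) n) (sym (shift-mono 9 (dil 40 (E ⊛ H)) n)))))))))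
  where
  ηf : ℕ → ℤ
  ηf = at (+ 0) (+ 0 ∷ + 0 ∷ + 0 ∷ + 1 ∷ + 0 ∷ + 0 ∷ + 0 ∷ - + 1 ∷ + 0 ∷ + 0 ∷ + 0 ∷ + 0 ∷ + 0 ∷ - + 1 ∷ + 0 ∷ + 0 ∷ + 0 ∷ + 1 ∷ + 0 ∷ + 0 ∷ [])
  β : ℕ → Series
  β = B¹.raise (B¹.raise α¹)
  lem : ∀ s a b c d e f g h i k → s * + 0 * a + s * + 0 * b + s * + 0 * c + s * + 1 * d + s * + 0 * e + s * + 0 * f + s * + 0 * g + s * - + 1 * h + s * + 0 * i + s * + 0 * k ≡ s * (d - h)
  lem = solve-∀
  assoc : ∀ e s x y → mono e ⊛ (mono e ⊛ (cst s ⊛ (mono x ⊖ mono y))) ≐ scale s (mono (e ℕ.+ e ℕ.+ x) ⊖ mono (e ℕ.+ e ℕ.+ y))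
  assoc e s x y = ≐-trans (≐-sym (⊛-assoc (mono e) (mono e) (cst s ⊛ (mono x ⊖ mono y)))) (≐-trans (⊛-congʳ (cst s ⊛ (mono x ⊖ mono y)) (≐-sym (mono-+ e e))) (absorb⊖ (e ℕ.+ e) s x y))
  at-sq : ∀ {k s} → k ≡ s → mono k n ≡ δ s n
  at-sq {s = s} h = trans (cong (δ n) h) (δ-sym n s)
  general : ∀ j s x y → β j ≐ scale s (mono x ⊖ mono y) → 9 ℕ.+ x ℕ.* 40 ≡ (3 ℕ.+ j ℕ.* 10) ℕ.* (3 ℕ.+ j ℕ.* 10) → 9 ℕ.+ y ℕ.* 40 ≡ (7 ℕ.+ j ℕ.* 10) ℕ.* (7 ℕ.+ j ℕ.* 10) →
    (mono 9 ⊛ dil 40 (β j)) n ≡ s * (δ ((3 ℕ.+ j ℕ.* 10) ℕ.* (3 ℕ.+ j ℕ.* 10)) n - δ ((7 ℕ.+ j ℕ.* 10) ℕ.* (7 ℕ.+ j ℕ.* 10)) n)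
  general j s x y e p q = trans (⊛-congˡ (mono 9) (dil-cong 40 e) n) (trans (move-scale 9 40 s (mono x ⊖ mono y) n) (cong (s *_) (trans (move-⊖ 9 40 x y n) (cong₂ _-_ (at-sq p) (at-sq q)))))
  cell : ∀ j → (mono 9 ⊛ dil 40 (β j)) n ≡ (- + 1) ℤ.^ j * (δ ((3 ℕ.+ j ℕ.* 10) ℕ.* (3 ℕ.+ j ℕ.* 10)) n - δ ((7 ℕ.+ j ℕ.* 10) ℕ.* (7 ℕ.+ j ℕ.* 10)) n)
  cell zero    = general 0 (+ 1) 0 1 (≐-trans (⊛-identityˡ (mono 0 ⊛ 1- mono 1)) (≐-trans (⊛-identityˡ (1- mono 1)) (λ i → trans (cong (_- mono 1 i) (sym (one≐ i))) (sym (ℤₚ.*-identityˡ (one i - mono 1 i)))))) refl refl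
  cell (suc j) = general (suc j) ((- + 1) ℤ.^ suc j) (e ℕ.+ e ℕ.+ tri j) (e ℕ.+ e ℕ.+ tri (suc (suc j))) (assoc e ((- + 1) ℤ.^ suc j) (tri j) (tri (suc (suc j)))) (trans (l₁ j (tri j)) (trans (cong (λ t → 9 ℕ.+ 80 ℕ.* (suc j ℕ.* (suc j ℕ.+ 1)) ℕ.+ t) (tri₄ j 20)) (l₂ j))) (trans (l₁ j (tri (suc (suc j)))) (trans (cong (λ t → 9 ℕ.+ 80 ℕ.* (suc j ℕ.* (suc j ℕ.+ 1)) ℕ.+ t) (tri₄ (suc (suc j)) 20)) (l₃ j)))
    where
    e = suc j ℕ.* (suc j ℕ.+ 1)
    l₁ : ∀ j t → 9 ℕ.+ (suc j ℕ.* (suc j ℕ.+ 1) ℕ.+ suc j ℕ.* (suc j ℕ.+ 1) ℕ.+ t) ℕ.* 40 ≡ 9 ℕ.+ 80 ℕ.* (suc j ℕ.* (suc j ℕ.+ 1)) ℕ.+ (t ℕ.+ t) ℕ.* 20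
    l₁ = ℕR.solve-∀
    l₂ : ∀ j → 9 ℕ.+ 80 ℕ.* (suc j ℕ.* (suc j ℕ.+ 1)) ℕ.+ j ℕ.* suc j ℕ.* 20 ≡ (3 ℕ.+ suc j ℕ.* 10) ℕ.* (3 ℕ.+ suc j ℕ.* 10)
    l₂ = ℕR.solve-∀
    l₃ : ∀ j → 9 ℕ.+ 80 ℕ.* (suc j ℕ.* (suc j ℕ.+ 1)) ℕ.+ suc (suc j) ℕ.* suc (suc (suc j)) ℕ.* 20 ≡ (7 ℕ.+ suc j ℕ.* 10) ℕ.* (7 ℕ.+ suc j ℕ.* 10)
    l₃ = ℕR.solve-∀

tri-half : ∀ m → (m ℕ.* suc m) ℕ./ 2 ≡ tri m
tri-half m = trans (cong (ℕ._/ 2) (trans (sym (tri-double m)) (trans (cong (tri m ℕ.+_) (sym (ℕₚ.+-identityʳ (tri m)))) (ℕₚ.*-comm 2 (tri m))))) (ℕD.m*n/n≡m (tri m) 2)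

tri-order : ∀ m j → m ℕ.< j → mono (tri j) ≈[ m ] zeroS
tri-order m j p = mono-≈0 (ℕₚ.≤-trans p (n≤tri j))

ψ≐ : ψ ≐ lim (λ j → mono (tri j))
ψ≐ n = trans (sumTo-cong′ n (λ m → trans (cong (λ t → δ t n) (tri-half m)) (δ-sym (tri m) n))) (sym (Ss-at n (λ j → mono (tri j)) n))

ψ≐lim : lim tψ ≐ ψ
ψ≐lim n = sym (trans (ψ≐ n) (trans (lim-≈ (λ j → mono (tri j)) tri-order (n ℕ.* 2) n (ℕₚ.m≤m*n n 2)) (pairs n n)))
  where
  pairs : ∀ k → Ss (k ℕ.* 2) (λ j → mono (tri j)) ≐ Ss k tψ
  pairs zero    = one≐
  pairs (suc k) i = trans (cong (λ t → t + mono (tri (suc (k ℕ.* 2))) i + mono (tri (suc (suc (k ℕ.* 2)))) i) (pairs k i)) (ℤₚ.+-assoc (Ss k tψ i) (mono (tri (suc (k ℕ.* 2))) i) (mono (tri (suc (suc (k ℕ.* 2)))) i))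

oddsq≐ : oddsq ≐ scale (+ 2) (shift 1 (dil 8 ψ))
oddsq≐ n = drop0 (oddsq n) (+ 0 * δ 0 n) _ (ℤₚ.*-zeroˡ (δ 0 n)) (trans (Lat-unary 2 odd refl n) (cong (+ 2 *_) (trans (square-blocks 2 1 odd (+ 1) refl n) (trans (sumTo-cong′ n (λ j → trans (lem ((+ 1) ℤ.^ j) _ _) (trans (cong (_* δ ((1 ℕ.+ j ℕ.* 2) ℕ.* (1 ℕ.+ j ℕ.* 2)) n) (ℤₚ.^-zeroˡ j)) (trans (ℤₚ.*-identityˡ _) (sym (cell j)))))) (trans (sym (shift-dil-lim 1 8 (λ j → mono (tri j)) tri-order n)) (trans (shift-mono 1 (dil 8 (lim (λ j → mono (tri j)))) n) (trans (⊛-congˡ (mono 1) (dil-cong 8 (≐-sym ψ≐)) n) (sym (shift-mono 1 (dil 8 ψ) n)))))))))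
  where
  lem : ∀ s a b → s * + 0 * a + s * + 1 * b ≡ s * b
  lem = solve-∀
  cell : ∀ j → (mono 1 ⊛ dil 8 (mono (tri j))) n ≡ δ ((1 ℕ.+ j ℕ.* 2) ℕ.* (1 ℕ.+ j ℕ.* 2)) n
  cell j = trans (move-mono 1 8 (tri j) n) (trans (cong (δ n) (trans (l₁ (tri j)) (trans (cong (λ t → 1 ℕ.+ t) (tri₄ j 4)) (l₂ j)))) (δ-sym n _))
    where
    l₁ : ∀ t → 1 ℕ.+ t ℕ.* 8 ≡ 1 ℕ.+ (t ℕ.+ t) ℕ.* 4
    l₁ = ℕR.solve-∀
    l₂ : ∀ j → 1 ℕ.+ j ℕ.* suc j ℕ.* 4 ≡ (1 ℕ.+ j ℕ.* 2) ℕ.* (1 ℕ.+ j ℕ.* 2)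
    l₂ = ℕR.solve-∀

alt≐ : alt ≐ lim tφ
alt≐ n = cancel (+ 1 * δ 0 n) (alt n) (lim tφ n) (trans (Lat-unary 2 sgn refl n) (trans (cong (+ 2 *_) (trans (square-blocks 2 0 sgn (- + 1) refl n) (sumTo-cong′ n (λ j → cong₂ (λ s t → s * δ (t ℕ.* t) n) (ℤₚ.*-identityʳ ((- + 1) ℤ.^ j)) (ℕₚ.*-identityʳ j))))) (sym (trans (cong (_+ + 1 * δ 0 n) (Ss-at n tφ n)) (double n)))))
  where
  cancel : ∀ c a b → a + c ≡ b + c → a ≡ b
  cancel c a b e = trans (l a c) (trans (cong (_- c) e) (sym (l b c)))
    where
    l : ∀ a c → a ≡ a + c - c
    l = solve-∀
  double : ∀ k → sumTo k (λ j → tφ j n) + + 1 * δ 0 n ≡ + 2 * sumTo k (λ j → (- + 1) ℤ.^ j * δ (j ℕ.* j) n)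
  double zero    = trans (cong (λ t → + 1 * t + + 1 * δ 0 n) (δ-sym n 0)) (l (δ 0 n))
    where
    l : ∀ d → + 1 * d + + 1 * d ≡ + 2 * (+ 1 * d)
    l = solve-∀
  double (suc k) = trans (cong (λ t → sumTo k (λ j → tφ j n) + t + + 1 * δ 0 n) (trans (sym (scale-cst (+ 2 * (- + 1) ℤ.^ suc k) (mono (suc k ℕ.* suc k)) n)) (cong (+ 2 * (- + 1) ℤ.^ suc k *_) (δ-sym n (suc k ℕ.* suc k))))) (trans (l (sumTo k (λ j → tφ j n)) ((- + 1) ℤ.^ suc k) (δ (suc k ℕ.* suc k) n) (+ 1 * δ 0 n)) (trans (cong (_+ + 2 * ((- + 1) ℤ.^ suc k * δ (suc k ℕ.* suc k) n)) (double k)) (sym (ℤₚ.*-distribˡ-+ (+ 2) (sumTo k (λ j → (- + 1) ℤ.^ j * δ (j ℕ.* j) n)) _))))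
    where
    l : ∀ a s d b → a + + 2 * s * d + b ≡ a + b + + 2 * (s * d)
    l = solve-∀

φ≐ : φ ≐ Lat (fun (ones {1} {4})) (unary 1)
φ≐ n = sym (trans (cong (λ N → sumZ N (λ x → + 1 * δℤ (Q (gram (unary 1)) (x ∷ [])) (+ n))) (ℕₚ.*-identityˡ n)) (sumZ-cong n (λ x → trans (ℤₚ.*-identityˡ _) (conv x))))
  where
  val : ∀ x → x * (+ 1 * x + + 0) + + 0 ≡ x * x
  val = solve-∀
  conv : ∀ x → δℤ (Q (gram (unary 1)) (x ∷ [])) (+ n) ≡ δ (∣ x ∣ ℕ.* ∣ x ∣) n
  conv x with ∣ x ∣ ℕ.* ∣ x ∣ ℕ.≟ n
  ... | yes e = trans (cong (λ t → δℤ t (+ n)) (trans (val x) (trans (sq x) (cong +_ e)))) (δℤ-refl (+ n))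
  ... | no  e = δℤ-≢ (λ q → e (ℤₚ.+-injective (trans (sym (sq x)) (trans (sym (val x)) q))))

negvφ : negv φ ≐ alt
negvφ = ≐-trans (negv-cong φ≐) (negv-Lat (λ _ → + 1) (fun (per₁ 2 sgn)) (unary 1) (λ x → ℤₚ.i-j≡0⇒i≡j _ _ (trans (lem (sgn (Q (gram (unary 1)) x %ℕ 2) * + 1) (fun (per₁ 2 sgn) x)) (vanishes (perGate 2 (divides 1 refl) sgn (gram (unary 1)) (ones {1} {2}) ∔ - + 1 · per₁ 2 sgn) refl x))))
  where
  lem : ∀ x y → x - y ≡ x + - + 1 * y
  lem = solve-∀

-- Binary theta series as products in q^8.

dil-≡ : ∀ {m n} .{{_ : NonZero m}} .{{_ : NonZero n}} f → m ≡ n → dil m f ≐ dil n f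
dil-≡ f refl = ≐-refl

dil-1 : ∀ f → dil 1 f ≐ f
dil-1 f = dil-char 1 (λ m → cong f (ℕₚ.*-identityʳ m)) (λ n e → ⊥-elim (e (ℕₚ.n<1⇒n≡0 (ℕD.m%n<n n 1))))

dil-⊖ : ∀ k .{{_ : NonZero k}} f g → dil k (f ⊖ g) ≐ dil k f ⊖ dil k g
dil-⊖ k f g = ≐-trans (dil-⊕ k f (⊝ g)) (⊕-cong (≐-refl {dil k f}) (dil-⊝ k g))

dil-cst : ∀ k .{{_ : NonZero k}} c → dil k (cst c) ≐ cst c
dil-cst k c = ≐-trans (dil-scale k c one) (λ n → cong (c *_) (dil-mono k 0 n))

mono-cancel : ∀ k {f g} → mono k ⊛ f ≐ mono k ⊛ g → f ≐ g
mono-cancel k {f} {g} e n = trans (sym (shift-+ k f n)) (trans (shift-mono k f (k ℕ.+ n)) (trans (e (k ℕ.+ n)) (trans (sym (shift-mono k g (k ℕ.+ n))) (shift-+ k g n))))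

-- The common shape 2 q^k f(q^d): a series f is studied through its lift, where it is a theta
-- series.
lift : ℕ → (d : ℕ) .{{_ : NonZero d}} → Series → Series
lift k d f = cst (+ 2) ⊛ (mono k ⊛ dil d f)

lift-≐ : ∀ k d .{{_ : NonZero d}} f → scale (+ 2) (shift k (dil d f)) ≐ lift k d f
lift-≐ k d f = ≐-trans (scale-cst (+ 2) (shift k (dil d f))) (⊛-congˡ (cst (+ 2)) (shift-mono k (dil d f)))

lift-cong : ∀ k d .{{_ : NonZero d}} {f g} → f ≐ g → lift k d f ≐ lift k d g
lift-cong k d p = ⊛-congˡ (cst (+ 2)) (⊛-congˡ (mono k) (dil-cong d p))

lift-dil : ∀ c k d .{{_ : NonZero c}} .{{_ : NonZero d}} .{{_ : NonZero (d ℕ.* c)}} .{{_ : NonZero (c ℕ.* d)}} f → dil c (lift k d f) ≐ lift (k ℕ.* c) d (dil c f)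
lift-dil c k d f = ≐-trans (dil-⊛ c (cst (+ 2)) (mono k ⊛ dil d f)) (⊛-cong (dil-cst c (+ 2)) (≐-trans (dil-⊛ c (mono k) (dil d f)) (⊛-cong (dil-mono c k) (≐-trans (dil-dil c d f) (≐-trans (dil-≡ f (ℕₚ.*-comm d c)) (≐-sym (dil-dil d c f)))))))

lift-⊛ : ∀ k l d .{{_ : NonZero d}} f g → lift k d f ⊛ lift l d g ≐ cst (+ 4) ⊛ (mono (k ℕ.+ l) ⊛ dil d (f ⊛ g))
lift-⊛ k l d f g = ≐-trans (solve 4 (λ a b x y → (con (+ 2) :* (a :* x)) :* (con (+ 2) :* (b :* y)) := con (+ 4) :* ((a :* b) :* (x :* y))) ≐-refl (mono k) (mono l) (dil d f) (dil d g)) (⊛-congˡ (cst (+ 4)) (⊛-cong (≐-sym (mono-+ k l)) (≐-sym (dil-⊛ d f g))))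

lift-shift : ∀ k l d .{{_ : NonZero d}} f → mono (k ℕ.+ l ℕ.* d) ⊛ dil d f ≐ mono k ⊛ dil d (mono l ⊛ f)
lift-shift k l d f = ≐-trans (⊛-congʳ (dil d f) (mono-+ k (l ℕ.* d))) (≐-trans (⊛-assoc (mono k) (mono (l ℕ.* d)) (dil d f)) (⊛-congˡ (mono k) (≐-sym (≐-trans (dil-⊛ d (mono l) f) (⊛-congʳ (dil d f) (dil-mono d l))))))

-- A product of two unary lifts has coefficient 4 and is twice a dilation by c = 3 or 5; injectivity
-- of the dilation brings it back to a single lift.
lift-descend : ∀ c k d .{{_ : NonZero c}} .{{_ : NonZero d}} .{{_ : NonZero (d ℕ.* c)}} f t → cst (+ 4) ⊛ (mono (k ℕ.* c) ⊛ dil (d ℕ.* c) f) ≐ scale (+ 2) (dil c t) → t ≐ lift k d f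
lift-descend c k d f t e = dil-injective c (cancelˡ (cst (+ 2)) (λ ()) (≐-sym (begin
  cst (+ 2) ⊛ dil c (lift k d f)
    ≈⟨ ⊛-congˡ (cst (+ 2)) (≐-trans (dil-⊛ c (cst (+ 2)) (mono k ⊛ dil d f)) (⊛-cong (dil-cst c (+ 2)) (≐-trans (dil-⊛ c (mono k) (dil d f)) (⊛-cong (dil-mono c k) (dil-dil c d f))))) ⟩
  cst (+ 2) ⊛ (cst (+ 2) ⊛ (mono (k ℕ.* c) ⊛ dil (d ℕ.* c) f))
    ≈⟨ solve 1 (λ z → con (+ 2) :* (con (+ 2) :* z) := con (+ 4) :* z) ≐-refl (mono (k ℕ.* c) ⊛ dil (d ℕ.* c) f) ⟩
  cst (+ 4) ⊛ (mono (k ℕ.* c) ⊛ dil (d ℕ.* c) f)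
    ≈⟨ e ⟩
  scale (+ 2) (dil c t)
    ≈⟨ scale-cst (+ 2) (dil c t) ⟩
  cst (+ 2) ⊛ dil c t ∎)))
  where open SR

χ-lift : ∀ c .{{_ : NonZero c}} .{{_ : NonZero (24 ℕ.* c)}} .{{_ : NonZero (c ℕ.* 24)}} → dil c χsq ≐ lift (1 ℕ.* c) 24 (dil c E)
χ-lift c = ≐-trans (dil-cong c (≐-trans χsq≐ (lift-≐ 1 24 E))) (lift-dil c 1 24 E)

γ-lift : ∀ c .{{_ : NonZero c}} .{{_ : NonZero (40 ℕ.* c)}} .{{_ : NonZero (c ℕ.* 40)}} → dil c γsq ≐ lift (1 ℕ.* c) 40 (dil c (E ⊛ G))
γ-lift c = ≐-trans (dil-cong c (≐-trans γsq≐ (lift-≐ 1 40 (E ⊛ G)))) (lift-dil c 1 40 (E ⊛ G))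

η-lift : ∀ c .{{_ : NonZero c}} .{{_ : NonZero (40 ℕ.* c)}} .{{_ : NonZero (c ℕ.* 40)}} → dil c ηsq ≐ lift (9 ℕ.* c) 40 (dil c (E ⊛ H))
η-lift c = ≐-trans (dil-cong c (≐-trans ηsq≐ (lift-≐ 9 40 (E ⊛ H)))) (lift-dil c 9 40 (E ⊛ H))

ψ-lift : ∀ c .{{_ : NonZero c}} .{{_ : NonZero (8 ℕ.* c)}} .{{_ : NonZero (c ℕ.* 8)}} → dil c oddsq ≐ lift (1 ℕ.* c) 8 (dil c ψ)
ψ-lift c = ≐-trans (dil-cong c (≐-trans oddsq≐ (lift-≐ 1 8 ψ))) (lift-dil c 1 8 ψ)

a b x y c d a₂ b₂ : Series
a = dil 1 E ⊛ dil 26 E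
b = dil 2 E ⊛ dil 13 E
x = dil 1 (E ⊛ H) ⊛ dil 26 (E ⊛ G) ⊖ mono 5 ⊛ (dil 1 (E ⊛ G) ⊛ dil 26 (E ⊛ H))
y = dil 2 (E ⊛ G) ⊛ dil 13 (E ⊛ G) ⊕ mono 3 ⊛ (dil 2 (E ⊛ H) ⊛ dil 13 (E ⊛ H))
c = dil 13 ψ ⊛ alt
d = dil 1 ψ ⊛ dil 13 alt
a₂ = dil 2 a
b₂ = dil 2 b

tA-lift : tA ≐ lift 9 8 a
tA-lift = lift-descend 3 9 8 a tA (≐-trans (≐-sym (≐-trans (⊛-cong (χ-lift 1) (χ-lift 26)) (lift-⊛ 1 26 24 (dil 1 E) (dil 26 E)))) χχ-A)

tB-lift : tB ≐ lift 5 8 b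
tB-lift = lift-descend 3 5 8 b tB (≐-trans (≐-sym (≐-trans (⊛-cong (χ-lift 2) (χ-lift 13)) (lift-⊛ 2 13 24 (dil 2 E) (dil 13 E)))) χχ-B)

-- The exponents are 9 + 26 = 35 = 5·7 and 1 + 9·26 = 235 = 35 + 5·40, whence q^7 and the factor q^5
-- in `x`.
tX-lift : tX ≐ lift 7 8 x
tX-lift = lift-descend 5 7 8 x tX (≐-trans (≐-sym (begin
  (dil 1 ηsq ⊛ dil 26 γsq) ⊖ (dil 1 γsq ⊛ dil 26 ηsq)
    ≈⟨ ⊖-cong (≐-trans (⊛-cong (η-lift 1) (γ-lift 26)) (lift-⊛ 9 26 40 (dil 1 (E ⊛ H)) (dil 26 (E ⊛ G)))) (≐-trans (≐-trans (⊛-cong (γ-lift 1) (η-lift 26)) (lift-⊛ 1 234 40 (dil 1 (E ⊛ G)) (dil 26 (E ⊛ H)))) (⊛-congˡ (cst (+ 4)) (lift-shift 35 5 40 q))) ⟩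
  cst (+ 4) ⊛ (mono 35 ⊛ dil 40 p) ⊖ cst (+ 4) ⊛ (mono 35 ⊛ dil 40 (mono 5 ⊛ q))
    ≈⟨ solve 3 (λ m p q → con (+ 4) :* (m :* p) :- con (+ 4) :* (m :* q) := con (+ 4) :* (m :* (p :- q))) ≐-refl (mono 35) (dil 40 p) (dil 40 (mono 5 ⊛ q)) ⟩
  cst (+ 4) ⊛ (mono 35 ⊛ (dil 40 p ⊖ dil 40 (mono 5 ⊛ q)))
    ≈⟨ ⊛-congˡ (cst (+ 4)) (⊛-congˡ (mono 35) (≐-sym (dil-⊖ 40 p (mono 5 ⊛ q)))) ⟩
  cst (+ 4) ⊛ (mono 35 ⊛ dil 40 x) ∎)) γη-X)
  where
  open SR
  p q : Series
  p = dil 1 (E ⊛ H) ⊛ dil 26 (E ⊛ G)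
  q = dil 1 (E ⊛ G) ⊛ dil 26 (E ⊛ H)

tY-lift : tY ≐ lift 3 8 y
tY-lift = lift-descend 5 3 8 y tY (≐-trans (≐-sym (begin
  (dil 2 γsq ⊛ dil 13 γsq) ⊕ (dil 2 ηsq ⊛ dil 13 ηsq)
    ≈⟨ ⊕-cong (≐-trans (⊛-cong (γ-lift 2) (γ-lift 13)) (lift-⊛ 2 13 40 (dil 2 (E ⊛ G)) (dil 13 (E ⊛ G)))) (≐-trans (≐-trans (⊛-cong (η-lift 2) (η-lift 13)) (lift-⊛ 18 117 40 (dil 2 (E ⊛ H)) (dil 13 (E ⊛ H)))) (⊛-congˡ (cst (+ 4)) (lift-shift 15 3 40 q))) ⟩
  cst (+ 4) ⊛ (mono 15 ⊛ dil 40 p) ⊕ cst (+ 4) ⊛ (mono 15 ⊛ dil 40 (mono 3 ⊛ q))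
    ≈⟨ solve 3 (λ m p q → con (+ 4) :* (m :* p) :+ con (+ 4) :* (m :* q) := con (+ 4) :* (m :* (p :+ q))) ≐-refl (mono 15) (dil 40 p) (dil 40 (mono 3 ⊛ q)) ⟩
  cst (+ 4) ⊛ (mono 15 ⊛ (dil 40 p ⊕ dil 40 (mono 3 ⊛ q)))
    ≈⟨ ⊛-congˡ (cst (+ 4)) (⊛-congˡ (mono 15) (≐-sym (dil-⊕ 40 p (mono 3 ⊛ q)))) ⟩
  cst (+ 4) ⊛ (mono 15 ⊛ dil 40 y) ∎)) γη-Y)
  where
  open SR
  p q : Series
  p = dil 2 (E ⊛ G) ⊛ dil 13 (E ⊛ G)
  q = dil 2 (E ⊛ H) ⊛ dil 13 (E ⊛ H)

lift-by : ∀ k e .{{_ : NonZero e}} f g → lift k e f ⊛ dil e g ≐ lift k e (f ⊛ g)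
lift-by k e f g = ≐-trans (solve 3 (λ m f g → (con (+ 2) :* (m :* f)) :* g := con (+ 2) :* (m :* (f :* g))) ≐-refl (mono k) (dil e f) (dil e g)) (⊛-congˡ (cst (+ 2)) (⊛-congˡ (mono k) (≐-sym (dil-⊛ e f g))))

tC-lift : tC ≐ lift 13 8 c
tC-lift = ≐-trans tC≐ (≐-trans (⊛-congʳ (dil 8 alt) (ψ-lift 13)) (lift-by 13 8 (dil 13 ψ) alt))

tD-lift : tD ≐ lift 1 8 d
tD-lift = ≐-trans tD≐ (≐-trans (⊛-cong (ψ-lift 1) (≐-sym (dil-dil 8 13 alt))) (lift-by 1 8 (dil 1 ψ) (dil 13 alt)))

ω₁-lift : ω₁ ≐ cst (+ 4) ⊛ (mono 27 ⊛ dil 8 (dil 1 ψ ⊛ dil 26 ψ))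
ω₁-lift = ≐-trans ω₁≐ (≐-trans (⊛-cong (ψ-lift 1) (ψ-lift 26)) (lift-⊛ 1 26 8 (dil 1 ψ) (dil 26 ψ)))

ω₂-lift : ω₂ ≐ cst (+ 4) ⊛ (mono 15 ⊛ dil 8 (dil 2 ψ ⊛ dil 13 ψ))
ω₂-lift = ≐-trans ω₂≐ (≐-trans (⊛-cong (ψ-lift 2) (ψ-lift 13)) (lift-⊛ 2 13 8 (dil 2 ψ) (dil 13 ψ)))

-- Eliminating the common factor tW from the two ternary identities.
tXtB : tX ⊛ tB ≐ tY ⊛ tA
tXtB = dil-injective 3 (cancelˡ (cst (+ 4)) (λ ()) (begin
  cst (+ 4) ⊛ dil 3 (tX ⊛ tB)
    ≈⟨ ⊛-congˡ (cst (+ 4)) (dil-⊛ 3 tX tB) ⟩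
  cst (+ 4) ⊛ (dil 3 tX ⊛ dil 3 tB)
    ≈⟨ solve 2 (λ x b → con (+ 4) :* (x :* b) := con (+ 2) :* (x :* (con (+ 2) :* b))) ≐-refl (dil 3 tX) (dil 3 tB) ⟩
  cst (+ 2) ⊛ (dil 3 tX ⊛ (cst (+ 2) ⊛ dil 3 tB))
    ≈⟨ ⊛-congˡ (cst (+ 2)) (⊛-congˡ (dil 3 tX) (≐-sym (≐-trans χχ-B (scale-cst (+ 2) (dil 3 tB))))) ⟩
  cst (+ 2) ⊛ (dil 3 tX ⊛ (dil 2 χsq ⊛ dil 13 χsq))
    ≈⟨ solve 3 (λ x p q → con (+ 2) :* (x :* (p :* q)) := (con (+ 2) :* (x :* p)) :* q) ≐-refl (dil 3 tX) (dil 2 χsq) (dil 13 χsq) ⟩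
  (cst (+ 2) ⊛ (dil 3 tX ⊛ dil 2 χsq)) ⊛ dil 13 χsq
    ≈⟨ ⊛-congʳ (dil 13 χsq) (≐-trans (≐-sym (scale-cst (+ 2) (dil 3 tX ⊛ dil 2 χsq))) X-ternary) ⟩
  (tW ⊛ dil 1 χsq) ⊛ dil 13 χsq
    ≈⟨ solve 3 (λ w p q → (w :* p) :* q := (w :* q) :* p) ≐-refl tW (dil 1 χsq) (dil 13 χsq) ⟩
  (tW ⊛ dil 13 χsq) ⊛ dil 1 χsq
    ≈⟨ ⊛-congʳ (dil 1 χsq) (≐-sym (≐-trans (≐-sym (scale-cst (+ 2) (dil 3 tY ⊛ dil 26 χsq))) Y-ternary)) ⟩
  (cst (+ 2) ⊛ (dil 3 tY ⊛ dil 26 χsq)) ⊛ dil 1 χsq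
    ≈⟨ solve 3 (λ x p q → (con (+ 2) :* (x :* q)) :* p := con (+ 2) :* (x :* (p :* q))) ≐-refl (dil 3 tY) (dil 1 χsq) (dil 26 χsq) ⟩
  cst (+ 2) ⊛ (dil 3 tY ⊛ (dil 1 χsq ⊛ dil 26 χsq))
    ≈⟨ ⊛-congˡ (cst (+ 2)) (⊛-congˡ (dil 3 tY) (≐-trans χχ-A (scale-cst (+ 2) (dil 3 tA)))) ⟩
  cst (+ 2) ⊛ (dil 3 tY ⊛ (cst (+ 2) ⊛ dil 3 tA))
    ≈⟨ solve 2 (λ x b → con (+ 2) :* (x :* (con (+ 2) :* b)) := con (+ 4) :* (x :* b)) ≐-refl (dil 3 tY) (dil 3 tA) ⟩
  cst (+ 4) ⊛ (dil 3 tY ⊛ dil 3 tA)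
    ≈⟨ ⊛-congˡ (cst (+ 4)) (≐-sym (dil-⊛ 3 tY tA)) ⟩
  cst (+ 4) ⊛ dil 3 (tY ⊛ tA) ∎))
  where open SR

xb≐ya : x ⊛ b ≐ y ⊛ a
xb≐ya = dil-injective 8 (mono-cancel 12 (cancelˡ (cst (+ 4)) (λ ()) (≐-trans (≐-sym (lift-⊛ 7 5 8 x b)) (≐-trans (⊛-cong (≐-sym tX-lift) (≐-sym tB-lift)) (≐-trans tXtB (≐-trans (⊛-cong tY-lift tA-lift) (lift-⊛ 3 9 8 y a)))))))

-- The product x y.

x̃ ỹ : Series
x̃ = θ₅ ⊖ θ₂
ỹ = θ₁ ⊖ θ₃

private
  halved : ∀ k l f p q → cst (+ 4) ⊛ (mono (k ℕ.+ l ℕ.* 8) ⊛ dil 8 f) ≐ dil 8 p ⊛ lift k 8 q → cst (+ 2) ⊛ (mono l ⊛ f) ≐ p ⊛ q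
  halved k l f p q e = dil-injective 8 (mono-cancel k (cancelˡ (cst (+ 2)) (λ ()) (begin
    cst (+ 2) ⊛ (mono k ⊛ dil 8 (cst (+ 2) ⊛ (mono l ⊛ f)))
      ≈⟨ ⊛-congˡ (cst (+ 2)) (⊛-congˡ (mono k) (≐-trans (dil-⊛ 8 (cst (+ 2)) (mono l ⊛ f)) (⊛-congʳ (dil 8 (mono l ⊛ f)) (dil-cst 8 (+ 2))))) ⟩
    cst (+ 2) ⊛ (mono k ⊛ (cst (+ 2) ⊛ dil 8 (mono l ⊛ f)))
      ≈⟨ solve 2 (λ m z → con (+ 2) :* (m :* (con (+ 2) :* z)) := con (+ 4) :* (m :* z)) ≐-refl (mono k) (dil 8 (mono l ⊛ f)) ⟩
    cst (+ 4) ⊛ (mono k ⊛ dil 8 (mono l ⊛ f))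
      ≈⟨ ⊛-congˡ (cst (+ 4)) (≐-sym (lift-shift k l 8 f)) ⟩
    cst (+ 4) ⊛ (mono (k ℕ.+ l ℕ.* 8) ⊛ dil 8 f)
      ≈⟨ e ⟩
    dil 8 p ⊛ lift k 8 q
      ≈⟨ ⊛-comm (dil 8 p) (lift k 8 q) ⟩
    lift k 8 q ⊛ dil 8 p
      ≈⟨ lift-by k 8 q p ⟩
    lift k 8 (q ⊛ p)
      ≈⟨ lift-cong k 8 (⊛-comm q p) ⟩
    lift k 8 (p ⊛ q) ∎)))
    where open SR

-- The left factor q comes from 7 + 2·5 = 9 + 8·1, and q² in the next identity from 3 + 2·9 = 5 +
-- 8·2.
xb₂ : cst (+ 2) ⊛ (mono 1 ⊛ (x ⊛ b₂)) ≐ ỹ ⊛ a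
xb₂ = halved 9 1 (x ⊛ b₂) ỹ a (≐-trans (≐-sym (≐-trans (⊛-cong tX-lift (≐-trans (dil-cong 2 tB-lift) (lift-dil 2 5 8 b))) (lift-⊛ 7 10 8 x b₂))) (≐-trans link₁ (⊛-cong (≐-sym (dil-⊖ 8 θ₁ θ₃)) tA-lift)))

ya₂ : cst (+ 2) ⊛ (mono 2 ⊛ (y ⊛ a₂)) ≐ x̃ ⊛ b
ya₂ = halved 5 2 (y ⊛ a₂) x̃ b (≐-trans (≐-sym (≐-trans (⊛-cong tY-lift (≐-trans (dil-cong 2 tA-lift) (lift-dil 2 9 8 a))) (lift-⊛ 3 18 8 y a₂))) (≐-trans link₂ (⊛-cong (≐-sym (dil-⊖ 8 θ₅ θ₂)) tB-lift)))

negv-⊕ : ∀ f g → negv (f ⊕ g) ≐ negv f ⊕ negv g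
negv-⊕ f g n = ℤₚ.*-distribˡ-+ ((- + 1) ℤ.^ n) (f n) (g n)

negv-⊖ : ∀ f g → negv (f ⊖ g) ≐ negv f ⊖ negv g
negv-⊖ f g n = lem ((- + 1) ℤ.^ n) (f n) (g n)
  where
  lem : ∀ s a b → s * (a - b) ≡ s * a - s * b
  lem = solve-∀

negv-mono : ∀ k → negv (mono k) ≐ cst ((- + 1) ℤ.^ k) ⊛ mono k
negv-mono k n = trans (go n) (scale-cst ((- + 1) ℤ.^ k) (mono k) n)
  where
  go : ∀ n → (- + 1) ℤ.^ n * δ n k ≡ (- + 1) ℤ.^ k * δ n k
  go n with n ℕ.≟ k
  ... | yes refl = refl
  ... | no  _    = trans (ℤₚ.*-zeroʳ ((- + 1) ℤ.^ n)) (sym (ℤₚ.*-zeroʳ ((- + 1) ℤ.^ k)))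

negv-cst : ∀ c → negv (cst c) ≐ cst c
negv-cst c zero    = ℤₚ.*-identityˡ (cst c 0)
negv-cst c (suc n) = trans (cong ((- + 1) ℤ.^ suc n *_) (ℤₚ.*-zeroʳ c)) (trans (ℤₚ.*-zeroʳ ((- + 1) ℤ.^ suc n)) (sym (ℤₚ.*-zeroʳ c)))

negv-13 : ∀ f → negv (dil 13 f) ≐ dil 13 (negv f)
negv-13 f = ≐-sym (dil-char 13 {f = negv f} (λ m → cong₂ _*_ (trans (cong ((- + 1) ℤ.^_) (ℕₚ.*-comm m 13)) (sym (ℤₚ.^-*-assoc (- + 1) 13 m))) (dil-* 13 f m)) (λ n e → trans (cong ((- + 1) ℤ.^ n *_) (dil-∤ 13 f {n} e)) (ℤₚ.*-zeroʳ ((- + 1) ℤ.^ n))))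

negv-26 : ∀ f → negv (dil 26 f) ≐ dil 26 f
negv-26 f = ≐-trans (negv-cong (≐-sym (dil-dil 2 13 f))) (≐-trans (negv-even (dil 13 f)) (dil-dil 2 13 f))

-- The right-hand products of the quaternary identity after q ↦ -q; even dilations are unaffected by
-- this substitution.
R₁ R₂ : Series
R₁ = negv a ⊛ (dil 2 ψ ⊛ negv (dil 13 ψ))
R₂ = negv b ⊛ (negv (dil 1 ψ) ⊛ dil 26 ψ)

-- `quat` is this identity at -q, since each `κ` is the corresponding `θ` with q negated. Undoing
-- the substitution changes the sign of q³ but not of q⁴, which makes the right side a difference.
x̃ỹ : x̃ ⊛ ỹ ≐ cst (+ 4) ⊛ (mono 3 ⊛ (R₁ ⊖ mono 1 ⊛ R₂))
x̃ỹ = cancelˡ (cst (+ 2)) (λ ()) (λ n → finish n (negated n))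
  where
  open SR
  P P′ K : Series
  P = a ⊛ (dil 2 ψ ⊛ dil 13 ψ)
  P′ = b ⊛ (dil 1 ψ ⊛ dil 26 ψ)
  K = (κ₅ ⊖ κ₂) ⊛ (κ₁ ⊖ κ₃)
  S : Series
  S = cst (+ 2) ⊛ K ⊕ (cst (+ 8) ⊛ (mono 3 ⊛ P) ⊕ cst (+ 8) ⊛ (mono 4 ⊛ P′))
  eight : ∀ k l f g → lift k 8 f ⊛ (cst (+ 4) ⊛ (mono l ⊛ dil 8 g)) ≐ cst (+ 8) ⊛ (mono (k ℕ.+ l) ⊛ dil 8 (f ⊛ g))
  eight k l f g = ≐-trans (solve 4 (λ a b x y → (con (+ 2) :* (a :* x)) :* (con (+ 4) :* (b :* y)) := con (+ 8) :* ((a :* b) :* (x :* y))) ≐-refl (mono k) (mono l) (dil 8 f) (dil 8 g)) (⊛-congˡ (cst (+ 8)) (⊛-cong (≐-sym (mono-+ k l)) (≐-sym (dil-⊛ 8 f g))))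
  pull : ∀ k f → cst (+ 8) ⊛ (mono (k ℕ.* 8) ⊛ dil 8 f) ≐ dil 8 (cst (+ 8) ⊛ (mono k ⊛ f))
  pull k f = ≐-sym (≐-trans (dil-⊛ 8 (cst (+ 8)) (mono k ⊛ f)) (⊛-cong (dil-cst 8 (+ 8)) (≐-trans (dil-⊛ 8 (mono k) f) (⊛-congʳ (dil 8 f) (dil-mono 8 k)))))
  S≐0 : S ≐ zeroS
  S≐0 = dil-injective 8 (begin
    dil 8 S
      ≈⟨ ≐-trans (dil-⊕ 8 (cst (+ 2) ⊛ K) (cst (+ 8) ⊛ (mono 3 ⊛ P) ⊕ cst (+ 8) ⊛ (mono 4 ⊛ P′))) (⊕-cong (≐-trans (dil-⊛ 8 (cst (+ 2)) K) (⊛-cong (dil-cst 8 (+ 2)) (≐-trans (dil-⊛ 8 (κ₅ ⊖ κ₂) (κ₁ ⊖ κ₃)) (⊛-cong (dil-⊖ 8 κ₅ κ₂) (dil-⊖ 8 κ₁ κ₃))))) (≐-trans (dil-⊕ 8 (cst (+ 8) ⊛ (mono 3 ⊛ P)) (cst (+ 8) ⊛ (mono 4 ⊛ P′))) (⊕-cong (≐-sym (≐-trans (⊛-cong tA-lift ω₂-lift) (≐-trans (eight 9 15 a (dil 2 ψ ⊛ dil 13 ψ)) (pull 3 P)))) (≐-sym (≐-trans (⊛-cong tB-lift ω₁-lift) (≐-trans (eight 5 27 b (dil 1 ψ ⊛ dil 26 ψ)) (pull 4 P′))))))) ⟩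
    cst (+ 2) ⊛ ((dil 8 κ₅ ⊖ dil 8 κ₂) ⊛ (dil 8 κ₁ ⊖ dil 8 κ₃)) ⊕ (tA ⊛ ω₂ ⊕ tB ⊛ ω₁)
      ≈⟨ quat ⟩
    zeroS
      ≈⟨ ≐-sym (dil-char 8 (λ _ → refl) (λ _ _ → refl)) ⟩
    dil 8 zeroS ∎)
  unneg : ∀ {f g} → negv f ≐ g → negv g ≐ f
  unneg {f} e = ≐-trans (negv-cong (≐-sym e)) (negv-involutive f)
  negated : cst (+ 2) ⊛ (x̃ ⊛ ỹ) ⊕ (cst (+ 8) ⊛ ((cst (- + 1) ⊛ mono 3) ⊛ R₁) ⊕ cst (+ 8) ⊛ ((cst (+ 1) ⊛ mono 4) ⊛ R₂)) ≐ zeroS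
  negated = ≐-trans (≐-sym (≐-trans (negv-⊕ (cst (+ 2) ⊛ K) (cst (+ 8) ⊛ (mono 3 ⊛ P) ⊕ cst (+ 8) ⊛ (mono 4 ⊛ P′))) (⊕-cong (≐-trans (negv-⊛ (cst (+ 2)) K) (⊛-cong (negv-cst (+ 2)) (≐-trans (negv-⊛ (κ₅ ⊖ κ₂) (κ₁ ⊖ κ₃)) (⊛-cong (≐-trans (negv-⊖ κ₅ κ₂) (⊖-cong (unneg κ₅≐) (unneg κ₂≐))) (≐-trans (negv-⊖ κ₁ κ₃) (⊖-cong (unneg κ₁≐) (unneg κ₃≐))))))) (≐-trans (negv-⊕ (cst (+ 8) ⊛ (mono 3 ⊛ P)) (cst (+ 8) ⊛ (mono 4 ⊛ P′))) (⊕-cong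
      (≐-trans (negv-⊛ (cst (+ 8)) (mono 3 ⊛ P)) (⊛-cong (negv-cst (+ 8)) (≐-trans (negv-⊛ (mono 3) P) (⊛-cong (negv-mono 3) (≐-trans (negv-⊛ a (dil 2 ψ ⊛ dil 13 ψ)) (⊛-congˡ (negv a) (≐-trans (negv-⊛ (dil 2 ψ) (dil 13 ψ)) (⊛-congʳ (negv (dil 13 ψ)) (negv-even ψ)))))))))
      (≐-trans (negv-⊛ (cst (+ 8)) (mono 4 ⊛ P′)) (⊛-cong (negv-cst (+ 8)) (≐-trans (negv-⊛ (mono 4) P′) (⊛-cong (negv-mono 4) (≐-trans (negv-⊛ b (dil 1 ψ ⊛ dil 26 ψ)) (⊛-congˡ (negv b) (≐-trans (negv-⊛ (dil 1 ψ) (dil 26 ψ)) (⊛-congˡ (negv (dil 1 ψ)) (negv-26 ψ))))))))))))))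
    (≐-trans (negv-cong S≐0) (λ n → ℤₚ.*-zeroʳ ((- + 1) ℤ.^ n)))
  finish : ∀ n → (cst (+ 2) ⊛ (x̃ ⊛ ỹ) ⊕ (cst (+ 8) ⊛ ((cst (- + 1) ⊛ mono 3) ⊛ R₁) ⊕ cst (+ 8) ⊛ ((cst (+ 1) ⊛ mono 4) ⊛ R₂))) n ≡ + 0 → (cst (+ 2) ⊛ (x̃ ⊛ ỹ)) n ≡ (cst (+ 2) ⊛ (cst (+ 4) ⊛ (mono 3 ⊛ (R₁ ⊖ mono 1 ⊛ R₂)))) n
  finish n e = ℤₚ.i-j≡0⇒i≡j _ _ (trans (rearr n) e)
    where
    rearr : cst (+ 2) ⊛ (x̃ ⊛ ỹ) ⊖ cst (+ 2) ⊛ (cst (+ 4) ⊛ (mono 3 ⊛ (R₁ ⊖ mono 1 ⊛ R₂))) ≐ cst (+ 2) ⊛ (x̃ ⊛ ỹ) ⊕ (cst (+ 8) ⊛ ((cst (- + 1) ⊛ mono 3) ⊛ R₁) ⊕ cst (+ 8) ⊛ ((cst (+ 1) ⊛ mono 4) ⊛ R₂))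
    rearr = ≐-trans (solve 5 (λ z m n r s → con (+ 2) :* z :- con (+ 2) :* (con (+ 4) :* (m :* (r :- n :* s))) := con (+ 2) :* z :+ (con (+ 8) :* ((con (- + 1) :* m) :* r) :+ con (+ 8) :* ((con (+ 1) :* (m :* n)) :* s))) ≐-refl (x̃ ⊛ ỹ) (mono 3) (mono 1) R₁ R₂) (⊕-cong (≐-refl {cst (+ 2) ⊛ (x̃ ⊛ ỹ)}) (⊕-cong (≐-refl {cst (+ 8) ⊛ ((cst (- + 1) ⊛ mono 3) ⊛ R₁)}) (⊛-congˡ (cst (+ 8)) (⊛-congʳ R₂ (⊛-congˡ (cst (+ 1)) (≐-sym (mono-+ 3 1)))))))

-- Product identities from Gauss's formulas.

E₂ E₄ Ē : Series
E₂ = dil 2 E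
E₄ = dil 4 E
Ē = negv E

gauss-φ′ : E ⊛ E ≐ E₂ ⊛ alt
gauss-φ′ = ≐-trans gauss-φ (⊛-congˡ E₂ (≐-sym alt≐))

gauss-ψ′ : E₂ ⊛ E₂ ≐ E ⊛ ψ
gauss-ψ′ = ≐-trans gauss-ψ (⊛-congˡ E ψ≐lim)

-- The classical E(q) E(-q) E(q⁴) = E(q²)³, which removes E(-q). Gauss's formula at q, -q and q²,
-- with φ(q) φ(-q) = φ(-q²)², shows that the squares agree; constant term 1 selects the root.
E₂³ : E ⊛ (Ē ⊛ E₄) ≐ E₂ ⊛ (E₂ ⊛ E₂)
E₂³ = sqrt-unique (E ⊛ (Ē ⊛ E₄)) (E₂ ⊛ (E₂ ⊛ E₂)) refl refl (begin
  (E ⊛ (Ē ⊛ E₄)) ⊛ (E ⊛ (Ē ⊛ E₄))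
    ≈⟨ solve 3 (λ e f g → (e :* (f :* g)) :* (e :* (f :* g)) := (e :* e) :* ((f :* f) :* (g :* g))) ≐-refl E Ē E₄ ⟩
  (E ⊛ E) ⊛ ((Ē ⊛ Ē) ⊛ (E₄ ⊛ E₄))
    ≈⟨ ⊛-cong gauss-φ′ (⊛-congʳ (E₄ ⊛ E₄) negated) ⟩
  (E₂ ⊛ alt) ⊛ ((E₂ ⊛ φ) ⊛ (E₄ ⊛ E₄))
    ≈⟨ solve 4 (λ e a p g → (e :* a) :* ((e :* p) :* (g :* g)) := (e :* e) :* ((p :* a) :* (g :* g))) ≐-refl E₂ alt φ E₄ ⟩
  (E₂ ⊛ E₂) ⊛ ((φ ⊛ alt) ⊛ (E₄ ⊛ E₄))
    ≈⟨ ⊛-congˡ (E₂ ⊛ E₂) (⊛-congʳ (E₄ ⊛ E₄) φalt) ⟩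
  (E₂ ⊛ E₂) ⊛ ((dil 2 alt ⊛ dil 2 alt) ⊛ (E₄ ⊛ E₄))
    ≈⟨ solve 3 (λ e a g → (e :* e) :* ((a :* a) :* (g :* g)) := (e :* e) :* ((g :* a) :* (g :* a))) ≐-refl E₂ (dil 2 alt) E₄ ⟩
  (E₂ ⊛ E₂) ⊛ ((E₄ ⊛ dil 2 alt) ⊛ (E₄ ⊛ dil 2 alt))
    ≈⟨ ⊛-congˡ (E₂ ⊛ E₂) (⊛-cong double double) ⟩
  (E₂ ⊛ E₂) ⊛ ((E₂ ⊛ E₂) ⊛ (E₂ ⊛ E₂))
    ≈⟨ solve 1 (λ e → (e :* e) :* ((e :* e) :* (e :* e)) := (e :* (e :* e)) :* (e :* (e :* e))) ≐-refl E₂ ⟩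
  (E₂ ⊛ (E₂ ⊛ E₂)) ⊛ (E₂ ⊛ (E₂ ⊛ E₂)) ∎)
  where
  open SR
  negated : Ē ⊛ Ē ≐ E₂ ⊛ φ
  negated = ≐-trans (≐-sym (negv-⊛ E E)) (≐-trans (negv-cong gauss-φ′) (≐-trans (negv-⊛ E₂ alt) (⊛-cong (negv-even E) (≐-trans (negv-cong (≐-sym negvφ)) (negv-involutive φ)))))
  φalt : φ ⊛ alt ≐ dil 2 alt ⊛ dil 2 alt
  φalt = ≐-trans (⊛-cong (≐-trans φ≐ (≐-sym (dil-1 (Lat (fun (ones {1} {4})) (unary 1))))) (≐-sym (dil-1 alt))) (≐-trans alt² (≐-trans (dil-cong 2 (⊛-cong (dil-1 alt) (dil-1 alt))) (dil-⊛ 2 alt alt)))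
  double : E₄ ⊛ dil 2 alt ≐ E₂ ⊛ E₂
  double = ≐-sym (≐-trans (≐-sym (dil-⊛ 2 E E)) (≐-trans (dil-cong 2 gauss-φ′) (≐-trans (dil-⊛ 2 E₂ alt) (⊛-congʳ (dil 2 alt) (dil-dil 2 2 E)))))

EĒψ₂ : E ⊛ (Ē ⊛ dil 2 ψ) ≐ (E₂ ⊛ E₂) ⊛ E₄
EĒψ₂ = cancelˡ E₂ (λ ()) (begin
  E₂ ⊛ (E ⊛ (Ē ⊛ dil 2 ψ))       ≈⟨ solve 4 (λ e f g p → e :* (f :* (g :* p)) := (f :* g) :* (e :* p)) ≐-refl E₂ E Ē (dil 2 ψ) ⟩
  (E ⊛ Ē) ⊛ (E₂ ⊛ dil 2 ψ)       ≈⟨ ⊛-congˡ (E ⊛ Ē) (≐-sym (≐-trans (⊛-cong (≐-sym (dil-dil 2 2 E)) (≐-sym (dil-dil 2 2 E))) (≐-trans (≐-sym (dil-⊛ 2 E₂ E₂)) (≐-trans (dil-cong 2 gauss-ψ′) (dil-⊛ 2 E ψ))))) ⟩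
  (E ⊛ Ē) ⊛ (E₄ ⊛ E₄)            ≈⟨ solve 3 (λ f g e → (f :* g) :* (e :* e) := (f :* (g :* e)) :* e) ≐-refl E Ē E₄ ⟩
  (E ⊛ (Ē ⊛ E₄)) ⊛ E₄            ≈⟨ ⊛-congʳ E₄ E₂³ ⟩
  (E₂ ⊛ (E₂ ⊛ E₂)) ⊛ E₄          ≈⟨ solve 2 (λ e f → (e :* (e :* e)) :* f := e :* ((e :* e) :* f)) ≐-refl E₂ E₄ ⟩
  E₂ ⊛ ((E₂ ⊛ E₂) ⊛ E₄) ∎)
  where open SR

E₂ψ̄ : E₂ ⊛ negv ψ ≐ E ⊛ E₄
E₂ψ̄ = cancelˡ Ē (λ ()) (begin
  Ē ⊛ (E₂ ⊛ negv ψ)    ≈⟨ solve 3 (λ e f p → e :* (f :* p) := f :* (e :* p)) ≐-refl Ē E₂ (negv ψ) ⟩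
  E₂ ⊛ (Ē ⊛ negv ψ)    ≈⟨ ⊛-congˡ E₂ (≐-sym (≐-trans (⊛-cong (≐-sym (negv-even E)) (≐-sym (negv-even E))) (≐-trans (≐-sym (negv-⊛ E₂ E₂)) (≐-trans (negv-cong gauss-ψ′) (negv-⊛ E ψ))))) ⟩
  E₂ ⊛ (E₂ ⊛ E₂)       ≈⟨ ≐-sym E₂³ ⟩
  E ⊛ (Ē ⊛ E₄)         ≈⟨ solve 3 (λ e f g → e :* (f :* g) := f :* (e :* g)) ≐-refl E Ē E₄ ⟩
  Ē ⊛ (E ⊛ E₄) ∎)
  where open SR

private
  E₁₃ E₂₆ E₅₂ : Series
  E₁₃ = dil 13 E
  E₂₆ = dil 26 E
  E₅₂ = dil 52 E

  a₂≐ : a₂ ≐ E₂ ⊛ E₅₂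
  a₂≐ = ≐-trans (dil-⊛ 2 (dil 1 E) E₂₆) (⊛-cong (dil-dil 2 1 E) (dil-dil 2 26 E))

  b₂≐ : b₂ ≐ E₄ ⊛ E₂₆
  b₂≐ = ≐-trans (dil-⊛ 2 E₂ E₁₃) (⊛-cong (dil-dil 2 2 E) (dil-dil 2 13 E))

  ā≐ : negv a ≐ Ē ⊛ E₂₆
  ā≐ = ≐-trans (negv-⊛ (dil 1 E) E₂₆) (⊛-cong (negv-cong (dil-1 E)) (negv-26 E))

  b̄≐ : negv b ≐ E₂ ⊛ dil 13 Ē
  b̄≐ = ≐-trans (negv-⊛ E₂ E₁₃) (⊛-cong (negv-even E) (negv-13 E))

  a≐ : a ≐ E ⊛ E₂₆
  a≐ = ⊛-congʳ E₂₆ (dil-1 E)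

  -- `EĒψ₂` handles the factors in q and `E₂ψ̄` those in q^13; in `bR₂` they exchange roles. The
  -- common factor `a₂ ⊛ b₂` is the one to be cancelled in `xy`.
  aR₁ : a ⊛ R₁ ≐ (a₂ ⊛ b₂) ⊛ b
  aR₁ = begin
    a ⊛ (negv a ⊛ (dil 2 ψ ⊛ negv (dil 13 ψ)))
      ≈⟨ ⊛-cong a≐ (⊛-cong ā≐ (⊛-congˡ (dil 2 ψ) (negv-13 ψ))) ⟩
    (E ⊛ E₂₆) ⊛ ((Ē ⊛ E₂₆) ⊛ (dil 2 ψ ⊛ dil 13 (negv ψ)))
      ≈⟨ solve 5 (λ e f g p q → (e :* f) :* ((g :* f) :* (p :* q)) := (e :* (g :* p)) :* (f :* (f :* q))) ≐-refl E E₂₆ Ē (dil 2 ψ) (dil 13 (negv ψ)) ⟩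
    (E ⊛ (Ē ⊛ dil 2 ψ)) ⊛ (E₂₆ ⊛ (E₂₆ ⊛ dil 13 (negv ψ)))
      ≈⟨ ⊛-cong EĒψ₂ (⊛-congˡ E₂₆ (≐-trans (⊛-congʳ (dil 13 (negv ψ)) (≐-sym (dil-dil 13 2 E))) (≐-trans (≐-sym (dil-⊛ 13 E₂ (negv ψ))) (≐-trans (dil-cong 13 E₂ψ̄) (≐-trans (dil-⊛ 13 E E₄) (⊛-congˡ E₁₃ (dil-dil 13 4 E))))))) ⟩
    ((E₂ ⊛ E₂) ⊛ E₄) ⊛ (E₂₆ ⊛ (E₁₃ ⊛ E₅₂))
      ≈⟨ solve 5 (λ e f g h k → ((e :* e) :* f) :* (g :* (h :* k)) := ((e :* k) :* (f :* g)) :* (e :* h)) ≐-refl E₂ E₄ E₂₆ E₁₃ E₅₂ ⟩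
    ((E₂ ⊛ E₅₂) ⊛ (E₄ ⊛ E₂₆)) ⊛ (E₂ ⊛ E₁₃)
      ≈⟨ ⊛-congʳ b (⊛-cong (≐-sym a₂≐) (≐-sym b₂≐)) ⟩
    (a₂ ⊛ b₂) ⊛ b ∎
    where open SR

  bR₂ : b ⊛ R₂ ≐ (a₂ ⊛ b₂) ⊛ a
  bR₂ = begin
    b ⊛ (negv b ⊛ (negv (dil 1 ψ) ⊛ dil 26 ψ))
      ≈⟨ ⊛-congˡ b (⊛-cong b̄≐ (⊛-cong (negv-cong (dil-1 ψ)) (≐-sym (dil-dil 13 2 ψ)))) ⟩
    (E₂ ⊛ E₁₃) ⊛ ((E₂ ⊛ dil 13 Ē) ⊛ (negv ψ ⊛ dil 13 (dil 2 ψ)))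
      ≈⟨ solve 5 (λ e f g p q → (e :* f) :* ((e :* g) :* (p :* q)) := (e :* (e :* p)) :* (f :* (g :* q))) ≐-refl E₂ E₁₃ (dil 13 Ē) (negv ψ) (dil 13 (dil 2 ψ)) ⟩
    (E₂ ⊛ (E₂ ⊛ negv ψ)) ⊛ (E₁₃ ⊛ (dil 13 Ē ⊛ dil 13 (dil 2 ψ)))
      ≈⟨ ⊛-cong (⊛-congˡ E₂ E₂ψ̄) (≐-trans (⊛-congˡ E₁₃ (≐-sym (dil-⊛ 13 Ē (dil 2 ψ)))) (≐-trans (≐-sym (dil-⊛ 13 E (Ē ⊛ dil 2 ψ))) (≐-trans (dil-cong 13 EĒψ₂) (≐-trans (dil-⊛ 13 (E₂ ⊛ E₂) E₄) (⊛-cong (≐-trans (dil-⊛ 13 E₂ E₂) (⊛-cong (dil-dil 13 2 E) (dil-dil 13 2 E))) (dil-dil 13 4 E)))))) ⟩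
    (E₂ ⊛ (E ⊛ E₄)) ⊛ ((E₂₆ ⊛ E₂₆) ⊛ E₅₂)
      ≈⟨ solve 5 (λ e f g h k → (e :* (f :* g)) :* ((h :* h) :* k) := ((e :* k) :* (g :* h)) :* (f :* h)) ≐-refl E₂ E E₄ E₂₆ E₅₂ ⟩
    ((E₂ ⊛ E₅₂) ⊛ (E₄ ⊛ E₂₆)) ⊛ (E ⊛ E₂₆)
      ≈⟨ ⊛-cong (⊛-cong (≐-sym a₂≐) (≐-sym b₂≐)) (≐-sym a≐) ⟩
    (a₂ ⊛ b₂) ⊛ a ∎
    where open SR

xy : x ⊛ y ≐ b ⊛ b ⊖ mono 1 ⊛ (a ⊛ a)
xy = cancelˡ (a₂ ⊛ b₂) (λ ()) (mono-cancel 3 (cancelˡ (cst (+ 4)) (λ ()) (begin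
  cst (+ 4) ⊛ (mono 3 ⊛ ((a₂ ⊛ b₂) ⊛ (x ⊛ y)))
    ≈⟨ ⊛-congˡ (cst (+ 4)) (⊛-congʳ ((a₂ ⊛ b₂) ⊛ (x ⊛ y)) (mono-+ 1 2)) ⟩
  cst (+ 4) ⊛ ((mono 1 ⊛ mono 2) ⊛ ((a₂ ⊛ b₂) ⊛ (x ⊛ y)))
    ≈⟨ solve 6 (λ m n a b x y → con (+ 4) :* ((m :* n) :* ((a :* b) :* (x :* y))) := (con (+ 2) :* (m :* (x :* b))) :* (con (+ 2) :* (n :* (y :* a)))) ≐-refl (mono 1) (mono 2) a₂ b₂ x y ⟩
  (cst (+ 2) ⊛ (mono 1 ⊛ (x ⊛ b₂))) ⊛ (cst (+ 2) ⊛ (mono 2 ⊛ (y ⊛ a₂)))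
    ≈⟨ ⊛-cong xb₂ ya₂ ⟩
  (ỹ ⊛ a) ⊛ (x̃ ⊛ b)
    ≈⟨ solve 4 (λ p q a b → (q :* a) :* (p :* b) := (p :* q) :* (a :* b)) ≐-refl x̃ ỹ a b ⟩
  (x̃ ⊛ ỹ) ⊛ (a ⊛ b)
    ≈⟨ ⊛-congʳ (a ⊛ b) x̃ỹ ⟩
  (cst (+ 4) ⊛ (mono 3 ⊛ (R₁ ⊖ mono 1 ⊛ R₂))) ⊛ (a ⊛ b)
    ≈⟨ solve 6 (λ m n r s a b → (con (+ 4) :* (m :* (r :- n :* s))) :* (a :* b) := con (+ 4) :* (m :* ((a :* r) :* b :- n :* ((b :* s) :* a)))) ≐-refl (mono 3) (mono 1) R₁ R₂ a b ⟩
  cst (+ 4) ⊛ (mono 3 ⊛ ((a ⊛ R₁) ⊛ b ⊖ mono 1 ⊛ ((b ⊛ R₂) ⊛ a)))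
    ≈⟨ ⊛-congˡ (cst (+ 4)) (⊛-congˡ (mono 3) (⊖-cong (⊛-congʳ b aR₁) (⊛-congˡ (mono 1) (⊛-congʳ a bR₂)))) ⟩
  cst (+ 4) ⊛ (mono 3 ⊛ (((a₂ ⊛ b₂) ⊛ b) ⊛ b ⊖ mono 1 ⊛ (((a₂ ⊛ b₂) ⊛ a) ⊛ a)))
    ≈⟨ solve 5 (λ m n z a b → con (+ 4) :* (m :* ((z :* b) :* b :- n :* ((z :* a) :* a))) := con (+ 4) :* (m :* (z :* (b :* b :- n :* (a :* a))))) ≐-refl (mono 3) (mono 1) (a₂ ⊛ b₂) a b ⟩
  cst (+ 4) ⊛ (mono 3 ⊛ ((a₂ ⊛ b₂) ⊛ (b ⊛ b ⊖ mono 1 ⊛ (a ⊛ a)))) ∎)))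
  where open SR

-- Gauss's formula for φ at q times the one for ψ at q^13; `da` uses them the other way round. These
-- turn the squares in `xy` into multiples of `b` and of `a`.
cb : c ⊛ b ≐ a ⊛ a
cb = begin
  (dil 13 ψ ⊛ alt) ⊛ (E₂ ⊛ dil 13 E)   ≈⟨ solve 4 (λ p q e f → (p :* q) :* (e :* f) := (e :* q) :* (f :* p)) ≐-refl (dil 13 ψ) alt E₂ (dil 13 E) ⟩
  (E₂ ⊛ alt) ⊛ (dil 13 E ⊛ dil 13 ψ)   ≈⟨ ⊛-cong (≐-sym gauss-φ′) (≐-sym (≐-trans (⊛-cong (≐-sym (dil-dil 13 2 E)) (≐-sym (dil-dil 13 2 E))) (≐-trans (≐-sym (dil-⊛ 13 E₂ E₂)) (≐-trans (dil-cong 13 gauss-ψ′) (dil-⊛ 13 E ψ))))) ⟩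
  (E ⊛ E) ⊛ (dil 26 E ⊛ dil 26 E)      ≈⟨ solve 2 (λ e f → (e :* e) :* (f :* f) := (e :* f) :* (e :* f)) ≐-refl E (dil 26 E) ⟩
  (E ⊛ dil 26 E) ⊛ (E ⊛ dil 26 E)      ≈⟨ ⊛-cong (≐-sym a≐) (≐-sym a≐) ⟩
  a ⊛ a ∎
  where open SR

da : d ⊛ a ≐ b ⊛ b
da = begin
  (dil 1 ψ ⊛ dil 13 alt) ⊛ a                 ≈⟨ ⊛-cong (⊛-congʳ (dil 13 alt) (dil-1 ψ)) a≐ ⟩
  (ψ ⊛ dil 13 alt) ⊛ (E ⊛ dil 26 E)          ≈⟨ solve 4 (λ p q e f → (p :* q) :* (e :* f) := (e :* p) :* (f :* q)) ≐-refl ψ (dil 13 alt) E (dil 26 E) ⟩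
  (E ⊛ ψ) ⊛ (dil 26 E ⊛ dil 13 alt)          ≈⟨ ⊛-cong (≐-sym gauss-ψ′) (≐-sym (≐-trans (≐-sym (dil-⊛ 13 E E)) (≐-trans (dil-cong 13 gauss-φ′) (≐-trans (dil-⊛ 13 E₂ alt) (⊛-congʳ (dil 13 alt) (dil-dil 13 2 E)))))) ⟩
  (E₂ ⊛ E₂) ⊛ (dil 13 E ⊛ dil 13 E)          ≈⟨ solve 2 (λ e f → (e :* e) :* (f :* f) := (e :* f) :* (e :* f)) ≐-refl E₂ (dil 13 E) ⟩
  b ⊛ b ∎
  where open SR

x² : x ⊛ x ≐ a ⊛ (b ⊖ mono 1 ⊛ c)
x² = cancelˡ b (λ ()) (begin
  b ⊛ (x ⊛ x)                                  ≈⟨ solve 2 (λ b x → b :* (x :* x) := x :* (x :* b)) ≐-refl b x ⟩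
  x ⊛ (x ⊛ b)                                  ≈⟨ ⊛-congˡ x xb≐ya ⟩
  x ⊛ (y ⊛ a)                                  ≈⟨ ≐-sym (⊛-assoc x y a) ⟩
  (x ⊛ y) ⊛ a                                  ≈⟨ ⊛-congʳ a xy ⟩
  (b ⊛ b ⊖ mono 1 ⊛ (a ⊛ a)) ⊛ a               ≈⟨ ⊛-congʳ a (⊖-cong (≐-refl {b ⊛ b}) (⊛-congˡ (mono 1) (≐-sym cb))) ⟩
  (b ⊛ b ⊖ mono 1 ⊛ (c ⊛ b)) ⊛ a               ≈⟨ solve 4 (λ a b c m → (b :* b :- m :* (c :* b)) :* a := b :* (a :* (b :- m :* c))) ≐-refl a b c (mono 1) ⟩
  b ⊛ (a ⊛ (b ⊖ mono 1 ⊛ c)) ∎)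
  where open SR

y² : y ⊛ y ≐ b ⊛ (d ⊖ mono 1 ⊛ a)
y² = cancelˡ a (λ ()) (begin
  a ⊛ (y ⊛ y)                                  ≈⟨ solve 2 (λ a y → a :* (y :* y) := y :* (y :* a)) ≐-refl a y ⟩
  y ⊛ (y ⊛ a)                                  ≈⟨ ⊛-congˡ y (≐-sym xb≐ya) ⟩
  y ⊛ (x ⊛ b)                                  ≈⟨ solve 3 (λ x y b → y :* (x :* b) := (x :* y) :* b) ≐-refl x y b ⟩
  (x ⊛ y) ⊛ b                                  ≈⟨ ⊛-congʳ b xy ⟩
  (b ⊛ b ⊖ mono 1 ⊛ (a ⊛ a)) ⊛ b               ≈⟨ ⊛-congʳ b (⊖-cong (≐-sym da) (≐-refl {mono 1 ⊛ (a ⊛ a)})) ⟩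
  (d ⊛ a ⊖ mono 1 ⊛ (a ⊛ a)) ⊛ b               ≈⟨ solve 4 (λ a b d m → (d :* a :- m :* (a :* a)) :* b := a :* (b :* (d :- m :* a))) ≐-refl a b d (mono 1) ⟩
  a ⊛ (b ⊛ (d ⊖ mono 1 ⊛ a)) ∎)
  where open SR

-- The stated identities.

private
  U₁ U₂ : Series
  U₁ = dil 8 U-1-26
  U₂ = dil 8 U-2-13

x≐aU : x ≐ a ⊛ U-1-26
x≐aU = begin
  x
    ≈⟨ ⊖-cong (⊛-cong (dil-⊛ 1 E H) (dil-⊛ 26 E G)) (⊛-congˡ (mono 5) (⊛-cong (dil-⊛ 1 E G) (dil-⊛ 26 E H))) ⟩
  (dil 1 E ⊛ dil 1 H) ⊛ (dil 26 E ⊛ dil 26 G) ⊖ mono 5 ⊛ ((dil 1 E ⊛ dil 1 G) ⊛ (dil 26 E ⊛ dil 26 H))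
    ≈⟨ solve 7 (λ e f h g m k l → (e :* h) :* (f :* g) :- m :* ((e :* k) :* (f :* l)) := (e :* f) :* (h :* g :- m :* (k :* l))) ≐-refl (dil 1 E) (dil 26 E) (dil 1 H) (dil 26 G) (mono 5) (dil 1 G) (dil 26 H) ⟩
  a ⊛ (dil 1 H ⊛ dil 26 G ⊖ mono 5 ⊛ (dil 1 G ⊛ dil 26 H))
    ≈⟨ ⊛-congˡ a (⊖-cong (≐-refl {dil 1 H ⊛ dil 26 G}) (≐-sym (shift-mono 5 (dil 1 G ⊛ dil 26 H)))) ⟩
  a ⊛ U-1-26 ∎
  where open SR

y≐bU : y ≐ b ⊛ U-2-13
y≐bU = begin
  y
    ≈⟨ ⊕-cong (⊛-cong (dil-⊛ 2 E G) (dil-⊛ 13 E G)) (⊛-congˡ (mono 3) (⊛-cong (dil-⊛ 2 E H) (dil-⊛ 13 E H))) ⟩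
  (dil 2 E ⊛ dil 2 G) ⊛ (dil 13 E ⊛ dil 13 G) ⊕ mono 3 ⊛ ((dil 2 E ⊛ dil 2 H) ⊛ (dil 13 E ⊛ dil 13 H))
    ≈⟨ solve 7 (λ e f h g m k l → (e :* h) :* (f :* g) :+ m :* ((e :* k) :* (f :* l)) := (e :* f) :* (h :* g :+ m :* (k :* l))) ≐-refl (dil 2 E) (dil 13 E) (dil 2 G) (dil 13 G) (mono 3) (dil 2 H) (dil 13 H) ⟩
  b ⊛ (dil 2 G ⊛ dil 13 G ⊕ mono 3 ⊛ (dil 2 H ⊛ dil 13 H))
    ≈⟨ ⊛-congˡ b (⊕-cong (≐-refl {dil 2 G ⊛ dil 13 G}) (≐-sym (shift-mono 3 (dil 2 H ⊛ dil 13 H)))) ⟩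
  b ⊛ U-2-13 ∎
  where open SR

aU² : a ⊛ (U-1-26 ⊛ U-1-26) ≐ b ⊖ mono 1 ⊛ c
aU² = cancelˡ a (λ ()) (≐-trans (solve 2 (λ a u → a :* (a :* (u :* u)) := (a :* u) :* (a :* u)) ≐-refl a U-1-26) (≐-trans (⊛-cong (≐-sym x≐aU) (≐-sym x≐aU)) x²))

bU² : b ⊛ (U-2-13 ⊛ U-2-13) ≐ d ⊖ mono 1 ⊛ a
bU² = cancelˡ b (λ ()) (≐-trans (solve 2 (λ a u → a :* (a :* (u :* u)) := (a :* u) :* (a :* u)) ≐-refl b U-2-13) (≐-trans (⊛-cong (≐-sym y≐bU) (≐-sym y≐bU)) y²))

scale-shift : ∀ k {f g} → f ≐ dil 8 g → scale (+ 2) (shift k f) ≐ lift k 8 g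
scale-shift k {f} {g} e = ≐-trans (scale-cst (+ 2) (shift k f)) (⊛-congˡ (cst (+ 2)) (≐-trans (shift-mono k f) (⊛-congˡ (mono k) e)))

lift-⊖ : ∀ k f g → lift k 8 (f ⊖ mono 1 ⊛ g) ≐ lift k 8 f ⊖ lift (k ℕ.+ 8) 8 g
lift-⊖ k f g = ≐-trans (⊛-congˡ (cst (+ 2)) (⊛-congˡ (mono k) (dil-⊖ 8 f (mono 1 ⊛ g)))) (≐-trans (solve 3 (λ m p q → con (+ 2) :* (m :* (p :- q)) := con (+ 2) :* (m :* p) :- con (+ 2) :* (m :* q)) ≐-refl (mono k) (dil 8 f) (dil 8 (mono 1 ⊛ g))) (⊖-cong (≐-refl {lift k 8 f}) (⊛-congˡ (cst (+ 2)) (≐-sym (lift-shift k 1 8 g)))))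

lift-lead : ∀ k f → lift k 8 f k ≡ + 2 * f 0
lift-lead k f = trans (sym (lift-≐ k 8 f k)) (cong (+ 2 *_) (trans (cong (shift k (dil 8 f)) (sym (ℕₚ.+-identityʳ k))) (trans (shift-+ k (dil 8 f) 0) (dil-* 8 f 0))))

-- The coefficient of q^k in such a lift is twice the constant term of `f`, hence 2.
nonzero : ∀ k f {g} → g ≐ lift k 8 f → f 0 ≡ + 1 → NonZeroSeries g
nonzero k f e h = k , λ z → absurd (trans (sym (trans (e k) (trans (lift-lead k f) (cong (+ 2 *_) h)))) z)
  where
  absurd : ¬ (+ 2 ≡ + 0)
  absurd ()

private
  dil-a : dil 8 E ⊛ dil 208 E ≐ dil 8 a
  dil-a = ≐-sym (≐-trans (dil-⊛ 8 (dil 1 E) (dil 26 E)) (⊛-cong (dil-dil 8 1 E) (dil-dil 8 26 E)))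

  dil-b : dil 16 E ⊛ dil 104 E ≐ dil 8 b
  dil-b = ≐-sym (≐-trans (dil-⊛ 8 (dil 2 E) (dil 13 E)) (⊛-cong (dil-dil 8 2 E) (dil-dil 8 13 E)))

  θBC : theta (+ 5) (+ 4) (+ 84) ⊕ theta (+ 21) (+ 10) (+ 21) ⊖ theta (+ 13) (+ 0) (+ 32) ⊖ theta (+ 20) (+ 4) (+ 21) ≐ tB ⊖ tC
  θBC n = trans (lem (theta (+ 5) (+ 4) (+ 84) n) (theta (+ 21) (+ 10) (+ 21) n) (theta (+ 13) (+ 0) (+ 32) n) (theta (+ 20) (+ 4) (+ 21) n)) (cong₂ _-_ (θB n) (θC n))
    where
    lem : ∀ p q r s → p + q - r - s ≡ (p - s) - (r - q)
    lem = solve-∀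

  θDA : theta (+ 1) (+ 0) (+ 416) ⊕ theta (+ 17) (+ 6) (+ 25) ⊖ theta (+ 4) (+ 4) (+ 105) ⊖ theta (+ 9) (+ 8) (+ 48) ≐ tD ⊖ tA
  θDA n = trans (lem (theta (+ 1) (+ 0) (+ 416) n) (theta (+ 17) (+ 6) (+ 25) n) (theta (+ 4) (+ 4) (+ 105) n) (theta (+ 9) (+ 8) (+ 48) n)) (cong₂ _-_ (θD n) (θA n))
    where
    lem : ∀ p q r s → p + q - r - s ≡ (p - r) - (s - q)
    lem = solve-∀

  BC-lift : tB ⊖ tC ≐ lift 5 8 (b ⊖ mono 1 ⊛ c)
  BC-lift = ≐-trans (⊖-cong tB-lift tC-lift) (≐-sym (lift-⊖ 5 b c))

  DA-lift : tD ⊖ tA ≐ lift 1 8 (d ⊖ mono 1 ⊛ a)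
  DA-lift = ≐-trans (⊖-cong tD-lift tA-lift) (≐-sym (lift-⊖ 1 d a))

  -- By `cb` and `da` both sides equal b² - q a².
  ratio : (b ⊖ mono 1 ⊛ c) ⊛ b ≐ (d ⊖ mono 1 ⊛ a) ⊛ a
  ratio = ≐-trans (solve 3 (λ b m c → (b :- m :* c) :* b := b :* b :- m :* (c :* b)) ≐-refl b (mono 1) c) (≐-trans (⊖-cong (≐-sym da) (⊛-congˡ (mono 1) cb)) (solve 3 (λ d m a → d :* a :- m :* (a :* a) := (d :- m :* a) :* a) ≐-refl d (mono 1) a))

  eq₁ : scale (+ 2) (shift 3 (dil 16 E ⊛ dil 104 E ⊛ dil 8 U-2-13)) ≐ tY
  eq₁ = ≐-trans (scale-shift 3 (≐-trans (⊛-congʳ U₂ dil-b) (≐-sym (≐-trans (dil-cong 8 y≐bU) (dil-⊛ 8 b U-2-13))))) (≐-sym tY-lift)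

  eq₂ : scale (+ 2) (shift 7 (dil 8 E ⊛ dil 208 E ⊛ dil 8 U-1-26)) ≐ tX
  eq₂ = ≐-trans (scale-shift 7 (≐-trans (⊛-congʳ U₁ dil-a) (≐-sym (≐-trans (dil-cong 8 x≐aU) (dil-⊛ 8 a U-1-26))))) (≐-sym tX-lift)

  eq₃ : scale (+ 2) (shift 9 (dil 8 E ⊛ dil 208 E)) ≐ tA
  eq₃ = ≐-trans (scale-shift 9 dil-a) (≐-sym tA-lift)

  eq₄ : scale (+ 2) (shift 5 (dil 16 E ⊛ dil 104 E)) ≐ tB
  eq₄ = ≐-trans (scale-shift 5 dil-b) (≐-sym tB-lift)

  eq₅ : scale (+ 2) (shift 5 (dil 8 E ⊛ dil 208 E ⊛ (dil 8 U-1-26 ⊛ dil 8 U-1-26))) ≐ tB ⊖ tC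
  eq₅ = ≐-trans (scale-shift 5 (≐-trans (⊛-cong dil-a (≐-sym (dil-⊛ 8 U-1-26 U-1-26))) (≐-trans (≐-sym (dil-⊛ 8 a (U-1-26 ⊛ U-1-26))) (dil-cong 8 aU²)))) (≐-sym BC-lift)

  eq₆ : scale (+ 2) (shift 13 (dil 104 ψ ⊛ dil 8 (negv φ))) ≐ tC
  eq₆ = ≐-trans (scale-shift 13 (≐-trans (⊛-cong (≐-sym (dil-dil 8 13 ψ)) (dil-cong 8 negvφ)) (≐-sym (dil-⊛ 8 (dil 13 ψ) alt)))) (≐-sym tC-lift)

  eq₇ : scale (+ 2) (shift 1 (dil 16 E ⊛ dil 104 E ⊛ (dil 8 U-2-13 ⊛ dil 8 U-2-13))) ≐ tD ⊖ tA
  eq₇ = ≐-trans (scale-shift 1 (≐-trans (⊛-cong dil-b (≐-sym (dil-⊛ 8 U-2-13 U-2-13))) (≐-trans (≐-sym (dil-⊛ 8 b (U-2-13 ⊛ U-2-13))) (dil-cong 8 bU²)))) (≐-sym DA-lift)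

  eq₈ : scale (+ 2) (shift 1 (dil 8 ψ ⊛ dil 104 (negv φ))) ≐ tD
  eq₈ = ≐-trans (scale-shift 1 (≐-trans (⊛-cong (≐-sym (dil-dil 8 1 ψ)) (≐-trans (≐-sym (dil-dil 8 13 (negv φ))) (dil-cong 8 (dil-cong 13 negvφ)))) (≐-sym (dil-⊛ 8 (dil 1 ψ) (dil 13 alt))))) (≐-sym tD-lift)

  cross₁ : (tB ⊖ tC) ⊛ tB ≐ (tD ⊖ tA) ⊛ tA
  cross₁ = ≐-trans (⊛-cong BC-lift tB-lift) (≐-trans (lift-⊛ 5 5 8 (b ⊖ mono 1 ⊛ c) b) (≐-trans (⊛-congˡ (cst (+ 4)) (⊛-congˡ (mono 10) (dil-cong 8 ratio))) (≐-sym (≐-trans (⊛-cong DA-lift tA-lift) (lift-⊛ 1 9 8 (d ⊖ mono 1 ⊛ a) a)))))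

  cross₂ : tA ⊛ tY ≐ tB ⊛ tX
  cross₂ = ≐-trans (⊛-comm tA tY) (≐-trans (≐-sym tXtB) (⊛-comm tX tB))

  cross₃ : tX ⊛ (dil 16 E ⊛ dil 104 E) ≐ tY ⊛ shift 4 (dil 8 E ⊛ dil 208 E)
  cross₃ = begin
    tX ⊛ (dil 16 E ⊛ dil 104 E)                ≈⟨ ⊛-cong tX-lift dil-b ⟩
    lift 7 8 x ⊛ dil 8 b                       ≈⟨ lift-by 7 8 x b ⟩
    lift 7 8 (x ⊛ b)                           ≈⟨ lift-cong 7 8 xb≐ya ⟩
    lift 7 8 (y ⊛ a)                           ≈⟨ ⊛-congˡ (cst (+ 2)) (⊛-cong (mono-+ 3 4) (dil-⊛ 8 y a)) ⟩
    cst (+ 2) ⊛ ((mono 3 ⊛ mono 4) ⊛ (dil 8 y ⊛ dil 8 a)) ≈⟨ solve 4 (λ m n y a → con (+ 2) :* ((m :* n) :* (y :* a)) := (con (+ 2) :* (m :* y)) :* (n :* a)) ≐-refl (mono 3) (mono 4) (dil 8 y) (dil 8 a) ⟩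
    lift 3 8 y ⊛ (mono 4 ⊛ dil 8 a)            ≈⟨ ⊛-cong (≐-sym tY-lift) (≐-sym (≐-trans (shift-mono 4 (dil 8 E ⊛ dil 208 E)) (⊛-congˡ (mono 4) dil-a))) ⟩
    tY ⊛ shift 4 (dil 8 E ⊛ dil 208 E) ∎
    where open SR

theorem4p7 :
  -- 2 q^3 E(q^16) E(Q^8) U(2,13,q^8) = (3,2,139) - (12,4,35)
  (scale (+ 2) (shift 3 (dil 16 E ⊛ dil 104 E ⊛ dil 8 U-2-13))
    ≐ theta (+ 3) (+ 2) (+ 139) ⊖ theta (+ 12) (+ 4) (+ 35))
  ×
  -- 2 q^7 E(q^8) E(Q^16) U(1,26,q^8) = (7,4,60) - (15,4,28)
  (scale (+ 2) (shift 7 (dil 8 E ⊛ dil 208 E ⊛ dil 8 U-1-26))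
    ≐ theta (+ 7) (+ 4) (+ 60) ⊖ theta (+ 15) (+ 4) (+ 28))
  ×
  -- 2 q^9 E(q^8) E(Q^16) = (9,8,48) - (17,6,25)
  (scale (+ 2) (shift 9 (dil 8 E ⊛ dil 208 E))
    ≐ theta (+ 9) (+ 8) (+ 48) ⊖ theta (+ 17) (+ 6) (+ 25))
  ×
  -- 2 q^5 E(q^16) E(Q^8) = (5,4,84) - (20,4,21)
  (scale (+ 2) (shift 5 (dil 16 E ⊛ dil 104 E))
    ≐ theta (+ 5) (+ 4) (+ 84) ⊖ theta (+ 20) (+ 4) (+ 21))
  ×
  -- 2 q^5 E(q^8) E(Q^16) U(1,26,q^8)^2 = (5,4,84)+(21,10,21)-(13,0,32)-(20,4,21)
  (scale (+ 2) (shift 5 (dil 8 E ⊛ dil 208 E ⊛ (dil 8 U-1-26 ⊛ dil 8 U-1-26)))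
    ≐ theta (+ 5) (+ 4) (+ 84) ⊕ theta (+ 21) (+ 10) (+ 21)
      ⊖ theta (+ 13) (+ 0) (+ 32) ⊖ theta (+ 20) (+ 4) (+ 21))
  ×
  -- ... = 2 q^5 E(q^16) E(Q^8) - 2 q^13 ψ(Q^8) φ(-q^8)
  (theta (+ 5) (+ 4) (+ 84) ⊕ theta (+ 21) (+ 10) (+ 21)
      ⊖ theta (+ 13) (+ 0) (+ 32) ⊖ theta (+ 20) (+ 4) (+ 21)
    ≐ scale (+ 2) (shift 5 (dil 16 E ⊛ dil 104 E))
      ⊖ scale (+ 2) (shift 13 (dil 104 ψ ⊛ dil 8 (negv φ))))
  ×
  -- 2 q E(q^16) E(Q^8) U(2,13,q^8)^2 = (1,0,416)+(17,6,25)-(4,4,105)-(9,8,48)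
  (scale (+ 2) (shift 1 (dil 16 E ⊛ dil 104 E ⊛ (dil 8 U-2-13 ⊛ dil 8 U-2-13)))
    ≐ theta (+ 1) (+ 0) (+ 416) ⊕ theta (+ 17) (+ 6) (+ 25)
      ⊖ theta (+ 4) (+ 4) (+ 105) ⊖ theta (+ 9) (+ 8) (+ 48))
  ×
  -- ... = 2 q ψ(q^8) φ(-Q^8) - 2 q^9 E(q^8) E(Q^16)
  (theta (+ 1) (+ 0) (+ 416) ⊕ theta (+ 17) (+ 6) (+ 25)
      ⊖ theta (+ 4) (+ 4) (+ 105) ⊖ theta (+ 9) (+ 8) (+ 48)
    ≐ scale (+ 2) (shift 1 (dil 8 ψ ⊛ dil 104 (negv φ)))
      ⊖ scale (+ 2) (shift 9 (dil 8 E ⊛ dil 208 E)))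
  ×
  -- the denominators in the ratio identities are nonzero series
  NonZeroSeries (theta (+ 1) (+ 0) (+ 416) ⊕ theta (+ 17) (+ 6) (+ 25)
      ⊖ theta (+ 4) (+ 4) (+ 105) ⊖ theta (+ 9) (+ 8) (+ 48))
  ×
  NonZeroSeries (theta (+ 5) (+ 4) (+ 84) ⊖ theta (+ 20) (+ 4) (+ 21))
  ×
  NonZeroSeries (theta (+ 3) (+ 2) (+ 139) ⊖ theta (+ 12) (+ 4) (+ 35))
  ×
  NonZeroSeries (dil 16 E ⊛ dil 104 E)
  ×
  -- [(5,4,84)+(21,10,21)-(13,0,32)-(20,4,21)] / [(1,0,416)+(17,6,25)-(4,4,105)-(9,8,48)]
  --   = [(9,8,48)-(17,6,25)] / [(5,4,84)-(20,4,21)]   (cross-multiplied)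
  ((theta (+ 5) (+ 4) (+ 84) ⊕ theta (+ 21) (+ 10) (+ 21)
      ⊖ theta (+ 13) (+ 0) (+ 32) ⊖ theta (+ 20) (+ 4) (+ 21))
    ⊛ (theta (+ 5) (+ 4) (+ 84) ⊖ theta (+ 20) (+ 4) (+ 21))
    ≐ (theta (+ 1) (+ 0) (+ 416) ⊕ theta (+ 17) (+ 6) (+ 25)
      ⊖ theta (+ 4) (+ 4) (+ 105) ⊖ theta (+ 9) (+ 8) (+ 48))
    ⊛ (theta (+ 9) (+ 8) (+ 48) ⊖ theta (+ 17) (+ 6) (+ 25)))
  ×
  -- [(9,8,48)-(17,6,25)] / [(5,4,84)-(20,4,21)]
  --   = [(7,4,60)-(15,4,28)] / [(3,2,139)-(12,4,35)]   (cross-multiplied)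
  ((theta (+ 9) (+ 8) (+ 48) ⊖ theta (+ 17) (+ 6) (+ 25))
    ⊛ (theta (+ 3) (+ 2) (+ 139) ⊖ theta (+ 12) (+ 4) (+ 35))
    ≐ (theta (+ 5) (+ 4) (+ 84) ⊖ theta (+ 20) (+ 4) (+ 21))
    ⊛ (theta (+ 7) (+ 4) (+ 60) ⊖ theta (+ 15) (+ 4) (+ 28)))
  ×
  -- [(7,4,60)-(15,4,28)] / [(3,2,139)-(12,4,35)]
  --   = q^4 E(q^8) E(Q^16) / (E(q^16) E(Q^8))   (cross-multiplied)
  ((theta (+ 7) (+ 4) (+ 60) ⊖ theta (+ 15) (+ 4) (+ 28))
    ⊛ (dil 16 E ⊛ dil 104 E)
    ≐ (theta (+ 3) (+ 2) (+ 139) ⊖ theta (+ 12) (+ 4) (+ 35))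
    ⊛ shift 4 (dil 8 E ⊛ dil 208 E))
theorem4p7 =
    ≐-trans eq₁ (≐-sym θY)
  , ≐-trans eq₂ (≐-sym θX)
  , ≐-trans eq₃ (≐-sym θA)
  , ≐-trans eq₄ (≐-sym θB)
  , ≐-trans eq₅ (≐-sym θBC)
  , ≐-trans θBC (≐-sym (⊖-cong eq₄ eq₆))
  , ≐-trans eq₇ (≐-sym θDA)
  , ≐-trans θDA (≐-sym (⊖-cong eq₈ eq₃))
  , nonzero 1 (d ⊖ mono 1 ⊛ a) (≐-trans θDA DA-lift) refl
  , nonzero 5 b (≐-trans θB tB-lift) refl
  , nonzero 3 y (≐-trans θY tY-lift) refl
  , (0 , λ ())
  , ≐-trans (⊛-cong θBC θB) (≐-trans cross₁ (≐-sym (⊛-cong θDA θA)))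
  , ≐-trans (⊛-cong θA θY) (≐-trans cross₂ (≐-sym (⊛-cong θB θX)))
  , ≐-trans (⊛-congʳ (dil 16 E ⊛ dil 104 E) θX) (≐-trans cross₃ (≐-sym (⊛-congʳ (shift 4 (dil 8 E ⊛ dil 208 E)) θY)))
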